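{- Let $f(x)\in\mathbb{F}_{q^n}[x]$ be a scattered polynomial, with $q>3$ and $n>2$. (i) If $|G_f|=q-1$ (i.e. $f\notin\mathcal{S}_{n,q}$), then the plane $\mathcal{A}_f$ admits no nontrivial group of affine central collineations, and the group of all collineations of $\mathcal{A}_f$ lying in $\mathrm{GL}(2,q^n)$ has order $q^n-1$ and equals the kernel homology group $\{(x,y)\mapsto(ax,ay)\colon a\in\mathbb{F}_{q^n}^*\}$ of the associated Desarguesian plane. (ii) If $f\in\mathcal{S}_{n,q}$ and $G_f$ is isomorphic to $\mathbb{F}_{q^t}^*$, then $\mathcal{A}_f$ admits cyclic symmetric affine homology groups of order $(q^t-1)/(q-1)$ but admits no nontrivial affine elation; there exist two distinct components $X$ and $Y$ of $\mathcal{A}_f$ such that every affine homology of $\mathcal{A}_f$ has center $X$ or $Y$, and $X,Y$ are elements of the Desarguesian spread $\mathcal{D}$ of $\mathbb{F}_{q^n}^2$; moreover the group of all collineations of $\mathcal{A}_f$ lying in $\mathrm{GL}(2,q^n)$ is the direct product of the kernel homology group of the associated Desarguesian plane (of order $q^n-1$) by a cyclic homology group of order $(q^t-1)/(q-1)$.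
   Context: $q$ is a prime power. A $q$-polynomial $f(x)=\sum_{i=0}^{n-1}a_ix^{q^i}\in\mathbb{F}_{q^n}[x]$ is scattered if for all $y,z\in\mathbb{F}_{q^n}$, $zf(y)-yf(z)=0$ implies $y,z$ are $\mathbb{F}_q$-linearly dependent. $U_f=\{(x,f(x))\colon x\in\mathbb{F}_{q^n}\}$; matrices act by $(x,y)\mapsto(x,y)A$; $G_f=\{A\in\mathrm{GL}(2,q^n)\colon U_fA=U_f\}$ (it always contains the scalar matrices $aI$, $a\in\mathbb{F}_q^*$); $\mathcal{S}_{n,q}$ is the set of scattered $f$ with $|G_f|>q-1$. $L_f=\{\langle(x,f(x))\rangle_{\mathbb{F}_{q^n}}\colon x\ne0\}$, $\mathcal{D}=\{\langle v\rangle_{\mathbb{F}_{q^n}}\colon v\ne0\}$; $\mathcal{B}_f=(\mathcal{D}\setminus L_f)\cup\{hU_f\colon h\in\mathbb{F}_{q^n}^*\}$ is a spread of $\mathbb{F}_{q^n}^2$ (as $2n$-dim $\mathbb{F}_q$-space), and $\mathcal{A}_f$ is the translation plane with points the vectors of $\mathbb{F}_{q^n}^2$ and lines the cosets $v+W$, $W\in\mathcal{B}_f$; the elements of $\mathcal{B}_f$ (components) are also the points at infinity. A central collineation of a projective plane is a nonidentity collineation fixing a line (axis) pointwise; it then fixes all lines through a unique point (center); it is an elation if the center lies on the axis and a homology otherwise. An affine central collineation (affine homology, affine elation) of $\mathcal{A}_f$ is a collineation whose extension to the projective closure is a central collineation (homology, elation) whose axis is an affine line; its center is then a component; an affine line through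 the center is a coaxis. Two groups $G,H$ of affine homologies are symmetric affine homology groups if there are lines $\ell,m$ such that $\ell$ is the axis of every element of $G$ and a coaxis of every element of $H$, and $m$ is the axis of every element of $H$ and a coaxis of every element of $G$. -}

module Defs where

open import Level using (Level; 0ℓ; _⊔_) renaming (suc to lsuc)
open import Algebra.Core using (Op₁; Op₂)
open import Algebra.Bundles using (CommutativeRing; Semiring; Group)
open import Algebra.Structures using (IsCommutativeRing)
open import Algebra.Morphism.Structures using (IsRingHomomorphism; IsGroupIsomorphism)
import Algebra.Definitions.RawSemiring as RawSemiringDefs
import Algebra.Definitions.RawMonoid as RawMonoidDefs
import Algebra.Properties.Group as GroupProperties
open import Data.Empty using (⊥)
open import Data.Unit using (⊤)
open import Data.Nat.Base as ℕ using (ℕ; suc; _∸_; _/_; NonZero)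
open import Data.Nat.Primality using (Prime)
open import Data.Nat.Properties using (m<n⇒0<n∸m; <-trans)
open import Data.Fin.Base using (Fin; toℕ)
open import Data.Vec.Functional using (Vector)
open import Data.Product.Base using (Σ; ∃; ∃₂; _×_; _,_; proj₁; proj₂)
open import Data.Sum.Base using (_⊎_; inj₁; inj₂)
open import Data.Sum.Relation.Binary.Pointwise using (_⊎ₛ_; inj₁; inj₂)
open import Function.Base using (_∘_)
open import Function.Bundles using (Inverse; _⇔_; Equivalence; mk⇔; _↔_)
import Function.Construct.Composition as Composition
import Function.Construct.Identity as Identity
import Function.Construct.Symmetry as Symmetry
open import Relation.Binary.Bundles using (Setoid)
open import Relation.Binary.PropositionalEquality hiding (resp)
open import Relation.Nullary.Negation using (¬_)
open import Relation.Unary using (Pred; _∈_; _∉_; _⊆_; _≐_)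
open import Relation.Unary.Properties using (≐-refl; ≐-sym; ≐-trans)
import Algebra.Solver.Ring.NaturalCoefficients.Default as NaturalCoefficients

private
  variable
    a ℓ ℓ₁ ℓ₂ ℓ₃ : Level
    q N : ℕ

PrimePower : Pred ℕ 0ℓ
PrimePower q = ∃₂ λ p e → Prime p × 0 ℕ.< e × q ≡ p ℕ.^ e

-- (q ^ t - 1) / (q - 1); the hypothesis only serves to make the divisor nonzero.
homologyOrder : (q t : ℕ) → 3 ℕ.< q → ℕ
homologyOrder q t 3<q = ((q ℕ.^ t) ∸ 1) / (q ∸ 1)
  where instance
    q-1≢0 : NonZero (q ∸ 1)
    q-1≢0 = ℕ.>-nonZero (m<n⇒0<n∸m (<-trans (ℕ.s≤s (ℕ.s≤s ℕ.z≤n)) 3<q))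

HasOrder : Group a ℓ → ℕ → Set (a ⊔ ℓ)
HasOrder G m = Inverse (Group.setoid G) (setoid (Fin m))

IsCyclic : Group a ℓ → Set (a ⊔ ℓ)
IsCyclic G = ∃ λ g → ∀ x → ∃ λ k → x ≈ k ·′ g ⊎ x ≈ (k ·′ g) ⁻¹
  where
  open Group G
  open RawMonoidDefs rawMonoid using () renaming (_×_ to _·′_)

_≅_ : ∀ {b ℓ′} → Group a ℓ → Group b ℓ′ → Set _
G ≅ H = ∃ λ φ → IsGroupIsomorphism (Group.rawGroup G) (Group.rawGroup H) φ

record Subgroup (G : Group a ℓ) ℓ₁ : Set (a ⊔ ℓ ⊔ lsuc ℓ₁) where
  open Group G
  field
    Member    : Pred Carrier ℓ₁
    resp      : ∀ {x y} → x ≈ y → Member x → Member y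
    ∙-closed  : ∀ {x y} → Member x → Member y → Member (x ∙ y)
    ε-closed  : Member ε
    ⁻¹-closed : ∀ {x} → Member x → Member (x ⁻¹)

  toGroup : Group (a ⊔ ℓ₁) ℓ
  toGroup = record
    { Carrier = Σ Carrier Member
    ; _≈_     = λ x y → proj₁ x ≈ proj₁ y
    ; _∙_     = λ x y → proj₁ x ∙ proj₁ y , ∙-closed (proj₂ x) (proj₂ y)
    ; ε       = ε , ε-closed
    ; _⁻¹     = λ x → proj₁ x ⁻¹ , ⁻¹-closed (proj₂ x)
    ; isGroup = record
      { isMonoid = record
        { isSemigroup = record
          { isMagma = record
            { isEquivalence = record { refl = Group.refl G ; sym = Group.sym G ; trans = Group.trans G }
            ; ∙-cong = ∙-cong
            }
          ; assoc = λ x y z → assoc (proj₁ x) (proj₁ y) (proj₁ z)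
          }
        ; identity = (λ x → identityˡ (proj₁ x)) , (λ x → identityʳ (proj₁ x))
        }
      ; inverse = (λ x → inverseˡ (proj₁ x)) , (λ x → inverseʳ (proj₁ x))
      ; ⁻¹-cong = ⁻¹-cong
      }
    }

open Subgroup public using (Member; toGroup)

record IsInternalDirectProduct {G : Group a ℓ} (P : Subgroup G ℓ₁)
         (A : Subgroup G ℓ₂) (B : Subgroup G ℓ₃) : Set (a ⊔ ℓ ⊔ ℓ₁ ⊔ ℓ₂ ⊔ ℓ₃) where
  open Group G
  field
    A⊆P     : Member A ⊆ Member P
    B⊆P     : Member B ⊆ Member P
    commute : ∀ {x y} → x ∈ Member A → y ∈ Member B → x ∙ y ≈ y ∙ x
    trivial : ∀ {x} → x ∈ Member A → x ∈ Member B → x ≈ ε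
    product : ∀ {z} → z ∈ Member P → ∃₂ λ x y → x ∈ Member A × y ∈ Member B × z ≈ x ∙ y

record IncidenceStructure p ℓ l i : Set (lsuc (p ⊔ ℓ ⊔ l ⊔ i)) where
  infix 4 _on_
  field
    points  : Setoid p ℓ
    Line    : Set l
  open Setoid points public renaming (Carrier to Point)
  field
    _on_    : Point → Line → Set i
    on-resp : ∀ {x y m} → x ≈ y → x on m → y on m

module Collineations {p ℓ l i} (𝒫 : IncidenceStructure p ℓ l i) where
  open IncidenceStructure 𝒫

  -- Two lines are regarded as the same line when they have the same points, so
  -- a collineation is determined by its action on points.
  MapsLine : (Point → Point) → Line → Line → Set _
  MapsLine φ m m′ = ∀ x → x on m ⇔ φ x on m′

  record Collineation : Set (p ⊔ ℓ ⊔ l ⊔ i) where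
    field
      perm : Inverse points points
    open Inverse perm public using (to; from; to-cong; from-cong; strictlyInverseˡ; strictlyInverseʳ)
    field
      to-line   : ∀ m → ∃ (MapsLine to m)
      from-line : ∀ m → ∃ (MapsLine from m)

  open Collineation public using (to; from)

  infix 4 _≋_
  _≋_ : Collineation → Collineation → Set _
  φ ≋ ψ = ∀ x → to φ x ≈ to ψ x

  private
    ⇔-trans : ∀ {a b c} {A : Set a} {B : Set b} {C : Set c} → A ⇔ B → B ⇔ C → A ⇔ C
    ⇔-trans f g = mk⇔ (Equivalence.to g ∘ Equivalence.to f) (Equivalence.from f ∘ Equivalence.from g)

  identity : Collineation
  identity = record
    { perm      = Identity.inverse points
    ; to-line   = λ m → m , λ _ → mk⇔ (λ h → h) (λ h → h)
    ; from-line = λ m → m , λ _ → mk⇔ (λ h → h) (λ h → h)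
    }

  infixl 7 _⨾_
  _⨾_ : Collineation → Collineation → Collineation
  φ ⨾ ψ = record
    { perm      = Composition.inverse (Collineation.perm φ) (Collineation.perm ψ)
    ; to-line   = λ m →
        let m₁ , h₁ = Collineation.to-line φ m
            m₂ , h₂ = Collineation.to-line ψ m₁
        in m₂ , λ x → ⇔-trans (h₁ x) (h₂ (to φ x))
    ; from-line = λ m →
        let m₁ , h₁ = Collineation.from-line ψ m
            m₂ , h₂ = Collineation.from-line φ m₁
        in m₂ , λ x → ⇔-trans (h₁ x) (h₂ (from ψ x))
    }

  infix 8 _⁻
  _⁻ : Collineation → Collineation
  φ ⁻ = record
    { perm      = Symmetry.inverse (Collineation.perm φ)
    ; to-line   = Collineation.from-line φ
    ; from-line = Collineation.to-line φ
    }

  collineationGroup : Group (p ⊔ ℓ ⊔ l ⊔ i) (p ⊔ ℓ)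
  collineationGroup = record
    { Carrier = Collineation
    ; _≈_     = _≋_
    ; _∙_     = _⨾_
    ; ε       = identity
    ; _⁻¹     = _⁻
    ; isGroup = record
      { isMonoid = record
        { isSemigroup = record
          { isMagma = record
            { isEquivalence = record
              { refl  = λ _ → Setoid.refl points
              ; sym   = λ h x → Setoid.sym points (h x)
              ; trans = λ h k x → Setoid.trans points (h x) (k x)
              }
            ; ∙-cong = λ {_} {φ′} {ψ} h k x →
                Setoid.trans points (Collineation.to-cong ψ (h x)) (k (to φ′ x))
            }
          ; assoc = λ _ _ _ _ → Setoid.refl points
          }
        ; identity = (λ _ _ → Setoid.refl points) , (λ _ _ → Setoid.refl points)
        }
      ; inverse = (λ φ → Collineation.strictlyInverseˡ φ) , (λ φ → Collineation.strictlyInverseʳ φ)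
      ; ⁻¹-cong = λ {φ} {ψ} h x →
          Setoid.trans points
            (Collineation.from-cong φ
              (Setoid.trans points (Setoid.sym points (Collineation.strictlyInverseˡ ψ x))
                (Setoid.sym points (h (from ψ x)))))
            (Collineation.strictlyInverseʳ φ (from ψ x))
      }
    }

  FixesPointwise : Collineation → Line → Set _
  FixesPointwise φ m = ∀ x → x on m → to φ x ≈ x

  IsCenter : Collineation → Point → Set _
  IsCenter φ c = ∀ m → c on m → MapsLine (to φ) m m

  IsCentral : Collineation → Line → Set _
  IsCentral φ axis = ¬ φ ≋ identity × FixesPointwise φ axis

  IsElation IsHomology : Collineation → Line → Point → Set _
  IsElation  φ axis c = IsCentral φ axis × IsCenter φ c × c on axis
  IsHomology φ axis c = IsCentral φ axis × IsCenter φ c × ¬ c on axis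

module TranslationPlane {V : Set} (_+ᵥ_ : Op₂ V) (ℬ : Pred (Pred V 0ℓ) 0ℓ) where

  Component : Set₁
  Component = ∃ ℬ

  components : Setoid _ _
  components = record
    { Carrier       = Component
    ; _≈_           = λ X Y → proj₁ X ≐ proj₁ Y
    ; isEquivalence = record { refl = ≐-refl ; sym = ≐-sym ; trans = ≐-trans }
    }

  -- (v , W) stands for the coset v + W.
  AffineLine : Set₁
  AffineLine = V × Component

  _∈ₗ_ : V → AffineLine → Set
  x ∈ₗ (v , W , _) = ∃ λ w → w ∈ W × x ≡ v +ᵥ w

  affinePlane : IncidenceStructure _ _ _ _
  affinePlane = record
    { points  = setoid V
    ; Line    = AffineLine
    ; _on_    = _∈ₗ_
    ; on-resp = λ { refl h → h }
    }

  -- The components are the points at infinity and inj₂ _ is the line at infinity.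
  projectiveClosure : IncidenceStructure _ _ _ _
  projectiveClosure = record
    { points  = setoid V ⊎ₛ components
    ; Line    = AffineLine ⊎ ⊤
    ; _on_    = _∈ₚ_
    ; on-resp = resp
    }
    where
    open Setoid (setoid V ⊎ₛ components) using (_≈_)
    _∈ₚ_ : V ⊎ Component → AffineLine ⊎ ⊤ → Set
    inj₁ x ∈ₚ inj₁ m           = x ∈ₗ m
    inj₁ _ ∈ₚ inj₂ _           = ⊥
    inj₂ X ∈ₚ inj₁ (_ , W , _) = proj₁ X ≐ W
    inj₂ _ ∈ₚ inj₂ _           = ⊤
    resp : ∀ {x y m} → x ≈ y → x ∈ₚ m → y ∈ₚ m
    resp            (inj₁ refl) h = h
    resp {m = inj₁ _} (inj₂ X≐Y) h = ≐-trans (≐-sym X≐Y) h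
    resp {m = inj₂ _} (inj₂ _)   h = h

  module Affine = Collineations affinePlane
  module Projective = Collineations projectiveClosure
  open IncidenceStructure projectiveClosure public using (_on_) renaming (Point to ProjectivePoint; _≈_ to _≈ₚ_)
  open Affine public using (Collineation; collineationGroup; _≋_; identity; to)

  Extends : Projective.Collineation → Collineation → Set₁
  Extends ψ φ = ∀ x → Projective.to ψ (inj₁ x) ≈ₚ inj₁ (to φ x)

  IsAffineCentral : Collineation → AffineLine → Set₁
  IsAffineCentral φ axis = ∃ λ ψ → Extends ψ φ × Projective.IsCentral ψ (inj₁ axis)

  IsAffineElation IsAffineHomology : Collineation → AffineLine → ProjectivePoint → Set₁
  IsAffineElation  φ axis c = ∃ λ ψ → Extends ψ φ × Projective.IsElation ψ (inj₁ axis) c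
  IsAffineHomology φ axis c = ∃ λ ψ → Extends ψ φ × Projective.IsHomology ψ (inj₁ axis) c

  CollineationSubgroup : Set₂
  CollineationSubgroup = Subgroup collineationGroup (lsuc 0ℓ)

  -- As the identity is not a central collineation, conditions on the elements of
  -- a group of central collineations are imposed on the nonidentity ones.
  EachNonidentity : CollineationSubgroup → (Collineation → Set₁) → Set₁
  EachNonidentity H P = ∀ φ → φ ∈ Member H → ¬ φ ≋ identity → P φ

  IsTrivial : CollineationSubgroup → Set₁
  IsTrivial H = ∀ φ → φ ∈ Member H → φ ≋ identity

  IsAffineCentralGroup : CollineationSubgroup → Set₁
  IsAffineCentralGroup H = EachNonidentity H λ φ → ∃ λ axis → IsAffineCentral φ axis

  HasAxisAndCoaxis : CollineationSubgroup → AffineLine → AffineLine → Set₁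
  HasAxisAndCoaxis H axis coaxis =
    EachNonidentity H λ φ → ∃ λ c → IsAffineHomology φ axis c × c on inj₁ coaxis

  AreSymmetricAffineHomologyGroups : CollineationSubgroup → CollineationSubgroup → Set₁
  AreSymmetricAffineHomologyGroups G H =
    ∃₂ λ m₁ m₂ → HasAxisAndCoaxis G m₁ m₂ × HasAxisAndCoaxis H m₂ m₁

record FiniteField (N : ℕ) : Set₁ where
  infix  8 -_
  infixl 7 _*_
  infixl 6 _+_
  field
    Carrier           : Set
    _+_ _*_           : Op₂ Carrier
    -_                : Op₁ Carrier
    0# 1#             : Carrier
    isCommutativeRing : IsCommutativeRing _≡_ _+_ _*_ -_ 0# 1#
    1≢0               : 1# ≢ 0#
    reciprocal        : ∀ x → x ≢ 0# → ∃ λ y → x * y ≡ 1#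
    enumeration       : Carrier ↔ Fin N

  commutativeRing : CommutativeRing 0ℓ 0ℓ
  commutativeRing = record { isCommutativeRing = isCommutativeRing }

  open CommutativeRing commutativeRing public
    using (_-_; rawRing; semiring; +-rawMonoid; *-assoc; *-comm; *-identityˡ; *-identityʳ; zeroˡ; zeroʳ)
  open RawSemiringDefs (Semiring.rawSemiring semiring) public using (_^_)
  open RawMonoidDefs +-rawMonoid public using (sum)

  reciprocal-unique : ∀ {x y z} → x * y ≡ 1# → x * z ≡ 1# → y ≡ z
  reciprocal-unique {x} {y} {z} xy xz = begin
    y            ≡⟨ sym (*-identityʳ y) ⟩
    y * 1#       ≡⟨ cong (y *_) (sym xz) ⟩
    y * (x * z)  ≡⟨ sym (*-assoc y x z) ⟩
    y * x * z    ≡⟨ cong (_* z) (trans (*-comm y x) xy) ⟩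
    1# * z       ≡⟨ *-identityˡ z ⟩
    z            ∎
    where open ≡-Reasoning

  *-≢0 : ∀ {x y} → x ≢ 0# → y ≢ 0# → x * y ≢ 0#
  *-≢0 {x} {y} x≢0 y≢0 xy≡0 = let x′ , xx′ = reciprocal x x≢0 in y≢0 (begin
    y              ≡⟨ sym (*-identityˡ y) ⟩
    1# * y         ≡⟨ cong (_* y) (trans (sym xx′) (*-comm x x′)) ⟩
    x′ * x * y     ≡⟨ *-assoc x′ x y ⟩
    x′ * (x * y)   ≡⟨ cong (x′ *_) xy≡0 ⟩
    x′ * 0#        ≡⟨ zeroʳ x′ ⟩
    0#             ∎)
    where open ≡-Reasoning

  reciprocal-≢0 : ∀ {x y} → x * y ≡ 1# → y ≢ 0#
  reciprocal-≢0 {x} xy refl = 1≢0 (trans (sym xy) (zeroʳ x))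

record Embedding {q N} (F : FiniteField q) (K : FiniteField N) : Set where
  field
    ⟦_⟧               : FiniteField.Carrier F → FiniteField.Carrier K
    isRingHomomorphism : IsRingHomomorphism (FiniteField.rawRing F) (FiniteField.rawRing K) ⟦_⟧

_ˣ : FiniteField N → Group 0ℓ 0ℓ
K ˣ = record
  { Carrier = ∃ λ x → x ≢ 0#
  ; _≈_     = λ x y → proj₁ x ≡ proj₁ y
  ; _∙_     = λ { (x , x≢0) (y , y≢0) → x * y , *-≢0 x≢0 y≢0 }
  ; ε       = 1# , 1≢0
  ; _⁻¹     = λ { (x , x≢0) → let y , xy = reciprocal x x≢0 in y , reciprocal-≢0 xy }
  ; isGroup = record
    { isMonoid = record
      { isSemigroup = record
        { isMagma = record
          { isEquivalence = record { refl = refl ; sym = sym ; trans = trans }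
          ; ∙-cong = cong₂ _*_
          }
        ; assoc = λ x y z → *-assoc (proj₁ x) (proj₁ y) (proj₁ z)
        }
      ; identity = (λ x → *-identityˡ (proj₁ x)) , (λ x → *-identityʳ (proj₁ x))
      }
    ; inverse =
        (λ { (x , x≢0) → trans (*-comm _ x) (proj₂ (reciprocal x x≢0)) }) ,
        (λ { (x , x≢0) → proj₂ (reciprocal x x≢0) })
    ; ⁻¹-cong = λ { {x , x≢0} {.x , x≢0′} refl →
        reciprocal-unique (proj₂ (reciprocal x x≢0)) (proj₂ (reciprocal x x≢0′)) }
    }
  }
  where open FiniteField K

module MatrixIdentities (R : CommutativeRing 0ℓ 0ℓ) where
  open CommutativeRing R using (_≈_; _+_; _*_; 0#; 1#; commutativeSemiring) renaming (refl to ≈-refl)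
  open NaturalCoefficients commutativeSemiring using (solve; _:=_; _:+_; _:*_; con)

  row-assoc : ∀ x y a b c d e f →
              (x * a + y * c) * e + (x * b + y * d) * f ≈ x * (a * e + b * f) + y * (c * e + d * f)
  row-assoc = solve 8 (λ x y a b c d e f →
    (x :* a :+ y :* c) :* e :+ (x :* b :+ y :* d) :* f :=
    x :* (a :* e :+ b :* f) :+ y :* (c :* e :+ d :* f)) ≈-refl

  row-1₁ : ∀ x y → x * 1# + y * 0# ≈ x
  row-1₁ = solve 2 (λ x y → x :* con 1 :+ y :* con 0 := x) ≈-refl

  row-1₂ : ∀ x y → x * 0# + y * 1# ≈ y
  row-1₂ = solve 2 (λ x y → x :* con 0 :+ y :* con 1 := y) ≈-refl

  col-1₁ : ∀ x y → 1# * x + 0# * y ≈ x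
  col-1₁ = solve 2 (λ x y → con 1 :* x :+ con 0 :* y := x) ≈-refl

  col-1₂ : ∀ x y → 0# * x + 1# * y ≈ y
  col-1₂ = solve 2 (λ x y → con 0 :* x :+ con 1 :* y := y) ≈-refl

  diag₁ : ∀ k l → k * l + 0# * 0# ≈ k * l
  diag₁ = solve 2 (λ k l → k :* l :+ con 0 :* con 0 := k :* l) ≈-refl

  diag₂ : ∀ k l → 0# * 0# + k * l ≈ k * l
  diag₂ = solve 2 (λ k l → con 0 :* con 0 :+ k :* l := k :* l) ≈-refl

  off₁ : ∀ k l → k * 0# + 0# * l ≈ 0#
  off₁ = solve 2 (λ k l → k :* con 0 :+ con 0 :* l := con 0) ≈-refl

  off₂ : ∀ k l → 0# * l + k * 0# ≈ 0#
  off₂ = solve 2 (λ k l → con 0 :* l :+ k :* con 0 := con 0) ≈-refl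

module Space {N} (K : FiniteField N) where
  open FiniteField K
  open MatrixIdentities commutativeRing

  V : Set
  V = Carrier × Carrier

  infixl 6 _+ᵥ_
  _+ᵥ_ : Op₂ V
  (x , y) +ᵥ (x′ , y′) = x + x′ , y + y′

  infixr 7 _*ᵥ_
  _*ᵥ_ : Carrier → V → V
  k *ᵥ (x , y) = k * x , k * y

  0ᵥ : V
  0ᵥ = 0# , 0#

  ⟨_⟩ : V → Pred V 0ℓ
  ⟨ v ⟩ w = ∃ λ k → w ≡ k *ᵥ v

  desarguesianSpread : Pred (Pred V 0ℓ) 0ℓ
  desarguesianSpread W = ∃ λ v → v ≢ 0ᵥ × W ≐ ⟨ v ⟩

  record Matrix : Set where
    constructor mat
    field
      a₁₁ a₁₂ a₂₁ a₂₂ : Carrier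

  infixl 7 _*ₘ_
  _*ₘ_ : Op₂ Matrix
  mat a b c d *ₘ mat a′ b′ c′ d′ =
    mat (a * a′ + b * c′) (a * b′ + b * d′) (c * a′ + d * c′) (c * b′ + d * d′)

  scalar : Carrier → Matrix
  scalar k = mat k 0# 0# k

  1ₘ : Matrix
  1ₘ = scalar 1#

  infixl 7 _·_
  _·_ : V → Matrix → V
  (x , y) · mat a b c d = x * a + y * c , x * b + y * d

  private
    mat-cong : ∀ {a b c d a′ b′ c′ d′} → a ≡ a′ → b ≡ b′ → c ≡ c′ → d ≡ d′ →
               mat a b c d ≡ mat a′ b′ c′ d′
    mat-cong refl refl refl refl = refl

    scalar-* : ∀ k l → scalar k *ₘ scalar l ≡ scalar (k * l)
    scalar-* k l = mat-cong (diag₁ k l) (off₁ k l) (off₂ k l) (diag₂ k l)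

  *ₘ-assoc : ∀ A B C → (A *ₘ B) *ₘ C ≡ A *ₘ (B *ₘ C)
  *ₘ-assoc (mat a b c d) (mat e f g h) (mat i j k l) = mat-cong
    (row-assoc a b e f g h i k) (row-assoc a b e f g h j l)
    (row-assoc c d e f g h i k) (row-assoc c d e f g h j l)

  *ₘ-identityˡ : ∀ A → 1ₘ *ₘ A ≡ A
  *ₘ-identityˡ (mat a b c d) = mat-cong (col-1₁ a c) (col-1₁ b d) (col-1₂ a c) (col-1₂ b d)

  *ₘ-identityʳ : ∀ A → A *ₘ 1ₘ ≡ A
  *ₘ-identityʳ (mat a b c d) = mat-cong (row-1₁ a b) (row-1₂ a b) (row-1₁ c d) (row-1₂ c d)

  ·-*ₘ : ∀ v A B → v · (A *ₘ B) ≡ (v · A) · B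
  ·-*ₘ (x , y) (mat a b c d) (mat e f g h) =
    sym (cong₂ _,_ (row-assoc x y a b c d e g) (row-assoc x y a b c d f h))

  ·-1ₘ : ∀ v → v · 1ₘ ≡ v
  ·-1ₘ (x , y) = cong₂ _,_ (row-1₁ x y) (row-1₂ x y)

  record InvertibleMatrix : Set where
    field
      matrix  : Matrix
      inverse : Matrix
      inverseˡ : inverse *ₘ matrix ≡ 1ₘ
      inverseʳ : matrix *ₘ inverse ≡ 1ₘ

  open InvertibleMatrix public using (matrix)

  private
    inverse-unique : ∀ (A B : InvertibleMatrix) → matrix A ≡ matrix B →
                     InvertibleMatrix.inverse A ≡ InvertibleMatrix.inverse B
    inverse-unique A B A≡B = begin
      A.inverse                           ≡⟨ sym (*ₘ-identityʳ A.inverse) ⟩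
      A.inverse *ₘ 1ₘ                     ≡⟨ cong (A.inverse *ₘ_) (sym B.inverseʳ) ⟩
      A.inverse *ₘ (B.matrix *ₘ B.inverse) ≡⟨ sym (*ₘ-assoc A.inverse B.matrix B.inverse) ⟩
      A.inverse *ₘ B.matrix *ₘ B.inverse  ≡⟨ cong (λ M → A.inverse *ₘ M *ₘ B.inverse) (sym A≡B) ⟩
      A.inverse *ₘ A.matrix *ₘ B.inverse  ≡⟨ cong (_*ₘ B.inverse) A.inverseˡ ⟩
      1ₘ *ₘ B.inverse                     ≡⟨ *ₘ-identityˡ B.inverse ⟩
      B.inverse                           ∎
      where
      open ≡-Reasoning
      module A = InvertibleMatrix A
      module B = InvertibleMatrix B

    cancel : ∀ {A B C D} → B *ₘ C ≡ 1ₘ → A *ₘ D ≡ 1ₘ → (A *ₘ B) *ₘ (C *ₘ D) ≡ 1ₘ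
    cancel {A} {B} {C} {D} BC AD = begin
      (A *ₘ B) *ₘ (C *ₘ D)  ≡⟨ *ₘ-assoc A B (C *ₘ D) ⟩
      A *ₘ (B *ₘ (C *ₘ D))  ≡⟨ cong (A *ₘ_) (sym (*ₘ-assoc B C D)) ⟩
      A *ₘ (B *ₘ C *ₘ D)    ≡⟨ cong (λ M → A *ₘ (M *ₘ D)) BC ⟩
      A *ₘ (1ₘ *ₘ D)        ≡⟨ cong (A *ₘ_) (*ₘ-identityˡ D) ⟩
      A *ₘ D                ≡⟨ AD ⟩
      1ₘ                    ∎
      where open ≡-Reasoning

  GL₂ : Group 0ℓ 0ℓ
  GL₂ = record
    { Carrier = InvertibleMatrix
    ; _≈_     = λ A B → matrix A ≡ matrix B
    ; _∙_     = _∙_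
    ; ε       = one
    ; _⁻¹     = inv
    ; isGroup = record
      { isMonoid = record
        { isSemigroup = record
          { isMagma = record
            { isEquivalence = record { refl = refl ; sym = sym ; trans = trans }
            ; ∙-cong = cong₂ _*ₘ_
            }
          ; assoc = λ A B C → *ₘ-assoc (matrix A) (matrix B) (matrix C)
          }
        ; identity = (λ A → *ₘ-identityˡ (matrix A)) , (λ A → *ₘ-identityʳ (matrix A))
        }
      ; inverse = InvertibleMatrix.inverseˡ , InvertibleMatrix.inverseʳ
      ; ⁻¹-cong = λ {A} {B} → inverse-unique A B
      }
    }
    where
    open InvertibleMatrix
    _∙_ : Op₂ InvertibleMatrix
    A ∙ B = record
      { matrix   = matrix A *ₘ matrix B
      ; inverse  = inverse B *ₘ inverse A
      ; inverseˡ = cancel (inverseˡ A) (inverseˡ B)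
      ; inverseʳ = cancel (inverseʳ B) (inverseʳ A)
      }
    one : InvertibleMatrix
    one = record
      { matrix = 1ₘ ; inverse = 1ₘ ; inverseˡ = *ₘ-identityˡ 1ₘ ; inverseʳ = *ₘ-identityˡ 1ₘ }
    inv : Op₁ InvertibleMatrix
    inv A = record
      { matrix = inverse A ; inverse = matrix A ; inverseˡ = inverseʳ A ; inverseʳ = inverseˡ A }

  -- The kernel homology group of the Desarguesian plane with spread desarguesianSpread.
  kernelHomologies : Subgroup GL₂ 0ℓ
  kernelHomologies = record
    { Member    = λ A → ∃ λ k → k ≢ 0# × matrix A ≡ scalar k
    ; resp      = λ { A≡B (k , k≢0 , A≡k) → k , k≢0 , trans (sym A≡B) A≡k }
    ; ∙-closed  = λ { (k , k≢0 , A≡k) (l , l≢0 , B≡l) →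
        k * l , *-≢0 k≢0 l≢0 , trans (cong₂ _*ₘ_ A≡k B≡l) (scalar-* k l) }
    ; ε-closed  = 1# , 1≢0 , refl
    ; ⁻¹-closed = λ { {A} (k , k≢0 , A≡k) →
        let l , kl = reciprocal k k≢0
            kl′ = trans (scalar-* k l) (cong scalar kl)
            lk′ = trans (scalar-* l k) (cong scalar (trans (*-comm l k) kl))
        in l , reciprocal-≢0 kl ,
           inverse-unique A (record
             { matrix = scalar k ; inverse = scalar l ; inverseˡ = lk′ ; inverseʳ = kl′ }) A≡k }
    }

  image : Pred V 0ℓ → Matrix → Pred V 0ℓ
  image U A w = ∃ λ u → u ∈ U × w ≡ u · A

  stabilizer : Pred V 0ℓ → Subgroup GL₂ 0ℓ
  stabilizer U = record
    { Member    = λ A → image U (matrix A) ≐ U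
    ; resp      = λ { A≡B h → subst (λ M → image U M ≐ U) A≡B h }
    ; ∙-closed  = λ { {A} {B} (A⊆ , ⊆A) (B⊆ , ⊆B) →
        (λ { (u , u∈U , refl) → B⊆ (u · matrix A , A⊆ (u , u∈U , refl) , ·-*ₘ u (matrix A) (matrix B)) }) ,
        (λ w∈U → let v , v∈U , w≡vB = ⊆B w∈U
                     u , u∈U , v≡uA = ⊆A v∈U
                 in u , u∈U , trans w≡vB (trans (cong (_· matrix B) v≡uA) (sym (·-*ₘ u (matrix A) (matrix B))))) }
    ; ε-closed  =
        (λ { (u , u∈U , refl) → subst U (sym (·-1ₘ u)) u∈U }) ,
        (λ {w} w∈U → w , w∈U , sym (·-1ₘ w))
    ; ⁻¹-closed = λ { {A} (A⊆ , ⊆A) → let open InvertibleMatrix A renaming (matrix to M) in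
        (λ { (u , u∈U , refl) →
             let v , v∈U , u≡vA = ⊆A u∈U
             in subst U (sym (trans (cong (_· inverse) u≡vA)
                  (trans (sym (·-*ₘ v M inverse)) (trans (cong (v ·_) inverseʳ) (·-1ₘ v))))) v∈U }) ,
        (λ {w} w∈U → w · M , A⊆ (w , w∈U , refl) ,
             sym (trans (sym (·-*ₘ w M inverse)) (trans (cong (w ·_) inverseʳ) (·-1ₘ w)))) }
    }

  module _ (ℬ : Pred (Pred V 0ℓ) 0ℓ) where
    open TranslationPlane _+ᵥ_ ℬ
    private module C = Affine.Collineation

    Induces : InvertibleMatrix → Collineation → Set
    Induces A φ = ∀ v → to φ v ≡ v · matrix A

    linearCollineations : Subgroup GL₂ (lsuc 0ℓ)
    linearCollineations = record
      { Member    = λ A → ∃ λ φ → Induces A φ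
      ; resp      = λ { A≡B (φ , h) → φ , λ v → trans (h v) (cong (v ·_) A≡B) }
      ; ∙-closed  = λ { {A} {B} (φ , h) (ψ , k) → φ Affine.⨾ ψ , λ v →
          trans (k (to φ v)) (trans (cong (_· matrix B) (h v)) (sym (·-*ₘ v (matrix A) (matrix B)))) }
      ; ε-closed  = identity , λ v → sym (·-1ₘ v)
      ; ⁻¹-closed = λ { {A} (φ , h) → φ Affine.⁻ , λ v →
          let open InvertibleMatrix A renaming (matrix to M) in
          trans (cong (C.from φ) (sym (trans (h (v · inverse))
                  (trans (sym (·-*ₘ v inverse M)) (trans (cong (v ·_) inverseˡ) (·-1ₘ v))))))
                (C.strictlyInverseʳ φ (v · inverse)) }
      }

    IsLinearAffineHomologyGroup : Subgroup GL₂ (lsuc 0ℓ) → Set₁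
    IsLinearAffineHomologyGroup H =
      ∀ A → A ∈ Member H → matrix A ≢ 1ₘ →
      ∃ λ φ → Induces A φ × ∃₂ λ axis c → IsAffineHomology φ axis c

module Scattered (q n : ℕ) (F : FiniteField q) (K : FiniteField (q ℕ.^ n)) (ι : Embedding F K) where
  private module F = FiniteField F
  open FiniteField K
  open Space K public
  open Embedding ι

  -- The coefficients a₀ , … , aₙ₋₁ of ∑ aᵢ x^(q^i).
  QPolynomial : Set
  QPolynomial = Vector Carrier n

  eval : QPolynomial → Carrier → Carrier
  eval f x = sum λ i → f i * x ^ (q ℕ.^ toℕ i)

  Dependent : Carrier → Carrier → Set
  Dependent y z = ∃₂ λ a b → ¬ (a ≡ F.0# × b ≡ F.0#) × ⟦ a ⟧ * y + ⟦ b ⟧ * z ≡ 0#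

  IsScattered : QPolynomial → Set
  IsScattered f = ∀ y z → z * eval f y - y * eval f z ≡ 0# → Dependent y z

  module _ (f : QPolynomial) where

    graph : Pred V 0ℓ
    graph w = ∃ λ x → w ≡ (x , eval f x)

    G : Subgroup GL₂ 0ℓ
    G = stabilizer graph

    L : Pred (Pred V 0ℓ) 0ℓ
    L W = ∃ λ x → x ≢ 0# × W ≐ ⟨ x , eval f x ⟩

    dilate : Carrier → Pred V 0ℓ → Pred V 0ℓ
    dilate h U w = ∃ λ u → u ∈ U × w ≡ h *ᵥ u

    ℬ : Pred (Pred V 0ℓ) 0ℓ
    ℬ W = (W ∈ desarguesianSpread × W ∉ L) ⊎ ∃ λ h → h ≢ 0# × W ≐ dilate h graph

  𝒮 : Pred QPolynomial 0ℓ
  𝒮 f = IsScattered f × ∃ λ m → HasOrder (toGroup (G f)) m × q ∸ 1 ℕ.< m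

{-# OPTIONS --safe #-}
module Submission where

-- Three facts carry the proof. Write U for the graph of f.
--
-- Every collineation φ fixing 0 is K-semilinear. It is additive by completing
-- parallelograms. Since q > 3, more than a third of the lines e₁ + m e₂ of any
-- pencil are components that φ maps to K-lines. After a choice of frame
-- φ (x , y) = (α x , α y), and such a line gives α (x m) = α x α m. The m with
-- this property form a subfield of index less than 3, so α is an automorphism.
-- If moreover φ fixes a component pointwise, then it is K-linear: otherwise the
-- component is h U, the fixed field of α lies in F_q by scatteredness, and K
-- has dimension at most 2 over it, contrary to n > 2. A K-linear collineation
-- maps U to some h U, hence is a multiple of an element of G_f.
--
-- The difference of two elements of G_f is zero or invertible, because its
-- kernel and its image would meet U in at most q elements each and q ^ n > q ^ 2.
-- So A ∈ G_f acts freely on the nonzero elements of U, whence A ^ (q ^ n - 1) = 1,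
-- and X ^ (q ^ n - 1) - 1 has distinct roots in K: A is diagonalizable, and if A
-- is not a scalar then its eigenlines avoid L_f, hence are components.
--
-- In part (ii) G_f is commutative, so it is diagonal in an eigenbasis of any
-- nonscalar A. The quotients of the two eigenvalues form a cyclic group, being a
-- finite subgroup of K ˣ, and the fibres of G_f over it are the cosets of the
-- F_q-scalars. The matrices diag (r , 1) and diag (1 , r), for r in this group, are
-- the homologies.

open import Defs
open import Algebra.Bundles using (CommutativeRing; Group)
import Algebra.Definitions.RawMonoid as RawMonoid
open import Algebra.Morphism.Structures using (module IsRingHomomorphism; IsGroupIsomorphism)
import Algebra.Properties.CommutativeSemigroup as CommutativeSemigroupProperties
import Algebra.Properties.CommutativeSemiring.Binomial as Binomial
import Algebra.Properties.CommutativeSemiring.Exp as CommutativeExp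
import Algebra.Properties.Ring as RingProperties
import Algebra.Properties.Semiring.Exp as Exp
import Algebra.Properties.Semiring.Mult as Mult
import Algebra.Properties.Semiring.Sum as Sum
import Algebra.Solver.Ring
open import Algebra.Solver.Ring.AlmostCommutativeRing using (fromCommutativeRing; _-Raw-AlmostCommutative⟶_)
open import Data.Empty using (⊥; ⊥-elim)
open import Data.Fin.Base as Fin using (Fin; toℕ; punchIn; punchOut)
import Data.Fin.Properties as Fin
open import Data.Integer.Base as ℤ using (ℤ)
import Data.Integer.Properties as ℤ
open import Data.List.Base as List using (List; []; _∷_; length)
open import Data.List.Membership.Propositional using () renaming (_∈_ to _∈ˡ_)
import Data.List.Membership.Propositional.Properties as List
import Data.List.Properties as List
open import Data.List.Relation.Unary.All as All using (All; []; _∷_)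
import Data.List.Relation.Unary.All.Properties as All
open import Data.List.Relation.Unary.AllPairs using ([]; _∷_)
open import Data.List.Relation.Unary.Any using (here; there)
open import Data.List.Relation.Unary.Unique.Propositional using (Unique)
import Data.List.Relation.Unary.Unique.Propositional.Properties as Unique
import Data.Maybe.Base as Maybe
open import Data.Nat.Base as ℕ using (ℕ; zero; suc; z≤n; s≤s; NonZero; _!)
open import Data.Nat.Combinatorics using (nCk≡n!/k![n-k]!; k![n∸k]!∣n!; nCn≡1) renaming (_C_ to _choose_)
open import Data.Nat.Coprimality as Coprime using (Coprime; coprime-divisor)
open import Data.Nat.Divisibility as ℕ using (_∣_; divides)
open import Data.Nat.DivMod using (_/_; _%_; m≡m%n+[m/n]*n; m%n<n; m/n*n≡m; m*n/n≡m)
open import Data.Nat.Induction using (<-rec)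
import Data.Nat.ListAction as ℕ
open import Data.Nat.Primality using (Prime; euclidsLemma; prime⇒irreducible; prime⇒nonZero; prime⇒nonTrivial)
open import Data.Nat.Primality.Factorisation using (factorise)
import Data.Nat.Properties as ℕ
open import Data.Product.Base using (∃; ∃₂; _×_; _,_; proj₁; proj₂)
open import Data.Product.Function.NonDependent.Propositional using (_×-↔_)
open import Data.Sum.Base using (_⊎_; inj₁; inj₂)
open import Data.Sum.Relation.Binary.Pointwise using (inj₁; inj₂)
open import Function.Base using (_∘_)
open import Function.Bundles using (Inverse; _⇔_; Equivalence; mk⇔; _↔_)
open import Function.Construct.Composition using (_↔-∘_)
open import Function.Construct.Identity using (↔-id)
open import Function.Construct.Symmetry using (↔-sym)
open import Function.Definitions using (Injective)
open import Level using (0ℓ; Lift; lift) renaming (suc to lsuc)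
open import Relation.Binary.Bundles using (Setoid)
open import Relation.Binary.PropositionalEquality
open import Relation.Nullary using (¬_; Dec; yes; no; contradiction)
open import Relation.Nullary.Decidable using (map′; ¬?; _×-dec_; dec⇒maybe)
open import Relation.Unary using (Pred; Decidable; _∈_; _∉_; _≐_; _⊆_)
open import Relation.Unary.Properties using (≐-refl; ≐-sym; ≐-trans)

-- Counting

-- A collineation is only a permutation of points that carries lines to lines, and the spread mixes
-- K-lines with the sets h U, which are closed under F_q but not under K. Additivity alone gives
-- linearity over the prime field and nothing more, so the K-structure has to be recovered by
-- counting. In a pencil of q ^ n lines at most (q ^ n - 1) / (q - 1) belong to L_f, and at most as
-- many are carried onto sets h U, since F_q-multiples of h give the same set. For q - 1 ≥ 3 this
-- leaves more than q ^ n / 3 lines. One third is enough: an additive subgroup could have index 2,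
-- but if a proper subfield contains some s other than 0 and 1 and misses t, its translates by 0, t
-- and s t are disjoint. The characteristic polynomial of A ∈ G_f might be irreducible over K; it is
-- the exponent q ^ n - 1, coming from a free action on q ^ n - 1 vectors, that puts the eigenvalues
-- into K. The axis of a central collineation need not contain 0; conjugation by a translation
-- brings it there before any linear algebra applies.

injective⇒surjective : ∀ {n} {f : Fin n → Fin n} → Injective _≡_ _≡_ f → ∀ y → ∃ λ x → f x ≡ y
injective⇒surjective {suc n} {f} inj y with Fin.any? (λ x → f x Fin.≟ y)
... | yes hit = hit
-- A missed `y` can be punched out of the codomain, which leaves an injection of `Fin (suc n)` into
-- `Fin n`.
... | no miss = contradiction (Fin.injective⇒≤ punched-injective) ℕ.1+n≰n
  where
  avoids : ∀ x → y ≢ f x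
  avoids x y≡fx = miss (x , sym y≡fx)

  punched-injective : Injective _≡_ _≡_ (λ x → punchOut (avoids x))
  punched-injective {x} {x′} eq = inj (Fin.punchOut-injective (avoids x) (avoids x′) eq)

least : ∀ {p} {P : Pred ℕ p} → Decidable P → ∀ m → P m → ∃ λ o → P o × (∀ {k} → k ℕ.< o → ¬ P k)
least {P = P} P? = <-rec _ step
  where
  step : ∀ m → (∀ {k} → k ℕ.< m → P k → ∃ λ o → P o × (∀ {k} → k ℕ.< o → ¬ P k)) →
         P m → ∃ λ o → P o × (∀ {k} → k ℕ.< o → ¬ P k)
  step m rec Pm with Fin.any? {n = m} (λ i → P? (toℕ i))
  ... | yes (i , Pi) = rec (Fin.toℕ<n i) Pi
  ... | no none = m , Pm , λ k<m Pk → none (Fin.fromℕ< k<m , subst P (sym (Fin.toℕ-fromℕ< k<m)) Pk)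

-- Minimality is recorded as divisibility, the form in which periods and multiplicative orders are
-- used below.
record Generator {p} (P : Pred ℕ p) : Set p where
  constructor generator
  field
    o       : ℕ
    {{o≢0}} : NonZero o
    member  : P o
    minimal : ∀ k → P k → o ∣ k

-- A set of naturals closed under addition and cancellation is an ideal of ℕ.
leastPeriod : ∀ {p} {P : Pred ℕ p} → Decidable P →
              (∀ a b → P a → P b → P (a ℕ.+ b)) → (∀ a b → P b → P (a ℕ.+ b) → P a) →
              ∀ m → .{{NonZero m}} → P m → Generator P
leastPeriod {P = P} P? add cancel (suc m) Pm with least (λ k → P? (suc k)) m Pm
... | o , Po , minimal = generator (suc o) Po λ k Pk →
  divides (k / suc o) (trans (m≡m%n+[m/n]*n k (suc o)) (cong (ℕ._+ k / suc o ℕ.* suc o)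
    (remainder k (k % suc o) (m%n<n k (suc o))
      (cancel _ (k / suc o ℕ.* suc o) (multiple (k / suc o)) (subst P (m≡m%n+[m/n]*n k (suc o)) Pk)))))
  where
  multiple : ∀ d → P (d ℕ.* suc o)
  -- `P 0` is obtained by cancelling `suc o` from itself.
  multiple zero    = cancel 0 (suc o) Po Po
  multiple (suc d) = add (suc o) _ Po (multiple d)
  remainder : ∀ k r → r ℕ.< suc o → P r → r ≡ 0
  remainder k zero    _         _  = refl
  remainder k (suc r) (s≤s r<o) Pr = contradiction Pr (minimal r<o)

module Finite {c ℓ} {S : Setoid c ℓ} {n} (e : Inverse S (setoid (Fin n))) where
  open Setoid S renaming (Carrier to A; refl to ≈-refl; sym to ≈-sym; trans to ≈-trans)
  open Inverse e using (to; from; to-cong; strictlyInverseˡ; strictlyInverseʳ)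

  to-injective : ∀ {x y} → to x ≡ to y → x ≈ y
  to-injective {x} {y} eq =
    ≈-trans (≈-sym (strictlyInverseʳ x)) (≈-trans (reflexive (cong from eq)) (strictlyInverseʳ y))

  from-injective : ∀ {i j} → from i ≈ from j → i ≡ j
  from-injective {i} {j} eq = trans (sym (strictlyInverseˡ i)) (trans (to-cong eq) (strictlyInverseˡ j))

  infix 4 _≟_
  _≟_ : ∀ x y → Dec (x ≈ y)
  x ≟ y = map′ to-injective to-cong (to x Fin.≟ to y)

  any? : ∀ {p} {P : Pred A p} → (∀ {x y} → x ≈ y → P x → P y) → Decidable P → Dec (∃ P)
  any? {P = P} resp P? = map′ (λ { (i , Pi) → from i , Pi })
    (λ { (x , Px) → to x , resp (≈-sym (strictlyInverseʳ x)) Px }) (Fin.any? (λ i → P? (from i)))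

  all? : ∀ {p} {P : Pred A p} → (∀ {x y} → x ≈ y → P x → P y) → Decidable P → Dec (∀ x → P x)
  all? {P = P} resp P? = map′ (λ h x → resp (strictlyInverseʳ x) (h (to x)))
    (λ h i → h (from i)) (Fin.all? (λ i → P? (from i)))

  ¬∀⇒∃¬ : ∀ {p} {P : Pred A p} → (∀ {x y} → x ≈ y → P x → P y) → Decidable P →
          ¬ (∀ x → P x) → ∃ λ x → ¬ P x
  ¬∀⇒∃¬ {P = P} resp P? ¬∀ with Fin.¬∀⟶∃¬ n (P ∘ from) (P? ∘ from) (λ h → ¬∀ λ x → resp (strictlyInverseʳ x) (h (to x)))
  ... | i , ¬Pi = from i , ¬Pi

module _ {c ℓ d ℓ′} {S : Setoid c ℓ} {T : Setoid d ℓ′} {n}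
         (e : Inverse S (setoid (Fin n))) (e′ : Inverse T (setoid (Fin n))) where
  private
    module S = Setoid S
    module T = Setoid T
    module e = Inverse e
    module e′ = Inverse e′

  injection⇒surjection : (f : S.Carrier → T.Carrier) → (∀ {x y} → f x T.≈ f y → x S.≈ y) →
                         ∀ y → ∃ λ x → f x T.≈ y
  injection⇒surjection f inj y
    with injective⇒surjective {f = e′.to ∘ f ∘ e.from} (λ eq →
           trans (sym (e.strictlyInverseˡ _)) (trans (e.to-cong (inj (Finite.to-injective e′ eq))) (e.strictlyInverseˡ _)))
           (e′.to y)
  ... | i , eq = e.from i , Finite.to-injective e′ eq

module _ {c ℓ d ℓ′} {S : Setoid c ℓ} {T : Setoid d ℓ′} {m n}
         (e : Inverse S (setoid (Fin m))) (e′ : Inverse T (setoid (Fin n))) where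
  private
    module S = Setoid S
    module T = Setoid T
    module e = Inverse e
    module e′ = Inverse e′

  injection⇒≤ : (f : S.Carrier → T.Carrier) → (∀ {x y} → f x T.≈ f y → x S.≈ y) → m ℕ.≤ n
  injection⇒≤ f inj = Fin.injective⇒≤ {f = e′.to ∘ f ∘ e.from}
    (λ eq → Finite.from-injective e (inj (Finite.to-injective e′ eq)))

-- Iterates and orbits of a permutation

infixl 8 _^[_]_
_^[_]_ : ∀ {a} {A : Set a} → (A → A) → ℕ → A → A
π ^[ zero  ] x = x
π ^[ suc k ] x = π (π ^[ k ] x)

module _ {a} {A : Set a} (π : A → A) where

  iterate-+ : ∀ j k x → π ^[ j ℕ.+ k ] x ≡ π ^[ j ] (π ^[ k ] x)
  iterate-+ zero    k x = refl
  iterate-+ (suc j) k x = cong π (iterate-+ j k x)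

  iterate-* : ∀ {o x} → π ^[ o ] x ≡ x → ∀ d → π ^[ d ℕ.* o ] x ≡ x
  iterate-* {o} period zero    = refl
  iterate-* {o} {x} period (suc d) =
    trans (iterate-+ o (d ℕ.* o) x) (trans (cong (π ^[ o ]_) (iterate-* period d)) period)

  module _ (π-injective : Injective _≡_ _≡_ π) where

    iterate-injective : ∀ j {x y} → π ^[ j ] x ≡ π ^[ j ] y → x ≡ y
    iterate-injective zero    eq = eq
    iterate-injective (suc j) eq = iterate-injective j (π-injective eq)

    iterate-cancel : ∀ j k {x} → π ^[ j ] x ≡ π ^[ j ℕ.+ k ] x → π ^[ k ] x ≡ x
    iterate-cancel j k {x} eq = sym (iterate-injective j (trans eq (iterate-+ j k x)))

-- All orbits of π have the same length o, and n = r * o once r orbit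
-- representatives have been chosen greedily.
module _ {n} (π : Fin n → Fin n) (π-injective : Injective _≡_ _≡_ π)
         (homogeneous : ∀ k {x} y → π ^[ k ] x ≡ x → π ^[ k ] y ≡ y) where

  private
    module _ {o} {{o≢0 : NonZero o}} (period : ∀ x → π ^[ o ] x ≡ x)
             (o-least : ∀ k {x} → π ^[ k ] x ≡ x → o ∣ k) where

      orbit : ∀ {r} → (Fin r → Fin n) → Fin r × Fin o → Fin n
      orbit g (i , j) = π ^[ toℕ j ] g i

      reduce : ∀ k x → π ^[ k ] x ≡ π ^[ k % o ] x
      reduce k x = begin
        π ^[ k ] x                             ≡⟨ cong (π ^[_] x) (m≡m%n+[m/n]*n k o) ⟩
        π ^[ k % o ℕ.+ k / o ℕ.* o ] x         ≡⟨ iterate-+ π (k % o) _ x ⟩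
        π ^[ k % o ] (π ^[ k / o ℕ.* o ] x)    ≡⟨ cong (π ^[ k % o ]_) (iterate-* π (period x) (k / o)) ⟩
        π ^[ k % o ] x                         ∎
        where open ≡-Reasoning

      undo : ∀ {k} → k ℕ.< o → ∀ x → π ^[ o ℕ.∸ k ] (π ^[ k ] x) ≡ x
      undo {k} k<o x = trans (sym (iterate-+ π (o ℕ.∸ k) k x))
        (trans (cong (π ^[_] x) (ℕ.m∸n+n≡m (ℕ.<⇒≤ k<o))) (period x))

      same-≤ : ∀ {i j} x → i ℕ.≤ j → j ℕ.< o → π ^[ i ] x ≡ π ^[ j ] x → i ≡ j
      same-≤ {i} {j} x i≤j j<o eq with o-least (j ℕ.∸ i) {x} (iterate-cancel π π-injective i _
                                       (trans eq (cong (π ^[_] x) (sym (ℕ.m+[n∸m]≡n i≤j)))))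
      ... | divides zero j∸i≡0 = ℕ.≤-antisym i≤j (ℕ.m∸n≡0⇒m≤n j∸i≡0)
      ... | divides (suc d) j∸i≡ = contradiction
        (ℕ.≤-<-trans (ℕ.≤-trans (ℕ.m≤m+n o _) (ℕ.≤-reflexive (sym j∸i≡))) (ℕ.≤-<-trans (ℕ.m∸n≤m j i) j<o))
        (ℕ.<-irrefl refl)

      same : ∀ {i j} x → i ℕ.< o → j ℕ.< o → π ^[ i ] x ≡ π ^[ j ] x → i ≡ j
      same {i} {j} x i<o j<o eq with ℕ.≤-total i j
      ... | inj₁ i≤j = same-≤ x i≤j j<o eq
      ... | inj₂ j≤i = sym (same-≤ x j≤i i<o (sym eq))

      flat : ∀ {r} → (Fin r → Fin n) → Fin (r ℕ.* o) → Fin n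
      flat {r} g = orbit g ∘ Fin.remQuot {r} o

      flat-injective : ∀ {r} {g : Fin r → Fin n} → Injective _≡_ _≡_ (orbit g) → Injective _≡_ _≡_ (flat g)
      flat-injective {r} inj {x} {y} eq =
        trans (sym (Fin.combine-remQuot {r} o x)) (trans (cong (λ p → Fin.combine (proj₁ p) (proj₂ p)) (inj eq))
          (Fin.combine-remQuot {r} o y))

      extend : ∀ {r} → (Fin r → Fin n) → Fin n → Fin (suc r) → Fin n
      extend g y Fin.zero    = y
      extend g y (Fin.suc i) = g i

      -- As long as some `y` is off all chosen orbits, it becomes a new representative; once none is
      -- left, `flat g` is a bijection and n = r * o. The `fuel` bounds n - r, which drops at each
      -- step because distinct orbits keep r ≤ n.
      greedy : ∀ fuel {r} (g : Fin r → Fin n) → n ℕ.∸ r ℕ.< fuel → Injective _≡_ _≡_ (orbit g) → o ∣ n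
      greedy (suc fuel) {r} g n∸r<fuel inj with Fin.all? (λ y → Fin.any? (λ k → flat g k Fin.≟ y))
      ... | yes onto = divides r (ℕ.≤-antisym
              (Fin.injective⇒≤ {f = proj₁ ∘ onto} (λ {x} {y} eq →
                trans (sym (proj₂ (onto x))) (trans (cong (flat g) eq) (proj₂ (onto y)))))
              (Fin.injective⇒≤ (flat-injective inj)))
      ... | no ¬onto with Fin.¬∀⟶∃¬ n _ (λ y → Fin.any? (λ k → flat g k Fin.≟ y)) ¬onto
      ...   | y , new = greedy fuel (extend g y) smaller inj′
        where
        outside : ∀ i k → π ^[ k ] g i ≢ y
        outside i k eq = new (Fin.combine i (Fin.fromℕ< (m%n<n k o)) , (begin
          orbit g (Fin.remQuot {r} o (Fin.combine i (Fin.fromℕ< (m%n<n k o))))  ≡⟨ cong (orbit g) (Fin.remQuot-combine i _) ⟩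
          π ^[ toℕ (Fin.fromℕ< (m%n<n k o)) ] g i  ≡⟨ cong (π ^[_] g i) (Fin.toℕ-fromℕ< (m%n<n k o)) ⟩
          π ^[ k % o ] g i                         ≡⟨ sym (reduce k (g i)) ⟩
          π ^[ k ] g i                             ≡⟨ eq ⟩
          y                                        ∎))
          where open ≡-Reasoning

        crossing : ∀ i (j j′ : Fin o) → π ^[ toℕ j ] y ≢ π ^[ toℕ j′ ] g i
        -- Another o - j applications of `π` bring `y` back to itself, which would put it on the
        -- orbit of `g i`.
        crossing i j j′ eq = outside i (o ℕ.∸ toℕ j ℕ.+ toℕ j′) (begin
          π ^[ o ℕ.∸ toℕ j ℕ.+ toℕ j′ ] g i         ≡⟨ iterate-+ π (o ℕ.∸ toℕ j) (toℕ j′) (g i) ⟩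
          π ^[ o ℕ.∸ toℕ j ] (π ^[ toℕ j′ ] g i)    ≡⟨ cong (π ^[ o ℕ.∸ toℕ j ]_) (sym eq) ⟩
          π ^[ o ℕ.∸ toℕ j ] (π ^[ toℕ j ] y)       ≡⟨ undo (Fin.toℕ<n j) y ⟩
          y                                         ∎)
          where open ≡-Reasoning

        inj′ : Injective _≡_ _≡_ (orbit (extend g y))
        inj′ {Fin.zero , j} {Fin.zero , j′} eq =
          cong (Fin.zero ,_) (Fin.toℕ-injective (same y (Fin.toℕ<n j) (Fin.toℕ<n j′) eq))
        inj′ {Fin.zero , j} {Fin.suc i , j′} eq = contradiction eq (crossing i j j′)
        inj′ {Fin.suc i , j} {Fin.zero , j′} eq = contradiction (sym eq) (crossing i j′ j)
        inj′ {Fin.suc i , j} {Fin.suc i′ , j′} eq with inj {i , j} {i′ , j′} eq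
        ... | refl = refl

        column-injective : Injective _≡_ _≡_ (λ i → orbit (extend g y) (i , Fin.fromℕ< (ℕ.>-nonZero⁻¹ o)))
        column-injective {x} {y} eq = cong proj₁ (inj′ {x , Fin.fromℕ< (ℕ.>-nonZero⁻¹ o)} {y , Fin.fromℕ< (ℕ.>-nonZero⁻¹ o)} eq)

        smaller : n ℕ.∸ suc r ℕ.< fuel
        smaller = ℕ.<-≤-trans (ℕ.∸-monoʳ-< (ℕ.n<1+n r) (Fin.injective⇒≤ column-injective)) (ℕ.≤-pred n∸r<fuel)

  -- Lagrange's theorem for the cyclic group generated by `π`. Two of the first n + 1 iterates of
  -- `x` coincide, so there is a least period o; by homogeneity it is the period of every point, and
  -- the orbit count gives o ∣ n.
  iterate-size : ∀ x → π ^[ n ] x ≡ x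
  iterate-size x with Fin.pigeonhole (ℕ.n<1+n n) (λ (i : Fin (suc n)) → π ^[ toℕ i ] x)
  ... | i , j , i<j , eq with leastPeriod {P = λ k → π ^[ k ] x ≡ x} (λ k → _ Fin.≟ _)
          (λ a b pa pb → trans (iterate-+ π a b x) (trans (cong (π ^[ a ]_) pb) pa))
          (λ a b pb pab → trans (cong (π ^[ a ]_) (sym pb)) (trans (sym (iterate-+ π a b x)) pab))
          (toℕ j ℕ.∸ toℕ i) {{ℕ.>-nonZero (ℕ.m<n⇒0<n∸m i<j)}}
          (iterate-cancel π π-injective (toℕ i) _ (trans eq (cong (π ^[_] x) (sym (ℕ.m+[n∸m]≡n (ℕ.<⇒≤ i<j))))))
  ... | generator o member minimal
    with greedy (λ y → homogeneous o y member) (λ k {y} p → minimal k (homogeneous k x p))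
           (suc n) {0} (λ ()) (s≤s ℕ.≤-refl) (λ { {() , _} })
  ... | divides r n≡r*o = trans (cong (π ^[_] x) n≡r*o) (iterate-* π member r)

module _ {c ℓ} {S : Setoid c ℓ} {n} (e : Inverse S (setoid (Fin n))) where
  open Setoid S using (_≈_) renaming (Carrier to A; trans to ≈-trans)
  open Inverse e using (to; from; to-cong; strictlyInverseˡ; strictlyInverseʳ)

  -- The counting tool behind three facts: with f adding 1 it gives the characteristic, with f
  -- multiplying by a unit it gives Fermat's theorem, and with f the action of a matrix on the
  -- nonzero points of U it gives the exponent of that matrix.
  iterate-order : (f : A → A) → (∀ {x y} → x ≈ y → f x ≈ f y) → (∀ {x y} → f x ≈ f y → x ≈ y) →
                  (∀ k {x} y → f ^[ k ] x ≈ x → f ^[ k ] y ≈ y) → ∀ x → f ^[ n ] x ≈ x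
  iterate-order f f-cong f-injective f-homogeneous x =
    Finite.to-injective e (trans (transport n x) (iterate-size π π-injective π-homogeneous (to x)))
    where
    π : Fin n → Fin n
    π = to ∘ f ∘ from

    transport : ∀ k x → to (f ^[ k ] x) ≡ π ^[ k ] to x
    transport zero    x = refl
    transport (suc k) x =
      trans (sym (to-cong (f-cong (strictlyInverseʳ _)))) (cong π (transport k x))

    π-injective : Injective _≡_ _≡_ π
    π-injective {i} {j} eq = trans (sym (strictlyInverseˡ i))
      (trans (to-cong (f-injective (Finite.to-injective e eq))) (strictlyInverseˡ j))

    π-homogeneous : ∀ k {i} j → π ^[ k ] i ≡ i → π ^[ k ] j ≡ j
    π-homogeneous k {i} j eq = begin
      π ^[ k ] j                ≡⟨ cong (π ^[ k ]_) (sym (strictlyInverseˡ j)) ⟩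
      π ^[ k ] to (from j)      ≡⟨ sym (transport k (from j)) ⟩
      to (f ^[ k ] from j)      ≡⟨ to-cong (f-homogeneous k (from j) (Finite.to-injective e (begin
        to (f ^[ k ] from i)    ≡⟨ transport k (from i) ⟩
        π ^[ k ] to (from i)    ≡⟨ cong (π ^[ k ]_) (strictlyInverseˡ i) ⟩
        π ^[ k ] i              ≡⟨ eq ⟩
        i                       ≡⟨ sym (strictlyInverseˡ i) ⟩
        to (from i)             ∎))) ⟩
      to (from j)               ≡⟨ strictlyInverseˡ j ⟩
      j                         ∎
      where open ≡-Reasoning

-- Fields

module IntegerCoefficients (R : CommutativeRing 0ℓ 0ℓ) where
  open CommutativeRing R hiding (zero) renaming (setoid to ≈-setoid; refl to ≈-refl; sym to ≈-sym; trans to ≈-trans; reflexive to ≈-reflexive)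
  open RingProperties ring using (-0#≈0#; -‿distribˡ-*; -‿involutive; -‿+-comm)
  open import Data.Integer.Base using (+_; -[1+_])
  open CommutativeSemigroupProperties (CommutativeRing.+-commutativeSemigroup R) using (interchange)
  open import Relation.Binary.Reasoning.Setoid ≈-setoid

  private
    -- The separate clause for 1 makes the constant 1 of the solver evaluate to `1#` itself and not
    -- to `1# + 0#`, so that solved equations match the terms of the proof by `refl`.
    nat : ℕ → Carrier
    nat 0             = 0#
    nat 1             = 1#
    nat (suc (suc n)) = 1# + nat (suc n)

    int : ℤ → Carrier
    int (+ n)    = nat n
    int -[1+ n ] = - nat (suc n)

    nat-suc : ∀ n → nat (suc n) ≈ 1# + nat n
    nat-suc zero    = ≈-sym (+-identityʳ 1#)
    nat-suc (suc n) = ≈-refl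

    nat-+ : ∀ m n → nat (m ℕ.+ n) ≈ nat m + nat n
    nat-+ zero    n = ≈-sym (+-identityˡ _)
    nat-+ (suc m) n = begin
      nat (suc (m ℕ.+ n))   ≈⟨ nat-suc (m ℕ.+ n) ⟩
      1# + nat (m ℕ.+ n)    ≈⟨ +-congˡ (nat-+ m n) ⟩
      1# + (nat m + nat n)  ≈⟨ +-assoc _ _ _ ⟨
      1# + nat m + nat n    ≈⟨ +-congʳ (nat-suc m) ⟨
      nat (suc m) + nat n   ∎

    nat-* : ∀ m n → nat (m ℕ.* n) ≈ nat m * nat n
    nat-* zero    n = ≈-sym (zeroˡ _)
    nat-* (suc m) n = begin
      nat (n ℕ.+ m ℕ.* n)         ≈⟨ nat-+ n (m ℕ.* n) ⟩
      nat n + nat (m ℕ.* n)       ≈⟨ +-cong (≈-sym (*-identityˡ _)) (nat-* m n) ⟩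
      1# * nat n + nat m * nat n  ≈⟨ distribʳ _ _ _ ⟨
      (1# + nat m) * nat n        ≈⟨ *-congʳ (nat-suc m) ⟨
      nat (suc m) * nat n         ∎

    int-neg : ∀ i → int (ℤ.- i) ≈ - int i
    int-neg (+ zero)  = ≈-sym -0#≈0#
    int-neg (+ suc n) = ≈-refl
    int-neg -[1+ n ]  = ≈-sym (-‿involutive _)

    int-⊖ : ∀ m n → int (m ℤ.⊖ n) ≈ nat m - nat n
    int-⊖ m       zero    = ≈-sym (≈-trans (+-congˡ -0#≈0#) (+-identityʳ _))
    int-⊖ zero    (suc n) = ≈-sym (+-identityˡ _)
    int-⊖ (suc m) (suc n) = begin
      int (suc m ℤ.⊖ suc n)                ≡⟨ cong int (ℤ.[1+m]⊖[1+n]≡m⊖n m n) ⟩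
      int (m ℤ.⊖ n)                        ≈⟨ int-⊖ m n ⟩
      nat m - nat n                        ≈⟨ +-identityˡ _ ⟨
      0# + (nat m - nat n)                 ≈⟨ +-congʳ (-‿inverseʳ 1#) ⟨
      (1# - 1#) + (nat m - nat n)          ≈⟨ interchange _ _ _ _ ⟩
      (1# + nat m) + (- 1# - nat n)        ≈⟨ +-cong (≈-sym (nat-suc m)) (-‿+-comm _ _) ⟩
      nat (suc m) - (1# + nat n)           ≈⟨ +-congˡ (-‿cong (nat-suc n)) ⟨
      nat (suc m) - nat (suc n)            ∎

    int-+ : ∀ i j → int (i ℤ.+ j) ≈ int i + int j
    int-+ (+ m)    (+ n)    = nat-+ m n
    int-+ (+ m)    -[1+ n ] = int-⊖ m (suc n)
    int-+ -[1+ m ] (+ n)    = ≈-trans (int-⊖ n (suc m)) (+-comm _ _)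
    int-+ -[1+ m ] -[1+ n ] = begin
      - nat (suc (suc (m ℕ.+ n)))        ≡⟨ cong (λ k → - nat (suc k)) (sym (ℕ.+-suc m n)) ⟩
      - nat (suc m ℕ.+ suc n)            ≈⟨ -‿cong (nat-+ (suc m) (suc n)) ⟩
      - (nat (suc m) + nat (suc n))      ≈⟨ -‿+-comm _ _ ⟨
      - nat (suc m) + - nat (suc n)      ∎

    nat-*-int : ∀ m j → int (+ m ℤ.* j) ≈ nat m * int j
    nat-*-int m (+ n)    = ≈-trans (≈-reflexive (cong int (sym (ℤ.pos-* m n)))) (nat-* m n)
    nat-*-int m -[1+ n ] = begin
      int (+ m ℤ.* -[1+ n ])        ≡⟨ cong int (sym (ℤ.neg-distribʳ-* (+ m) (+ suc n))) ⟩
      int (ℤ.- (+ m ℤ.* + suc n))   ≈⟨ int-neg (+ m ℤ.* + suc n) ⟩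
      - int (+ m ℤ.* + suc n)       ≈⟨ -‿cong (nat-*-int m (+ suc n)) ⟩
      - (nat m * nat (suc n))       ≈⟨ RingProperties.-‿distribʳ-* ring _ _ ⟩
      nat m * - nat (suc n)         ∎

    int-* : ∀ i j → int (i ℤ.* j) ≈ int i * int j
    int-* (+ m)    j = nat-*-int m j
    int-* -[1+ m ] j = begin
      int (-[1+ m ] ℤ.* j)          ≡⟨ cong int (sym (ℤ.neg-distribˡ-* (+ suc m) j)) ⟩
      int (ℤ.- (+ suc m ℤ.* j))     ≈⟨ int-neg (+ suc m ℤ.* j) ⟩
      - int (+ suc m ℤ.* j)         ≈⟨ -‿cong (nat-*-int (suc m) j) ⟩
      - (nat (suc m) * int j)       ≈⟨ -‿distribˡ-* _ _ ⟩
      - nat (suc m) * int j         ∎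

    morphism : CommutativeRing.rawRing ℤ.+-*-commutativeRing -Raw-AlmostCommutative⟶ fromCommutativeRing R
    morphism = record
      { ⟦_⟧ = int ; +-homo = int-+ ; *-homo = int-* ; -‿homo = int-neg ; 0-homo = ≈-refl ; 1-homo = ≈-refl }

  open Algebra.Solver.Ring (CommutativeRing.rawRing ℤ.+-*-commutativeRing) (fromCommutativeRing R) morphism
    (λ i j → Maybe.map (λ i≡j → ≈-reflexive (cong int i≡j)) (dec⇒maybe (i ℤ.≟ j))) public
    using (solve; _:=_; _:+_; _:*_; _:-_; :-_; con)

module FieldProperties {N} (K : FiniteField N) where
  open FiniteField K public
  open CommutativeRing commutativeRing public
    using (+-assoc; +-comm; +-identityˡ; +-identityʳ; -‿inverseˡ; -‿inverseʳ; distribˡ; distribʳ; ring; commutativeSemiring)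
  open RingProperties ring public using (-0#≈0#)
  open Exp semiring public using (^-homo-*; ^-assocʳ)
  open CommutativeExp commutativeSemiring public using (^-distrib-*)
  open IntegerCoefficients commutativeRing public
  private module M = Mult semiring
  open Finite enumeration public using (_≟_)

  any? : ∀ {p} {P : Pred Carrier p} → Decidable P → Dec (∃ P)
  any? {P = P} = Finite.any? enumeration (subst P)

  all? : ∀ {p} {P : Pred Carrier p} → Decidable P → Dec (∀ x → P x)
  all? {P = P} = Finite.all? enumeration (subst P)

  ¬∀⇒∃¬ : ∀ {p} {P : Pred Carrier p} → Decidable P → ¬ (∀ x → P x) → ∃ λ x → ¬ P x
  ¬∀⇒∃¬ {P = P} = Finite.¬∀⇒∃¬ enumeration (subst P)

  x-y≡0⇒x≡y : ∀ {x y} → x - y ≡ 0# → x ≡ y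
  x-y≡0⇒x≡y {x} {y} eq = begin
    x              ≡⟨ solve 2 (λ x y → x := (x :- y) :+ y) refl x y ⟩
    (x - y) + y    ≡⟨ cong (_+ y) eq ⟩
    0# + y         ≡⟨ +-identityˡ y ⟩
    y              ∎
    where open ≡-Reasoning

  x≡y⇒x-y≡0 : ∀ {x y} → x ≡ y → x - y ≡ 0#
  x≡y⇒x-y≡0 {x} refl = -‿inverseʳ x

  +-cancelˡ : ∀ x {y z} → x + y ≡ x + z → y ≡ z
  +-cancelˡ x {y} {z} eq = begin
    y            ≡⟨ solve 2 (λ x y → y := (x :+ y) :- x) refl x y ⟩
    (x + y) - x  ≡⟨ cong (_- x) eq ⟩
    (x + z) - x  ≡⟨ solve 2 (λ x y → (x :+ y) :- x := y) refl x z ⟩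
    z            ∎
    where open ≡-Reasoning

  zero-product : ∀ {x y} → x * y ≡ 0# → x ≢ 0# → y ≡ 0#
  zero-product {x} {y} xy≡0 x≢0 with y ≟ 0#
  ... | yes y≡0 = y≡0
  ... | no y≢0 = contradiction xy≡0 (*-≢0 x≢0 y≢0)

  *-cancelˡ : ∀ {x y z} → x ≢ 0# → x * y ≡ x * z → y ≡ z
  *-cancelˡ {x} {y} {z} x≢0 eq = x-y≡0⇒x≡y (zero-product (trans
    (solve 3 (λ x y z → x :* (y :- z) := (x :* y) :- (x :* z)) refl x y z) (x≡y⇒x-y≡0 eq)) x≢0)

  *-cancelʳ : ∀ {x y z} → x ≢ 0# → y * x ≡ z * x → y ≡ z
  *-cancelʳ {x} {y} {z} x≢0 eq = *-cancelˡ x≢0 (trans (*-comm x y) (trans eq (*-comm z x)))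

  -- 0# ⁻¹ is 0#.
  infix 9 _⁻¹
  _⁻¹ : Carrier → Carrier
  x ⁻¹ with x ≟ 0#
  ... | yes _ = 0#
  ... | no x≢0 = proj₁ (reciprocal x x≢0)

  inverseʳ : ∀ {x} → x ≢ 0# → x * x ⁻¹ ≡ 1#
  inverseʳ {x} x≢0 with x ≟ 0#
  ... | yes x≡0 = contradiction x≡0 x≢0
  ... | no x≢0′ = proj₂ (reciprocal x x≢0′)

  inverseˡ : ∀ {x} → x ≢ 0# → x ⁻¹ * x ≡ 1#
  inverseˡ x≢0 = trans (*-comm _ _) (inverseʳ x≢0)

  ⁻¹-≢0 : ∀ {x} → x ≢ 0# → x ⁻¹ ≢ 0#
  ⁻¹-≢0 x≢0 = reciprocal-≢0 (inverseʳ x≢0)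

  *-≢0ˡ : ∀ {x y} → x * y ≢ 0# → x ≢ 0#
  *-≢0ˡ {x} {y} xy≢0 refl = xy≢0 (zeroˡ y)

  divide : ∀ {x} → x ≢ 0# → ∀ y → (y * x ⁻¹) * x ≡ y
  divide {x} x≢0 y = trans (*-assoc y _ x) (trans (cong (y *_) (inverseˡ x≢0)) (*-identityʳ y))

  ^-≢0 : ∀ {x} → x ≢ 0# → ∀ k → x ^ k ≢ 0#
  ^-≢0 x≢0 zero    = 1≢0
  ^-≢0 x≢0 (suc k) = *-≢0 x≢0 (^-≢0 x≢0 k)

  1^ : ∀ k → 1# ^ k ≡ 1#
  1^ zero    = refl
  1^ (suc k) = trans (*-identityˡ _) (1^ k)

  infixr 8 _×₁
  _×₁ : ℕ → Carrier
  k ×₁ = k M.× 1#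

  -- The k-th iterate of translation by 1 is translation by `k ×₁`, which fixes either every element
  -- or none; so the N-th iterate is the identity on the N elements of the field.
  characteristic : N ×₁ ≡ 0#
  characteristic = trans (sym (+-identityʳ _)) (trans (sym (iterated N 0#))
    (iterate-order enumeration (1# +_) (cong (1# +_)) (+-cancelˡ 1#) homogeneous 0#))
    where
    iterated : ∀ k x → (1# +_) ^[ k ] x ≡ k ×₁ + x
    iterated zero    x = sym (+-identityˡ x)
    iterated (suc k) x = trans (cong (1# +_) (iterated k x)) (sym (+-assoc 1# _ x))
    homogeneous : ∀ k {x} y → (1# +_) ^[ k ] x ≡ x → (1# +_) ^[ k ] y ≡ y
    homogeneous k {x} y eq = trans (iterated k y) (trans (cong (_+ y)
      (+-cancelˡ x (trans (+-comm x _) (trans (sym (iterated k x)) (trans eq (sym (+-identityʳ x)))))))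
      (+-identityˡ y))

  abstract
    units : HasOrder (K ˣ) (N ℕ.∸ 1)
    units = go N enumeration
      where
      -- N is generalized in the enumeration alone, since it has to be split into zero and successor
      -- while it indexes the type of `K`. The units are what remains when the index of `0#` is
      -- punched out.
      go : ∀ N → Inverse (setoid Carrier) (setoid (Fin N)) → HasOrder (K ˣ) (N ℕ.∸ 1)
      go zero    e = ⊥-elim (Fin.¬Fin0 (Inverse.to e 0#))
      go (suc M) e = record
        { to        = λ { (x , x≢0) → punchOut (index≢ x≢0) }
        ; from      = λ i → from (punchIn (to 0#) i) , λ eq →
                        Fin.punchInᵢ≢i (to 0#) i (trans (sym (strictlyInverseˡ _)) (cong to eq))
        ; to-cong   = λ {x} {y} eq → Fin.punchOut-cong (to 0#) (cong to eq)
        ; from-cong = λ { refl → refl }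
        ; inverse   =
            (λ {i} eq → trans (Fin.punchOut-cong (to 0#)
               {i≢k = λ eq → Fin.punchInᵢ≢i (to 0#) i (sym eq)} (trans (cong to eq) (strictlyInverseˡ _)))
               (trans (Fin.punchOut-cong (to 0#) refl) (Fin.punchOut-punchIn (to 0#)))) ,
            (λ { {x , x≢0} refl → trans (cong from (Fin.punchIn-punchOut (index≢ x≢0))) (strictlyInverseʳ x) })
        }
        where
        open Inverse e using (to; from; strictlyInverseˡ; strictlyInverseʳ)
        index≢ : ∀ {x} → x ≢ 0# → to 0# ≢ to x
        index≢ x≢0 eq = x≢0 (sym (Finite.to-injective e eq))

  1<N : 1 ℕ.< N
  1<N = go N enumeration
    where
    go : ∀ N → Inverse (setoid Carrier) (setoid (Fin N)) → 1 ℕ.< N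
    go 0 e = ⊥-elim (Fin.¬Fin0 (Inverse.to e 0#))
    go 1 e = ⊥-elim (1≢0 (Finite.to-injective e (trans (unique _) (sym (unique _)))))
      where
      unique : (i : Fin 1) → i ≡ Fin.zero
      unique Fin.zero = refl
    go (suc (suc _)) _ = s≤s (s≤s z≤n)

  instance
    N-1≢0 : NonZero (N ℕ.∸ 1)
    N-1≢0 = ℕ.>-nonZero (ℕ.m<n⇒0<n∸m 1<N)

  fermat : ∀ {x} → x ≢ 0# → x ^ (N ℕ.∸ 1) ≡ 1#
  fermat {x} x≢0 = trans (sym (*-identityʳ _)) (trans (sym (iterated (N ℕ.∸ 1) (1# , 1≢0)))
    (iterate-order units (x∙_) (cong (x *_)) (*-cancelˡ x≢0) homogeneous (1# , 1≢0)))
    where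
    x∙_ : Group.Carrier (K ˣ) → Group.Carrier (K ˣ)
    x∙_ = Group._∙_ (K ˣ) (x , x≢0)
    iterated : ∀ k y → proj₁ (x∙_ ^[ k ] y) ≡ x ^ k * proj₁ y
    iterated zero    y = sym (*-identityˡ _)
    iterated (suc k) y = trans (cong (x *_) (iterated k y)) (sym (*-assoc x _ _))
    homogeneous : ∀ k {y} z → proj₁ (x∙_ ^[ k ] y) ≡ proj₁ y → proj₁ (x∙_ ^[ k ] z) ≡ proj₁ z
    homogeneous k {y} z eq = trans (iterated k z) (trans (cong (_* proj₁ z)
      (*-cancelʳ (proj₂ y) (trans (sym (iterated k y)) (trans eq (sym (*-identityˡ _))))))
      (*-identityˡ _))

  suc[N-1]≡N : suc (N ℕ.∸ 1) ≡ N
  suc[N-1]≡N = ℕ.m+[n∸m]≡n (ℕ.<⇒≤ 1<N)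

  fermat′ : ∀ x → x ^ N ≡ x
  fermat′ x = trans (cong (x ^_) (sym suc[N-1]≡N)) (go (x ≟ 0#))
    where
    go : Dec (x ≡ 0#) → x ^ suc (N ℕ.∸ 1) ≡ x
    go (yes refl) = zeroˡ _
    go (no x≢0) = trans (cong (x *_) (fermat x≢0)) (*-identityʳ x)

-- Frobenius and polynomials

prime∤1 : ∀ {p} → Prime p → ¬ p ∣ 1
prime∤1 pp p∣1 = ℕ.<-irrefl (sym (ℕ.∣1⇒≡1 p∣1)) (ℕ.nonTrivial⇒n>1 _ {{prime⇒nonTrivial pp}})

prime∤! : ∀ {p} → Prime p → ∀ {k} → k ℕ.< p → ¬ p ∣ k !
prime∤! pp {zero}  _   p∣1 = prime∤1 pp p∣1
prime∤! pp {suc k} k<p p∣ with euclidsLemma (suc k) (k !) pp p∣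
... | inj₁ p∣k  = ℕ.>⇒∤ k<p p∣k
... | inj₂ p∣k! = prime∤! pp (ℕ.<-trans (ℕ.n<1+n k) k<p) p∣k!

-- p divides p ! = (p choose k) * k ! * (p - k) !, but neither of the two smaller factorials.
prime∣C : ∀ {p} → Prime p → ∀ {k} → 0 ℕ.< k → k ℕ.< p → p ∣ p choose k
prime∣C {p} pp {k} 0<k k<p
  with euclidsLemma (p choose k) (k ! ℕ.* (p ℕ.∸ k) !) pp (subst (p ∣_) (sym product-formula) (p∣p! p 0<p))
  where
  0<p : 0 ℕ.< p
  0<p = ℕ.<-trans 0<k k<p
  instance
    _ : NonZero (k ! ℕ.* (p ℕ.∸ k) !)
    _ = k ℕ.!* (p ℕ.∸ k) !≢0
  product-formula : (p choose k) ℕ.* (k ! ℕ.* (p ℕ.∸ k) !) ≡ p !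
  product-formula = trans (cong (ℕ._* (k ! ℕ.* (p ℕ.∸ k) !)) (nCk≡n!/k![n-k]! (ℕ.<⇒≤ k<p)))
    (m/n*n≡m (k![n∸k]!∣n! (ℕ.<⇒≤ k<p)))
  p∣p! : ∀ p → 0 ℕ.< p → p ∣ p !
  p∣p! (suc p) _ = ℕ.m∣m*n (p !)
... | inj₁ p∣C = p∣C
... | inj₂ p∣k![p-k]! with euclidsLemma (k !) ((p ℕ.∸ k) !) pp p∣k![p-k]!
...   | inj₁ p∣k! = contradiction p∣k! (prime∤! pp k<p)
...   | inj₂ p∣[p-k]! = contradiction p∣[p-k]! (prime∤! pp (ℕ.∸-monoʳ-< 0<k (ℕ.<⇒≤ k<p)))

prime∤⇒coprime : ∀ {p m} → Prime p → ¬ p ∣ m → Coprime p m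
prime∤⇒coprime pp p∤m (d∣p , d∣m) with prime⇒irreducible pp d∣p
... | inj₁ d≡1 = d≡1
... | inj₂ refl = contradiction d∣m p∤m

coprime-^ : ∀ {m p} → Coprime m p → ∀ j → Coprime m (p ℕ.^ j)
coprime-^ m⊥p zero    (_ , d∣1) = ℕ.∣1⇒≡1 d∣1
coprime-^ m⊥p (suc j) (d∣m , d∣p*p^j) = coprime-^ m⊥p j
  (d∣m , coprime-divisor (λ { (e∣d , e∣p) → m⊥p (ℕ.∣-trans e∣d d∣m , e∣p) }) d∣p*p^j)

coprime-*-∣ : ∀ {m n r} → Coprime m n → m ∣ r → n ∣ r → m ℕ.* n ∣ r
coprime-*-∣ {m} {n} m⊥n (divides a refl) n∣am with coprime-divisor (Coprime.sym m⊥n)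
                                                     (subst (n ∣_) (ℕ.*-comm a m) n∣am)
... | divides b refl = divides b (trans (ℕ.*-assoc b n m) (cong (b ℕ.*_) (ℕ.*-comm n m)))

^-∣ : ∀ p {i j} → i ℕ.≤ j → p ℕ.^ i ∣ p ℕ.^ j
^-∣ p {i} {j} i≤j = divides (p ℕ.^ (j ℕ.∸ i))
  (trans (cong (p ℕ.^_) (sym (ℕ.m∸n+n≡m i≤j))) (ℕ.^-distribˡ-+-* p (j ℕ.∸ i) i))

primePart : ∀ {p} → Prime p → ∀ m → .{{NonZero m}} → ∃₂ λ i m′ → m ≡ p ℕ.^ i ℕ.* m′ × ¬ p ∣ m′
primePart {p} pp m {{m≢0}} = <-rec (λ m → 0 ℕ.< m → ∃₂ λ i m′ → m ≡ p ℕ.^ i ℕ.* m′ × ¬ p ∣ m′) step m (ℕ.>-nonZero⁻¹ m)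
  where
  step : ∀ m → (∀ {k} → k ℕ.< m → 0 ℕ.< k → ∃₂ λ i m′ → k ≡ p ℕ.^ i ℕ.* m′ × ¬ p ∣ m′) →
         0 ℕ.< m → ∃₂ λ i m′ → m ≡ p ℕ.^ i ℕ.* m′ × ¬ p ∣ m′
  step m rec 0<m with p ℕ.∣? m
  ... | no p∤m = 0 , m , sym (ℕ.*-identityˡ m) , p∤m
  ... | yes (divides zero refl) = contradiction 0<m (λ ())
  ... | yes (divides k@(suc _) refl) with rec (ℕ.m<m*n k p (ℕ.nonTrivial⇒n>1 p {{prime⇒nonTrivial pp}})) (s≤s z≤n)
  ...   | i , m′ , k≡ , p∤m′ = suc i , m′ , (begin
          k ℕ.* p                    ≡⟨ ℕ.*-comm k p ⟩
          p ℕ.* k                    ≡⟨ cong (p ℕ.*_) k≡ ⟩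
          p ℕ.* (p ℕ.^ i ℕ.* m′)     ≡⟨ sym (ℕ.*-assoc p _ m′) ⟩
          p ℕ.* p ℕ.^ i ℕ.* m′       ∎) , p∤m′
    where open ≡-Reasoning

primeDivisor : ∀ n → .{{NonZero n}} → n ≢ 1 → ∃ λ p → Prime p × p ∣ n
primeDivisor n n≢1 with factorise n
... | record { factors = [] ; isFactorisation = n≡1 } = contradiction n≡1 n≢1
... | record { factors = p ∷ ps ; isFactorisation = n≡ ; factorsPrime = pp ∷ _ } =
  p , pp , subst (p ∣_) (sym n≡) (ℕ.m∣m*n (ℕ.product ps))

module Characteristic {N} (K : FiniteField N) where
  open FieldProperties K
  private
    module M = Mult semiring
    module S = Sum semiring
    open ≡-Reasoning

  module _ {p} (pp : Prime p) (char-p : p ×₁ ≡ 0#) where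

    private
      multiple-vanishes : ∀ {k} → p ∣ k → ∀ x → k M.× x ≡ 0#
      multiple-vanishes (divides d refl) x = begin
        (d ℕ.* p) M.× x      ≡⟨ sym (M.×-assocˡ x d p) ⟩
        d M.× (p M.× x)      ≡⟨ cong (λ z → d M.× (p M.× z)) (sym (*-identityˡ x)) ⟩
        d M.× (p M.× (1# * x))  ≡⟨ cong (d M.×_) (sym (M.×-assoc-* p 1# x)) ⟩
        d M.× (p ×₁ * x)     ≡⟨ cong (λ z → d M.× (z * x)) char-p ⟩
        d M.× (0# * x)       ≡⟨ sym (M.×-assoc-* d 0# x) ⟩
        (d M.× 0#) * x       ≡⟨ cong (_* x) (trans (sym (S.sum-replicate d)) (S.sum-replicate-zero d)) ⟩
        0# * x               ≡⟨ zeroˡ x ⟩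
        0#                   ∎

    freshman : ∀ x y → (x + y) ^ p ≡ x ^ p + y ^ p
    freshman x y = go p refl
      where
      go : ∀ r → p ≡ r → (x + y) ^ p ≡ x ^ p + y ^ p
      go zero    refl = contradiction (prime⇒nonZero pp) λ { () }
      go (suc r) refl = begin
        (x + y) ^ p                                       ≡⟨ Binomial.theorem commutativeSemiring p x y ⟩
        t Fin.zero + S.sum (t ∘ Fin.suc)                  ≡⟨ cong (t Fin.zero +_) (S.sum-init-last (t ∘ Fin.suc)) ⟩
        t Fin.zero + (S.sum middle + t (Fin.fromℕ p))     ≡⟨ cong₂ (λ a b → a + (b + t (Fin.fromℕ p))) first middle-vanishes ⟩
        y ^ p + (0# + t (Fin.fromℕ p))                    ≡⟨ cong (λ a → y ^ p + (0# + a)) last-term ⟩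
        y ^ p + (0# + x ^ p)                              ≡⟨ solve 2 (λ a b → b :+ (con (ℤ.+ 0) :+ a) := a :+ b) refl (x ^ p) (y ^ p) ⟩
        x ^ p + y ^ p                                     ∎
        where
        t : Fin (suc p) → Carrier
        t = Binomial.binomialTerm commutativeSemiring x y p
        middle : Fin r → Carrier
        middle i = t (Fin.suc (Fin.inject₁ i))
        first : t Fin.zero ≡ y ^ p
        first = trans (M.×-homo-1 _) (*-identityˡ _)
        last-term : t (Fin.fromℕ p) ≡ x ^ p
        last-term = begin
          (p choose toℕ (Fin.fromℕ p)) M.× (x ^ toℕ (Fin.fromℕ p) * y ^ (p ℕ.∸ toℕ (Fin.fromℕ p)))
            ≡⟨ cong (λ k → (p choose k) M.× (x ^ k * y ^ (p ℕ.∸ k))) (Fin.toℕ-fromℕ p) ⟩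
          (p choose p) M.× (x ^ p * y ^ (p ℕ.∸ p))
            ≡⟨ cong₂ (λ c k → c M.× (x ^ p * y ^ k)) (nCn≡1 p) (ℕ.n∸n≡0 p) ⟩
          1 M.× (x ^ p * 1#)
            ≡⟨ trans (M.×-homo-1 _) (*-identityʳ _) ⟩
          x ^ p ∎
        middle-vanishes : S.sum middle ≡ 0#
        middle-vanishes = trans (S.sum-cong-≗ λ i → multiple-vanishes
          (prime∣C pp (s≤s z≤n) (s≤s (subst (ℕ._< r) (sym (Fin.toℕ-inject₁ i)) (Fin.toℕ<n i)))) _)
          (S.sum-replicate-zero r)

    frobenius-+ : ∀ e x y → (x + y) ^ (p ℕ.^ e) ≡ x ^ (p ℕ.^ e) + y ^ (p ℕ.^ e)
    frobenius-+ zero    x y = trans (*-identityʳ _) (sym (cong₂ _+_ (*-identityʳ x) (*-identityʳ y)))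
    frobenius-+ (suc e) x y = begin
      (x + y) ^ (p ℕ.* p ℕ.^ e)                     ≡⟨ sym (^-assocʳ _ p (p ℕ.^ e)) ⟩
      ((x + y) ^ p) ^ (p ℕ.^ e)                     ≡⟨ cong (_^ (p ℕ.^ e)) (freshman x y) ⟩
      (x ^ p + y ^ p) ^ (p ℕ.^ e)                   ≡⟨ frobenius-+ e (x ^ p) (y ^ p) ⟩
      (x ^ p) ^ (p ℕ.^ e) + (y ^ p) ^ (p ℕ.^ e)     ≡⟨ cong₂ _+_ (^-assocʳ _ p _) (^-assocʳ _ p _) ⟩
      x ^ (p ℕ.* p ℕ.^ e) + y ^ (p ℕ.* p ℕ.^ e)     ∎

  -- `(p ^ e) ×₁` is a product of e factors `p ×₁`, and a field has no zero divisors. This lets the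
  -- prime characteristic be read off from the size of F_q.
  prime-characteristic : ∀ p e → (p ℕ.^ e) ×₁ ≡ 0# → p ×₁ ≡ 0#
  prime-characteristic p zero    eq = contradiction (trans (sym (+-identityʳ 1#)) eq) 1≢0
  prime-characteristic p (suc e) eq with p ×₁ ≟ 0#
  ... | yes p≡0 = p≡0
  ... | no p≢0 = prime-characteristic p e (zero-product (trans (sym (M.×1-homo-* p (p ℕ.^ e))) eq) p≢0)

-- A list cs of length m stands for the monic polynomial of degree m with
-- lower coefficients cs, evaluated by Horner's rule.
module Polynomial {N} (K : FiniteField N) where
  open FieldProperties K
  open Space K
  open ≡-Reasoning

  value : List Carrier → Carrier → Carrier
  value []       z = 1#
  value (c ∷ cs) z = c + z * value cs z

  -- The quotient of X·cs + c by X - k, which does not depend on c.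
  quotient : Carrier → List Carrier → List Carrier
  quotient k []       = []
  quotient k (d ∷ ds) = value (d ∷ ds) k ∷ quotient k ds

  length-quotient : ∀ k cs → length (quotient k cs) ≡ length cs
  length-quotient k []       = refl
  length-quotient k (d ∷ ds) = cong suc (length-quotient k ds)

  remainder : ∀ k c cs z → value (c ∷ cs) z ≡ (z - k) * value (quotient k cs) z + value (c ∷ cs) k
  remainder k c [] z = solve 4 (λ k c z u → c :+ z :* u := (z :- k) :* u :+ (c :+ k :* u)) refl k c z 1#
  remainder k c (d ∷ ds) z = trans (cong (λ w → c + z * w) (remainder k d ds z))
    (solve 5 (λ k c z Q r → c :+ z :* ((z :- k) :* Q :+ r) := (z :- k) :* (r :+ z :* Q) :+ (c :+ k :* r)) refl
      k c z (value (quotient k ds) z) (value (d ∷ ds) k))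

  quotient-root : ∀ {k c cs z} → value (c ∷ cs) k ≡ 0# → z ≢ k → value (c ∷ cs) z ≡ 0# →
                  value (quotient k cs) z ≡ 0#
  quotient-root {k} {c} {cs} {z} Pk≡0 z≢k Pz≡0 = zero-product (begin
    (z - k) * Q             ≡⟨ sym (+-identityʳ _) ⟩
    (z - k) * Q + 0#        ≡⟨ cong ((z - k) * Q +_) (sym Pk≡0) ⟩
    (z - k) * Q + value (c ∷ cs) k  ≡⟨ sym (remainder k c cs z) ⟩
    value (c ∷ cs) z        ≡⟨ Pz≡0 ⟩
    0#                      ∎) (λ eq → z≢k (x-y≡0⇒x≡y eq))
    where Q = value (quotient k cs) z

  root-bound : ∀ cs {ks} → Unique ks → length ks ≡ length cs → All (λ k → value cs k ≡ 0#) ks →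
               ∀ {z} → value cs z ≡ 0# → z ∈ˡ ks
  root-bound []       {[]}     _              _  _             eq = contradiction eq 1≢0
  root-bound (c ∷ cs) {k ∷ ks} (k∉ks ∷ uniq) len (Pk ∷ roots) {z} Pz with z ≟ k
  ... | yes z≡k = here z≡k
  ... | no z≢k = there (root-bound (quotient k cs) uniq (trans (ℕ.suc-injective len) (sym (length-quotient k cs)))
    (All.zipWith (λ { (k≢k′ , Pk′) → quotient-root {c = c} {cs} Pk (λ k′≡k → k≢k′ (sym k′≡k)) Pk′ }) (k∉ks , roots))
    (quotient-root {c = c} {cs} Pk z≢k Pz))

  -- X ^ suc m - 1#
  unity : ℕ → List Carrier
  unity m = - 1# ∷ List.replicate m 0#

  length-unity : ∀ m → length (unity m) ≡ suc m
  length-unity m = cong suc (List.length-replicate m)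

  value-replicate : ∀ m z → value (List.replicate m 0#) z ≡ z ^ m
  value-replicate zero    z = refl
  value-replicate (suc m) z = trans (+-identityˡ _) (cong (z *_) (value-replicate m z))

  unity-root : ∀ m {z} → z ^ suc m ≡ 1# → value (unity m) z ≡ 0#
  unity-root m {z} eq = begin
    - 1# + z * value (List.replicate m 0#) z  ≡⟨ cong (λ w → - 1# + z * w) (value-replicate m z) ⟩
    - 1# + z ^ suc m                          ≡⟨ cong (- 1# +_) eq ⟩
    - 1# + 1#                                 ≡⟨ -‿inverseˡ 1# ⟩
    0#                                        ∎

  module Operator (A : Matrix) where

    -- The vector v P(A), for the polynomial P stored in the list, again by Horner's rule.
    -- Accordingly `v ·- k` is v (A - k), and `productᵥ` applies a product of such factors to v.
    valueᵥ : List Carrier → V → V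
    valueᵥ []       v = v
    valueᵥ (c ∷ cs) v = c *ᵥ v +ᵥ valueᵥ cs v · A

    infix 7 _·-_
    _·-_ : V → Carrier → V
    v ·- k = v · A +ᵥ (- k) *ᵥ v

    productᵥ : List Carrier → V → V
    productᵥ []       v = v
    productᵥ (k ∷ ks) v = productᵥ ks v ·- k

    -- The division identity of `remainder` with the matrix A in place of z; A commutes with
    -- scalars, so the same computation goes through.
    remainderᵥ : ∀ k c cs v → valueᵥ (c ∷ cs) v ≡ valueᵥ (quotient k cs) v ·- k +ᵥ value (c ∷ cs) k *ᵥ v
    remainderᵥ k c [] (x , y) = cong₂ _,_
      (linear x (proj₁ ((x , y) · A))) (linear y (proj₂ ((x , y) · A)))
      where
      linear : ∀ x xA → _
      linear = solve 4 (λ k c x xA → c :* x :+ xA := xA :+ (:- k) :* x :+ (c :+ k :* con (ℤ.+ 1)) :* x) refl k c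
    remainderᵥ k c (d ∷ ds) v = trans (cong (λ w → c *ᵥ v +ᵥ w · A) (remainderᵥ k d ds v))
      (horner A (valueᵥ (quotient k ds) v) v (value (d ∷ ds) k))
      where
      horner : ∀ A w v r → c *ᵥ v +ᵥ ((w · A +ᵥ (- k) *ᵥ w) +ᵥ r *ᵥ v) · A ≡
               ((r *ᵥ v +ᵥ w · A) · A +ᵥ (- k) *ᵥ (r *ᵥ v +ᵥ w · A)) +ᵥ (c + k * r) *ᵥ v
      horner (mat a b e f) (w , w′) (v , v′) r = cong₂ _,_
        (identity₁ w w′ v v′ r c k a b e f) (identity₂ w w′ v v′ r c k a b e f)
        where
        identity₁ : ∀ w w′ v v′ r c k a b e f → _
        identity₁ = solve 11 (λ w w′ v v′ r c k a b e f →
          let t  = w :* a :+ w′ :* e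
              t′ = w :* b :+ w′ :* f
          in c :* v :+ (((t :+ (:- k) :* w) :+ r :* v) :* a :+ ((t′ :+ (:- k) :* w′) :+ r :* v′) :* e) :=
             (((r :* v :+ t) :* a :+ (r :* v′ :+ t′) :* e) :+ (:- k) :* (r :* v :+ t)) :+ (c :+ k :* r) :* v) refl
        identity₂ : ∀ w w′ v v′ r c k a b e f → _
        identity₂ = solve 11 (λ w w′ v v′ r c k a b e f →
          let t  = w :* a :+ w′ :* e
              t′ = w :* b :+ w′ :* f
          in c :* v′ :+ (((t :+ (:- k) :* w) :+ r :* v) :* b :+ ((t′ :+ (:- k) :* w′) :+ r :* v′) :* f) :=
             (((r :* v :+ t) :* b :+ (r :* v′ :+ t′) :* f) :+ (:- k) :* (r :* v′ :+ t′)) :+ (c :+ k :* r) :* v′) refl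

    -- With as many distinct roots as its degree, the polynomial is the product of its linear
    -- factors; at each division the remainder is the value at a root, hence zero.
    valueᵥ-product : ∀ cs {ks} → Unique ks → length ks ≡ length cs → All (λ k → value cs k ≡ 0#) ks →
                     ∀ v → valueᵥ cs v ≡ productᵥ ks v
    valueᵥ-product []       {[]}     _              _   _            v = refl
    valueᵥ-product (c ∷ cs) {k ∷ ks} (k∉ks ∷ uniq) len (Pk ∷ roots) v = begin
      valueᵥ (c ∷ cs) v                                            ≡⟨ remainderᵥ k c cs v ⟩
      valueᵥ (quotient k cs) v ·- k +ᵥ value (c ∷ cs) k *ᵥ v       ≡⟨ cong (λ r → valueᵥ (quotient k cs) v ·- k +ᵥ r *ᵥ v) Pk ⟩
      valueᵥ (quotient k cs) v ·- k +ᵥ 0# *ᵥ v                     ≡⟨ cong₂ _,_ (drop _ _) (drop _ _) ⟩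
      valueᵥ (quotient k cs) v ·- k                                ≡⟨ cong (_·- k) (valueᵥ-product (quotient k cs) uniq
        (trans (ℕ.suc-injective len) (sym (length-quotient k cs)))
        (All.zipWith (λ { (k≢k′ , Pk′) → quotient-root {c = c} {cs} Pk (λ k′≡k → k≢k′ (sym k′≡k)) Pk′ }) (k∉ks , roots)) v) ⟩
      productᵥ ks v ·- k                                           ∎
      where
      drop : ∀ x y → x + 0# * y ≡ x
      drop x y = trans (cong (x +_) (zeroˡ y)) (+-identityʳ x)

    private
      eigen : ∀ k x y → x + (- k) * y ≡ 0# → x ≡ k * y
      eigen k x y eq = x-y≡0⇒x≡y (trans (solve 3 (λ x y k → x :- k :* y := x :+ (:- k) :* y) refl x y k) eq)

    -- Strip factors from the outside until the remaining product applied to v is nonzero. The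
    -- factor stripped last kills that vector, so it is an eigenvector.
    annihilated⇒eigenvector : ∀ ks {v} → v ≢ 0ᵥ → productᵥ ks v ≡ 0ᵥ → ∃₂ λ w k → w ≢ 0ᵥ × w · A ≡ k *ᵥ w
    annihilated⇒eigenvector [] v≢0 eq = contradiction eq v≢0
    annihilated⇒eigenvector (k ∷ ks) {v} v≢0 eq = decide (proj₁ w ≟ 0#) (proj₂ w ≟ 0#)
      where
      w : V
      w = productᵥ ks v
      found : w ≢ 0ᵥ → ∃₂ λ w k → w ≢ 0ᵥ × w · A ≡ k *ᵥ w
      found w≢0 = w , k , w≢0 , cong₂ _,_ (eigen k _ (proj₁ w) (cong proj₁ eq)) (eigen k _ (proj₂ w) (cong proj₂ eq))
      decide : Dec (proj₁ w ≡ 0#) → Dec (proj₂ w ≡ 0#) → ∃₂ λ w k → w ≢ 0ᵥ × w · A ≡ k *ᵥ w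
      decide (yes p) (yes p′) = annihilated⇒eigenvector ks v≢0 (cong₂ _,_ p p′)
      decide (no ≢0) _        = found λ w≡0 → ≢0 (cong proj₁ w≡0)
      decide (yes _) (no ≢0)  = found λ w≡0 → ≢0 (cong proj₂ w≡0)

    -- X ^ (N ∸ 1) - 1# splits into linear factors over K.
    periodic⇒eigenvector : ∀ {v} → v ≢ 0ᵥ → (_· A) ^[ N ℕ.∸ 1 ] v ≡ v → ∃₂ λ w k → w ≢ 0ᵥ × w · A ≡ k *ᵥ w
    periodic⇒eigenvector {v} v≢0 = go (N ℕ.∸ 1) units fermat
      where
      iterated : ∀ m → valueᵥ (List.replicate m 0#) v ≡ (_· A) ^[ m ] v
      iterated zero    = refl
      iterated (suc m) = trans (cong₂ _,_ (drop _ _) (drop _ _)) (cong (_· A) (iterated m))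
        where
        drop : ∀ x y → 0# * x + y ≡ y
        drop x y = trans (cong (_+ y) (zeroˡ x)) (+-identityˡ y)
      go : ∀ m → .{{NonZero m}} → HasOrder (K ˣ) m → (∀ {x} → x ≢ 0# → x ^ m ≡ 1#) → (_· A) ^[ m ] v ≡ v →
           ∃₂ λ w k → w ≢ 0ᵥ × w · A ≡ k *ᵥ w
      go (suc m) e fermat-m period = annihilated⇒eigenvector ks v≢0 (begin
        productᵥ ks v                                        ≡⟨ sym (valueᵥ-product (unity m)
          (Unique.tabulate⁺ λ {i} {j} eq → trans (sym (strictlyInverseˡ i)) (trans (to-cong eq) (strictlyInverseˡ j)))
          (trans (List.length-tabulate unit) (sym (length-unity m)))
          (All.tabulate⁺ λ i → unity-root m (fermat-m (proj₂ (from i)))) v) ⟩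
        (- 1#) *ᵥ v +ᵥ valueᵥ (List.replicate m 0#) v · A    ≡⟨ cong (λ w → (- 1#) *ᵥ v +ᵥ w · A) (iterated m) ⟩
        (- 1#) *ᵥ v +ᵥ (_· A) ^[ suc m ] v                   ≡⟨ cong ((- 1#) *ᵥ v +ᵥ_) period ⟩
        (- 1#) *ᵥ v +ᵥ v                                     ≡⟨ cong₂ _,_ (cancel _) (cancel _) ⟩
        0ᵥ                                                   ∎)
        where
        open Inverse e using (from; to-cong; strictlyInverseˡ)
        unit : Fin (suc m) → Carrier
        unit i = proj₁ (from i)
        ks : List Carrier
        ks = List.tabulate unit
        cancel : ∀ x → (- 1#) * x + x ≡ 0#
        cancel = solve 1 (λ x → con (ℤ.-[1+ 0 ]) :* x :+ x := con (ℤ.+ 0)) refl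

-- Finite multiplicative groups are cyclic

module CyclicSubgroups {N} (K : FiniteField N) where
  open FieldProperties K
  open Polynomial K

  IsOrder : Carrier → ℕ → Set
  IsOrder x m = x ^ m ≡ 1# × (∀ k → x ^ k ≡ 1# → m ∣ k)

  order-≢0 : ∀ {x m} → x ≢ 0# → IsOrder x m → NonZero m
  order-≢0 {m = suc m} _   _           = _
  order-≢0 {m = zero}  x≢0 (_ , least) = contradiction (ℕ.0∣⇒≡0 (least _ (fermat x≢0))) (ℕ.≢-nonZero⁻¹ (N ℕ.∸ 1))

  1^-* : ∀ {x} k → x ^ k ≡ 1# → ∀ d → x ^ (d ℕ.* k) ≡ 1#
  1^-* {x} k eq d = begin
    x ^ (d ℕ.* k)  ≡⟨ cong (x ^_) (ℕ.*-comm d k) ⟩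
    x ^ (k ℕ.* d)  ≡⟨ sym (^-assocʳ x k d) ⟩
    (x ^ k) ^ d    ≡⟨ cong (_^ d) eq ⟩
    1# ^ d         ≡⟨ 1^ d ⟩
    1#             ∎
    where open ≡-Reasoning

  order : ∀ {x} → x ≢ 0# → ∃ (IsOrder x)
  order {x} x≢0 = Generator.o period , Generator.member period , Generator.minimal period
    where
    open ≡-Reasoning
    add : ∀ a b → x ^ a ≡ 1# → x ^ b ≡ 1# → x ^ (a ℕ.+ b) ≡ 1#
    add a b p q = begin
      x ^ (a ℕ.+ b)  ≡⟨ ^-homo-* x a b ⟩
      x ^ a * x ^ b  ≡⟨ cong₂ _*_ p q ⟩
      1# * 1#        ≡⟨ *-identityˡ 1# ⟩
      1#             ∎
    cancel : ∀ a b → x ^ b ≡ 1# → x ^ (a ℕ.+ b) ≡ 1# → x ^ a ≡ 1#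
    cancel a b q pq = begin
      x ^ a          ≡⟨ sym (*-identityʳ (x ^ a)) ⟩
      x ^ a * 1#     ≡⟨ cong (x ^ a *_) (sym q) ⟩
      x ^ a * x ^ b  ≡⟨ sym (^-homo-* x a b) ⟩
      x ^ (a ℕ.+ b)  ≡⟨ pq ⟩
      1#             ∎
    period : Generator (λ k → x ^ k ≡ 1#)
    period = leastPeriod (λ k → x ^ k ≟ 1#) add cancel (N ℕ.∸ 1) (fermat x≢0)

  order-^ : ∀ {x} d e → .{{NonZero e}} → IsOrder x (e ℕ.* d) → IsOrder (x ^ e) d
  order-^ {x} d e (x^ed≡1 , least) = trans (^-assocʳ x e d) x^ed≡1 ,
    λ k eq → ℕ.*-cancelˡ-∣ e (least (e ℕ.* k) (trans (sym (^-assocʳ x e k)) eq))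

  -- Raising (x y) ^ r to the power k removes y, so that an exponent of the product can be compared
  -- with the order of one factor.
  eliminate : ∀ {x y} k r → y ^ k ≡ 1# → (x * y) ^ r ≡ 1# → x ^ (k ℕ.* r) ≡ 1#
  eliminate {x} {y} k r y^k≡1 xy^r≡1 = begin
    x ^ (k ℕ.* r)                    ≡⟨ sym (*-identityʳ (x ^ (k ℕ.* r))) ⟩
    x ^ (k ℕ.* r) * 1#               ≡⟨ cong (x ^ (k ℕ.* r) *_) (sym y^kr≡1) ⟩
    x ^ (k ℕ.* r) * y ^ (k ℕ.* r)    ≡⟨ sym (^-distrib-* x y (k ℕ.* r)) ⟩
    (x * y) ^ (k ℕ.* r)              ≡⟨ 1^-* {x * y} r xy^r≡1 k ⟩
    1#                               ∎
    where
    open ≡-Reasoning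
    y^kr≡1 : y ^ (k ℕ.* r) ≡ 1#
    y^kr≡1 = trans (cong (y ^_) (ℕ.*-comm k r)) (1^-* {y} k y^k≡1 r)

  -- If r is an exponent of x y, then `eliminate` gives m ∣ k r and k ∣ m r, and coprimality turns
  -- these into m ∣ r and k ∣ r.
  order-* : ∀ {x y m k} → IsOrder x m → IsOrder y k → Coprime m k → IsOrder (x * y) (m ℕ.* k)
  order-* {x} {y} {m} {k} (x^m , x-least) (y^k , y-least) m⊥k = xy^mk≡1 , λ r eq →
    coprime-*-∣ m⊥k
      (coprime-divisor {m} {k} {r} m⊥k (x-least (k ℕ.* r) (eliminate k r y^k eq)))
      (coprime-divisor {k} {m} {r} (Coprime.sym m⊥k)
        (y-least (m ℕ.* r) (eliminate m r x^m (trans (cong (_^ r) (*-comm y x)) eq))))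
    where
    xy^mk≡1 : (x * y) ^ (m ℕ.* k) ≡ 1#
    xy^mk≡1 = begin
      (x * y) ^ (m ℕ.* k)              ≡⟨ ^-distrib-* x y (m ℕ.* k) ⟩
      x ^ (m ℕ.* k) * y ^ (m ℕ.* k)    ≡⟨ cong₂ _*_ (trans (cong (x ^_) (ℕ.*-comm m k)) (1^-* {x} m x^m k)) (1^-* {y} k y^k m) ⟩
      1# * 1#                          ≡⟨ *-identityˡ 1# ⟩
      1#                               ∎
      where open ≡-Reasoning

  powers-≤ : ∀ {c m} → c ≢ 0# → IsOrder c m → ∀ {i j : Fin m} → toℕ i ℕ.≤ toℕ j → c ^ toℕ i ≡ c ^ toℕ j → i ≡ j
  powers-≤ {c} {m} c≢0 (_ , least) {i} {j} i≤j eq = gap (toℕ j ℕ.∸ toℕ i) refl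
    where
    open ≡-Reasoning
    c^[j∸i]≡1 : c ^ (toℕ j ℕ.∸ toℕ i) ≡ 1#
    c^[j∸i]≡1 = *-cancelˡ {c ^ toℕ i} {c ^ (toℕ j ℕ.∸ toℕ i)} {1#} (^-≢0 c≢0 (toℕ i)) (begin
      c ^ toℕ i * c ^ (toℕ j ℕ.∸ toℕ i)    ≡⟨ sym (^-homo-* c (toℕ i) (toℕ j ℕ.∸ toℕ i)) ⟩
      c ^ (toℕ i ℕ.+ (toℕ j ℕ.∸ toℕ i))    ≡⟨ cong (c ^_) (ℕ.m+[n∸m]≡n i≤j) ⟩
      c ^ toℕ j                            ≡⟨ sym eq ⟩
      c ^ toℕ i                            ≡⟨ sym (*-identityʳ (c ^ toℕ i)) ⟩
      c ^ toℕ i * 1#                       ∎)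
    gap : ∀ d → toℕ j ℕ.∸ toℕ i ≡ d → i ≡ j
    gap zero    j∸i≡0 = Fin.toℕ-injective (ℕ.≤-antisym i≤j (ℕ.m∸n≡0⇒m≤n j∸i≡0))
    gap (suc d) j∸i≡  = contradiction (ℕ.∣⇒≤ (subst (m ∣_) j∸i≡ (least (toℕ j ℕ.∸ toℕ i) c^[j∸i]≡1)))
      (ℕ.<⇒≱ (subst (ℕ._< m) j∸i≡ (ℕ.≤-<-trans (ℕ.m∸n≤m (toℕ j) (toℕ i)) (Fin.toℕ<n j))))

  powers-injective : ∀ {c m} → c ≢ 0# → IsOrder c m → ∀ {i j : Fin m} → c ^ toℕ i ≡ c ^ toℕ j → i ≡ j
  powers-injective c≢0 c-ord {i} {j} eq with ℕ.≤-total (toℕ i) (toℕ j)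
  ... | inj₁ i≤j = powers-≤ c≢0 c-ord i≤j eq
  ... | inj₂ j≤i = sym (powers-≤ c≢0 c-ord j≤i (sym eq))

  -- The powers of c already exhaust the roots of X ^ m - 1#.
  order⇒generates : ∀ {c m x} → c ≢ 0# → IsOrder c m → x ^ m ≡ 1# → ∃ λ (i : Fin m) → x ≡ c ^ toℕ i
  order⇒generates {m = zero}  c≢0 ord x^m = contradiction (order-≢0 c≢0 ord) λ { () }
  order⇒generates {c} {suc m} c≢0 c-ord x^m = List.∈-tabulate⁻ (root-bound (unity m)
    (Unique.tabulate⁺ (powers-injective c≢0 c-ord))
    (trans (List.length-tabulate powers) (sym (length-unity m)))
    (All.tabulate⁺ λ i → unity-root m (trans (^-assocʳ c (toℕ i) (suc m)) (1^-* {c} (suc m) (proj₁ c-ord) (toℕ i))))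
    (unity-root m x^m))
    where
    powers : Fin (suc m) → Carrier
    powers i = c ^ toℕ i

  module _ {p} {P : Pred Carrier p} (P-≢0 : ∀ {x} → P x → x ≢ 0#)
           (P-1 : P 1#) (P-* : ∀ {x y} → P x → P y → P (x * y)) where

    P-^ : ∀ {x} → P x → ∀ k → P (x ^ k)
    P-^ Px zero    = P-1
    P-^ Px (suc k) = P-* Px (P-^ Px k)

    -- Write m = r ^ i * m′ with m′ prime to r. If j ≤ i, then x itself serves. Otherwise x ^ (r ^
    -- i) has order m′, and multiplying it by y replaces the r-part of m by the larger power r ^ j.
    mergePrimePower : ∀ {x y m r} j → Prime r → P x → P y → IsOrder x m → IsOrder y (r ℕ.^ j) →
                      ∃₂ λ c o → P c × IsOrder c o × m ∣ o × r ℕ.^ j ∣ o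
    mergePrimePower {x} {y} {m} {r} j pr Px Py x-ord y-ord
      with primePart pr m {{order-≢0 (P-≢0 Px) x-ord}}
    ... | i , m′ , refl , r∤m′ with ℕ.≤-total j i
    ...   | inj₁ j≤i = x , m , Px , x-ord , ℕ.∣-refl , ℕ.∣-trans (^-∣ r j≤i) (ℕ.m∣m*n m′)
    ...   | inj₂ i≤j = x ^ (r ℕ.^ i) * y , m′ ℕ.* r ℕ.^ j , P-* (P-^ Px (r ℕ.^ i)) Py ,
            order-* (order-^ m′ (r ℕ.^ i) x-ord) y-ord (coprime-^ (Coprime.sym (prime∤⇒coprime pr r∤m′)) j) ,
            subst (_∣ m′ ℕ.* r ℕ.^ j) (ℕ.*-comm m′ (r ℕ.^ i)) (ℕ.*-monoʳ-∣ m′ (^-∣ r i≤j)) , ℕ.n∣m*n m′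
      where instance
        _ : NonZero (r ℕ.^ i)
        _ = ℕ.m^n≢0 r i {{prime⇒nonZero pr}}

    -- Strong induction on k = r ^ (j + 1) * k′. The power y ^ k′ has prime power order and is
    -- merged at once; the power y ^ (r ^ (j + 1)) has the smaller order k′ and is left to the
    -- induction.
    merge : ∀ k {x y m} → P x → P y → IsOrder x m → IsOrder y k → ∃₂ λ c o → P c × IsOrder c o × m ∣ o × k ∣ o
    merge = <-rec (λ k → ∀ {x y m} → P x → P y → IsOrder x m → IsOrder y k →
                         ∃₂ λ c o → P c × IsOrder c o × m ∣ o × k ∣ o) step
      where
      step : ∀ k → (∀ {k′} → k′ ℕ.< k → ∀ {x y m} → P x → P y → IsOrder x m → IsOrder y k′ →
                    ∃₂ λ c o → P c × IsOrder c o × m ∣ o × k′ ∣ o) →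
             ∀ {x y m} → P x → P y → IsOrder x m → IsOrder y k → ∃₂ λ c o → P c × IsOrder c o × m ∣ o × k ∣ o
      step k rec {x} {y} {m} Px Py x-ord y-ord with k ℕ.≟ 1
      ... | yes refl = x , m , Px , x-ord , ℕ.∣-refl , ℕ.1∣ m
      ... | no k≢1 with primeDivisor k {{order-≢0 (P-≢0 Py) y-ord}} k≢1
      ...   | r , pr , r∣k with primePart pr k {{order-≢0 (P-≢0 Py) y-ord}}
      ...     | zero  , k′ , refl , r∤k′ = contradiction (subst (r ∣_) (ℕ.*-identityˡ k′) r∣k) r∤k′
      ...     | suc j , k′ , refl , r∤k′ = combine (mergePrimePower (suc j) pr Px (P-^ Py k′) x-ord
                  (order-^ (r ℕ.^ suc j) k′ (subst (IsOrder y) (ℕ.*-comm (r ℕ.^ suc j) k′) y-ord)))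
        where
        instance
          r^≢0 : NonZero (r ℕ.^ suc j)
          r^≢0 = ℕ.m^n≢0 r (suc j) {{prime⇒nonZero pr}}
          k′≢0 : NonZero k′
          k′≢0 = ℕ.m*n≢0⇒n≢0 (r ℕ.^ suc j) {{order-≢0 (P-≢0 Py) y-ord}}
        1<r^ : 1 ℕ.< r ℕ.^ suc j
        1<r^ = ℕ.<-≤-trans (ℕ.nonTrivial⇒n>1 r {{prime⇒nonTrivial pr}})
          (ℕ.m≤m*n r (r ℕ.^ j) {{ℕ.m^n≢0 r j {{prime⇒nonZero pr}}}})
        combine : (∃₂ λ c o → P c × IsOrder c o × m ∣ o × r ℕ.^ suc j ∣ o) →
                  ∃₂ λ c o → P c × IsOrder c o × m ∣ o × k ∣ o
        combine (c , o , Pc , c-ord , m∣o , r^∣o)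
          with rec (subst (k′ ℕ.<_) (ℕ.*-comm k′ (r ℕ.^ suc j)) (ℕ.m<m*n k′ (r ℕ.^ suc j) 1<r^))
                 Pc (P-^ Py (r ℕ.^ suc j)) c-ord (order-^ k′ (r ℕ.^ suc j) y-ord)
        ... | c′ , o′ , Pc′ , c′-ord , o∣o′ , k′∣o′ = c′ , o′ , Pc′ , c′-ord , ℕ.∣-trans m∣o o∣o′ ,
              coprime-*-∣ (Coprime.sym (coprime-^ (Coprime.sym (prime∤⇒coprime pr r∤k′)) (suc j))) (ℕ.∣-trans r^∣o o∣o′) k′∣o′

    -- The order of c is an exponent of the whole list, so by `order⇒generates` every listed element
    -- is a power of c. Applied to a list of all members, this is the cyclicity of a finite subgroup
    -- of `K ˣ`.
    commonGenerator : ∀ {xs} → All P xs → ∃₂ λ c o → P c × IsOrder c o × All (λ x → x ^ o ≡ 1#) xs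
    commonGenerator [] = 1# , 1 , P-1 , (*-identityʳ 1# , λ k _ → ℕ.1∣ k) , []
    commonGenerator {x ∷ xs} (Px ∷ Pxs) = extend (commonGenerator Pxs) (order (P-≢0 Px))
      where
      vanish : ∀ {y} o {o′} → o ∣ o′ → y ^ o ≡ 1# → y ^ o′ ≡ 1#
      vanish {y} o (divides d refl) y^o = 1^-* {y} o y^o d
      extend : (∃₂ λ c o → P c × IsOrder c o × All (λ x → x ^ o ≡ 1#) xs) → ∃ (IsOrder x) →
               ∃₂ λ c o → P c × IsOrder c o × All (λ x → x ^ o ≡ 1#) (x ∷ xs)
      extend (c , o , Pc , c-ord , xs^o) (m , x-ord) with merge m Pc Px c-ord x-ord
      ... | c′ , o′ , Pc′ , c′-ord , o∣o′ , m∣o′ = c′ , o′ , Pc′ , c′-ord ,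
            vanish {x} m m∣o′ (proj₁ x-ord) ∷ All.map (λ {y} → vanish {y} o o∣o′) xs^o

-- The plane K × K

module Plane {N} (K : FiniteField N) where
  open FieldProperties K
  open Space K
  open ≡-Reasoning

  negᵥ : V → V
  negᵥ (x , y) = - x , - y

  infixl 6 _-ᵥ_
  _-ᵥ_ : V → V → V
  u -ᵥ v = u +ᵥ negᵥ v

  infix 4 _≟ᵥ_
  _≟ᵥ_ : (u v : V) → Dec (u ≡ v)
  (x , y) ≟ᵥ (x′ , y′) = map′ (λ { (refl , refl) → refl }) (λ { refl → refl , refl }) (x ≟ x′ ×-dec y ≟ y′)

  +ᵥ-comm : ∀ u v → u +ᵥ v ≡ v +ᵥ u
  +ᵥ-comm (a , b) (c , d) = cong₂ _,_ (+-comm a c) (+-comm b d)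

  +ᵥ-assoc : ∀ u v w → (u +ᵥ v) +ᵥ w ≡ u +ᵥ (v +ᵥ w)
  +ᵥ-assoc (a , b) (c , d) (e , f) = cong₂ _,_ (+-assoc a c e) (+-assoc b d f)

  +ᵥ-identityˡ : ∀ u → 0ᵥ +ᵥ u ≡ u
  +ᵥ-identityˡ (a , b) = cong₂ _,_ (+-identityˡ a) (+-identityˡ b)

  +ᵥ-identityʳ : ∀ u → u +ᵥ 0ᵥ ≡ u
  +ᵥ-identityʳ (a , b) = cong₂ _,_ (+-identityʳ a) (+-identityʳ b)

  -ᵥ-inverseʳ : ∀ u → u -ᵥ u ≡ 0ᵥ
  -ᵥ-inverseʳ (a , b) = cong₂ _,_ (-‿inverseʳ a) (-‿inverseʳ b)

  -ᵥ0ᵥ : ∀ u → u -ᵥ 0ᵥ ≡ u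
  -ᵥ0ᵥ (a , b) = cong₂ _,_ (lemma a) (lemma b)
    where
    lemma : ∀ x → x - 0# ≡ x
    lemma = solve 1 (λ x → x :- con (ℤ.+ 0) := x) refl

  [u+v]-u : ∀ u v → (u +ᵥ v) -ᵥ u ≡ v
  [u+v]-u (a , b) (c , d) = cong₂ _,_ (lemma a c) (lemma b d)
    where
    lemma : ∀ x y → (x + y) - x ≡ y
    lemma = solve 2 (λ x y → (x :+ y) :- x := y) refl

  [u+v]-v : ∀ u v → (u +ᵥ v) -ᵥ v ≡ u
  [u+v]-v u v = trans (cong (_-ᵥ v) (+ᵥ-comm u v)) ([u+v]-u v u)

  u+[v-u] : ∀ u v → u +ᵥ (v -ᵥ u) ≡ v
  u+[v-u] (a , b) (c , d) = cong₂ _,_ (lemma a c) (lemma b d)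
    where
    lemma : ∀ x y → x + (y - x) ≡ y
    lemma = solve 2 (λ x y → x :+ (y :- x) := y) refl

  [u-v]+[v-w] : ∀ u v w → (u -ᵥ v) +ᵥ (v -ᵥ w) ≡ u -ᵥ w
  [u-v]+[v-w] (a , b) (c , d) (e , f) = cong₂ _,_ (lemma a c e) (lemma b d f)
    where
    lemma : ∀ x y z → (x - y) + (y - z) ≡ x - z
    lemma = solve 3 (λ x y z → (x :- y) :+ (y :- z) := x :- z) refl

  -[u-v] : ∀ u v → negᵥ (u -ᵥ v) ≡ v -ᵥ u
  -[u-v] (a , b) (c , d) = cong₂ _,_ (lemma a c) (lemma b d)
    where
    lemma : ∀ x y → - (x - y) ≡ y - x
    lemma = solve 2 (λ x y → :- (x :- y) := y :- x) refl

  [u-w]-[v-w] : ∀ u v w → (u -ᵥ w) -ᵥ (v -ᵥ w) ≡ u -ᵥ v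
  [u-w]-[v-w] u v w = trans (cong ((u -ᵥ w) +ᵥ_) (-[u-v] v w)) ([u-v]+[v-w] u w v)

  [u-v]+v : ∀ u v → (u -ᵥ v) +ᵥ v ≡ u
  [u-v]+v u v = trans (+ᵥ-comm (u -ᵥ v) v) (u+[v-u] v u)

  u-[u-v] : ∀ u v → u -ᵥ (u -ᵥ v) ≡ v
  u-[u-v] u v = trans (cong (u +ᵥ_) (-[u-v] u v)) (u+[v-u] u v)

  [w-v]-u : ∀ u v w → (w -ᵥ v) -ᵥ u ≡ w -ᵥ (u +ᵥ v)
  [w-v]-u (a , a′) (b , b′) (c , c′) = cong₂ _,_ (lemma a b c) (lemma a′ b′ c′)
    where
    lemma : ∀ a b c → (c - b) - a ≡ c - (a + b)
    lemma = solve 3 (λ a b c → (c :- b) :- a := c :- (a :+ b)) refl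

  u-v≡s+t⇒[v+s]-u≡-t : ∀ u v s t → u -ᵥ v ≡ s +ᵥ t → (v +ᵥ s) -ᵥ u ≡ negᵥ t
  u-v≡s+t⇒[v+s]-u≡-t (a , a′) (b , b′) (c , c′) (d , d′) eq =
    cong₂ _,_ (lemma a b c d (cong proj₁ eq)) (lemma a′ b′ c′ d′ (cong proj₂ eq))
    where
    lemma : ∀ a b c d → a - b ≡ c + d → (b + c) - a ≡ - d
    lemma a b c d e = x-y≡0⇒x≡y (trans (solve 4 (λ a b c d → ((b :+ c) :- a) :- (:- d) := (c :+ d) :- (a :- b)) refl a b c d)
      (x≡y⇒x-y≡0 (sym e)))

  u-v≡0⇒u≡v : ∀ {u v} → u -ᵥ v ≡ 0ᵥ → u ≡ v
  u-v≡0⇒u≡v eq = cong₂ _,_ (x-y≡0⇒x≡y (cong proj₁ eq)) (x-y≡0⇒x≡y (cong proj₂ eq))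

  +ᵥ-cancelˡ : ∀ u {v w} → u +ᵥ v ≡ u +ᵥ w → v ≡ w
  +ᵥ-cancelˡ u eq = cong₂ _,_ (+-cancelˡ _ (cong proj₁ eq)) (+-cancelˡ _ (cong proj₂ eq))

  1*ᵥ : ∀ v → 1# *ᵥ v ≡ v
  1*ᵥ (x , y) = cong₂ _,_ (*-identityˡ x) (*-identityˡ y)

  0*ᵥ : ∀ v → 0# *ᵥ v ≡ 0ᵥ
  0*ᵥ (x , y) = cong₂ _,_ (zeroˡ x) (zeroˡ y)

  *ᵥ0 : ∀ k → k *ᵥ 0ᵥ ≡ 0ᵥ
  *ᵥ0 k = cong₂ _,_ (zeroʳ k) (zeroʳ k)

  *ᵥ-assoc : ∀ k l v → (k * l) *ᵥ v ≡ k *ᵥ l *ᵥ v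
  *ᵥ-assoc k l (x , y) = cong₂ _,_ (*-assoc k l x) (*-assoc k l y)

  *ᵥ-comm : ∀ k l v → k *ᵥ l *ᵥ v ≡ l *ᵥ k *ᵥ v
  *ᵥ-comm k l v = trans (sym (*ᵥ-assoc k l v)) (trans (cong (_*ᵥ v) (*-comm k l)) (*ᵥ-assoc l k v))

  *ᵥ-distribˡ : ∀ k u v → k *ᵥ (u +ᵥ v) ≡ k *ᵥ u +ᵥ k *ᵥ v
  *ᵥ-distribˡ k (a , b) (c , d) = cong₂ _,_ (distribˡ k a c) (distribˡ k b d)

  *ᵥ-distribʳ : ∀ k l v → (k + l) *ᵥ v ≡ k *ᵥ v +ᵥ l *ᵥ v
  *ᵥ-distribʳ k l (x , y) = cong₂ _,_ (distribʳ x k l) (distribʳ y k l)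

  ⁻¹*ᵥ : ∀ {k} → k ≢ 0# → ∀ v → k ⁻¹ *ᵥ k *ᵥ v ≡ v
  ⁻¹*ᵥ {k} k≢0 v = trans (sym (*ᵥ-assoc _ _ v)) (trans (cong (_*ᵥ v) (inverseˡ k≢0)) (1*ᵥ v))

  *⁻¹ᵥ : ∀ {k} → k ≢ 0# → ∀ v → k *ᵥ k ⁻¹ *ᵥ v ≡ v
  *⁻¹ᵥ {k} k≢0 v = trans (*ᵥ-comm k (k ⁻¹) v) (⁻¹*ᵥ k≢0 v)

  *ᵥ-cancelˡ : ∀ {k u v} → k ≢ 0# → k *ᵥ u ≡ k *ᵥ v → u ≡ v
  *ᵥ-cancelˡ {k} {u} {v} k≢0 eq = trans (sym (⁻¹*ᵥ k≢0 u)) (trans (cong (k ⁻¹ *ᵥ_) eq) (⁻¹*ᵥ k≢0 v))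

  *ᵥ-≢0 : ∀ {k v} → k ≢ 0# → v ≢ 0ᵥ → k *ᵥ v ≢ 0ᵥ
  *ᵥ-≢0 {k} k≢0 v≢0 eq = v≢0 (*ᵥ-cancelˡ k≢0 (trans eq (sym (*ᵥ0 k))))

  *ᵥ-cancelʳ : ∀ {k l v} → v ≢ 0ᵥ → k *ᵥ v ≡ l *ᵥ v → k ≡ l
  *ᵥ-cancelʳ {k} {l} {x , y} v≢0 eq with x ≟ 0# | y ≟ 0#
  ... | no x≢0  | _       = *-cancelʳ x≢0 (cong proj₁ eq)
  ... | yes _   | no y≢0  = *-cancelʳ y≢0 (cong proj₂ eq)
  ... | yes x≡0 | yes y≡0 = contradiction (cong₂ _,_ x≡0 y≡0) v≢0

  *ᵥ-≢0ˡ : ∀ {k v} → k *ᵥ v ≢ 0ᵥ → k ≢ 0#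
  *ᵥ-≢0ˡ {v = v} kv≢0 refl = kv≢0 (0*ᵥ v)

  *ᵥ-≢0ʳ : ∀ {k v} → k *ᵥ v ≢ 0ᵥ → v ≢ 0ᵥ
  *ᵥ-≢0ʳ {k} kv≢0 refl = kv≢0 (*ᵥ0 k)

  det : V → V → Carrier
  det (a , b) (c , d) = a * d - b * c

  det-*ᵥˡ : ∀ k u v → det (k *ᵥ u) v ≡ k * det u v
  det-*ᵥˡ k (a , b) (c , d) =
    solve 5 (λ k a b c d → (k :* a) :* d :- (k :* b) :* c := k :* (a :* d :- b :* c)) refl k a b c d

  det-*ᵥʳ : ∀ k u v → det u (k *ᵥ v) ≡ k * det u v
  det-*ᵥʳ k (a , b) (c , d) =
    solve 5 (λ k a b c d → a :* (k :* d) :- b :* (k :* c) := k :* (a :* d :- b :* c)) refl k a b c d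

  det-self : ∀ u → det u u ≡ 0#
  det-self (a , b) = solve 2 (λ a b → a :* b :- b :* a := con (ℤ.+ 0)) refl a b

  det-swap : ∀ u v → det v u ≡ - det u v
  det-swap (a , b) (c , d) = solve 4 (λ a b c d → c :* b :- d :* a := :- (a :* d :- b :* c)) refl a b c d

  det-+ʳ : ∀ u v w → det u (v +ᵥ w) ≡ det u v + det u w
  det-+ʳ (a , b) (c , d) (e , f) = solve 6 (λ a b c d e f →
    a :* (d :+ f) :- b :* (c :+ e) := (a :* d :- b :* c) :+ (a :* f :- b :* e)) refl a b c d e f

  det-swap-≢0 : ∀ {u v} → det u v ≢ 0# → det v u ≢ 0#
  det-swap-≢0 {u} {v} uv≢0 vu≡0 =
    uv≢0 (trans (det-swap v u) (trans (cong -_ vu≡0) -0#≈0#))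

  det≢0⇒≢0ˡ : ∀ {u v} → det u v ≢ 0# → u ≢ 0ᵥ
  det≢0⇒≢0ˡ {v = v} uv≢0 refl = uv≢0 (trans (cong (λ u → det u v) (sym (0*ᵥ 0ᵥ))) (trans (det-*ᵥˡ 0# 0ᵥ v) (zeroˡ _)))

  det≢0⇒≢0ʳ : ∀ {u v} → det u v ≢ 0# → v ≢ 0ᵥ
  det≢0⇒≢0ʳ uv≢0 = det≢0⇒≢0ˡ (det-swap-≢0 uv≢0)

  cramer : ∀ u v w → det u v *ᵥ w ≡ det w v *ᵥ u +ᵥ det u w *ᵥ v
  cramer (a , b) (c , d) (e , f) = cong₂ _,_
    (solve 6 (λ a b c d e f → (a :* d :- b :* c) :* e := (e :* d :- f :* c) :* a :+ (a :* f :- b :* e) :* c) refl a b c d e f)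
    (solve 6 (λ a b c d e f → (a :* d :- b :* c) :* f := (e :* d :- f :* c) :* b :+ (a :* f :- b :* e) :* d) refl a b c d e f)

  proportional : ∀ {u v} → u ≢ 0ᵥ → det u v ≡ 0# → v ∈ ⟨ u ⟩
  proportional {a , b} {c , d} u≢0 eq with a ≟ 0# | b ≟ 0#
  ... | no a≢0  | _       = c * a ⁻¹ , cong₂ _,_ (sym (divide a≢0 c)) (*-cancelˡ a≢0 (begin
    a * d                ≡⟨ x-y≡0⇒x≡y eq ⟩
    b * c                ≡⟨ cong (b *_) (sym (divide a≢0 c)) ⟩
    b * (c * a ⁻¹ * a)   ≡⟨ solve 3 (λ a b k → b :* (k :* a) := a :* (k :* b)) refl a b (c * a ⁻¹) ⟩
    a * (c * a ⁻¹ * b)   ∎))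
  ... | yes _   | no b≢0  = d * b ⁻¹ , cong₂ _,_ (*-cancelˡ b≢0 (begin
    b * c                ≡⟨ sym (x-y≡0⇒x≡y eq) ⟩
    a * d                ≡⟨ cong (a *_) (sym (divide b≢0 d)) ⟩
    a * (d * b ⁻¹ * b)   ≡⟨ solve 3 (λ a b k → a :* (k :* b) := b :* (k :* a)) refl a b (d * b ⁻¹) ⟩
    b * (d * b ⁻¹ * a)   ∎)) (sym (divide b≢0 d))
  ... | yes a≡0 | yes b≡0 = contradiction (cong₂ _,_ a≡0 b≡0) u≢0

  ∈⟨⟩⇒det≡0 : ∀ {u v} → v ∈ ⟨ u ⟩ → det u v ≡ 0#
  ∈⟨⟩⇒det≡0 {u} (k , refl) = trans (det-*ᵥʳ k u u) (trans (cong (k *_) (det-self u)) (zeroʳ k))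

  module Basis {e₁ e₂ : V} (independent : det e₁ e₂ ≢ 0#) where

    e₁≢0 : e₁ ≢ 0ᵥ
    e₁≢0 = det≢0⇒≢0ˡ independent

    e₂≢0 : e₂ ≢ 0ᵥ
    e₂≢0 = det≢0⇒≢0ʳ independent

    infix 5 _e₁+_e₂
    _e₁+_e₂ : Carrier → Carrier → V
    x e₁+ y e₂ = x *ᵥ e₁ +ᵥ y *ᵥ e₂

    coordinates : ∀ v → ∃₂ λ x y → v ≡ x e₁+ y e₂
    coordinates v = Δ ⁻¹ * det v e₂ , Δ ⁻¹ * det e₁ v , (begin
      v                                              ≡⟨ sym (⁻¹*ᵥ independent v) ⟩
      Δ ⁻¹ *ᵥ Δ *ᵥ v                                 ≡⟨ cong (Δ ⁻¹ *ᵥ_) (cramer e₁ e₂ v) ⟩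
      Δ ⁻¹ *ᵥ (det v e₂ *ᵥ e₁ +ᵥ det e₁ v *ᵥ e₂)     ≡⟨ *ᵥ-distribˡ _ _ _ ⟩
      Δ ⁻¹ *ᵥ det v e₂ *ᵥ e₁ +ᵥ Δ ⁻¹ *ᵥ det e₁ v *ᵥ e₂  ≡⟨ cong₂ _+ᵥ_ (sym (*ᵥ-assoc _ _ e₁)) (sym (*ᵥ-assoc _ _ e₂)) ⟩
      (Δ ⁻¹ * det v e₂) e₁+ (Δ ⁻¹ * det e₁ v) e₂     ∎)
      where Δ = det e₁ e₂

    det-e₁ : ∀ x y → det e₁ (x e₁+ y e₂) ≡ y * det e₁ e₂
    det-e₁ x y = trans (det-+ʳ e₁ _ _) (trans (cong₂ _+_ (∈⟨⟩⇒det≡0 (x , refl)) (det-*ᵥʳ y e₁ e₂)) (+-identityˡ _))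

    det-e₂ : ∀ x y → det e₂ (x e₁+ y e₂) ≡ x * det e₂ e₁
    det-e₂ x y = trans (det-+ʳ e₂ _ _) (trans (cong₂ _+_ (det-*ᵥʳ x e₂ e₁) (∈⟨⟩⇒det≡0 (y , refl))) (+-identityʳ _))

    unique₁ : ∀ {x y x′ y′} → x e₁+ y e₂ ≡ x′ e₁+ y′ e₂ → x ≡ x′
    unique₁ {x} {y} {x′} {y′} eq = *-cancelʳ (det-swap-≢0 independent)
      (trans (sym (det-e₂ x y)) (trans (cong (det e₂) eq) (det-e₂ x′ y′)))

    unique₂ : ∀ {x y x′ y′} → x e₁+ y e₂ ≡ x′ e₁+ y′ e₂ → y ≡ y′
    unique₂ {x} {y} {x′} {y′} eq = *-cancelʳ independent
      (trans (sym (det-e₁ x y)) (trans (cong (det e₁) eq) (det-e₁ x′ y′)))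

    *-combination : ∀ k x y → k *ᵥ (x e₁+ y e₂) ≡ (k * x) e₁+ (k * y) e₂
    *-combination k x y = trans (*ᵥ-distribˡ k _ _) (cong₂ _+ᵥ_ (sym (*ᵥ-assoc k x e₁)) (sym (*ᵥ-assoc k y e₂)))

    0e₁+0e₂ : 0# e₁+ 0# e₂ ≡ 0ᵥ
    0e₁+0e₂ = trans (cong₂ _+ᵥ_ (0*ᵥ e₁) (0*ᵥ e₂)) (+ᵥ-identityˡ 0ᵥ)

  ·-+ᵥ : ∀ u v A → (u +ᵥ v) · A ≡ u · A +ᵥ v · A
  ·-+ᵥ (x , y) (x′ , y′) (mat a b c d) = cong₂ _,_ (lemma x y x′ y′ a c) (lemma x y x′ y′ b d)
    where
    lemma : ∀ x y x′ y′ a c → (x + x′) * a + (y + y′) * c ≡ (x * a + y * c) + (x′ * a + y′ * c)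
    lemma = solve 6 (λ x y x′ y′ a c → (x :+ x′) :* a :+ (y :+ y′) :* c := (x :* a :+ y :* c) :+ (x′ :* a :+ y′ :* c)) refl

  ·-*ᵥ : ∀ k v A → (k *ᵥ v) · A ≡ k *ᵥ (v · A)
  ·-*ᵥ k (x , y) (mat a b c d) = cong₂ _,_ (lemma k x y a c) (lemma k x y b d)
    where
    lemma : ∀ k x y a c → (k * x) * a + (k * y) * c ≡ k * (x * a + y * c)
    lemma = solve 5 (λ k x y a c → (k :* x) :* a :+ (k :* y) :* c := k :* (x :* a :+ y :* c)) refl

  ·-- : ∀ u v A → (u -ᵥ v) · A ≡ u · A -ᵥ v · A
  ·-- (x , y) (x′ , y′) (mat a b c d) = cong₂ _,_ (lemma x y x′ y′ a c) (lemma x y x′ y′ b d)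
    where
    lemma : ∀ x y x′ y′ a c → (x - x′) * a + (y - y′) * c ≡ (x * a + y * c) - (x′ * a + y′ * c)
    lemma = solve 6 (λ x y x′ y′ a c → (x :- x′) :* a :+ (y :- y′) :* c := (x :* a :+ y :* c) :- (x′ :* a :+ y′ :* c)) refl

  0ᵥ-· : ∀ A → 0ᵥ · A ≡ 0ᵥ
  0ᵥ-· A = trans (cong (_· A) (sym (0*ᵥ 0ᵥ))) (trans (·-*ᵥ 0# 0ᵥ A) (0*ᵥ _))

  ·-scalar : ∀ v k → v · scalar k ≡ k *ᵥ v
  ·-scalar (x , y) k = cong₂ _,_
    (solve 3 (λ x y k → x :* k :+ y :* con (ℤ.+ 0) := k :* x) refl x y k)
    (solve 3 (λ x y k → x :* con (ℤ.+ 0) :+ y :* k := k :* y) refl x y k)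

  vectors : V ↔ Fin (N ℕ.* N)
  vectors = ↔-sym Fin.*↔× ↔-∘ (enumeration ×-↔ enumeration)

  mat-cong : ∀ {a b c d a′ b′ c′ d′} → a ≡ a′ → b ≡ b′ → c ≡ c′ → d ≡ d′ → mat a b c d ≡ mat a′ b′ c′ d′
  mat-cong refl refl refl refl = refl

  matrix-ext : ∀ {A B} → (∀ v → v · A ≡ v · B) → A ≡ B
  matrix-ext {mat a b c d} {mat a′ b′ c′ d′} h =
    mat-cong (first a c a′ c′ (cong proj₁ (h (1# , 0#)))) (first b d b′ d′ (cong proj₂ (h (1# , 0#))))
         (second a c a′ c′ (cong proj₁ (h (0# , 1#)))) (second b d b′ d′ (cong proj₂ (h (0# , 1#))))
    where
    row₁ : ∀ a c → 1# * a + 0# * c ≡ a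
    row₁ = solve 2 (λ a c → con (ℤ.+ 1) :* a :+ con (ℤ.+ 0) :* c := a) refl
    row₂ : ∀ a c → 0# * a + 1# * c ≡ c
    row₂ = solve 2 (λ a c → con (ℤ.+ 0) :* a :+ con (ℤ.+ 1) :* c := c) refl
    first : ∀ a c a′ c′ → 1# * a + 0# * c ≡ 1# * a′ + 0# * c′ → a ≡ a′
    first a c a′ c′ eq = trans (sym (row₁ a c)) (trans eq (row₁ a′ c′))
    second : ∀ a c a′ c′ → 0# * a + 1# * c ≡ 0# * a′ + 1# * c′ → c ≡ c′
    second a c a′ c′ eq = trans (sym (row₂ a c)) (trans eq (row₂ a′ c′))

  matrix-ext-basis : ∀ {e₁ e₂} → det e₁ e₂ ≢ 0# → ∀ {A B} → e₁ · A ≡ e₁ · B → e₂ · A ≡ e₂ · B → A ≡ B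
  matrix-ext-basis {e₁} {e₂} independent {A} {B} h₁ h₂ = matrix-ext λ v → go (coordinates v)
    where
    open Basis independent
    go : ∀ {v} → (∃₂ λ x y → v ≡ x e₁+ y e₂) → v · A ≡ v · B
    go (x , y , refl) = begin
      (x e₁+ y e₂) · A                  ≡⟨ ·-+ᵥ _ _ A ⟩
      (x *ᵥ e₁) · A +ᵥ (y *ᵥ e₂) · A    ≡⟨ cong₂ _+ᵥ_ (·-*ᵥ x e₁ A) (·-*ᵥ y e₂ A) ⟩
      x *ᵥ (e₁ · A) +ᵥ y *ᵥ (e₂ · A)        ≡⟨ cong₂ (λ u v → x *ᵥ u +ᵥ y *ᵥ v) h₁ h₂ ⟩
      x *ᵥ (e₁ · B) +ᵥ y *ᵥ (e₂ · B)        ≡⟨ sym (cong₂ _+ᵥ_ (·-*ᵥ x e₁ B) (·-*ᵥ y e₂ B)) ⟩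
      (x *ᵥ e₁) · B +ᵥ (y *ᵥ e₂) · B    ≡⟨ sym (·-+ᵥ _ _ B) ⟩
      (x e₁+ y e₂) · B                  ∎

  linear⇒matrix : (T : V → V) → (∀ u v → T (u +ᵥ v) ≡ T u +ᵥ T v) → (∀ k v → T (k *ᵥ v) ≡ k *ᵥ T v) →
                  ∃ λ A → ∀ v → T v ≡ v · A
  linear⇒matrix T T-+ T-* = mat (proj₁ r₁) (proj₂ r₁) (proj₁ r₂) (proj₂ r₂) , λ { (x , y) → begin
    T (x , y)                              ≡⟨ cong T (cong₂ _,_ (split₁ x y) (split₂ x y)) ⟩
    T (x *ᵥ (1# , 0#) +ᵥ y *ᵥ (0# , 1#))   ≡⟨ T-+ _ _ ⟩
    T (x *ᵥ (1# , 0#)) +ᵥ T (y *ᵥ (0# , 1#))  ≡⟨ cong₂ _+ᵥ_ (T-* x _) (T-* y _) ⟩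
    x *ᵥ r₁ +ᵥ y *ᵥ r₂                     ∎ }
    where
    r₁ r₂ : V
    r₁ = T (1# , 0#)
    r₂ = T (0# , 1#)
    split₁ : ∀ x y → x ≡ x * 1# + y * 0#
    split₁ = solve 2 (λ x y → x := x :* con (ℤ.+ 1) :+ y :* con (ℤ.+ 0)) refl
    split₂ : ∀ x y → y ≡ x * 0# + y * 1#
    split₂ = solve 2 (λ x y → y := x :* con (ℤ.+ 0) :+ y :* con (ℤ.+ 1)) refl

  detₘ : Matrix → Carrier
  detₘ (mat a b c d) = a * d - b * c

  det-· : ∀ u v A → det (u · A) (v · A) ≡ det u v * detₘ A
  det-· (x , y) (x′ , y′) (mat a b c d) = solve 8 (λ x y x′ y′ a b c d →
    (x :* a :+ y :* c) :* (x′ :* b :+ y′ :* d) :- (x :* b :+ y :* d) :* (x′ :* a :+ y′ :* c) :=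
    (x :* y′ :- y :* x′) :* (a :* d :- b :* c)) refl x y x′ y′ a b c d

  singular⇒det≡0 : ∀ {v A} → v ≢ 0ᵥ → v · A ≡ 0ᵥ → detₘ A ≡ 0#
  singular⇒det≡0 {x , y} {mat a b c d} v≢0 eq with x ≟ 0# | y ≟ 0#
  ... | no x≢0  | _       = zero-product (begin
    x * (a * d - b * c)                          ≡⟨ solve 6 (λ x y a b c d → x :* (a :* d :- b :* c) :=
                                                      (x :* a :+ y :* c) :* d :- (x :* b :+ y :* d) :* c) refl x y a b c d ⟩
    (x * a + y * c) * d - (x * b + y * d) * c    ≡⟨ cong₂ (λ s t → s * d - t * c) (cong proj₁ eq) (cong proj₂ eq) ⟩
    0# * d - 0# * c                              ≡⟨ solve 2 (λ c d → con (ℤ.+ 0) :* d :- con (ℤ.+ 0) :* c := con (ℤ.+ 0)) refl c d ⟩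
    0#                                           ∎) x≢0
  ... | yes _   | no y≢0  = zero-product (begin
    y * (a * d - b * c)                          ≡⟨ solve 6 (λ x y a b c d → y :* (a :* d :- b :* c) :=
                                                      a :* (x :* b :+ y :* d) :- b :* (x :* a :+ y :* c)) refl x y a b c d ⟩
    a * (x * b + y * d) - b * (x * a + y * c)    ≡⟨ cong₂ (λ s t → a * t - b * s) (cong proj₁ eq) (cong proj₂ eq) ⟩
    a * 0# - b * 0#                              ≡⟨ solve 2 (λ a b → a :* con (ℤ.+ 0) :- b :* con (ℤ.+ 0) := con (ℤ.+ 0)) refl a b ⟩
    0#                                           ∎) y≢0
  ... | yes x≡0 | yes y≡0 = contradiction (cong₂ _,_ x≡0 y≡0) v≢0

  -ₘ : Matrix → Matrix → Matrix
  -ₘ (mat a b c d) (mat a′ b′ c′ d′) = mat (a - a′) (b - b′) (c - c′) (d - d′)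

  ·-ₘ : ∀ v A B → v · -ₘ A B ≡ v · A -ᵥ v · B
  ·-ₘ (x , y) (mat a b c d) (mat a′ b′ c′ d′) = cong₂ _,_ (lemma x y a c a′ c′) (lemma x y b d b′ d′)
    where
    lemma : ∀ x y a c a′ c′ → x * (a - a′) + y * (c - c′) ≡ (x * a + y * c) - (x * a′ + y * c′)
    lemma = solve 6 (λ x y a c a′ c′ → x :* (a :- a′) :+ y :* (c :- c′) := (x :* a :+ y :* c) :- (x :* a′ :+ y :* c′)) refl

-- Scattered polynomials and their graphs

record ScatteredPolynomial : Set₁ where
  constructor scatteredPolynomial
  field
    q n        : ℕ
    primePower : PrimePower q
    3<q        : 3 ℕ.< q
    2<n        : 2 ℕ.< n
    F          : FiniteField q
    K          : FiniteField (q ℕ.^ n)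
    ι          : Embedding F K
  open Scattered q n F K ι
  field
    f          : QPolynomial
    scattered  : IsScattered f

module ScatteredPlane (𝒫 : ScatteredPolynomial) where
  open ScatteredPolynomial 𝒫 public
  open FieldProperties K public
  open Scattered q n F K ι public
  open Plane K public
  open Embedding ι public
  open IsRingHomomorphism isRingHomomorphism public
    using () renaming (+-homo to ⟦⟧-+; *-homo to ⟦⟧-*; 0#-homo to ⟦⟧-0; 1#-homo to ⟦⟧-1; -‿homo to ⟦⟧--)
  open ≡-Reasoning
  module F = FieldProperties F
  private
    module S = Sum semiring

  g : Carrier → Carrier
  g = eval f

  ⟦⟧-≢0 : ∀ {a} → a ≢ F.0# → ⟦ a ⟧ ≢ 0#
  ⟦⟧-≢0 {a} a≢0 eq = 1≢0 (begin
    1#                   ≡⟨ sym ⟦⟧-1 ⟩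
    ⟦ F.1# ⟧             ≡⟨ cong ⟦_⟧ (sym (F.inverseʳ a≢0)) ⟩
    ⟦ a F.* a F.⁻¹ ⟧     ≡⟨ ⟦⟧-* a (a F.⁻¹) ⟩
    ⟦ a ⟧ * ⟦ a F.⁻¹ ⟧   ≡⟨ cong (_* ⟦ a F.⁻¹ ⟧) eq ⟩
    0# * ⟦ a F.⁻¹ ⟧      ≡⟨ zeroˡ _ ⟩
    0#                   ∎)

  ⟦⟧-injective : ∀ {a b} → ⟦ a ⟧ ≡ ⟦ b ⟧ → a ≡ b
  ⟦⟧-injective {a} {b} eq with (a F.- b) F.≟ F.0#
  ... | yes a-b≡0 = F.x-y≡0⇒x≡y a-b≡0
  ... | no a-b≢0 = contradiction (trans (⟦⟧-+ a (F.- b)) (trans (cong (⟦ a ⟧ +_) (⟦⟧-- b)) (x≡y⇒x-y≡0 eq))) (⟦⟧-≢0 a-b≢0)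

  ⟦⟧-^ : ∀ a k → ⟦ a F.^ k ⟧ ≡ ⟦ a ⟧ ^ k
  ⟦⟧-^ a zero    = ⟦⟧-1
  ⟦⟧-^ a (suc k) = trans (⟦⟧-* a (a F.^ k)) (cong (⟦ a ⟧ *_) (⟦⟧-^ a k))

  ⟦⟧-×₁ : ∀ k → ⟦ k F.×₁ ⟧ ≡ k ×₁
  ⟦⟧-×₁ zero    = ⟦⟧-0
  ⟦⟧-×₁ (suc k) = trans (⟦⟧-+ F.1# (k F.×₁)) (cong₂ _+_ ⟦⟧-1 (⟦⟧-×₁ k))

  frobenius : ∀ x y → (x + y) ^ q ≡ x ^ q + y ^ q
  frobenius x y with primePower
  ... | p , e , pp , _ , q≡p^e = begin
    (x + y) ^ q                      ≡⟨ cong ((x + y) ^_) q≡p^e ⟩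
    (x + y) ^ (p ℕ.^ e)              ≡⟨ Characteristic.frobenius-+ K pp char-p e x y ⟩
    x ^ (p ℕ.^ e) + y ^ (p ℕ.^ e)    ≡⟨ cong (λ k → x ^ k + y ^ k) (sym q≡p^e) ⟩
    x ^ q + y ^ q                    ∎
    where
    char-p : p ×₁ ≡ 0#
    char-p = begin
      p ×₁          ≡⟨ sym (⟦⟧-×₁ p) ⟩
      ⟦ p F.×₁ ⟧    ≡⟨ cong ⟦_⟧ (Characteristic.prime-characteristic F p e (trans (cong F._×₁ (sym q≡p^e)) F.characteristic)) ⟩
      ⟦ F.0# ⟧      ≡⟨ ⟦⟧-0 ⟩
      0#            ∎

  frobeniusⁱ : ∀ i x y → (x + y) ^ (q ℕ.^ i) ≡ x ^ (q ℕ.^ i) + y ^ (q ℕ.^ i)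
  frobeniusⁱ zero    x y = trans (*-identityʳ _) (sym (cong₂ _+_ (*-identityʳ x) (*-identityʳ y)))
  frobeniusⁱ (suc i) x y = begin
    (x + y) ^ (q ℕ.* q ℕ.^ i)                   ≡⟨ sym (^-assocʳ (x + y) q (q ℕ.^ i)) ⟩
    ((x + y) ^ q) ^ (q ℕ.^ i)                   ≡⟨ cong (_^ (q ℕ.^ i)) (frobenius x y) ⟩
    (x ^ q + y ^ q) ^ (q ℕ.^ i)                 ≡⟨ frobeniusⁱ i (x ^ q) (y ^ q) ⟩
    (x ^ q) ^ (q ℕ.^ i) + (y ^ q) ^ (q ℕ.^ i)   ≡⟨ cong₂ _+_ (^-assocʳ x q (q ℕ.^ i)) (^-assocʳ y q (q ℕ.^ i)) ⟩
    x ^ (q ℕ.* q ℕ.^ i) + y ^ (q ℕ.* q ℕ.^ i)   ∎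

  ⟦⟧-fixed : ∀ i a → ⟦ a ⟧ ^ (q ℕ.^ i) ≡ ⟦ a ⟧
  ⟦⟧-fixed zero    a = *-identityʳ _
  ⟦⟧-fixed (suc i) a = begin
    ⟦ a ⟧ ^ (q ℕ.* q ℕ.^ i)    ≡⟨ sym (^-assocʳ ⟦ a ⟧ q (q ℕ.^ i)) ⟩
    (⟦ a ⟧ ^ q) ^ (q ℕ.^ i)    ≡⟨ cong (_^ (q ℕ.^ i)) (trans (sym (⟦⟧-^ a q)) (cong ⟦_⟧ (F.fermat′ a))) ⟩
    ⟦ a ⟧ ^ (q ℕ.^ i)          ≡⟨ ⟦⟧-fixed i a ⟩
    ⟦ a ⟧                      ∎

  sum-+ : ∀ {m} (s t : Fin m → Carrier) → sum (λ i → s i + t i) ≡ sum s + sum t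
  sum-+ {zero}  s t = sym (+-identityˡ 0#)
  sum-+ {suc m} s t = trans (cong (s Fin.zero + t Fin.zero +_) (sum-+ (s ∘ Fin.suc) (t ∘ Fin.suc)))
    (solve 4 (λ a b c d → (a :+ b) :+ (c :+ d) := (a :+ c) :+ (b :+ d)) refl
      (s Fin.zero) (t Fin.zero) (sum (s ∘ Fin.suc)) (sum (t ∘ Fin.suc)))

  g-+ : ∀ x y → g (x + y) ≡ g x + g y
  g-+ x y = trans (S.sum-cong-≗ λ i → trans (cong (f i *_) (frobeniusⁱ (toℕ i) x y)) (distribˡ (f i) _ _))
    (sum-+ (λ i → f i * x ^ (q ℕ.^ toℕ i)) (λ i → f i * y ^ (q ℕ.^ toℕ i)))

  g-⟦⟧ : ∀ a x → g (⟦ a ⟧ * x) ≡ ⟦ a ⟧ * g x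
  g-⟦⟧ a x = trans (S.sum-cong-≗ (λ i → begin
    f i * (⟦ a ⟧ * x) ^ (q ℕ.^ toℕ i)                   ≡⟨ cong (f i *_) (^-distrib-* ⟦ a ⟧ x (q ℕ.^ toℕ i)) ⟩
    f i * (⟦ a ⟧ ^ (q ℕ.^ toℕ i) * x ^ (q ℕ.^ toℕ i))   ≡⟨ cong (λ z → f i * (z * x ^ (q ℕ.^ toℕ i))) (⟦⟧-fixed (toℕ i) a) ⟩
    f i * (⟦ a ⟧ * x ^ (q ℕ.^ toℕ i))                   ≡⟨ solve 3 (λ s a z → s :* (a :* z) := a :* (s :* z)) refl (f i) ⟦ a ⟧ (x ^ (q ℕ.^ toℕ i)) ⟩
    ⟦ a ⟧ * (f i * x ^ (q ℕ.^ toℕ i))                   ∎))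
    (sym (S.*-distribˡ-sum ⟦ a ⟧ (λ i → f i * x ^ (q ℕ.^ toℕ i))))

  γ : Carrier → V
  γ x = x , g x

  γ-+ : ∀ x y → γ (x + y) ≡ γ x +ᵥ γ y
  γ-+ x y = cong (x + y ,_) (g-+ x y)

  γ-⟦⟧ : ∀ a x → γ (⟦ a ⟧ * x) ≡ ⟦ a ⟧ *ᵥ γ x
  γ-⟦⟧ a x = cong (⟦ a ⟧ * x ,_) (g-⟦⟧ a x)

  γ-0 : γ 0# ≡ 0ᵥ
  γ-0 = begin
    γ 0#              ≡⟨ cong γ (sym (trans (cong (_* 0#) ⟦⟧-0) (zeroʳ 0#))) ⟩
    γ (⟦ F.0# ⟧ * 0#)  ≡⟨ γ-⟦⟧ F.0# 0# ⟩
    ⟦ F.0# ⟧ *ᵥ γ 0#   ≡⟨ cong (_*ᵥ γ 0#) ⟦⟧-0 ⟩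
    0# *ᵥ γ 0#         ≡⟨ 0*ᵥ (γ 0#) ⟩
    0ᵥ                 ∎

  γ-≢0 : ∀ {x} → x ≢ 0# → γ x ≢ 0ᵥ
  γ-≢0 x≢0 eq = x≢0 (cong proj₁ eq)

  γ-≢0⁻¹ : ∀ {x} → γ x ≢ 0ᵥ → x ≢ 0#
  γ-≢0⁻¹ γx≢0 refl = γx≢0 γ-0

  IsScalar : Carrier → Set
  IsScalar k = ∃ λ a → k ≡ ⟦ a ⟧

  -- The scattered condition: U_f meets every point of the projective line in at most an F_q-line.
  proportional⇒scalar : ∀ {y z k} → y ≢ 0# → γ z ≡ k *ᵥ γ y → IsScalar k
  proportional⇒scalar {y} {z} {k} y≢0 γz≡kγy = solve-for-z (scattered y z (begin
      z * g y - y * g z              ≡⟨ cong₂ (λ s t → s * g y - y * t) (cong proj₁ γz≡kγy) (cong proj₂ γz≡kγy) ⟩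
      (k * y) * g y - y * (k * g y)  ≡⟨ solve 3 (λ k y w → (k :* y) :* w :- y :* (k :* w) := con (ℤ.+ 0)) refl k y (g y) ⟩
      0#                             ∎))
    where
    nonzero : ∀ {a b} → ¬ (a ≡ F.0# × b ≡ F.0#) → ⟦ a ⟧ * y + ⟦ b ⟧ * z ≡ 0# → b ≢ F.0#
    nonzero {a} {b} ab≢0 eq b≡0 = *-≢0 (⟦⟧-≢0 (λ a≡0 → ab≢0 (a≡0 , b≡0))) y≢0 (begin
      ⟦ a ⟧ * y                    ≡⟨ solve 3 (λ a y z → a :* y := a :* y :+ con (ℤ.+ 0) :* z) refl ⟦ a ⟧ y z ⟩
      ⟦ a ⟧ * y + 0# * z           ≡⟨ cong (λ s → ⟦ a ⟧ * y + s * z) (sym (trans (cong ⟦_⟧ b≡0) ⟦⟧-0)) ⟩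
      ⟦ a ⟧ * y + ⟦ b ⟧ * z        ≡⟨ eq ⟩
      0#                           ∎)
    solve-for-z : Dependent y z → IsScalar k
    solve-for-z (a , b , ab≢0 , ay+bz≡0) = F.- c , *-cancelʳ y≢0 (*-cancelˡ (⟦⟧-≢0 b≢0) (begin
        ⟦ b ⟧ * (k * y)                       ≡⟨ cong (⟦ b ⟧ *_) (sym (cong proj₁ γz≡kγy)) ⟩
        ⟦ b ⟧ * z                             ≡⟨ solve 3 (λ ay b z → b :* z := (ay :+ b :* z) :- ay) refl (⟦ a ⟧ * y) ⟦ b ⟧ z ⟩
        (⟦ a ⟧ * y + ⟦ b ⟧ * z) - ⟦ a ⟧ * y   ≡⟨ cong (_- ⟦ a ⟧ * y) ay+bz≡0 ⟩
        0# - ⟦ a ⟧ * y                        ≡⟨ cong (λ s → 0# - ⟦ s ⟧ * y) (sym (F.divide b≢0 a)) ⟩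
        0# - ⟦ c F.* b ⟧ * y                  ≡⟨ cong (λ s → 0# - s * y) (⟦⟧-* c b) ⟩
        0# - (⟦ c ⟧ * ⟦ b ⟧) * y              ≡⟨ solve 3 (λ c b y → con (ℤ.+ 0) :- (c :* b) :* y := b :* ((:- c) :* y)) refl ⟦ c ⟧ ⟦ b ⟧ y ⟩
        ⟦ b ⟧ * (- ⟦ c ⟧ * y)                 ≡⟨ cong (λ s → ⟦ b ⟧ * (s * y)) (sym (⟦⟧-- c)) ⟩
        ⟦ b ⟧ * (⟦ F.- c ⟧ * y)               ∎))
      where
      b≢0 : b ≢ F.0#
      b≢0 = nonzero ab≢0 ay+bz≡0
      c : F.Carrier
      c = a F.* b F.⁻¹

  InSpan : Carrier → Carrier → Carrier → Set
  InSpan u v x = ∃₂ λ a b → x ≡ ⟦ a ⟧ * u + ⟦ b ⟧ * v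

  q²<qⁿ : q ℕ.* q ℕ.< q ℕ.^ n
  q²<qⁿ = subst (ℕ._< q ℕ.^ n) (cong (q ℕ.*_) (ℕ.*-identityʳ q))
    (ℕ.^-monoʳ-< q (ℕ.<-trans (s≤s (s≤s z≤n)) 3<q) 2<n)

  -- Otherwise the coefficient pairs would inject the q ^ n elements of K into F_q × F_q, against n
  -- > 2.
  notSpanned : ∀ u v → ¬ (∀ x → InSpan u v x)
  notSpanned u v spanned = ℕ.<⇒≱ q²<qⁿ (Fin.injective⇒≤ {f = index} index-injective)
    where
    module K↔ = Inverse enumeration
    module F↔ = Inverse F.enumeration
    α β : Carrier → F.Carrier
    α x = proj₁ (spanned x)
    β x = proj₁ (proj₂ (spanned x))
    index : Fin (q ℕ.^ n) → Fin (q ℕ.* q)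
    index i = Fin.combine (F↔.to (α (K↔.from i))) (F↔.to (β (K↔.from i)))
    spans : ∀ x → x ≡ ⟦ α x ⟧ * u + ⟦ β x ⟧ * v
    spans x = proj₂ (proj₂ (spanned x))
    same : ∀ {x y} → α x ≡ α y → β x ≡ β y → x ≡ y
    same {x} {y} α≡ β≡ = begin
      x                          ≡⟨ spans x ⟩
      ⟦ α x ⟧ * u + ⟦ β x ⟧ * v  ≡⟨ cong₂ (λ a b → ⟦ a ⟧ * u + ⟦ b ⟧ * v) α≡ β≡ ⟩
      ⟦ α y ⟧ * u + ⟦ β y ⟧ * v  ≡⟨ sym (spans y) ⟩
      y                          ∎
    index-injective : ∀ {i j} → index i ≡ index j → i ≡ j
    index-injective {i} {j} eq = trans (sym (K↔.strictlyInverseˡ i)) (trans (cong K↔.to (same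
      (Finite.to-injective F.enumeration (Fin.combine-injectiveˡ (F↔.to (α x)) (F↔.to (β x)) (F↔.to (α y)) (F↔.to (β y)) eq))
      (Finite.to-injective F.enumeration (Fin.combine-injectiveʳ (F↔.to (α x)) (F↔.to (β x)) (F↔.to (α y)) (F↔.to (β y)) eq))))
      (K↔.strictlyInverseˡ j))
      where
      x = K↔.from i
      y = K↔.from j

  InSpan? : ∀ u v → Decidable (InSpan u v)
  InSpan? u v x = F.any? λ a → F.any? λ b → x ≟ ⟦ a ⟧ * u + ⟦ b ⟧ * v

  abstract
    -- `InSpan 1# 0#` is membership in F_q, written as a degenerate span so that `notSpanned`
    -- applies.
    outside-Fq : ∃ λ x → ¬ InSpan 1# 0# x
    outside-Fq = ¬∀⇒∃¬ {P = InSpan 1# 0#} (InSpan? 1# 0#) (notSpanned 1# 0#)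

  θ : Carrier
  θ = proj₁ outside-Fq

  scalar⇒InSpan : ∀ {x} → IsScalar x → InSpan 1# 0# x
  scalar⇒InSpan {x} (a , x≡a) = a , F.0# , (begin
    x                            ≡⟨ x≡a ⟩
    ⟦ a ⟧                        ≡⟨ solve 2 (λ a b → a := a :* con (ℤ.+ 1) :+ b :* con (ℤ.+ 0)) refl ⟦ a ⟧ ⟦ F.0# ⟧ ⟩
    ⟦ a ⟧ * 1# + ⟦ F.0# ⟧ * 0#   ∎)

  -- In a relation γ θ = k γ 1 the first coordinates give k = θ, while scatteredness puts k into
  -- F_q. So U lies on no K-line.
  γ-independent : det (γ 1#) (γ θ) ≢ 0#
  γ-independent det≡0 = conclude (proportional {γ 1#} {γ θ} (γ-≢0 1≢0) det≡0)
    where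
    conclude : ¬ (γ θ ∈ ⟨ γ 1# ⟩)
    conclude (k , γθ≡kγ1) = proj₂ outside-Fq (subst (InSpan 1# 0#) k≡θ
      (scalar⇒InSpan (proportional⇒scalar {1#} {θ} {k} 1≢0 γθ≡kγ1)))
      where
      k≡θ : k ≡ θ
      k≡θ = trans (sym (*-identityʳ k)) (sym (cong proj₁ γθ≡kγ1))

  -- Components and additivity

  open TranslationPlane _+ᵥ_ (ℬ f) public hiding (module Affine; module Projective)
  module Affine = TranslationPlane.Affine _+ᵥ_ (ℬ f)
  module Projective = TranslationPlane.Projective _+ᵥ_ (ℬ f)

  -- K-lines and sets h U are both injective additive images of K. This common form yields the
  -- subgroup laws, decidable membership and the size q ^ n without a case distinction.
  record Parametrization (W : Pred V 0ℓ) : Set where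
    field
      point           : Carrier → V
      point-+         : ∀ x y → point (x + y) ≡ point x +ᵥ point y
      point-injective : ∀ {x y} → point x ≡ point y → x ≡ y
      sound           : ∀ x → point x ∈ W
      complete        : ∀ {w} → w ∈ W → ∃ λ x → w ≡ point x

  respects : ∀ {W W′ : Pred V 0ℓ} → W ≐ W′ → Parametrization W′ → Parametrization W
  respects (W⊆ , W⊇) P = record
    { point = point ; point-+ = point-+ ; point-injective = point-injective
    ; sound = λ x → W⊇ (sound x) ; complete = λ w∈W → complete (W⊆ w∈W) }
    where open Parametrization P

  line-parametrization : ∀ {v} → v ≢ 0ᵥ → Parametrization ⟨ v ⟩
  line-parametrization {v} v≢0 = record
    { point = _*ᵥ v ; point-+ = λ x y → *ᵥ-distribʳ x y v ; point-injective = *ᵥ-cancelʳ v≢0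
    ; sound = λ x → x , refl ; complete = λ h → h }

  dilate-parametrization : ∀ {h} → h ≢ 0# → Parametrization (dilate f h (graph f))
  dilate-parametrization {h} h≢0 = record
    { point = λ x → h *ᵥ γ x
    ; point-+ = λ x y → trans (cong (h *ᵥ_) (γ-+ x y)) (*ᵥ-distribˡ h (γ x) (γ y))
    ; point-injective = λ {x} {y} eq → cong proj₁ (*ᵥ-cancelˡ {h} {γ x} {γ y} h≢0 eq)
    ; sound = λ x → γ x , (x , refl) , refl
    ; complete = λ { (_ , (x , refl) , eq) → x , eq } }

  parametrize : ∀ {W} → W ∈ ℬ f → Parametrization W
  parametrize (inj₁ ((v , v≢0 , W≐) , _)) = respects W≐ (line-parametrization v≢0)
  parametrize (inj₂ (h , h≢0 , W≐))       = respects W≐ (dilate-parametrization h≢0)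

  module ParametrizationProperties {W : Pred V 0ℓ} (P : Parametrization W) where
    open Parametrization P public

    point-0 : point 0# ≡ 0ᵥ
    point-0 = +ᵥ-cancelˡ (point 0#) (trans (sym (point-+ 0# 0#))
      (trans (cong point (+-identityˡ 0#)) (sym (+ᵥ-identityʳ (point 0#)))))

    point-neg : ∀ x → point (- x) ≡ negᵥ (point x)
    point-neg x = +ᵥ-cancelˡ (point x) (trans (sym (point-+ x (- x)))
      (trans (cong point (-‿inverseʳ x)) (trans point-0 (sym (-ᵥ-inverseʳ (point x))))))

    point-≢0 : ∀ {x} → x ≢ 0# → point x ≢ 0ᵥ
    point-≢0 x≢0 eq = x≢0 (point-injective (trans eq (sym point-0)))

    0∈ : 0ᵥ ∈ W
    0∈ = subst W point-0 (sound 0#)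

    +-∈ : ∀ {u v} → u ∈ W → v ∈ W → u +ᵥ v ∈ W
    +-∈ u∈ v∈ with complete u∈ | complete v∈
    ... | x , refl | y , refl = subst W (point-+ x y) (sound (x + y))

    neg-∈ : ∀ {u} → u ∈ W → negᵥ u ∈ W
    neg-∈ u∈ with complete u∈
    ... | x , refl = subst W (point-neg x) (sound (- x))

    ∸-∈ : ∀ {u v} → u ∈ W → v ∈ W → u -ᵥ v ∈ W
    ∸-∈ u∈ v∈ = +-∈ u∈ (neg-∈ v∈)

    _∈? : ∀ v → Dec (v ∈ W)
    v ∈? = map′ (λ { (x , refl) → sound x }) complete (any? λ x → v ≟ᵥ point x)

  module ComponentProperties {W : Pred V 0ℓ} (W∈ℬ : W ∈ ℬ f) = ParametrizationProperties (parametrize W∈ℬ)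

  ⟨⟩-⊆ : ∀ {u v} → v ∈ ⟨ u ⟩ → ⟨ v ⟩ ⊆ ⟨ u ⟩
  ⟨⟩-⊆ {u} (k , refl) (l , refl) = l * k , sym (*ᵥ-assoc l k u)

  ⟨⟩-≐ : ∀ {u v} → v ≢ 0ᵥ → v ∈ ⟨ u ⟩ → ⟨ u ⟩ ≐ ⟨ v ⟩
  ⟨⟩-≐ {u} v≢0 v∈@(k , refl) = ⟨⟩-⊆ (k ⁻¹ , sym (⁻¹*ᵥ (*ᵥ-≢0ˡ {k} {u} v≢0) u)) , ⟨⟩-⊆ v∈

  -- From h γ y = h′ γ z with y ≠ 0, scatteredness puts h′ ⁻¹ h into F_q, and U is closed under
  -- multiplication by F_q.
  dilate-⊆ : ∀ {h h′ y} → y ≢ 0# → h *ᵥ γ y ∈ dilate f h′ (graph f) → h′ ≢ 0# → dilate f h (graph f) ⊆ dilate f h′ (graph f)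
  dilate-⊆ {h} {h′} {y} y≢0 (_ , (z , refl) , hy≡h′z) h′≢0 (_ , (x , refl) , refl) = conclude (proportional⇒scalar {y} {z} y≢0 γz≡)
    where
    γz≡ : γ z ≡ (h′ ⁻¹ * h) *ᵥ γ y
    γz≡ = begin
      γ z                      ≡⟨ sym (⁻¹*ᵥ h′≢0 (γ z)) ⟩
      h′ ⁻¹ *ᵥ h′ *ᵥ γ z       ≡⟨ cong (h′ ⁻¹ *ᵥ_) (sym hy≡h′z) ⟩
      h′ ⁻¹ *ᵥ h *ᵥ γ y        ≡⟨ sym (*ᵥ-assoc (h′ ⁻¹) h (γ y)) ⟩
      (h′ ⁻¹ * h) *ᵥ γ y       ∎
    conclude : IsScalar (h′ ⁻¹ * h) → h *ᵥ γ x ∈ dilate f h′ (graph f)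
    conclude (a , eq) = γ (⟦ a ⟧ * x) , (⟦ a ⟧ * x , refl) , (begin
      h *ᵥ γ x                  ≡⟨ sym (*⁻¹ᵥ h′≢0 (h *ᵥ γ x)) ⟩
      h′ *ᵥ h′ ⁻¹ *ᵥ h *ᵥ γ x   ≡⟨ cong (h′ *ᵥ_) (sym (*ᵥ-assoc (h′ ⁻¹) h (γ x))) ⟩
      h′ *ᵥ (h′ ⁻¹ * h) *ᵥ γ x  ≡⟨ cong (λ k → h′ *ᵥ k *ᵥ γ x) eq ⟩
      h′ *ᵥ ⟦ a ⟧ *ᵥ γ x        ≡⟨ cong (h′ *ᵥ_) (sym (γ-⟦⟧ a x)) ⟩
      h′ *ᵥ γ (⟦ a ⟧ * x)       ∎)

  -- A nonzero vector h γ x on the line of u would make that line the point of L_f spanned by γ x.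
  line-dilate-disjoint : ∀ {u h x} → ⟨ u ⟩ ∉ L f → h *ᵥ γ x ≢ 0ᵥ → h *ᵥ γ x ∉ ⟨ u ⟩
  line-dilate-disjoint {u} {h} {x} ⟨u⟩∉L hγx≢0 hγx∈⟨u⟩ = ⟨u⟩∉L (x , γ-≢0⁻¹ (*ᵥ-≢0ʳ {h} hγx≢0) ,
    ⟨⟩-≐ (*ᵥ-≢0ʳ {h} hγx≢0) (⟨⟩-⊆ hγx∈⟨u⟩ (h ⁻¹ , sym (⁻¹*ᵥ (*ᵥ-≢0ˡ {h} {γ x} hγx≢0) (γ x)))))

  ∉L-resp : ∀ {W W′} → W ≐ W′ → W ∉ L f → W′ ∉ L f
  ∉L-resp W≐W′ W∉L (x , x≢0 , W′≐) = W∉L (x , x≢0 , ≐-trans W≐W′ W′≐)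

  -- One half of the spread property; `componentOf` is the other half.
  meet : ∀ {W W′ v} → W ∈ ℬ f → W′ ∈ ℬ f → v ≢ 0ᵥ → v ∈ W → v ∈ W′ → W ≐ W′
  meet (inj₁ ((u , _ , W≐) , _)) (inj₁ ((u′ , _ , W′≐) , _)) v≢0 v∈W v∈W′ =
    ≐-trans W≐ (≐-trans (⟨⟩-≐ v≢0 (proj₁ W≐ v∈W)) (≐-trans (≐-sym (⟨⟩-≐ v≢0 (proj₁ W′≐ v∈W′))) (≐-sym W′≐)))
  meet (inj₁ ((u , _ , W≐) , W∉L)) (inj₂ (h , _ , W′≐)) v≢0 v∈W v∈W′ with proj₁ W′≐ v∈W′
  ... | _ , (x , refl) , refl = contradiction (proj₁ W≐ v∈W) (line-dilate-disjoint {u} {h} {x} (∉L-resp W≐ W∉L) v≢0)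
  meet (inj₂ (h , _ , W≐)) (inj₁ ((u′ , _ , W′≐) , W′∉L)) v≢0 v∈W v∈W′ with proj₁ W≐ v∈W
  ... | _ , (x , refl) , refl = contradiction (proj₁ W′≐ v∈W′) (line-dilate-disjoint {u′} {h} {x} (∉L-resp W′≐ W′∉L) v≢0)
  meet (inj₂ (h , h≢0 , W≐)) (inj₂ (h′ , h′≢0 , W′≐)) v≢0 v∈W v∈W′ with proj₁ W≐ v∈W | proj₁ W′≐ v∈W′
  ... | _ , (x , refl) , refl | v∈@(_ , (x′ , refl) , eq) = ≐-trans W≐ (≐-trans
    (dilate-⊆ {h} {h′} {x} (γ-≢0⁻¹ (*ᵥ-≢0ʳ {h} v≢0)) v∈ h′≢0 ,
     dilate-⊆ {h′} {h} {x′} (γ-≢0⁻¹ (*ᵥ-≢0ʳ {h′} {γ x′} (λ e → v≢0 (trans eq e)))) (γ x , (x , refl) , sym eq) h≢0) (≐-sym W′≐))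

  -- A search through the finite field decides whether v is a multiple of a vector of U. If it is
  -- not, its K-line avoids L_f and is itself a component.
  cover : ∀ {v} → v ≢ 0ᵥ → (∃₂ λ h x → h ≢ 0# × x ≢ 0# × v ≡ h *ᵥ γ x) ⊎ ⟨ v ⟩ ∈ ℬ f
  cover {v} v≢0 with any? (λ h → any? λ x → v ≟ᵥ h *ᵥ γ x)
  ... | yes (h , x , refl) = inj₁ (h , x , *ᵥ-≢0ˡ {h} {γ x} v≢0 , γ-≢0⁻¹ (*ᵥ-≢0ʳ {h} v≢0) , refl)
  ... | no ∉ = inj₂ (inj₁ ((v , v≢0 , ≐-refl) , λ { (x , x≢0 , (v⊆ , _)) →
          let k , eq = v⊆ (1# , sym (1*ᵥ v)) in ∉ (k , x , eq) }))

  graph∈ℬ : ∀ {h} → h ≢ 0# → dilate f h (graph f) ∈ ℬ f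
  graph∈ℬ {h} h≢0 = inj₂ (h , h≢0 , ≐-refl)

  componentOf : ∀ {v} → v ≢ 0ᵥ → ∃ λ W → W ∈ ℬ f × v ∈ W
  componentOf {v} v≢0 with cover v≢0
  ... | inj₁ (h , x , h≢0 , _ , refl) = dilate f h (graph f) , graph∈ℬ h≢0 , (γ x , (x , refl) , refl)
  ... | inj₂ ⟨v⟩∈ℬ = ⟨ v ⟩ , ⟨v⟩∈ℬ , (1# , sym (1*ᵥ v))

  disjoint⊎equal : ∀ {W W′} → W ∈ ℬ f → W′ ∈ ℬ f → (∀ {v} → v ∈ W → v ∈ W′ → v ≡ 0ᵥ) ⊎ W ≐ W′
  disjoint⊎equal {W} {W′} W∈ℬ W′∈ℬ with ComponentProperties._∈? W′∈ℬ (ComponentProperties.point W∈ℬ 1#)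
  ... | yes p∈W′ = inj₂ (meet W∈ℬ W′∈ℬ (ComponentProperties.point-≢0 W∈ℬ 1≢0) (ComponentProperties.sound W∈ℬ 1#) p∈W′)
  ... | no p∉W′ = inj₁ disjoint
    where
    disjoint : ∀ {v} → v ∈ W → v ∈ W′ → v ≡ 0ᵥ
    disjoint {v} v∈W v∈W′ with v ≟ᵥ 0ᵥ
    ... | yes v≡0 = v≡0
    ... | no v≢0 = contradiction (proj₁ (meet W∈ℬ W′∈ℬ v≢0 v∈W v∈W′) (ComponentProperties.sound W∈ℬ 1#)) p∉W′

  -- Since W and W′ meet only in 0, adding their parametrizations is an injective map from K × K to
  -- itself, hence onto.
  complementary : ∀ {W W′} → W ∈ ℬ f → W′ ∈ ℬ f → (∀ {v} → v ∈ W → v ∈ W′ → v ≡ 0ᵥ) →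
                  ∀ v → ∃₂ λ w w′ → w ∈ W × w′ ∈ W′ × v ≡ w +ᵥ w′
  complementary {W} {W′} W∈ℬ W′∈ℬ disjoint v = conclude (injection⇒surjection vectors vectors pair pair-injective v)
    where
    module P = ComponentProperties W∈ℬ
    module P′ = ComponentProperties W′∈ℬ
    pair : V → V
    pair (a , b) = P.point a +ᵥ P′.point b
    pair-injective : ∀ {x y} → pair x ≡ pair y → x ≡ y
    pair-injective {a , b} {c , d} eq = cong₂ _,_ (P.point-injective (u-v≡0⇒u≡v δ≡0))
      (P′.point-injective (sym (u-v≡0⇒u≡v (trans (sym δ≡) δ≡0))))
      where
      swap : ∀ x y z w → x + y ≡ z + w → x - z ≡ w - y
      swap x y z w e = x-y≡0⇒x≡y (trans (solve 4 (λ x y z w → (x :- z) :- (w :- y) := (x :+ y) :- (z :+ w)) refl x y z w)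
        (x≡y⇒x-y≡0 e))
      δ≡ : P.point a -ᵥ P.point c ≡ P′.point d -ᵥ P′.point b
      δ≡ = cong₂ _,_ (swap _ _ _ _ (cong proj₁ eq)) (swap _ _ _ _ (cong proj₂ eq))
      δ≡0 : P.point a -ᵥ P.point c ≡ 0ᵥ
      δ≡0 = disjoint (P.∸-∈ (P.sound a) (P.sound c)) (subst W′ (sym δ≡) (P′.∸-∈ (P′.sound d) (P′.sound b)))
    conclude : (∃ λ x → pair x ≡ v) → ∃₂ λ w w′ → w ∈ W × w′ ∈ W′ × v ≡ w +ᵥ w′
    conclude ((a , b) , eq) = P.point a , P′.point b , P.sound a , P′.sound b , sym eq

  -- A nonzero vector h γ x has nonzero first coordinate, so the vertical line is outside L_f for
  -- every f.
  vertical∈ℬ : ⟨ 0# , 1# ⟩ ∈ ℬ f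
  vertical∈ℬ with cover {0# , 1#} (λ eq → 1≢0 (cong proj₂ eq))
  ... | inj₁ (h , x , h≢0 , x≢0 , eq) = contradiction (sym (cong proj₁ eq)) (*-≢0 h≢0 x≢0)
  ... | inj₂ ∈ℬ = ∈ℬ

  outside : ∀ {W} → W ∈ ℬ f → ∃ λ z → z ∉ W
  outside {W} W∈ℬ with ComponentProperties._∈? W∈ℬ (0# , 1#)
  ... | no ∉ = (0# , 1#) , ∉
  ... | yes ∈W = (1# , 0#) , λ ∈′ → horizontal (proj₁ (meet W∈ℬ vertical∈ℬ (λ eq → 1≢0 (cong proj₂ eq)) ∈W (1# , sym (1*ᵥ _))) ∈′)
    where
    horizontal : (1# , 0#) ∉ ⟨ 0# , 1# ⟩
    horizontal (k , eq) = 1≢0 (trans (cong proj₁ eq) (zeroʳ k))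

  ∈ₗ⇔ : ∀ {x v W} (W∈ℬ : W ∈ ℬ f) → x ∈ₗ (v , W , W∈ℬ) ⇔ x -ᵥ v ∈ W
  ∈ₗ⇔ {x} {v} {W} W∈ℬ = mk⇔ (λ { (w , w∈W , refl) → subst W (sym ([u+v]-u v w)) w∈W })
    (λ x-v∈W → x -ᵥ v , x-v∈W , sym (u+[v-u] v x))

  module _ (φ : Collineation) where
    private
      module φ = Affine.Collineation φ

    -- The parallel class of W goes to that of W′, phrased with differences so that no base point
    -- appears.
    MapsClass : Pred V 0ℓ → Pred V 0ℓ → Set
    MapsClass W W′ = ∀ x y → x -ᵥ y ∈ W ⇔ to φ x -ᵥ to φ y ∈ W′

    lineImage : ∀ {W} → W ∈ ℬ f → ∀ y → ∃ λ W′ → W′ ∈ ℬ f × (∀ x → x -ᵥ y ∈ W ⇔ to φ x -ᵥ to φ y ∈ W′)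
    lineImage {W} W∈ℬ y with φ.to-line (y , W , W∈ℬ)
    ... | (c , W′ , W′∈ℬ) , maps = W′ , W′∈ℬ , λ x → mk⇔
      -- The image line comes with an arbitrary base point `c`; since φ y lies on it too, `c` can be
      -- traded for φ y.
      (λ h → subst W′ ([u-w]-[v-w] (to φ x) (to φ y) c) (P′.∸-∈ (forth x h) φy-c∈))
      (λ h → back x (subst W′ ([u-v]+[v-w] (to φ x) (to φ y) c) (P′.+-∈ h φy-c∈)))
      where
      module P′ = ComponentProperties W′∈ℬ
      forth : ∀ x → x -ᵥ y ∈ W → to φ x -ᵥ c ∈ W′
      forth x h = Equivalence.to (∈ₗ⇔ W′∈ℬ) (Equivalence.to (maps x) (Equivalence.from (∈ₗ⇔ W∈ℬ) h))
      back : ∀ x → to φ x -ᵥ c ∈ W′ → x -ᵥ y ∈ W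
      back x h = Equivalence.to (∈ₗ⇔ W∈ℬ) (Equivalence.from (maps x) (Equivalence.from (∈ₗ⇔ W′∈ℬ) h))
      φy-c∈ : to φ y -ᵥ c ∈ W′
      φy-c∈ = forth y (subst W (sym (-ᵥ-inverseʳ y)) (ComponentProperties.0∈ W∈ℬ))

    -- If the images of two parallel lines had different directions they would
    -- meet, and then the two lines would be equal.
    private
      meeting⇒equal : ∀ {W W′ W″ y} → W ∈ ℬ f → W′ ∈ ℬ f → W″ ∈ ℬ f →
                      (∀ x → x -ᵥ 0ᵥ ∈ W ⇔ to φ x -ᵥ to φ 0ᵥ ∈ W′) → (∀ x → x -ᵥ y ∈ W ⇔ to φ x -ᵥ to φ y ∈ W″) →
                      (∃₂ λ w w′ → w ∈ W′ × w′ ∈ W″ × to φ y -ᵥ to φ 0ᵥ ≡ w +ᵥ w′) → y ∈ W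
      meeting⇒equal {W} {W′} {W″} {y} W∈ℬ W′∈ℬ W″∈ℬ at-0 at-y (w , w′ , w∈W′ , w′∈W″ , eq) =
        subst W (u-[u-v] r y) (ComponentProperties.∸-∈ W∈ℬ {r} {r -ᵥ y} r∈W r-y∈W)
        where
        p r : V
        p = to φ 0ᵥ +ᵥ w
        r = φ.from p
        φr≡p : to φ r ≡ p
        φr≡p = φ.strictlyInverseˡ p
        φr-φ0≡w : to φ r -ᵥ to φ 0ᵥ ≡ w
        φr-φ0≡w = trans (cong (_-ᵥ to φ 0ᵥ) φr≡p) ([u+v]-u (to φ 0ᵥ) w)
        φr-φy≡-w′ : to φ r -ᵥ to φ y ≡ negᵥ w′
        φr-φy≡-w′ = trans (cong (_-ᵥ to φ y) φr≡p) (u-v≡s+t⇒[v+s]-u≡-t (to φ y) (to φ 0ᵥ) w w′ eq)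
        r∈W : r ∈ W
        r∈W = subst W (-ᵥ0ᵥ r) (Equivalence.from (at-0 r) (subst W′ (sym φr-φ0≡w) w∈W′))
        r-y∈W : r -ᵥ y ∈ W
        r-y∈W = Equivalence.from (at-y r) (subst W″ (sym φr-φy≡-w′) (ComponentProperties.neg-∈ W″∈ℬ {w′} w′∈W″))

    mapsClass : ∀ {W} → W ∈ ℬ f → ∃ λ W′ → W′ ∈ ℬ f × MapsClass W W′
    mapsClass {W} W∈ℬ = conclude (lineImage W∈ℬ 0ᵥ)
      where
      module P = ComponentProperties W∈ℬ
      conclude : (∃ λ W′ → W′ ∈ ℬ f × (∀ x → x -ᵥ 0ᵥ ∈ W ⇔ to φ x -ᵥ to φ 0ᵥ ∈ W′)) → ∃ λ W′ → W′ ∈ ℬ f × MapsClass W W′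
      conclude (W′ , W′∈ℬ , at-0) = W′ , W′∈ℬ , λ x y → parallel x y (lineImage W∈ℬ y)
        where
        module P′ = ComponentProperties W′∈ℬ
        same-line : ∀ x y → y ∈ W → x -ᵥ y ∈ W ⇔ to φ x -ᵥ to φ y ∈ W′
        same-line x y y∈W = mk⇔
          (λ h → subst W′ ([u-w]-[v-w] (to φ x) (to φ y) (to φ 0ᵥ)) (P′.∸-∈ {to φ x -ᵥ to φ 0ᵥ} {to φ y -ᵥ to φ 0ᵥ}
            (Equivalence.to (at-0 x) (subst W (sym (-ᵥ0ᵥ x)) (subst W ([u-v]+v x y) (P.+-∈ {x -ᵥ y} {y} h y∈W)))) φy-φ0∈W′))
          (λ h → P.∸-∈ {x} {y} (subst W (-ᵥ0ᵥ x) (Equivalence.from (at-0 x)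
            (subst W′ ([u-v]+[v-w] (to φ x) (to φ y) (to φ 0ᵥ)) (P′.+-∈ {to φ x -ᵥ to φ y} {to φ y -ᵥ to φ 0ᵥ} h φy-φ0∈W′)))) y∈W)
          where
          φy-φ0∈W′ : to φ y -ᵥ to φ 0ᵥ ∈ W′
          φy-φ0∈W′ = Equivalence.to (at-0 y) (subst W (sym (-ᵥ0ᵥ y)) y∈W)
        parallel : ∀ x y → (∃ λ W″ → W″ ∈ ℬ f × (∀ x → x -ᵥ y ∈ W ⇔ to φ x -ᵥ to φ y ∈ W″)) →
                   x -ᵥ y ∈ W ⇔ to φ x -ᵥ to φ y ∈ W′
        parallel x y (W″ , W″∈ℬ , at-y) with disjoint⊎equal W′∈ℬ W″∈ℬ
        ... | inj₂ (W′⊆W″ , W″⊆W′) = mk⇔ (λ h → W″⊆W′ (Equivalence.to (at-y x) h)) (λ h → Equivalence.from (at-y x) (W′⊆W″ h))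
        -- This case is not refuted. It yields y ∈ W, and then the line through y is the one through
        -- 0, for which W′ is already known to work.
        ... | inj₁ disjoint = same-line x y (meeting⇒equal W∈ℬ W′∈ℬ W″∈ℬ at-0 at-y
                (complementary W′∈ℬ W″∈ℬ disjoint (to φ y -ᵥ to φ 0ᵥ)))

    to-injective : ∀ {x y} → to φ x ≡ to φ y → x ≡ y
    to-injective {x} {y} eq = trans (sym (φ.strictlyInverseʳ x)) (trans (cong φ.from eq) (φ.strictlyInverseʳ y))

    module Additivity (φ0≡0 : to φ 0ᵥ ≡ 0ᵥ) where

      MapsComponent : Pred V 0ℓ → Pred V 0ℓ → Set
      MapsComponent W W′ = ∀ x → x ∈ W ⇔ to φ x ∈ W′

      class⇒component : ∀ {W W′} → MapsClass W W′ → MapsComponent W W′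
      class⇒component {W} {W′} maps x = mk⇔
        (λ x∈ → subst W′ φx-φ0 (Equivalence.to (maps x 0ᵥ) (subst W (sym (-ᵥ0ᵥ x)) x∈)))
        (λ φx∈ → subst W (-ᵥ0ᵥ x) (Equivalence.from (maps x 0ᵥ) (subst W′ (sym φx-φ0) φx∈)))
        where
        φx-φ0 : to φ x -ᵥ to φ 0ᵥ ≡ to φ x
        φx-φ0 = trans (cong (to φ x -ᵥ_) φ0≡0) (-ᵥ0ᵥ (to φ x))

      -- The defect `δ` of additivity lies in the image of W, because x + y and y are on a line
      -- parallel to W, and in the image of the component of y, because x + y and x are on a line
      -- parallel to that one. The two images are different components and meet only in 0.
      additive-transversal : ∀ {W x y} → W ∈ ℬ f → x ∈ W → y ∉ W → to φ (x +ᵥ y) ≡ to φ x +ᵥ to φ y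
      additive-transversal {W} {x} {y} W∈ℬ x∈W y∉W =
        parallelogram (componentOf {y} λ y≡0 → y∉W (subst W (sym y≡0) (ComponentProperties.0∈ W∈ℬ))) (mapsClass W∈ℬ)
        where
        δ : V
        δ = to φ (x +ᵥ y) -ᵥ (to φ x +ᵥ to φ y)

        -- x + y is the fourth vertex of the parallelogram with vertices 0, x, y.
        parallelogram : (∃ λ Y → Y ∈ ℬ f × y ∈ Y) → (∃ λ W′ → W′ ∈ ℬ f × MapsClass W W′) →
                        to φ (x +ᵥ y) ≡ to φ x +ᵥ to φ y
        parallelogram (Y , Y∈ℬ , y∈Y) (W′ , W′∈ℬ , W-maps) = finish (mapsClass Y∈ℬ)
          where
          δ∈W′ : δ ∈ W′
          δ∈W′ = subst W′ ([w-v]-u (to φ x) (to φ y) (to φ (x +ᵥ y)))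
            (ComponentProperties.∸-∈ W′∈ℬ {to φ (x +ᵥ y) -ᵥ to φ y} {to φ x}
              (Equivalence.to (W-maps (x +ᵥ y) y) (subst W (sym ([u+v]-v x y)) x∈W))
              (Equivalence.to (class⇒component {W} {W′} W-maps x) x∈W))
          finish : (∃ λ Y′ → Y′ ∈ ℬ f × MapsClass Y Y′) → to φ (x +ᵥ y) ≡ to φ x +ᵥ to φ y
          finish (Y′ , Y′∈ℬ , Y-maps) = u-v≡0⇒u≡v (vanishes (disjoint⊎equal W′∈ℬ Y′∈ℬ))
            where
            φy∈Y′ : to φ y ∈ Y′
            φy∈Y′ = Equivalence.to (class⇒component {Y} {Y′} Y-maps y) y∈Y
            δ∈Y′ : δ ∈ Y′
            δ∈Y′ = subst Y′ (trans ([w-v]-u (to φ y) (to φ x) (to φ (x +ᵥ y)))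
                (cong (to φ (x +ᵥ y) -ᵥ_) (+ᵥ-comm (to φ y) (to φ x))))
              (ComponentProperties.∸-∈ Y′∈ℬ {to φ (x +ᵥ y) -ᵥ to φ x} {to φ y}
                (Equivalence.to (Y-maps (x +ᵥ y) x) (subst Y (sym ([u+v]-u x y)) y∈Y)) φy∈Y′)
            vanishes : (∀ {v} → v ∈ W′ → v ∈ Y′ → v ≡ 0ᵥ) ⊎ W′ ≐ Y′ → δ ≡ 0ᵥ
            vanishes (inj₁ disjoint)     = disjoint {δ} δ∈W′ δ∈Y′
            vanishes (inj₂ (_ , Y′⊆W′)) = contradiction
              (Equivalence.from (class⇒component {W} {W′} W-maps y) (Y′⊆W′ φy∈Y′)) y∉W

      additive : ∀ x y → to φ (x +ᵥ y) ≡ to φ x +ᵥ to φ y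
      additive x y with x ≟ᵥ 0ᵥ
      ... | yes refl = trans (cong (to φ) (+ᵥ-identityˡ y)) (sym (trans (cong (_+ᵥ to φ y) φ0≡0) (+ᵥ-identityˡ (to φ y))))
      ... | no x≢0 = split (componentOf x≢0)
        where
        split : (∃ λ W → W ∈ ℬ f × x ∈ W) → to φ (x +ᵥ y) ≡ to φ x +ᵥ to φ y
        split (W , W∈ℬ , x∈W) = decide (y P.∈?)
          where
          module P = ComponentProperties W∈ℬ
          -- When x and y share the component W, a vector z outside it makes (x + y) + z, x + (y +
          -- z) and y + z transversal sums, and z cancels at the end.
          detour : y ∈ W → (∃ λ z → z ∉ W) → to φ (x +ᵥ y) ≡ to φ x +ᵥ to φ y
          detour y∈W (z , z∉W) = +ᵥ-cancelˡ (to φ z) (begin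
            to φ z +ᵥ to φ (x +ᵥ y)           ≡⟨ +ᵥ-comm (to φ z) (to φ (x +ᵥ y)) ⟩
            to φ (x +ᵥ y) +ᵥ to φ z           ≡⟨ sym (additive-transversal W∈ℬ (P.+-∈ {x} {y} x∈W y∈W) z∉W) ⟩
            to φ ((x +ᵥ y) +ᵥ z)              ≡⟨ cong (to φ) (+ᵥ-assoc x y z) ⟩
            to φ (x +ᵥ (y +ᵥ z))              ≡⟨ additive-transversal W∈ℬ x∈W y+z∉W ⟩
            to φ x +ᵥ to φ (y +ᵥ z)           ≡⟨ cong (to φ x +ᵥ_) (additive-transversal W∈ℬ y∈W z∉W) ⟩
            to φ x +ᵥ (to φ y +ᵥ to φ z)      ≡⟨ sym (+ᵥ-assoc (to φ x) (to φ y) (to φ z)) ⟩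
            (to φ x +ᵥ to φ y) +ᵥ to φ z      ≡⟨ +ᵥ-comm (to φ x +ᵥ to φ y) (to φ z) ⟩
            to φ z +ᵥ (to φ x +ᵥ to φ y)      ∎)
            where
            y+z∉W : y +ᵥ z ∉ W
            y+z∉W y+z∈W = z∉W (subst W ([u+v]-u y z) (P.∸-∈ {y +ᵥ z} {y} y+z∈W y∈W))
          decide : Dec (y ∈ W) → to φ (x +ᵥ y) ≡ to φ x +ᵥ to φ y
          decide (no y∉W)  = additive-transversal W∈ℬ x∈W y∉W
          decide (yes y∈W) = detour y∈W (outside W∈ℬ)

  -- Semilinearity

  private
    3≤q-1 : 3 ℕ.≤ q ℕ.∸ 1
    3≤q-1 = ℕ.∸-monoˡ-≤ 1 3<q

    -- Six values are reserved for `goodAvoiding`: three for each of two excluded slopes.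
    6≤qⁿ : 6 ℕ.≤ q ℕ.^ n
    6≤qⁿ = ℕ.≤-trans (ℕ.≤-trans (ℕ.m≤m+n 6 10) (ℕ.*-mono-≤ 3<q 3<q)) (ℕ.<⇒≤ q²<qⁿ)

    -- Three distinct elements of F_q other than 0. Multiplying by them lets each bad line of a
    -- pencil occupy three values.
    ζ : Fin 3 → F.Carrier
    ζ j = proj₁ (Inverse.from F.units (Fin.inject≤ j 3≤q-1))

    ζ-≢0 : ∀ j → ζ j ≢ F.0#
    ζ-≢0 j = proj₂ (Inverse.from F.units (Fin.inject≤ j 3≤q-1))

    ζ-injective : ∀ {i j} → ⟦ ζ i ⟧ ≡ ⟦ ζ j ⟧ → i ≡ j
    ζ-injective {i} {j} eq = Fin.inject≤-injective 3≤q-1 3≤q-1 i j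
      (Finite.from-injective F.units {Fin.inject≤ i 3≤q-1} {Fin.inject≤ j 3≤q-1} (⟦⟧-injective eq))

    six : Fin 6 → Carrier
    six i = Inverse.from enumeration (Fin.inject≤ i 6≤qⁿ)

    six-injective : ∀ {i j} → six i ≡ six j → i ≡ j
    six-injective {i} {j} eq = Fin.inject≤-injective 6≤qⁿ 6≤qⁿ i j
      (Finite.from-injective enumeration {Fin.inject≤ i 6≤qⁿ} {Fin.inject≤ j 6≤qⁿ} eq)

  module _ (φ : Collineation) (φ0≡0 : to φ 0ᵥ ≡ 0ᵥ) where
    open Additivity φ φ0≡0 using (MapsComponent; class⇒component; additive)

    private
      T : V → V
      T = to φ

      T-≢0 : ∀ {v} → v ≢ 0ᵥ → T v ≢ 0ᵥ
      T-≢0 v≢0 Tv≡0 = v≢0 (to-injective φ (trans Tv≡0 (sym φ0≡0)))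

    imageComponent : ∀ {W} → W ∈ ℬ f → ∃ λ W′ → W′ ∈ ℬ f × MapsComponent W W′
    imageComponent {W} W∈ℬ = let W′ , W′∈ℬ , maps = mapsClass φ W∈ℬ in W′ , W′∈ℬ , class⇒component {W} {W′} maps

    -- The K-line of v is carried into a K-line, whether or not it is a component.
    Good : V → Set
    Good v = ∀ k → ∃ λ l → T (k *ᵥ v) ≡ l *ᵥ T v

    Good? : Decidable Good
    Good? v = all? λ k → any? λ l → T (k *ᵥ v) ≟ᵥ l *ᵥ T v

    -- `covered` puts the line of v into L_f, and `moved` says that its image is a set h U. The
    -- cases may overlap; the count needs one of them to be chosen for each line.
    data Class (v : V) : Set where
      covered : ∀ h x → h ≢ 0# → x ≢ 0# → v ≡ h *ᵥ γ x → Class v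
      moved   : ∀ h → h ≢ 0# → (∀ w → w ∈ ⟨ v ⟩ ⇔ T w ∈ dilate f h (graph f)) → Class v
      good    : Good v → Class v

    classify : ∀ {v} → v ≢ 0ᵥ → Class v
    classify {v} v≢0 = before (cover v≢0)
      where
      v∈⟨v⟩ : v ∈ ⟨ v ⟩
      v∈⟨v⟩ = 1# , sym (1*ᵥ v)
      after : (∃ λ W′ → W′ ∈ ℬ f × MapsComponent ⟨ v ⟩ W′) → Class v
      after (W′ , inj₂ (h , h≢0 , W′⊆ , W′⊇) , maps) = moved h h≢0 λ w →
        mk⇔ (λ w∈ → W′⊆ (Equivalence.to (maps w) w∈)) (λ Tw∈ → Equivalence.from (maps w) (W′⊇ Tw∈))
      after (W′ , inj₁ ((u , u≢0 , W′⊆ , _) , _) , maps) = good λ k →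
        proj₁ (⟨⟩-≐ {u} {T v} (T-≢0 v≢0) (W′⊆ (Equivalence.to (maps v) v∈⟨v⟩))) (W′⊆ (Equivalence.to (maps (k *ᵥ v)) (k , refl)))
      before : (∃₂ λ h x → h ≢ 0# × x ≢ 0# × v ≡ h *ᵥ γ x) ⊎ ⟨ v ⟩ ∈ ℬ f → Class v
      before (inj₁ (h , x , h≢0 , x≢0 , eq)) = covered h x h≢0 x≢0 eq
      before (inj₂ ⟨v⟩∈ℬ)                    = after (imageComponent ⟨v⟩∈ℬ)

    Good-* : ∀ {v k} → v ≢ 0ᵥ → k ≢ 0# → Good v → Good (k *ᵥ v)
    Good-* {v} {k} v≢0 k≢0 G l = a * b ⁻¹ , (begin
      T (l *ᵥ k *ᵥ v)              ≡⟨ cong T (sym (*ᵥ-assoc l k v)) ⟩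
      T ((l * k) *ᵥ v)             ≡⟨ proj₂ (G (l * k)) ⟩
      a *ᵥ T v                     ≡⟨ cong (_*ᵥ T v) (sym (divide b≢0 a)) ⟩
      (a * b ⁻¹ * b) *ᵥ T v        ≡⟨ *ᵥ-assoc (a * b ⁻¹) b (T v) ⟩
      (a * b ⁻¹) *ᵥ b *ᵥ T v       ≡⟨ cong ((a * b ⁻¹) *ᵥ_) (sym (proj₂ (G k))) ⟩
      (a * b ⁻¹) *ᵥ T (k *ᵥ v)     ∎)
      where
      a b : Carrier
      a = proj₁ (G (l * k))
      b = proj₁ (G k)
      b≢0 : b ≢ 0#
      b≢0 = *ᵥ-≢0ˡ {b} {T v} (subst (_≢ 0ᵥ) (proj₂ (G k)) (T-≢0 (*ᵥ-≢0 {k} {v} k≢0 v≢0)))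

    module Pencil {e₁ e₂ : V} (independent : det e₁ e₂ ≢ 0#) where
      open Basis {e₁} {e₂} independent public

      ℓ : Carrier → V
      ℓ m = 1# e₁+ m e₂

      ℓ-≢0 : ∀ m → ℓ m ≢ 0ᵥ
      ℓ-≢0 m eq = 1≢0 (unique₁ {1#} {m} {0#} {0#} (trans eq (sym 0e₁+0e₂)))

      ℓ-injective : ∀ {m m′} → ℓ m′ ∈ ⟨ ℓ m ⟩ → m ≡ m′
      ℓ-injective {m} {m′} (k , eq) = sym (begin
        m′        ≡⟨ unique₂ {1#} {m′} {k * 1#} {k * m} eq′ ⟩
        k * m     ≡⟨ cong (_* m) (sym (trans (unique₁ {1#} {m′} {k * 1#} {k * m} eq′) (*-identityʳ k))) ⟩
        1# * m    ≡⟨ *-identityˡ m ⟩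
        m         ∎)
        where
        eq′ : ℓ m′ ≡ (k * 1#) e₁+ (k * m) e₂
        eq′ = trans eq (*-combination k 1# m)

      -- Each line of the pencil that is covered by L f, and each line that is
      -- moved onto some h U, accounts for q - 1 ≥ 3 elements of K \ {0}.
      module _ (s : Carrier → Fin 3 → Carrier)
               (s-injective : ∀ {m m′ j j′} → Good (ℓ m) → Good (ℓ m′) → s m j ≡ s m′ j′ → m ≡ m′ × j ≡ j′) where

        private
          encode : ∀ {m} → Fin 3 → Class (ℓ m) → Fin 3 × Carrier
          encode {m} j (good _)            = Fin.zero , s m j
          encode     j (covered h x _ _ _) = Fin.suc Fin.zero , ⟦ ζ j ⟧ * x
          encode     j (moved h _ _)       = Fin.suc (Fin.suc Fin.zero) , ⟦ ζ j ⟧ * h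

          ratio : Fin 3 → Fin 3 → F.Carrier
          ratio j j′ = ζ j F.⁻¹ F.* ζ j′

          quotient : ∀ j j′ {x x′} → ⟦ ζ j ⟧ * x ≡ ⟦ ζ j′ ⟧ * x′ → x ≡ ⟦ ratio j j′ ⟧ * x′
          quotient j j′ {x} {x′} eq = *-cancelˡ {⟦ ζ j ⟧} {x} {⟦ ratio j j′ ⟧ * x′} (⟦⟧-≢0 (ζ-≢0 j)) (begin
            ⟦ ζ j ⟧ * x                        ≡⟨ eq ⟩
            ⟦ ζ j′ ⟧ * x′                      ≡⟨ cong (λ z → ⟦ z ⟧ * x′) (sym cancelled) ⟩
            ⟦ ζ j F.* ratio j j′ ⟧ * x′        ≡⟨ cong (_* x′) (⟦⟧-* (ζ j) (ratio j j′)) ⟩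
            ⟦ ζ j ⟧ * ⟦ ratio j j′ ⟧ * x′      ≡⟨ *-assoc ⟦ ζ j ⟧ ⟦ ratio j j′ ⟧ x′ ⟩
            ⟦ ζ j ⟧ * (⟦ ratio j j′ ⟧ * x′)    ∎)
            where
            cancelled : ζ j F.* ratio j j′ ≡ ζ j′
            cancelled = trans (sym (F.*-assoc (ζ j) (ζ j F.⁻¹) (ζ j′)))
              (trans (cong (F._* ζ j′) (F.inverseʳ {ζ j} (ζ-≢0 j))) (F.*-identityˡ (ζ j′)))

          -- Equal codes give x = a x′, respectively h = a h′, with a in F_q. Then γ x and γ x′ are
          -- on one K-line, respectively h U = h′ U, so the two lines of the pencil coincide.
          encode-line : ∀ {m m′} j j′ (C : Class (ℓ m)) (C′ : Class (ℓ m′)) → encode j C ≡ encode j′ C′ → m ≡ m′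
          encode-line j j′ (good G) (good G′) eq = proj₁ (s-injective G G′ (cong proj₂ eq))
          encode-line j j′ (good _) (covered _ _ _ _ _) ()
          encode-line j j′ (good _) (moved _ _ _) ()
          encode-line j j′ (covered _ _ _ _ _) (good _) ()
          encode-line j j′ (covered _ _ _ _ _) (moved _ _ _) ()
          encode-line j j′ (moved _ _ _) (good _) ()
          encode-line j j′ (moved _ _ _) (covered _ _ _ _ _) ()
          encode-line {m} {m′} j j′ (covered h x h≢0 _ ℓm≡) (covered h′ x′ h′≢0 _ ℓm′≡) eq =
            sym (ℓ-injective {m′} {m} (h * (⟦ a ⟧ * h′ ⁻¹) , (begin
              ℓ m                                  ≡⟨ ℓm≡ ⟩
              h *ᵥ γ x                             ≡⟨ cong (λ z → h *ᵥ γ z) (quotient j j′ {x} {x′} (cong proj₂ eq)) ⟩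
              h *ᵥ γ (⟦ a ⟧ * x′)                  ≡⟨ cong (h *ᵥ_) (γ-⟦⟧ a x′) ⟩
              h *ᵥ ⟦ a ⟧ *ᵥ γ x′                   ≡⟨ cong (λ v → h *ᵥ ⟦ a ⟧ *ᵥ v) (sym (⁻¹*ᵥ h′≢0 (γ x′))) ⟩
              h *ᵥ ⟦ a ⟧ *ᵥ h′ ⁻¹ *ᵥ h′ *ᵥ γ x′    ≡⟨ cong (λ v → h *ᵥ ⟦ a ⟧ *ᵥ h′ ⁻¹ *ᵥ v) (sym ℓm′≡) ⟩
              h *ᵥ ⟦ a ⟧ *ᵥ h′ ⁻¹ *ᵥ ℓ m′          ≡⟨ cong (h *ᵥ_) (sym (*ᵥ-assoc ⟦ a ⟧ (h′ ⁻¹) (ℓ m′))) ⟩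
              h *ᵥ (⟦ a ⟧ * h′ ⁻¹) *ᵥ ℓ m′         ≡⟨ sym (*ᵥ-assoc h (⟦ a ⟧ * h′ ⁻¹) (ℓ m′)) ⟩
              (h * (⟦ a ⟧ * h′ ⁻¹)) *ᵥ ℓ m′        ∎)))
            where a = ratio j j′
          encode-line {m} {m′} j j′ (moved h h≢0 maps) (moved h′ h′≢0 maps′) eq =
            sym (ℓ-injective {m′} {m} (Equivalence.from (maps′ (ℓ m))
              (rescale {T (ℓ m)} (Equivalence.to (maps (ℓ m)) (1# , sym (1*ᵥ (ℓ m)))))))
            where
            a = ratio j j′
            h≡ : h ≡ h′ * ⟦ a ⟧
            h≡ = trans (quotient j j′ {h} {h′} (cong proj₂ eq)) (*-comm ⟦ a ⟧ h′)
            rescale : ∀ {w} → w ∈ dilate f h (graph f) → w ∈ dilate f h′ (graph f)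
            rescale {w} (_ , (y , refl) , w≡) = γ (⟦ a ⟧ * y) , (⟦ a ⟧ * y , refl) , (begin
              w                       ≡⟨ w≡ ⟩
              h *ᵥ γ y                ≡⟨ cong (_*ᵥ γ y) h≡ ⟩
              (h′ * ⟦ a ⟧) *ᵥ γ y     ≡⟨ *ᵥ-assoc h′ ⟦ a ⟧ (γ y) ⟩
              h′ *ᵥ ⟦ a ⟧ *ᵥ γ y      ≡⟨ cong (h′ *ᵥ_) (sym (γ-⟦⟧ a y)) ⟩
              h′ *ᵥ γ (⟦ a ⟧ * y)     ∎)

          encode-index : ∀ {m} j j′ (C : Class (ℓ m)) → encode j C ≡ encode j′ C → j ≡ j′
          encode-index j j′ (good G)              eq = proj₂ (s-injective G G (cong proj₂ eq))
          encode-index j j′ (covered _ x _ x≢0 _) eq = ζ-injective (*-cancelʳ {x} {⟦ ζ j ⟧} {⟦ ζ j′ ⟧} x≢0 (cong proj₂ eq))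
          encode-index j j′ (moved h h≢0 _)       eq = ζ-injective (*-cancelʳ {h} {⟦ ζ j ⟧} {⟦ ζ j′ ⟧} h≢0 (cong proj₂ eq))

          missed : ∀ {m} j (C : Class (ℓ m)) → encode j C ≢ (Fin.suc Fin.zero , 0#)
          missed j (good _)              ()
          missed j (moved _ _ _)         ()
          missed j (covered _ x _ x≢0 _) eq = *-≢0 {⟦ ζ j ⟧} {x} (⟦⟧-≢0 (ζ-≢0 j)) x≢0 (cong proj₂ eq)

          cells : (Fin 3 × Carrier) ↔ Fin (3 ℕ.* (q ℕ.^ n))
          cells = ↔-sym Fin.*↔× ↔-∘ (↔-id (Fin 3) ×-↔ enumeration)

          code : Fin 3 × Carrier → Fin 3 × Carrier
          code (j , m) = encode {m} j (classify {ℓ m} (ℓ-≢0 m))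

          code-injective : ∀ {x y} → code x ≡ code y → x ≡ y
          code-injective {j , m} {j′ , m′} eq = combine (encode-line {m} {m′} j j′ (classify (ℓ-≢0 m)) (classify (ℓ-≢0 m′)) eq) eq
            where
            combine : ∀ {m m′} → m ≡ m′ → code (j , m) ≡ code (j′ , m′) → (j , m) ≡ (j′ , m′)
            combine {m} refl eq = cong (_, m) (encode-index {m} j j′ (classify (ℓ-≢0 m)) eq)

        -- If the good slopes could be spread injectively over three values each, `code` would be an
        -- injection of the 3 q ^ n pairs into themselves. It misses the pair with second entry `0#`
        -- in the copy of the covered lines, as x ≠ 0 there. Hence more than a third of the slopes
        -- are good.
        goodLines-sparse : ⊥
        goodLines-sparse = conclude (injection⇒surjection cells cells code code-injective (Fin.suc Fin.zero , 0#))
          where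
          conclude : ¬ (∃ λ x → code x ≡ (Fin.suc Fin.zero , 0#))
          conclude ((j , m) , eq) = missed {m} j (classify (ℓ-≢0 m)) eq

      abstract
        -- If every good slope were a or b, the six reserved values would give each of them three
        -- private values, which `goodLines-sparse` excludes.
        goodAvoiding : ∀ a b → ∃ λ m → Good (ℓ m) × m ≢ a × m ≢ b
        goodAvoiding a b = decide (any? λ m → Good? (ℓ m) ×-dec (¬? (m ≟ a) ×-dec ¬? (m ≟ b)))
          where
          flag : ∀ {m} → Dec (m ≡ a) → Fin 2
          flag (yes _) = Fin.zero
          flag (no _)  = Fin.suc Fin.zero
          s : Carrier → Fin 3 → Carrier
          s m j = six (Fin.combine (flag (m ≟ a)) j)
          decide : Dec (∃ λ m → Good (ℓ m) × m ≢ a × m ≢ b) → ∃ λ m → Good (ℓ m) × m ≢ a × m ≢ b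
          decide (yes found) = found
          decide (no none)   = ⊥-elim (goodLines-sparse s λ {m} {m′} {j} {j′} G G′ eq →
            line G G′ (m ≟ a) (m′ ≟ a) (Fin.combine-injectiveˡ (flag (m ≟ a)) j (flag (m′ ≟ a)) j′ (six-injective eq)) ,
            Fin.combine-injectiveʳ (flag (m ≟ a)) j (flag (m′ ≟ a)) j′ (six-injective eq))
            where
            is-b : ∀ {m} → Good (ℓ m) → m ≢ a → m ≡ b
            is-b {m} G m≢a with m ≟ b
            ... | yes m≡b = m≡b
            ... | no m≢b = contradiction (m , G , m≢a , m≢b) none
            line : ∀ {m m′} → Good (ℓ m) → Good (ℓ m′) → (d : Dec (m ≡ a)) (d′ : Dec (m′ ≡ a)) → flag d ≡ flag d′ → m ≡ m′
            line G G′ (yes m≡a) (yes m′≡a) _ = trans m≡a (sym m′≡a)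
            line G G′ (no m≢a)  (no m′≢a)  _ = trans (is-b G m≢a) (sym (is-b G′ m′≢a))
            line G G′ (yes _)   (no _)     ()
            line G G′ (no _)    (yes _)    ()

  -- Only the scaling rule is recorded. Additivity of T is available from `additive`, and σ inherits
  -- its own additivity and multiplicativity from T in `σ-+` and `σ-*`.
  IsSemilinear : (V → V) → Set
  IsSemilinear T = ∃ λ (σ : Carrier → Carrier) → ∀ k v → T (k *ᵥ v) ≡ σ k *ᵥ T v

  module _ (φ : Collineation) (φ0≡0 : to φ 0ᵥ ≡ 0ᵥ) where
    open Additivity φ φ0≡0 using (additive)

    private
      T : V → V
      T = to φ

      T-≢0 : ∀ {v} → v ≢ 0ᵥ → T v ≢ 0ᵥ
      T-≢0 v≢0 Tv≡0 = v≢0 (to-injective φ (trans Tv≡0 (sym φ0≡0)))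

    -- In a frame of good lines φ reads (x , y) ↦ (α x , α y), and every further
    -- good line e₁ + m e₂ yields α (x m) = α x α m for all x.
    module Frame {e₁ e₂ : V} (independent : det e₁ e₂ ≢ 0#)
                 (G₁ : Good φ φ0≡0 e₁) (G₂ : Good φ φ0≡0 e₂) (G₃ : Good φ φ0≡0 (e₁ +ᵥ e₂)) where
      open Pencil φ φ0≡0 {e₁} {e₂} independent

      private
        w₁ w₂ : V
        w₁ = T e₁
        w₂ = T e₂

        α β : Carrier → Carrier
        α x = proj₁ (G₁ x)
        β x = proj₁ (G₂ x)

        T-e₁ : ∀ x → T (x *ᵥ e₁) ≡ α x *ᵥ w₁
        T-e₁ x = proj₂ (G₁ x)

        T-e₂ : ∀ x → T (x *ᵥ e₂) ≡ β x *ᵥ w₂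
        T-e₂ x = proj₂ (G₂ x)

        w₁≢0 : w₁ ≢ 0ᵥ
        w₁≢0 = T-≢0 e₁≢0

        α-+ : ∀ x y → α (x + y) ≡ α x + α y
        α-+ x y = *ᵥ-cancelʳ {α (x + y)} {α x + α y} {w₁} w₁≢0 (begin
          α (x + y) *ᵥ w₁                ≡⟨ sym (T-e₁ (x + y)) ⟩
          T ((x + y) *ᵥ e₁)              ≡⟨ cong T (*ᵥ-distribʳ x y e₁) ⟩
          T (x *ᵥ e₁ +ᵥ y *ᵥ e₁)         ≡⟨ additive (x *ᵥ e₁) (y *ᵥ e₁) ⟩
          T (x *ᵥ e₁) +ᵥ T (y *ᵥ e₁)     ≡⟨ cong₂ _+ᵥ_ (T-e₁ x) (T-e₁ y) ⟩
          α x *ᵥ w₁ +ᵥ α y *ᵥ w₁         ≡⟨ sym (*ᵥ-distribʳ (α x) (α y) w₁) ⟩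
          (α x + α y) *ᵥ w₁              ∎)

        α-injective : ∀ {x y} → α x ≡ α y → x ≡ y
        α-injective {x} {y} eq = *ᵥ-cancelʳ {x} {y} {e₁} e₁≢0
          (to-injective φ (trans (T-e₁ x) (trans (cong (_*ᵥ w₁) eq) (sym (T-e₁ y)))))

        α-surjective : ∀ y → ∃ λ x → α x ≡ y
        α-surjective = injection⇒surjection enumeration enumeration α α-injective

        α-1 : α 1# ≡ 1#
        α-1 = *ᵥ-cancelʳ {α 1#} {1#} {w₁} w₁≢0 (trans (sym (T-e₁ 1#)) (trans (cong T (1*ᵥ e₁)) (sym (1*ᵥ w₁))))

        α-0 : α 0# ≡ 0#
        α-0 = *ᵥ-cancelʳ {α 0#} {0#} {w₁} w₁≢0 (trans (sym (T-e₁ 0#)) (trans (cong T (0*ᵥ e₁)) (trans φ0≡0 (sym (0*ᵥ w₁)))))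

        α-≢0 : ∀ {x} → x ≢ 0# → α x ≢ 0#
        α-≢0 x≢0 eq = x≢0 (α-injective (trans eq (sym α-0)))

        -- `α` is onto by finiteness, so if w₂ were on the K-line of w₁, then e₂ would be on the
        -- K-line of e₁.
        w-independent : det w₁ w₂ ≢ 0#
        w-independent eq = impossible (proportional {w₁} {w₂} w₁≢0 eq)
          where
          impossible : ¬ (w₂ ∈ ⟨ w₁ ⟩)
          impossible (k , w₂≡) = let x , αx≡k = α-surjective k in independent (∈⟨⟩⇒det≡0 {e₁} {e₂} (x ,
            to-injective φ (trans w₂≡ (trans (cong (_*ᵥ w₁) (sym αx≡k)) (sym (T-e₁ x))))))

        module W = Basis {w₁} {w₂} w-independent

        -- The third good line forces the two coordinates of x (e₁ + e₂) to be scaled alike.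
        α≡β : ∀ x → β x ≡ α x
        α≡β x = trans (W.unique₂ {α x} {β x} {c} {c} eq) (sym (W.unique₁ {α x} {β x} {c} {c} eq))
          where
          c : Carrier
          c = proj₁ (G₃ x)
          eq : α x *ᵥ w₁ +ᵥ β x *ᵥ w₂ ≡ c *ᵥ w₁ +ᵥ c *ᵥ w₂
          eq = begin
            α x *ᵥ w₁ +ᵥ β x *ᵥ w₂         ≡⟨ sym (cong₂ _+ᵥ_ (T-e₁ x) (T-e₂ x)) ⟩
            T (x *ᵥ e₁) +ᵥ T (x *ᵥ e₂)     ≡⟨ sym (additive (x *ᵥ e₁) (x *ᵥ e₂)) ⟩
            T (x *ᵥ e₁ +ᵥ x *ᵥ e₂)         ≡⟨ cong T (sym (*ᵥ-distribˡ x e₁ e₂)) ⟩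
            T (x *ᵥ (e₁ +ᵥ e₂))            ≡⟨ proj₂ (G₃ x) ⟩
            c *ᵥ T (e₁ +ᵥ e₂)              ≡⟨ cong (c *ᵥ_) (additive e₁ e₂) ⟩
            c *ᵥ (w₁ +ᵥ w₂)                ≡⟨ *ᵥ-distribˡ c w₁ w₂ ⟩
            c *ᵥ w₁ +ᵥ c *ᵥ w₂             ∎

        T-combination : ∀ x y → T (x e₁+ y e₂) ≡ α x *ᵥ w₁ +ᵥ α y *ᵥ w₂
        T-combination x y = begin
          T (x *ᵥ e₁ +ᵥ y *ᵥ e₂)         ≡⟨ additive (x *ᵥ e₁) (y *ᵥ e₂) ⟩
          T (x *ᵥ e₁) +ᵥ T (y *ᵥ e₂)     ≡⟨ cong₂ _+ᵥ_ (T-e₁ x) (T-e₂ y) ⟩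
          α x *ᵥ w₁ +ᵥ β y *ᵥ w₂         ≡⟨ cong (λ z → α x *ᵥ w₁ +ᵥ z *ᵥ w₂) (α≡β y) ⟩
          α x *ᵥ w₁ +ᵥ α y *ᵥ w₂         ∎

        Multiplicative : Carrier → Set
        Multiplicative m = ∀ x → α (x * m) ≡ α x * α m

        Multiplicative? : Decidable Multiplicative
        Multiplicative? m = all? λ x → α (x * m) ≟ α x * α m

        good⇒multiplicative : ∀ {m} → Good φ φ0≡0 (ℓ m) → Multiplicative m
        good⇒multiplicative {m} G x = trans (W.unique₂ {α (x * 1#)} {α (x * m)} {c * α 1#} {c * α m} eq) (cong (_* α m) c≡αx)
          where
          c : Carrier
          c = proj₁ (G x)
          eq : α (x * 1#) *ᵥ w₁ +ᵥ α (x * m) *ᵥ w₂ ≡ (c * α 1#) *ᵥ w₁ +ᵥ (c * α m) *ᵥ w₂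
          eq = begin
            α (x * 1#) *ᵥ w₁ +ᵥ α (x * m) *ᵥ w₂       ≡⟨ sym (T-combination (x * 1#) (x * m)) ⟩
            T ((x * 1#) e₁+ (x * m) e₂)               ≡⟨ cong T (sym (*-combination x 1# m)) ⟩
            T (x *ᵥ ℓ m)                              ≡⟨ proj₂ (G x) ⟩
            c *ᵥ T (ℓ m)                              ≡⟨ cong (c *ᵥ_) (T-combination 1# m) ⟩
            c *ᵥ (α 1# *ᵥ w₁ +ᵥ α m *ᵥ w₂)            ≡⟨ W.*-combination c (α 1#) (α m) ⟩
            (c * α 1#) *ᵥ w₁ +ᵥ (c * α m) *ᵥ w₂       ∎
          c≡αx : c ≡ α x
          c≡αx = begin
            c           ≡⟨ sym (*-identityʳ c) ⟩
            c * 1#      ≡⟨ cong (c *_) (sym α-1) ⟩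
            c * α 1#    ≡⟨ sym (W.unique₁ {α (x * 1#)} {α (x * m)} {c * α 1#} {c * α m} eq) ⟩
            α (x * 1#)  ≡⟨ cong α (*-identityʳ x) ⟩
            α x         ∎

        α-- : ∀ x y → α (x - y) ≡ α x - α y
        α-- x y = begin
          α (x - y)                  ≡⟨ solve 2 (λ a b → a := (a :+ b) :- b) refl (α (x - y)) (α y) ⟩
          (α (x - y) + α y) - α y    ≡⟨ cong (_- α y) (sym (α-+ (x - y) y)) ⟩
          α ((x - y) + y) - α y      ≡⟨ cong (λ z → α z - α y) (solve 2 (λ x y → (x :- y) :+ y := x) refl x y) ⟩
          α x - α y                  ∎

        multiplicative-- : ∀ {a b} → Multiplicative a → Multiplicative b → Multiplicative (a - b)
        multiplicative-- {a} {b} Ma Mb x = begin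
          α (x * (a - b))            ≡⟨ cong α (solve 3 (λ x a b → x :* (a :- b) := x :* a :- x :* b) refl x a b) ⟩
          α (x * a - x * b)          ≡⟨ α-- (x * a) (x * b) ⟩
          α (x * a) - α (x * b)      ≡⟨ cong₂ _-_ (Ma x) (Mb x) ⟩
          α x * α a - α x * α b      ≡⟨ solve 3 (λ x a b → x :* a :- x :* b := x :* (a :- b)) refl (α x) (α a) (α b) ⟩
          α x * (α a - α b)          ≡⟨ cong (α x *_) (sym (α-- a b)) ⟩
          α x * α (a - b)            ∎

        multiplicative-1 : Multiplicative 1#
        multiplicative-1 x = trans (cong α (*-identityʳ x)) (sym (trans (cong (α x *_) α-1) (*-identityʳ (α x))))

        multiplicative-/ : ∀ {r t} → r ≢ 0# → Multiplicative r → Multiplicative (r * t) → Multiplicative t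
        multiplicative-/ {r} {t} r≢0 Mr Mrt x = *-cancelʳ {α r} {α (x * t)} {α x * α t} (α-≢0 r≢0) (begin
          α (x * t) * α r        ≡⟨ sym (Mr (x * t)) ⟩
          α (x * t * r)          ≡⟨ cong α (solve 3 (λ x t r → x :* t :* r := x :* (r :* t)) refl x t r) ⟩
          α (x * (r * t))        ≡⟨ Mrt x ⟩
          α x * α (r * t)        ≡⟨ cong (λ z → α x * α z) (*-comm r t) ⟩
          α x * α (t * r)        ≡⟨ cong (α x *_) (Mr t) ⟩
          α x * (α t * α r)      ≡⟨ sym (*-assoc (α x) (α t) (α r)) ⟩
          α x * α t * α r        ∎)

        -- Subtraction is the closure rule at hand, so 0 is produced as 1 - 1.
        multiplicative-neg : ∀ {a b} → Multiplicative (a - b) → Multiplicative (b - a)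
        multiplicative-neg {a} {b} M = subst Multiplicative
          (solve 3 (λ a b u → (u :- u) :- (a :- b) := b :- a) refl a b 1#)
          (multiplicative-- (multiplicative-- multiplicative-1 multiplicative-1) M)

        -- If t were outside the subfield of multiplicative elements, its
        -- translates by 0, t and s t would be disjoint, but the good lines
        -- already make up more than a third of the pencil.
        module Translates {s t : Carrier} (Ms : Multiplicative s) (s≢0 : s ≢ 0#) (s≢1 : s ≢ 1#)
                          (¬Mt : ¬ Multiplicative t) where

          u : Fin 3 → Carrier
          u Fin.zero                       = 0#
          u (Fin.suc Fin.zero)             = t
          u (Fin.suc (Fin.suc Fin.zero))   = s * t

          ¬M[t-0] : ¬ Multiplicative (t - 0#)
          ¬M[t-0] M = ¬Mt (subst Multiplicative (solve 1 (λ t → t :- con (ℤ.+ 0) := t) refl t) M)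

          ¬M[st-0] : ¬ Multiplicative (s * t - 0#)
          ¬M[st-0] M = ¬Mt (multiplicative-/ {s} {t} s≢0 Ms
            (subst Multiplicative (solve 1 (λ t → t :- con (ℤ.+ 0) := t) refl (s * t)) M))

          ¬M[st-t] : ¬ Multiplicative (s * t - t)
          ¬M[st-t] M = ¬Mt (multiplicative-/ {s - 1#} {t} (λ eq → s≢1 (x-y≡0⇒x≡y eq)) (multiplicative-- Ms multiplicative-1)
            (subst Multiplicative (solve 2 (λ s t → s :* t :- t := (s :- con (ℤ.+ 1)) :* t) refl s t) M))

          separated : ∀ j j′ → Multiplicative (u j - u j′) → j ≡ j′
          separated Fin.zero Fin.zero _ = refl
          separated Fin.zero (Fin.suc Fin.zero) M = contradiction (multiplicative-neg {0#} {t} M) ¬M[t-0]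
          separated Fin.zero (Fin.suc (Fin.suc Fin.zero)) M = contradiction (multiplicative-neg {0#} {s * t} M) ¬M[st-0]
          separated (Fin.suc Fin.zero) Fin.zero M = contradiction M ¬M[t-0]
          separated (Fin.suc Fin.zero) (Fin.suc Fin.zero) _ = refl
          separated (Fin.suc Fin.zero) (Fin.suc (Fin.suc Fin.zero)) M = contradiction (multiplicative-neg {t} {s * t} M) ¬M[st-t]
          separated (Fin.suc (Fin.suc Fin.zero)) Fin.zero M = contradiction M ¬M[st-0]
          separated (Fin.suc (Fin.suc Fin.zero)) (Fin.suc Fin.zero) M = contradiction M ¬M[st-t]
          separated (Fin.suc (Fin.suc Fin.zero)) (Fin.suc (Fin.suc Fin.zero)) _ = refl

          disjoint : ∀ {m m′ j j′} → Good φ φ0≡0 (ℓ m) → Good φ φ0≡0 (ℓ m′) → m + u j ≡ m′ + u j′ → m ≡ m′ × j ≡ j′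
          disjoint {m} {m′} {j} {j′} G G′ eq = same (separated j j′ (subst Multiplicative difference
            (multiplicative-- (good⇒multiplicative {m′} G′) (good⇒multiplicative {m} G)))) eq
            where
            difference : m′ - m ≡ u j - u j′
            difference = x-y≡0⇒x≡y (trans (solve 4 (λ m m′ a b → (m′ :- m) :- (a :- b) := (m′ :+ b) :- (m :+ a)) refl m m′ (u j) (u j′))
              (x≡y⇒x-y≡0 (sym eq)))
            same : ∀ {j′} → j ≡ j′ → m + u j ≡ m′ + u j′ → m ≡ m′ × j ≡ j′
            same refl e = +-cancelˡ (u j) {m} {m′} (trans (+-comm (u j) m) (trans e (+-comm m′ (u j)))) , refl

          impossible : ⊥
          impossible = goodLines-sparse (λ m j → m + u j) disjoint

        multiplicative : ∀ t → Multiplicative t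
        multiplicative t = decide (Multiplicative? t)
          where
          decide : Dec (Multiplicative t) → Multiplicative t
          decide (yes M) = M
          decide (no ¬M) = let s , G , s≢0 , s≢1 = goodAvoiding 0# 1# in
            ⊥-elim (Translates.impossible {s} {t} (good⇒multiplicative {s} G) s≢0 s≢1 ¬M)

      semilinear-frame : IsSemilinear T
      semilinear-frame = α , λ k v → let x , y , v≡ = coordinates v in begin
        T (k *ᵥ v)                               ≡⟨ cong (λ v → T (k *ᵥ v)) v≡ ⟩
        T (k *ᵥ (x e₁+ y e₂))                    ≡⟨ cong T (*-combination k x y) ⟩
        T ((k * x) e₁+ (k * y) e₂)               ≡⟨ T-combination (k * x) (k * y) ⟩
        α (k * x) *ᵥ w₁ +ᵥ α (k * y) *ᵥ w₂       ≡⟨ cong₂ (λ a b → a *ᵥ w₁ +ᵥ b *ᵥ w₂) (multiplicative x k) (multiplicative y k) ⟩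
        (α k * α x) *ᵥ w₁ +ᵥ (α k * α y) *ᵥ w₂   ≡⟨ sym (W.*-combination (α k) (α x) (α y)) ⟩
        α k *ᵥ (α x *ᵥ w₁ +ᵥ α y *ᵥ w₂)          ≡⟨ cong (α k *ᵥ_) (sym (T-combination x y)) ⟩
        α k *ᵥ T (x e₁+ y e₂)                    ≡⟨ cong (λ v → α k *ᵥ T v) (sym v≡) ⟩
        α k *ᵥ T v                               ∎

    abstract
      -- Three good lines of the standard pencil make a frame. By Cramer's rule d₁ u₁ + d₂ u₂ = det
      -- u₁ u₂ times u₃, so e₁ = d₁ u₁ and e₂ = d₂ u₂ span good lines whose diagonal e₁ + e₂ is good
      -- as well.
      semilinear : IsSemilinear T
      -- The slopes to avoid are placeholders here, as the first good line is unrestricted.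
      semilinear = first (goodAvoiding 0# 0#)
        where
        standard : det (1# , 0#) (0# , 1#) ≢ 0#
        standard eq = 1≢0 (trans (solve 0 (con (ℤ.+ 1) := con (ℤ.+ 1) :* con (ℤ.+ 1) :- con (ℤ.+ 0) :* con (ℤ.+ 0)) refl) eq)
        open Pencil φ φ0≡0 {1# , 0#} {0# , 1#} standard
        distinct⇒independent : ∀ {m m′} → m′ ≢ m → det (ℓ m) (ℓ m′) ≢ 0#
        distinct⇒independent {m} {m′} m′≢m eq = m′≢m (sym (ℓ-injective {m} {m′} (proportional {ℓ m} {ℓ m′} (ℓ-≢0 m) eq)))
        third : ∀ {m₁ m₂} → Good φ φ0≡0 (ℓ m₁) → Good φ φ0≡0 (ℓ m₂) → m₂ ≢ m₁ →
                (∃ λ m → Good φ φ0≡0 (ℓ m) × m ≢ m₁ × m ≢ m₂) → IsSemilinear T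
        third {m₁} {m₂} G₁ G₂ m₂≢m₁ (m₃ , G₃ , m₃≢m₁ , m₃≢m₂) = Frame.semilinear-frame {d₁ *ᵥ u₁} {d₂ *ᵥ u₂} frame
          (Good-* φ φ0≡0 {u₁} {d₁} (ℓ-≢0 m₁) d₁≢0 G₁) (Good-* φ φ0≡0 {u₂} {d₂} (ℓ-≢0 m₂) d₂≢0 G₂)
          (subst (Good φ φ0≡0) (cramer u₁ u₂ u₃) (Good-* φ φ0≡0 {u₃} {det u₁ u₂} (ℓ-≢0 m₃) u₁₂ G₃))
          where
          u₁ u₂ u₃ : V
          u₁ = ℓ m₁
          u₂ = ℓ m₂
          u₃ = ℓ m₃
          d₁ d₂ : Carrier
          d₁ = det u₃ u₂
          d₂ = det u₁ u₃
          u₁₂ : det u₁ u₂ ≢ 0#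
          u₁₂ = distinct⇒independent {m₁} {m₂} m₂≢m₁
          d₁≢0 : d₁ ≢ 0#
          d₁≢0 = det-swap-≢0 {u₂} {u₃} (distinct⇒independent {m₂} {m₃} m₃≢m₂)
          d₂≢0 : d₂ ≢ 0#
          d₂≢0 = distinct⇒independent {m₁} {m₃} m₃≢m₁
          frame : det (d₁ *ᵥ u₁) (d₂ *ᵥ u₂) ≢ 0#
          frame eq = *-≢0 {d₁} {d₂ * det u₁ u₂} d₁≢0 (*-≢0 {d₂} {det u₁ u₂} d₂≢0 u₁₂)
            (trans (sym (trans (det-*ᵥˡ d₁ u₁ (d₂ *ᵥ u₂)) (cong (d₁ *_) (det-*ᵥʳ d₂ u₁ u₂)))) eq)
        second : ∀ {m₁} → Good φ φ0≡0 (ℓ m₁) → (∃ λ m → Good φ φ0≡0 (ℓ m) × m ≢ m₁ × m ≢ m₁) →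
                 IsSemilinear T
        second {m₁} G₁ (m₂ , G₂ , m₂≢m₁ , _) = third {m₁} {m₂} G₁ G₂ m₂≢m₁ (goodAvoiding m₁ m₂)
        first : (∃ λ m → Good φ φ0≡0 (ℓ m) × m ≢ 0# × m ≢ 0#) → IsSemilinear T
        first (m₁ , G₁ , _) = second {m₁} G₁ (goodAvoiding m₁ m₁)

  -- Linearity of central collineations

  module _ (φ : Collineation) (φ0≡0 : to φ 0ᵥ ≡ 0ᵥ) {W : Pred V 0ℓ} (W∈ℬ : W ∈ ℬ f) (fixed : ∀ {w} → w ∈ W → to φ w ≡ w) where
    open Additivity φ φ0≡0 using (additive)

    private
      T : V → V
      T = to φ

      σ : Carrier → Carrier
      σ = proj₁ (semilinear φ φ0≡0)

      T-* : ∀ k v → T (k *ᵥ v) ≡ σ k *ᵥ T v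
      T-* = proj₂ (semilinear φ φ0≡0)

      w₀ : V
      w₀ = ComponentProperties.point W∈ℬ 1#

      w₀≢0 : w₀ ≢ 0ᵥ
      w₀≢0 = ComponentProperties.point-≢0 W∈ℬ 1≢0

      T-*w₀ : ∀ k → T (k *ᵥ w₀) ≡ σ k *ᵥ w₀
      T-*w₀ k = trans (T-* k w₀) (cong (σ k *ᵥ_) (fixed (ComponentProperties.sound W∈ℬ 1#)))

      σ-+ : ∀ a b → σ (a + b) ≡ σ a + σ b
      σ-+ a b = *ᵥ-cancelʳ {σ (a + b)} {σ a + σ b} {w₀} w₀≢0 (begin
        σ (a + b) *ᵥ w₀               ≡⟨ sym (T-*w₀ (a + b)) ⟩
        T ((a + b) *ᵥ w₀)             ≡⟨ cong T (*ᵥ-distribʳ a b w₀) ⟩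
        T (a *ᵥ w₀ +ᵥ b *ᵥ w₀)        ≡⟨ additive (a *ᵥ w₀) (b *ᵥ w₀) ⟩
        T (a *ᵥ w₀) +ᵥ T (b *ᵥ w₀)    ≡⟨ cong₂ _+ᵥ_ (T-*w₀ a) (T-*w₀ b) ⟩
        σ a *ᵥ w₀ +ᵥ σ b *ᵥ w₀        ≡⟨ sym (*ᵥ-distribʳ (σ a) (σ b) w₀) ⟩
        (σ a + σ b) *ᵥ w₀             ∎)

      σ-* : ∀ a b → σ (a * b) ≡ σ a * σ b
      σ-* a b = *ᵥ-cancelʳ {σ (a * b)} {σ a * σ b} {w₀} w₀≢0 (begin
        σ (a * b) *ᵥ w₀       ≡⟨ sym (T-*w₀ (a * b)) ⟩
        T ((a * b) *ᵥ w₀)     ≡⟨ cong T (*ᵥ-assoc a b w₀) ⟩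
        T (a *ᵥ b *ᵥ w₀)      ≡⟨ T-* a (b *ᵥ w₀) ⟩
        σ a *ᵥ T (b *ᵥ w₀)    ≡⟨ cong (σ a *ᵥ_) (T-*w₀ b) ⟩
        σ a *ᵥ σ b *ᵥ w₀      ≡⟨ sym (*ᵥ-assoc (σ a) (σ b) w₀) ⟩
        (σ a * σ b) *ᵥ w₀     ∎)

      fixed-line : ∀ {u} → u ≢ 0ᵥ → W ≐ ⟨ u ⟩ → ∀ k → σ k ≡ k
      fixed-line {u} u≢0 (_ , ⊆W) k = *ᵥ-cancelʳ {σ k} {k} {u} u≢0 (begin
        σ k *ᵥ u      ≡⟨ cong (σ k *ᵥ_) (sym (fixed (⊆W (1# , sym (1*ᵥ u))))) ⟩
        σ k *ᵥ T u    ≡⟨ sym (T-* k u) ⟩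
        T (k *ᵥ u)    ≡⟨ fixed (⊆W (k , refl)) ⟩
        k *ᵥ u        ∎)

      -- If σ moved t, then h U would be the set of points with coordinates in
      -- the fixed field of σ, which by scatteredness lies in F_q, while K would
      -- have dimension at most 2 over that field.
      module FixedGraph {h : Carrier} (h≢0 : h ≢ 0#) (W≐ : W ≐ dilate f h (graph f)) {t : Carrier} (σt≢t : σ t ≢ t) where

        u₁ u₂ : V
        u₁ = h *ᵥ γ 1#
        u₂ = h *ᵥ γ θ

        hγ-fixed : ∀ x → T (h *ᵥ γ x) ≡ h *ᵥ γ x
        hγ-fixed x = fixed (proj₂ W≐ (γ x , (x , refl) , refl))

        independent : det u₁ u₂ ≢ 0#
        independent eq = *-≢0 {h} {h * det (γ 1#) (γ θ)} h≢0 (*-≢0 {h} {det (γ 1#) (γ θ)} h≢0 γ-independent)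
          (trans (sym (trans (det-*ᵥˡ h (γ 1#) u₂) (cong (h *_) (det-*ᵥʳ h (γ 1#) (γ θ))))) eq)

        open Basis {u₁} {u₂} independent

        Fixed : Carrier → Set
        Fixed c = σ c ≡ c

        A B : Carrier → Carrier
        A x = proj₁ (coordinates (h *ᵥ γ x))
        B x = proj₁ (proj₂ (coordinates (h *ᵥ γ x)))

        hγ≡ : ∀ x → h *ᵥ γ x ≡ A x e₁+ B x e₂
        hγ≡ x = proj₂ (proj₂ (coordinates (h *ᵥ γ x)))

        T-coordinates : ∀ x → σ (A x) e₁+ σ (B x) e₂ ≡ A x e₁+ B x e₂
        T-coordinates x = begin
          σ (A x) *ᵥ u₁ +ᵥ σ (B x) *ᵥ u₂       ≡⟨ cong₂ (λ u v → σ (A x) *ᵥ u +ᵥ σ (B x) *ᵥ v) (sym (hγ-fixed 1#)) (sym (hγ-fixed θ)) ⟩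
          σ (A x) *ᵥ T u₁ +ᵥ σ (B x) *ᵥ T u₂   ≡⟨ sym (cong₂ _+ᵥ_ (T-* (A x) u₁) (T-* (B x) u₂)) ⟩
          T (A x *ᵥ u₁) +ᵥ T (B x *ᵥ u₂)       ≡⟨ sym (additive (A x *ᵥ u₁) (B x *ᵥ u₂)) ⟩
          T (A x e₁+ B x e₂)                   ≡⟨ cong T (sym (hγ≡ x)) ⟩
          T (h *ᵥ γ x)                         ≡⟨ hγ-fixed x ⟩
          h *ᵥ γ x                             ≡⟨ hγ≡ x ⟩
          A x e₁+ B x e₂                       ∎

        A-fixed : ∀ x → Fixed (A x)
        A-fixed x = unique₁ {σ (A x)} {σ (B x)} {A x} {B x} (T-coordinates x)

        B-fixed : ∀ x → Fixed (B x)
        B-fixed x = unique₂ {σ (A x)} {σ (B x)} {A x} {B x} (T-coordinates x)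

        σ-- : ∀ {a b} → Fixed a → Fixed b → Fixed (a - b)
        σ-- {a} {b} σa≡a σb≡b = begin
          σ (a - b)                  ≡⟨ solve 2 (λ c b → c := (c :+ b) :- b) refl (σ (a - b)) (σ b) ⟩
          (σ (a - b) + σ b) - σ b    ≡⟨ cong (_- σ b) (sym (σ-+ (a - b) b)) ⟩
          σ ((a - b) + b) - σ b      ≡⟨ cong (λ c → σ c - σ b) (solve 2 (λ a b → (a :- b) :+ b := a) refl a b) ⟩
          σ a - σ b                  ≡⟨ cong₂ _-_ σa≡a σb≡b ⟩
          a - b                      ∎

        t-independent : ∀ {a b} → Fixed a → Fixed b → a ≡ b * t → b ≡ 0#
        t-independent {a} {b} σa≡a σb≡b a≡bt with b ≟ 0#
        ... | yes b≡0 = b≡0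
        ... | no b≢0 = contradiction (*-cancelˡ {b} {σ t} {t} b≢0 (begin
          b * σ t      ≡⟨ cong (_* σ t) (sym σb≡b) ⟩
          σ b * σ t    ≡⟨ sym (σ-* b t) ⟩
          σ (b * t)    ≡⟨ cong σ (sym a≡bt) ⟩
          σ a          ≡⟨ σa≡a ⟩
          a            ≡⟨ a≡bt ⟩
          b * t        ∎)) σt≢t

        unique-B : ∀ {a b a′ b′} → Fixed a → Fixed b → Fixed a′ → Fixed b′ → a + b * t ≡ a′ + b′ * t → b ≡ b′
        unique-B {a} {b} {a′} {b′} Fa Fb Fa′ Fb′ eq = sym (x-y≡0⇒x≡y (t-independent {a - a′} {b′ - b} (σ-- Fa Fa′) (σ-- Fb′ Fb)
          (x-y≡0⇒x≡y (trans (solve 5 (λ a b a′ b′ t → (a :- a′) :- (b′ :- b) :* t := (a :+ b :* t) :- (a′ :+ b′ :* t)) refl a b a′ b′ t)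
            (x≡y⇒x-y≡0 eq)))))

        unique-A : ∀ {a b a′ b′} → Fixed a → Fixed b → Fixed a′ → Fixed b′ → a + b * t ≡ a′ + b′ * t → a ≡ a′
        unique-A {a} {b} {a′} {b′} Fa Fb Fa′ Fb′ eq = x-y≡0⇒x≡y (trans
          (solve 5 (λ a b a′ b′ t → a :- a′ := ((a :+ b :* t) :- (a′ :+ b′ :* t)) :+ (b′ :- b) :* t) refl a b a′ b′ t)
          (trans (cong₂ (λ c d → c + d * t) (x≡y⇒x-y≡0 eq) (x≡y⇒x-y≡0 (sym (unique-B Fa Fb Fa′ Fb′ eq))))
            (solve 1 (λ t → con (ℤ.+ 0) :+ con (ℤ.+ 0) :* t := con (ℤ.+ 0)) refl t)))

        -- The elements 1 and t are independent over the fixed field of σ, and `A x`, `B x` are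
        -- fixed. So ρ is injective, hence onto: every element of K is a fixed element plus a fixed
        -- multiple of t.
        ρ : Carrier → Carrier
        ρ x = A x + B x * t

        ρ-injective : ∀ {x y} → ρ x ≡ ρ y → x ≡ y
        ρ-injective {x} {y} eq = cong proj₁ (*ᵥ-cancelˡ {h} {γ x} {γ y} h≢0 (begin
          h *ᵥ γ x          ≡⟨ hγ≡ x ⟩
          A x e₁+ B x e₂    ≡⟨ cong₂ _e₁+_e₂ (unique-A (A-fixed x) (B-fixed x) (A-fixed y) (B-fixed y) eq)
                                 (unique-B (A-fixed x) (B-fixed x) (A-fixed y) (B-fixed y) eq) ⟩
          A y e₁+ B y e₂    ≡⟨ sym (hγ≡ y) ⟩
          h *ᵥ γ y          ∎))

        ρ-surjective : ∀ y → ∃ λ x → ρ x ≡ y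
        ρ-surjective = injection⇒surjection enumeration enumeration ρ ρ-injective

        σ-0 : Fixed 0#
        σ-0 = trans (cong σ (sym (-‿inverseʳ (A 0#)))) (trans (σ-- (A-fixed 0#) (A-fixed 0#)) (-‿inverseʳ (A 0#)))

        -- Writing c as ρ x and comparing coefficients gives `A x` = c and `B x` = 0, that is h γ x
        -- = c h γ 1, and scatteredness puts c into F_q.
        fixed⇒scalar : ∀ {c} → Fixed c → IsScalar c
        fixed⇒scalar {c} Fc = conclude (ρ-surjective c)
          where
          conclude : (∃ λ x → ρ x ≡ c) → IsScalar c
          conclude (x , ρx≡c) = proportional⇒scalar {1#} {x} {c} 1≢0 (*ᵥ-cancelˡ {h} {γ x} {c *ᵥ γ 1#} h≢0 (begin
            h *ᵥ γ x           ≡⟨ hγ≡ x ⟩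
            A x e₁+ B x e₂     ≡⟨ cong₂ _e₁+_e₂ (unique-A (A-fixed x) (B-fixed x) Fc σ-0 eq) (unique-B (A-fixed x) (B-fixed x) Fc σ-0 eq) ⟩
            c e₁+ 0# e₂        ≡⟨ trans (cong (c *ᵥ u₁ +ᵥ_) (0*ᵥ u₂)) (+ᵥ-identityʳ (c *ᵥ u₁)) ⟩
            c *ᵥ h *ᵥ γ 1#     ≡⟨ *ᵥ-comm c h (γ 1#) ⟩
            h *ᵥ c *ᵥ γ 1#     ∎))
            where
            eq : A x + B x * t ≡ c + 0# * t
            eq = trans ρx≡c (solve 2 (λ c t → c := c :+ con (ℤ.+ 0) :* t) refl c t)

        impossible : ⊥
        impossible = notSpanned 1# t λ y → let
            x , ρx≡y = ρ-surjective y
            a , A≡a = fixed⇒scalar (A-fixed x)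
            b , B≡b = fixed⇒scalar (B-fixed x)
          in a , b , trans (sym ρx≡y) (cong₂ (λ u v → u + v * t) (trans A≡a (sym (*-identityʳ ⟦ a ⟧))) B≡b)

      σ≡id : ∀ k → σ k ≡ k
      σ≡id = go W∈ℬ
        where
        decide : ∀ {h} → h ≢ 0# → W ≐ dilate f h (graph f) → ∀ k → Dec (σ k ≡ k) → σ k ≡ k
        decide h≢0 W≐ k (yes σk≡k) = σk≡k
        decide h≢0 W≐ k (no σk≢k)  = ⊥-elim (FixedGraph.impossible h≢0 W≐ {k} σk≢k)
        go : W ∈ ℬ f → ∀ k → σ k ≡ k
        go (inj₁ ((u , u≢0 , W≐) , _)) = fixed-line {u} u≢0 W≐
        go (inj₂ (h , h≢0 , W≐)) k     = decide {h} h≢0 W≐ k (σ k ≟ k)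

    fixesComponent⇒linear : ∀ k v → to φ (k *ᵥ v) ≡ k *ᵥ to φ v
    fixesComponent⇒linear k v = trans (T-* k v) (cong (_*ᵥ T v) (σ≡id k))

  linear⇒induced : (φ : Collineation) → to φ 0ᵥ ≡ 0ᵥ → (∀ k v → to φ (k *ᵥ v) ≡ k *ᵥ to φ v) →
                   ∃ λ A → Induces (ℬ f) A φ
  linear⇒induced φ φ0≡0 linear = record { matrix = A ; inverse = B
      ; inverseˡ = matrix-ext λ v → trans (·-*ₘ v B A) (trans (sym (A-spec (v · B))) (trans (cong (to φ) (sym (B-spec v)))
          (trans (φ.strictlyInverseˡ v) (sym (·-1ₘ v)))))
      ; inverseʳ = matrix-ext λ v → trans (·-*ₘ v A B) (trans (sym (B-spec (v · A))) (trans (cong φ.from (sym (A-spec v)))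
          (trans (φ.strictlyInverseʳ v) (sym (·-1ₘ v)))))
      } , A-spec
    where
    module φ = Affine.Collineation φ
    open Additivity φ φ0≡0 using (additive)
    φφ⁻¹ : ∀ v → to φ (φ.from v) ≡ v
    φφ⁻¹ = φ.strictlyInverseˡ
    A-exists : ∃ λ A → ∀ v → to φ v ≡ v · A
    A-exists = linear⇒matrix (to φ) additive linear
    B-exists : ∃ λ B → ∀ v → φ.from v ≡ v · B
    B-exists = linear⇒matrix φ.from
      (λ u v → to-injective φ (trans (φφ⁻¹ (u +ᵥ v)) (sym (trans (additive (φ.from u) (φ.from v)) (cong₂ _+ᵥ_ (φφ⁻¹ u) (φφ⁻¹ v))))))
      (λ k v → to-injective φ (trans (φφ⁻¹ (k *ᵥ v)) (sym (trans (linear k (φ.from v)) (cong (k *ᵥ_) (φφ⁻¹ v))))))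
    A B : Matrix
    A = proj₁ A-exists
    B = proj₁ B-exists
    A-spec : ∀ v → to φ v ≡ v · A
    A-spec = proj₂ A-exists
    B-spec : ∀ v → φ.from v ≡ v · B
    B-spec = proj₂ B-exists

  translation : V → Collineation
  translation v = record
    { perm = record
      { to = _+ᵥ v ; from = _-ᵥ v ; to-cong = cong (_+ᵥ v) ; from-cong = cong (_-ᵥ v)
      ; inverse = (λ { {x} refl → [u-v]+v x v }) , (λ { {x} refl → [u+v]-v x v }) }
    ; to-line = λ { (u , W , W∈ℬ) → (u +ᵥ v , W , W∈ℬ) , λ x → mk⇔
        (λ { (w , w∈W , refl) → w , w∈W , exchange u w v })
        (λ { (w , w∈W , eq) → w , w∈W , (begin
          x                          ≡⟨ sym ([u+v]-v x v) ⟩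
          (x +ᵥ v) -ᵥ v              ≡⟨ cong (_-ᵥ v) eq ⟩
          ((u +ᵥ v) +ᵥ w) -ᵥ v       ≡⟨ exchange (u +ᵥ v) w (negᵥ v) ⟩
          ((u +ᵥ v) -ᵥ v) +ᵥ w       ≡⟨ cong (_+ᵥ w) ([u+v]-v u v) ⟩
          u +ᵥ w                     ∎) }) }
    ; from-line = λ { (u , W , W∈ℬ) → (u -ᵥ v , W , W∈ℬ) , λ x → mk⇔
        (λ { (w , w∈W , refl) → w , w∈W , exchange u w (negᵥ v) })
        (λ { (w , w∈W , eq) → w , w∈W , (begin
          x                          ≡⟨ sym ([u-v]+v x v) ⟩
          (x -ᵥ v) +ᵥ v              ≡⟨ cong (_+ᵥ v) eq ⟩
          ((u -ᵥ v) +ᵥ w) +ᵥ v       ≡⟨ exchange (u -ᵥ v) w v ⟩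
          ((u -ᵥ v) +ᵥ v) +ᵥ w       ≡⟨ cong (_+ᵥ w) ([u-v]+v u v) ⟩
          u +ᵥ w                     ∎) }) }
    }
    where
    exchange : ∀ a b c → (a +ᵥ b) +ᵥ c ≡ (a +ᵥ c) +ᵥ b
    exchange a b c = trans (+ᵥ-assoc a b c) (trans (cong (a +ᵥ_) (+ᵥ-comm b c)) (sym (+ᵥ-assoc a c b)))

  -- Conjugation by the translation by v replaces the axis v + W by the component W. The new
  -- collineation fixes 0, so additivity and K-linearity become available.
  module Recentered (φ : Collineation) {v : V} {W : Pred V 0ℓ} (W∈ℬ : W ∈ ℬ f)
                    (φ≢id : ¬ φ ≋ identity) (fixed : ∀ x → x ∈ₗ (v , W , W∈ℬ) → to φ x ≡ x) where

    recentered : Collineation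
    recentered = translation v Affine.⨾ (φ Affine.⨾ translation (negᵥ v))

    recentered-fixed : ∀ {w} → w ∈ W → to recentered w ≡ w
    recentered-fixed {w} w∈W = trans (cong (_-ᵥ v) (fixed (w +ᵥ v) (w , w∈W , +ᵥ-comm w v))) ([u+v]-v w v)

    recentered-0 : to recentered 0ᵥ ≡ 0ᵥ
    recentered-0 = recentered-fixed {0ᵥ} (ComponentProperties.0∈ W∈ℬ)

    recenter : ∀ x → to φ x ≡ to recentered (x -ᵥ v) +ᵥ v
    recenter x = trans (cong (to φ) (sym ([u-v]+v x v))) (sym ([u-v]+v (to φ ((x -ᵥ v) +ᵥ v)) v))

    recentered≢id : ¬ (∀ x → to recentered x ≡ x)
    recentered≢id id = φ≢id λ x → trans (recenter x) (trans (cong (_+ᵥ v) (id (x -ᵥ v))) ([u-v]+v x v))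

    recentered-induced : ∃ λ A → Induces (ℬ f) A recentered
    recentered-induced = linear⇒induced recentered recentered-0
      (fixesComponent⇒linear recentered recentered-0 W∈ℬ (λ {w} → recentered-fixed {w}))

  -- Similarities of U

  private
    module GL = Group GL₂

  ·-inverseʳ : ∀ (A : InvertibleMatrix) v → (v · matrix A) · InvertibleMatrix.inverse A ≡ v
  ·-inverseʳ A v = trans (sym (·-*ₘ v (matrix A) (InvertibleMatrix.inverse A)))
    (trans (cong (v ·_) (InvertibleMatrix.inverseʳ A)) (·-1ₘ v))

  ·-inverseˡ : ∀ (A : InvertibleMatrix) v → (v · InvertibleMatrix.inverse A) · matrix A ≡ v
  ·-inverseˡ A v = ·-inverseʳ (A GL.⁻¹) v

  ·-injective : ∀ (A : InvertibleMatrix) {u v} → u · matrix A ≡ v · matrix A → u ≡ v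
  ·-injective A {u} {v} eq = trans (sym (·-inverseʳ A u)) (trans (cong (_· InvertibleMatrix.inverse A) eq) (·-inverseʳ A v))

  ·-≢0 : ∀ (A : InvertibleMatrix) {v} → v ≢ 0ᵥ → v · matrix A ≢ 0ᵥ
  ·-≢0 A {v} v≢0 eq = v≢0 (·-injective A {v} {0ᵥ} (trans eq (sym (0ᵥ-· (matrix A)))))

  scalarGL : ∀ k → k ≢ 0# → InvertibleMatrix
  scalarGL k k≢0 = record
    { matrix = scalar k ; inverse = scalar (k ⁻¹)
    ; inverseˡ = matrix-ext λ v → trans (product v (k ⁻¹) k) (trans (*⁻¹ᵥ k≢0 v) (sym (·-1ₘ v)))
    ; inverseʳ = matrix-ext λ v → trans (product v k (k ⁻¹)) (trans (⁻¹*ᵥ k≢0 v) (sym (·-1ₘ v)))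
    }
    where
    product : ∀ v k l → v · (scalar k *ₘ scalar l) ≡ l *ᵥ k *ᵥ v
    product v k l = trans (·-*ₘ v (scalar k) (scalar l)) (trans (·-scalar (v · scalar k) l) (cong (l *ᵥ_) (·-scalar v k)))

  unscale : ∀ {B : InvertibleMatrix} {h} (h≢0 : h ≢ 0#) {v k} → v · (matrix B *ₘ scalar (h ⁻¹)) ≡ k *ᵥ v → v · matrix B ≡ (h * k) *ᵥ v
  unscale {B} {h} h≢0 {v} {k} eq = begin
    v · matrix B                               ≡⟨ sym (*⁻¹ᵥ h≢0 (v · matrix B)) ⟩
    h *ᵥ h ⁻¹ *ᵥ (v · matrix B)                ≡⟨ cong (h *ᵥ_) (sym (·-scalar (v · matrix B) (h ⁻¹))) ⟩
    h *ᵥ ((v · matrix B) · scalar (h ⁻¹))      ≡⟨ cong (h *ᵥ_) (sym (·-*ₘ v (matrix B) (scalar (h ⁻¹)))) ⟩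
    h *ᵥ (v · (matrix B *ₘ scalar (h ⁻¹)))     ≡⟨ cong (h *ᵥ_) eq ⟩
    h *ᵥ k *ᵥ v                                ≡⟨ sym (*ᵥ-assoc h k v) ⟩
    (h * k) *ᵥ v                               ∎

  MapsGraph : InvertibleMatrix → Carrier → Set
  MapsGraph A h = ∀ x → ∃ λ y → γ x · matrix A ≡ h *ᵥ γ y

  -- These matrices turn out to be exactly the linear collineations, by `induced⇒similar` and
  -- `similar⇒induced`; this form is a condition on U alone.
  Similar : InvertibleMatrix → Set
  Similar A = ∃ λ h → h ≢ 0# × MapsGraph A h

  mapsGraph-surjective : ∀ {A h} → h ≢ 0# → MapsGraph A h → ∀ y → ∃ λ x → γ x · matrix A ≡ h *ᵥ γ y
  mapsGraph-surjective {A} {h} h≢0 maps y = let x , eq = surjective y in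
      x , trans (proj₂ (maps x)) (cong (λ z → h *ᵥ γ z) eq)
    where
    injective : ∀ {x x′} → proj₁ (maps x) ≡ proj₁ (maps x′) → x ≡ x′
    injective {x} {x′} eq = cong proj₁ (·-injective A {γ x} {γ x′}
      (trans (proj₂ (maps x)) (trans (cong (λ z → h *ᵥ γ z) eq) (sym (proj₂ (maps x′))))))
    surjective : ∀ y → ∃ λ x → proj₁ (maps x) ≡ y
    surjective = injection⇒surjection enumeration enumeration (λ x → proj₁ (maps x)) injective

  similar-⁻¹ : ∀ {A} → Similar A → Similar (A GL.⁻¹)
  similar-⁻¹ {A} (h , h≢0 , maps) = h ⁻¹ , ⁻¹-≢0 h≢0 , λ y → let x , eq = mapsGraph-surjective {A} h≢0 maps y in x , (begin
    γ y · A⁻¹                         ≡⟨ cong (_· A⁻¹) (sym (⁻¹*ᵥ h≢0 (γ y))) ⟩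
    (h ⁻¹ *ᵥ h *ᵥ γ y) · A⁻¹          ≡⟨ ·-*ᵥ (h ⁻¹) (h *ᵥ γ y) A⁻¹ ⟩
    h ⁻¹ *ᵥ ((h *ᵥ γ y) · A⁻¹)        ≡⟨ cong (λ v → h ⁻¹ *ᵥ (v · A⁻¹)) (sym eq) ⟩
    h ⁻¹ *ᵥ ((γ x · matrix A) · A⁻¹)  ≡⟨ cong (h ⁻¹ *ᵥ_) (·-inverseʳ A (γ x)) ⟩
    h ⁻¹ *ᵥ γ x                       ∎)
    where A⁻¹ = InvertibleMatrix.inverse A

  stabilizer⇒maps : ∀ {A} → A ∈ Member (G f) → ∀ x → ∃ λ y → γ x · matrix A ≡ γ y
  stabilizer⇒maps {A} (⊆U , _) x = ⊆U (γ x , (x , refl) , refl)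

  maps⇒stabilizer : ∀ {A} → (∀ x → ∃ λ y → γ x · matrix A ≡ γ y) → A ∈ Member (G f)
  maps⇒stabilizer {A} maps = (λ { (_ , (x , refl) , refl) → maps x }) ,
    λ { (y , refl) → let x , eq = mapsGraph-surjective {A} {1#} 1≢0 maps₁ y in γ x , (x , refl) , sym (trans eq (1*ᵥ (γ y))) }
    where
    maps₁ : MapsGraph A 1#
    maps₁ x = proj₁ (maps x) , trans (proj₂ (maps x)) (sym (1*ᵥ (γ (proj₁ (maps x)))))

  -- This reduces linear collineations to G_f modulo the kernel homologies.
  similar⇒scaled-stabilizer : ∀ {A} → ((h , h≢0 , _) : Similar A) → (A GL.∙ scalarGL (h ⁻¹) (⁻¹-≢0 h≢0)) ∈ Member (G f)
  similar⇒scaled-stabilizer {A} (h , h≢0 , maps) = maps⇒stabilizer {A GL.∙ scalarGL (h ⁻¹) (⁻¹-≢0 h≢0)} λ x →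
    proj₁ (maps x) , (begin
    γ x · (matrix A *ₘ scalar (h ⁻¹))     ≡⟨ ·-*ₘ (γ x) (matrix A) (scalar (h ⁻¹)) ⟩
    (γ x · matrix A) · scalar (h ⁻¹)      ≡⟨ ·-scalar (γ x · matrix A) (h ⁻¹) ⟩
    h ⁻¹ *ᵥ (γ x · matrix A)              ≡⟨ cong (h ⁻¹ *ᵥ_) (proj₂ (maps x)) ⟩
    h ⁻¹ *ᵥ h *ᵥ γ (proj₁ (maps x))       ≡⟨ ⁻¹*ᵥ h≢0 (γ (proj₁ (maps x))) ⟩
    γ (proj₁ (maps x))                    ∎)

  induced-0 : ∀ {A φ} → Induces (ℬ f) A φ → to φ 0ᵥ ≡ 0ᵥ
  induced-0 {A} induces = trans (induces 0ᵥ) (0ᵥ-· (matrix A))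

  -- The image of U contains two K-independent vectors, so it is some h U.
  induced⇒similar : ∀ {A φ} → Induces (ℬ f) A φ → Similar A
  induced⇒similar {A} {φ} induces = go (imageComponent φ (induced-0 {A} {φ} induces) (graph∈ℬ {1#} 1≢0))
    where
    open Additivity φ (induced-0 {A} {φ} induces) using (MapsComponent)
    A⁻¹ = InvertibleMatrix.inverse A
    image∈ : ∀ {W′} → MapsComponent (dilate f 1# (graph f)) W′ → ∀ x → γ x · matrix A ∈ W′
    image∈ {W′} maps x = subst W′ (induces (γ x)) (Equivalence.to (maps (γ x)) (γ x , (x , refl) , sym (1*ᵥ (γ x))))
    go : (∃ λ W′ → W′ ∈ ℬ f × MapsComponent (dilate f 1# (graph f)) W′) → Similar A
    go (W′ , inj₂ (h , h≢0 , ⊆hU , _) , maps) = h , h≢0 , λ x → on-graph (⊆hU (image∈ {W′} maps x))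
      where
      on-graph : ∀ {w} → w ∈ dilate f h (graph f) → ∃ λ y → w ≡ h *ᵥ γ y
      on-graph (_ , (y , refl) , eq) = y , eq
    go (W′ , inj₁ ((u , u≢0 , ⊆⟨u⟩ , _) , _) , maps) = contradiction det≡0 γ-independent
      where
      preimage : ∀ x → γ x ∈ ⟨ u · A⁻¹ ⟩
      preimage x = let k , eq = ⊆⟨u⟩ (image∈ {W′} maps x) in k ,
        trans (sym (·-inverseʳ A (γ x))) (trans (cong (_· A⁻¹) eq) (·-*ᵥ k u A⁻¹))
      det≡0 : det (γ 1#) (γ θ) ≡ 0#
      det≡0 = ∈⟨⟩⇒det≡0 {γ 1#} {γ θ} (proj₁ (⟨⟩-≐ {u · A⁻¹} {γ 1#} (γ-≢0 1≢0) (preimage 1#)) (preimage θ))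

  image-∈ : ∀ {A : InvertibleMatrix} {W : Pred V 0ℓ} {v} → v · matrix A ∈ image W (matrix A) → v ∈ W
  image-∈ {A} {W} {v} (w , w∈W , eq) = subst W (sym (·-injective A {v} {w} eq)) w∈W

  image-≐ : ∀ {M} {W W′ : Pred V 0ℓ} → W ≐ W′ → image W M ≐ image W′ M
  image-≐ (⊆ , ⊇) = (λ { (w , w∈ , eq) → w , ⊆ w∈ , eq }) , (λ { (w , w∈ , eq) → w , ⊇ w∈ , eq })

  image-inverse : ∀ (A : InvertibleMatrix) (W : Pred V 0ℓ) → image (image W (matrix A)) (InvertibleMatrix.inverse A) ≐ W
  image-inverse A W = (λ { (_ , (w , w∈W , refl) , refl) → subst W (sym (·-inverseʳ A w)) w∈W }) ,
    (λ {w} w∈W → w · matrix A , (w , w∈W , refl) , sym (·-inverseʳ A w))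

  -- A permutes the sets h U, and hence the K-lines spanned by their nonzero vectors, which form
  -- L_f. So K-lines outside L_f stay outside.
  similar⇒image∈ℬ : ∀ {A} → Similar A → ∀ {W} → W ∈ ℬ f → image W (matrix A) ∈ ℬ f
  similar⇒image∈ℬ {A} (h , h≢0 , maps) {W} (inj₁ ((u , u≢0 , W≐) , W∉L)) =
    inj₁ ((u · M , ·-≢0 A u≢0 , WA≐) , WA∉L)
    where
    M = matrix A
    WA≐ : image W M ≐ ⟨ u · M ⟩
    WA≐ = (λ { (w , w∈W , refl) → let k , w≡ku = proj₁ W≐ w∈W in k , trans (cong (_· M) w≡ku) (·-*ᵥ k u M) }) ,
          (λ { (k , refl) → k *ᵥ u , proj₂ W≐ (k , refl) , sym (·-*ᵥ k u M) })
    WA∉L : image W M ∉ L f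
    WA∉L (y , y≢0 , WA≐γy) = W∉L (x , x≢0 , ≐-trans W≐ (⟨⟩-≐ {u} {γ x} (γ-≢0 x≢0) (proj₁ W≐ γx∈W)))
      where
      x = proj₁ (mapsGraph-surjective {A} h≢0 maps y)
      γxA≡ : γ x · M ≡ h *ᵥ γ y
      γxA≡ = proj₂ (mapsGraph-surjective {A} h≢0 maps y)
      γx∈W : γ x ∈ W
      γx∈W = image-∈ {A} {W} {γ x} (subst (image W M) (sym γxA≡) (proj₂ WA≐γy (h , refl)))
      x≢0 : x ≢ 0#
      x≢0 x≡0 = *ᵥ-≢0 {h} {γ y} h≢0 (γ-≢0 y≢0) (trans (sym γxA≡) (trans (cong (λ z → γ z · M) x≡0)
        (trans (cong (_· M) γ-0) (0ᵥ-· M))))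
  similar⇒image∈ℬ {A} (h , h≢0 , maps) {W} (inj₂ (k , k≢0 , W≐)) = inj₂ (k * h , *-≢0 k≢0 h≢0 ,
      (λ { (w , w∈W , refl) → forward (proj₁ W≐ w∈W) }) , backward)
    where
    M = matrix A
    forward : ∀ {w} → w ∈ dilate f k (graph f) → w · M ∈ dilate f (k * h) (graph f)
    forward (_ , (x , refl) , refl) = let y , eq = maps x in γ y , (y , refl) ,
      trans (·-*ᵥ k (γ x) M) (trans (cong (k *ᵥ_) eq) (sym (*ᵥ-assoc k h (γ y))))
    backward : ∀ {w} → w ∈ dilate f (k * h) (graph f) → w ∈ image W M
    backward (_ , (y , refl) , refl) = let x , eq = mapsGraph-surjective {A} h≢0 maps y in
      k *ᵥ γ x , proj₂ W≐ (γ x , (x , refl) , refl) ,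
      sym (trans (·-*ᵥ k (γ x) M) (trans (cong (k *ᵥ_) eq) (sym (*ᵥ-assoc k h (γ y)))))

  translate-image : ∀ (A : InvertibleMatrix) {W : Pred V 0ℓ} {v x} →
                    (∃ λ w → w ∈ W × x ≡ v +ᵥ w) ⇔ (∃ λ w → w ∈ image W (matrix A) × x · matrix A ≡ v · matrix A +ᵥ w)
  translate-image A {W} {v} {x} = mk⇔
    (λ { (w , w∈W , refl) → w · matrix A , (w , w∈W , refl) , ·-+ᵥ v w (matrix A) })
    (λ { (_ , (w , w∈W , refl) , eq) → w , w∈W , ·-injective A {x} {v +ᵥ w} (trans eq (sym (·-+ᵥ v w (matrix A)))) })

  module _ {A : InvertibleMatrix} (similar : Similar A) where
    private
      A⁻¹ : InvertibleMatrix
      A⁻¹ = A GL.⁻¹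

      imageLine : AffineLine → AffineLine
      imageLine (v , W , W∈ℬ) = v · matrix A , image W (matrix A) , similar⇒image∈ℬ {A} similar W∈ℬ

      preimageLine : AffineLine → AffineLine
      preimageLine (v , W , W∈ℬ) = v · matrix A⁻¹ , image W (matrix A⁻¹) , similar⇒image∈ℬ {A⁻¹} (similar-⁻¹ {A} similar) W∈ℬ

    inducedCollineation : Collineation
    inducedCollineation = record
      { perm = record
        { to = _· matrix A ; from = _· matrix A⁻¹ ; to-cong = cong (_· matrix A) ; from-cong = cong (_· matrix A⁻¹)
        ; inverse = (λ { {x} refl → ·-inverseˡ A x }) , (λ { {x} refl → ·-inverseʳ A x }) }
      ; to-line   = λ { m@(v , W , _) → imageLine m , λ x → translate-image A {W} {v} {x} }
      ; from-line = λ { m@(v , W , _) → preimageLine m , λ x → translate-image A⁻¹ {W} {v} {x} }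
      }

    inducedProjective : Projective.Collineation
    inducedProjective = record
      { perm = record
        { to        = imagePoint
        ; from      = preimagePoint
        ; to-cong   = λ { (inj₁ refl) → inj₁ refl ; {inj₂ (W , _)} {inj₂ (W′ , _)} (inj₂ W≐) → inj₂ (image-≐ {matrix A} {W} {W′} W≐) }
        ; from-cong = λ { (inj₁ refl) → inj₁ refl ; {inj₂ (W , _)} {inj₂ (W′ , _)} (inj₂ W≐) → inj₂ (image-≐ {matrix A⁻¹} {W} {W′} W≐) }
        ; inverse   = (λ {x} {y} → to-from {x} {y}) , (λ {x} {y} → from-to {x} {y})
        }
      ; to-line   = λ
        { (inj₁ m@(v , W , _)) → inj₁ (imageLine m) , λ
          { (inj₁ x)       → translate-image A {W} {v} {x}
          ; (inj₂ (Z , _)) → mk⇔ (image-≐ {matrix A} {Z} {W}) λ ZA≐WA →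
              ≐-trans (≐-sym (image-inverse A Z)) (≐-trans (image-≐ {matrix A⁻¹} {image Z (matrix A)} {image W (matrix A)} ZA≐WA) (image-inverse A W)) }
        ; (inj₂ ∞) → inj₂ ∞ , λ { (inj₁ x) → mk⇔ (λ ()) (λ ()) ; (inj₂ Z) → mk⇔ _ _ } }
      ; from-line = λ
        { (inj₁ m@(v , W , _)) → inj₁ (preimageLine m) , λ
          { (inj₁ x)       → translate-image A⁻¹ {W} {v} {x}
          ; (inj₂ (Z , _)) → mk⇔ (image-≐ {matrix A⁻¹} {Z} {W}) λ ZA≐WA →
              ≐-trans (≐-sym (image-inverse A⁻¹ Z)) (≐-trans (image-≐ {matrix A} {image Z (matrix A⁻¹)} {image W (matrix A⁻¹)} ZA≐WA) (image-inverse A⁻¹ W)) }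
        ; (inj₂ ∞) → inj₂ ∞ , λ { (inj₁ x) → mk⇔ (λ ()) (λ ()) ; (inj₂ Z) → mk⇔ _ _ } }
      }
      where
      imagePoint preimagePoint : ProjectivePoint → ProjectivePoint
      imagePoint (inj₁ x)           = inj₁ (x · matrix A)
      imagePoint (inj₂ (W , W∈ℬ))   = inj₂ (image W (matrix A) , similar⇒image∈ℬ {A} similar W∈ℬ)
      preimagePoint (inj₁ x)         = inj₁ (x · matrix A⁻¹)
      preimagePoint (inj₂ (W , W∈ℬ)) = inj₂ (image W (matrix A⁻¹) , similar⇒image∈ℬ {A⁻¹} (similar-⁻¹ {A} similar) W∈ℬ)
      to-from : ∀ {x y} → y ≈ₚ preimagePoint x → imagePoint y ≈ₚ x
      to-from {inj₁ x}       (inj₁ refl) = inj₁ (·-inverseˡ A x)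
      to-from {inj₂ (W , _)} {inj₂ (Z , _)} (inj₂ Z≐) =
        inj₂ (≐-trans (image-≐ {matrix A} {Z} {image W (matrix A⁻¹)} Z≐) (image-inverse A⁻¹ W))
      from-to : ∀ {x y} → y ≈ₚ imagePoint x → preimagePoint y ≈ₚ x
      from-to {inj₁ x}       (inj₁ refl) = inj₁ (·-inverseʳ A x)
      from-to {inj₂ (W , _)} {inj₂ (Z , _)} (inj₂ Z≐) =
        inj₂ (≐-trans (image-≐ {matrix A⁻¹} {Z} {image W (matrix A)} Z≐) (image-inverse A W))

    similar⇒induced : A ∈ Member (linearCollineations (ℬ f))
    similar⇒induced = inducedCollineation , λ _ → refl

  -- The stabilizer of U

  γ-- : ∀ x y → γ (x - y) ≡ γ x -ᵥ γ y
  γ-- x y = begin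
    γ (x - y)                        ≡⟨ sym ([u+v]-v (γ (x - y)) (γ y)) ⟩
    (γ (x - y) +ᵥ γ y) -ᵥ γ y        ≡⟨ cong (_-ᵥ γ y) (sym (γ-+ (x - y) y)) ⟩
    γ ((x - y) + y) -ᵥ γ y           ≡⟨ cong (λ z → γ z -ᵥ γ y) (solve 2 (λ x y → (x :- y) :+ y := x) refl x y) ⟩
    γ x -ᵥ γ y                       ∎

  -- D = A - B maps U into itself. If it is singular but nonzero, then its kernel
  -- and its image each meet U in at most an F_q-line, so that q ^ n ≤ q ^ 2.
  module Agree {A B : InvertibleMatrix} (A∈G : A ∈ Member (G f)) (B∈G : B ∈ Member (G f))
               {v : V} (v≢0 : v ≢ 0ᵥ) (vA≡vB : v · matrix A ≡ v · matrix B) where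

    private
      D : Matrix
      D = -ₘ (matrix A) (matrix B)

      D-singular : detₘ D ≡ 0#
      D-singular = singular⇒det≡0 {v} {D} v≢0 (trans (·-ₘ v (matrix A) (matrix B))
        (trans (cong (_-ᵥ v · matrix B) vA≡vB) (-ᵥ-inverseʳ (v · matrix B))))

      δ : Carrier → Carrier
      δ x = proj₁ (stabilizer⇒maps {A} A∈G x) - proj₁ (stabilizer⇒maps {B} B∈G x)

      γ-D : ∀ x → γ x · D ≡ γ (δ x)
      γ-D x = begin
        γ x · D                              ≡⟨ ·-ₘ (γ x) (matrix A) (matrix B) ⟩
        γ x · matrix A -ᵥ γ x · matrix B     ≡⟨ cong₂ _-ᵥ_ (proj₂ (stabilizer⇒maps {A} A∈G x)) (proj₂ (stabilizer⇒maps {B} B∈G x)) ⟩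
        γ a -ᵥ γ b                           ≡⟨ sym (γ-- a b) ⟩
        γ (a - b)                            ∎
        where
        a b : Carrier
        a = proj₁ (stabilizer⇒maps {A} A∈G x)
        b = proj₁ (stabilizer⇒maps {B} B∈G x)

      killed⇒agree : ∀ {u} → u · D ≡ 0ᵥ → u · matrix A ≡ u · matrix B
      killed⇒agree {u} eq = u-v≡0⇒u≡v (trans (sym (·-ₘ u (matrix A) (matrix B))) eq)

      killed-basis : ∀ {u u′} → det u u′ ≢ 0# → u · D ≡ 0ᵥ → u′ · D ≡ 0ᵥ → matrix A ≡ matrix B
      killed-basis {u} {u′} independent eq eq′ =
        matrix-ext-basis {u} {u′} independent {matrix A} {matrix B} (killed⇒agree {u} eq) (killed⇒agree {u′} eq′)

      module _ {x₀ : Carrier} (x₀D≢0 : γ x₀ · D ≢ 0ᵥ) where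

        A≢B : matrix A ≢ matrix B
        A≢B eq = x₀D≢0 (trans (·-ₘ (γ x₀) (matrix A) (matrix B))
          (trans (cong (λ M → γ x₀ · M -ᵥ γ x₀ · matrix B) eq) (-ᵥ-inverseʳ (γ x₀ · matrix B))))

        δx₀≢0 : δ x₀ ≢ 0#
        δx₀≢0 = γ-≢0⁻¹ (subst (_≢ 0ᵥ) (γ-D x₀) x₀D≢0)

        -- D is singular, so its values on U are all K-proportional; they lie on U again by `γ-D`,
        -- so the ratios are in F_q.
        image-scalar : ∀ x → ∃ λ a → γ x · D ≡ ⟦ a ⟧ *ᵥ (γ x₀ · D)
        image-scalar x = conclude (proportional {γ x₀ · D} {γ x · D} x₀D≢0
            (trans (det-· (γ x₀) (γ x) D) (trans (cong (det (γ x₀) (γ x) *_) D-singular) (zeroʳ (det (γ x₀) (γ x))))))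
          where
          conclude : γ x · D ∈ ⟨ γ x₀ · D ⟩ → ∃ λ a → γ x · D ≡ ⟦ a ⟧ *ᵥ (γ x₀ · D)
          conclude (k , eq) = let a , k≡a = proportional⇒scalar {δ x₀} {δ x} {k} δx₀≢0
                                    (trans (sym (γ-D x)) (trans eq (cong (k *ᵥ_) (γ-D x₀))))
                              in a , trans eq (cong (_*ᵥ (γ x₀ · D)) k≡a)

        difference-killed : ∀ {x a} → γ x · D ≡ ⟦ a ⟧ *ᵥ (γ x₀ · D) → γ (x - ⟦ a ⟧ * x₀) · D ≡ 0ᵥ
        difference-killed {x} {a} eq = begin
          γ (x - ⟦ a ⟧ * x₀) · D                       ≡⟨ cong (_· D) (γ-- x (⟦ a ⟧ * x₀)) ⟩
          (γ x -ᵥ γ (⟦ a ⟧ * x₀)) · D                  ≡⟨ ·-- (γ x) (γ (⟦ a ⟧ * x₀)) D ⟩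
          γ x · D -ᵥ γ (⟦ a ⟧ * x₀) · D                ≡⟨ cong (λ u → γ x · D -ᵥ u · D) (γ-⟦⟧ a x₀) ⟩
          γ x · D -ᵥ (⟦ a ⟧ *ᵥ γ x₀) · D               ≡⟨ cong₂ _-ᵥ_ eq (·-*ᵥ ⟦ a ⟧ (γ x₀) D) ⟩
          ⟦ a ⟧ *ᵥ (γ x₀ · D) -ᵥ ⟦ a ⟧ *ᵥ (γ x₀ · D)   ≡⟨ -ᵥ-inverseʳ (⟦ a ⟧ *ᵥ (γ x₀ · D)) ⟩
          0ᵥ                                           ∎

        -- Modulo the kernel of D every x is an F_q-multiple of x₀. If the kernel on U is an
        -- F_q-line through y₀, then x₀ and y₀ span K over F_q.
        spanned : ∀ {y₀} → (∀ {y} → γ y · D ≡ 0ᵥ → ∃ λ b → y ≡ ⟦ b ⟧ * y₀) → ⊥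
        spanned {y₀} kernel = notSpanned x₀ y₀ λ x →
          let a , eq = image-scalar x
              b , eq′ = kernel (difference-killed {x} {a} eq)
          in a , b , (begin
            x                                       ≡⟨ solve 2 (λ x c → x := c :+ (x :- c)) refl x (⟦ a ⟧ * x₀) ⟩
            ⟦ a ⟧ * x₀ + (x - ⟦ a ⟧ * x₀)           ≡⟨ cong (⟦ a ⟧ * x₀ +_) eq′ ⟩
            ⟦ a ⟧ * x₀ + ⟦ b ⟧ * y₀                 ∎)

        impossible : ⊥
        impossible = decide (any? λ y → ¬? (y ≟ 0#) ×-dec (γ y · D ≟ᵥ 0ᵥ))
          where
          decide : Dec (∃ λ y → y ≢ 0# × γ y · D ≡ 0ᵥ) → ⊥
          -- If D kills no nonzero point of U, the kernel is zero and y₀ = 0 serves.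
          decide (no none) = spanned {0#} λ {y} yD≡0 → F.0# , trans (y≡0 yD≡0 (y ≟ 0#)) (sym (zeroʳ ⟦ F.0# ⟧))
            where
            y≡0 : ∀ {y} → γ y · D ≡ 0ᵥ → Dec (y ≡ 0#) → y ≡ 0#
            y≡0 yD≡0 (yes y≡0) = y≡0
            y≡0 {y} yD≡0 (no y≢0) = contradiction (y , y≢0 , yD≡0) none
          decide (yes (y₀ , y₀≢0 , y₀D≡0)) = spanned {y₀} λ {y} yD≡0 → conclude yD≡0 (det (γ y₀) (γ y) ≟ 0#)
            where
            conclude : ∀ {y} → γ y · D ≡ 0ᵥ → Dec (det (γ y₀) (γ y) ≡ 0#) → ∃ λ b → y ≡ ⟦ b ⟧ * y₀
            conclude {y} yD≡0 (no independent) = contradiction (killed-basis {γ y₀} {γ y} independent y₀D≡0 yD≡0) A≢B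
            conclude {y} yD≡0 (yes det≡0) = go (proportional {γ y₀} {γ y} (γ-≢0 y₀≢0) det≡0)
              where
              go : γ y ∈ ⟨ γ y₀ ⟩ → ∃ λ b → y ≡ ⟦ b ⟧ * y₀
              go (k , eq) = let b , k≡b = proportional⇒scalar {y₀} {y} {k} y₀≢0 eq in b , trans (cong proj₁ eq) (cong (_* y₀) k≡b)

    agree : matrix A ≡ matrix B
    agree = decide (any? λ x → ¬? (γ x · D ≟ᵥ 0ᵥ))
      where
      decide : Dec (∃ λ x → γ x · D ≢ 0ᵥ) → matrix A ≡ matrix B
      decide (yes (x₀ , x₀D≢0)) = ⊥-elim (impossible {x₀} x₀D≢0)
      decide (no none) = killed-basis {γ 1#} {γ θ} γ-independent (killed 1# (γ 1# · D ≟ᵥ 0ᵥ)) (killed θ (γ θ · D ≟ᵥ 0ᵥ))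
        where
        killed : ∀ x → Dec (γ x · D ≡ 0ᵥ) → γ x · D ≡ 0ᵥ
        killed x (yes eq) = eq
        killed x (no ≢0)  = contradiction (x , ≢0) none

  -- So G_f acts freely on all nonzero vectors of the plane, not only on those of U.
  agree⇒equal : ∀ {A B v} → A ∈ Member (G f) → B ∈ Member (G f) → v ≢ 0ᵥ → v · matrix A ≡ v · matrix B → matrix A ≡ matrix B
  agree⇒equal {A} {B} {v} A∈G B∈G v≢0 eq = Agree.agree {A} {B} A∈G B∈G {v} v≢0 eq

  scalar∈G : ∀ {a} (a≢0 : a ≢ F.0#) → scalarGL ⟦ a ⟧ (⟦⟧-≢0 a≢0) ∈ Member (G f)
  scalar∈G {a} a≢0 = maps⇒stabilizer {scalarGL ⟦ a ⟧ (⟦⟧-≢0 a≢0)} λ x →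
    ⟦ a ⟧ * x , trans (·-scalar (γ x) ⟦ a ⟧) (sym (γ-⟦⟧ a x))

  scalar-injective : ∀ {k l} → scalar k ≡ scalar l → k ≡ l
  scalar-injective refl = refl

  eigenvalue-≢0 : ∀ {A : InvertibleMatrix} {k v} → v ≢ 0ᵥ → v · matrix A ≡ k *ᵥ v → k ≢ 0#
  eigenvalue-≢0 {A} {k} {v} v≢0 eq = *ᵥ-≢0ˡ {k} {v} (subst (_≢ 0ᵥ) eq (·-≢0 A v≢0))

  -- The eigenvalue lies in F_q by scatteredness, so A agrees at γ x with an F_q-scalar, which is
  -- itself in G_f.
  eigenpoint⇒scalar : ∀ {A k x} → A ∈ Member (G f) → x ≢ 0# → γ x · matrix A ≡ k *ᵥ γ x → ∃ λ a → a ≢ F.0# × matrix A ≡ scalar ⟦ a ⟧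
  eigenpoint⇒scalar {A} {k} {x} A∈G x≢0 eq = let y , eq′ = stabilizer⇒maps {A} A∈G x in
      conclude (proportional⇒scalar {x} {y} {k} x≢0 (trans (sym eq′) eq))
    where
    conclude : IsScalar k → ∃ λ a → a ≢ F.0# × matrix A ≡ scalar ⟦ a ⟧
    conclude (a , k≡a) = a , a≢0 , agree⇒equal {A} {scalarGL ⟦ a ⟧ (⟦⟧-≢0 a≢0)} {γ x} A∈G (scalar∈G a≢0) (γ-≢0 x≢0)
        (trans eq (trans (cong (_*ᵥ γ x) k≡a) (sym (·-scalar (γ x) ⟦ a ⟧))))
      where
      a≢0 : a ≢ F.0#
      a≢0 a≡0 = eigenvalue-≢0 {A} {k} {γ x} (γ-≢0 x≢0) eq (trans k≡a (trans (cong ⟦_⟧ a≡0) ⟦⟧-0))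

  scalar∈G⇒ : ∀ {A k} → A ∈ Member (G f) → matrix A ≡ scalar k → ∃ λ a → a ≢ F.0# × matrix A ≡ scalar ⟦ a ⟧
  scalar∈G⇒ {A} {k} A∈G eq = eigenpoint⇒scalar {A} {k} {1#} A∈G 1≢0 (trans (cong (γ 1# ·_) eq) (·-scalar (γ 1#) k))

  kernel⊆linear : Member kernelHomologies ⊆ Member (linearCollineations (ℬ f))
  kernel⊆linear {A} (k , k≢0 , eq) = similar⇒induced {A} (k , k≢0 , λ x → x , trans (cong (γ x ·_) eq) (·-scalar (γ x) k))

  -- Formulated for any subgroup with these members, because it is applied both to the kernel
  -- homologies and, in part (i), to the group of linear collineations.
  kernelOrder : ∀ {p} (P : Subgroup GL₂ p) → Member P ≐ Member kernelHomologies → HasOrder (toGroup P) (q ℕ.^ n ℕ.∸ 1)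
  kernelOrder P (P⊆ , ⊆P) = record
    { to        = λ A → U.to (unit A)
    ; from      = λ i → element (U.from i)
    ; to-cong   = λ {A} {B} eq → U.to-cong {unit A} {unit B} (unit-cong {A} {B} eq)
    ; from-cong = λ { refl → refl }
    ; inverse   = (λ {i} {A} eq → trans (U.to-cong {unit A} {U.from i} (unit-cong {A} {element (U.from i)} eq ∙ unit-element (U.from i)))
                                    (U.strictlyInverseˡ i)) ,
                  (λ { {A} refl → trans (cong scalar (U.strictlyInverseʳ (unit A))) (sym (proj₂ (proj₂ (P⊆ (proj₂ A))))) })
    }
    where
    module U = Inverse units
    infixl 5 _∙_
    _∙_ = trans
    unit : Group.Carrier (toGroup P) → Group.Carrier (K ˣ)
    unit (A , A∈P) = let k , k≢0 , _ = P⊆ A∈P in k , k≢0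
    element : Group.Carrier (K ˣ) → Group.Carrier (toGroup P)
    element (k , k≢0) = scalarGL k k≢0 , ⊆P (k , k≢0 , refl)
    unit-cong : ∀ {A B} → matrix (proj₁ A) ≡ matrix (proj₁ B) → proj₁ (unit A) ≡ proj₁ (unit B)
    unit-cong {A} {B} eq = scalar-injective (trans (sym (proj₂ (proj₂ (P⊆ (proj₂ A))))) (trans eq (proj₂ (proj₂ (P⊆ (proj₂ B))))))
    unit-element : ∀ u → proj₁ (unit (element u)) ≡ proj₁ u
    unit-element u = scalar-injective (sym (proj₂ (proj₂ (P⊆ (proj₂ (element u))))))

  ≋identity? : (φ : Collineation) → Dec (φ ≋ identity)
  ≋identity? φ = Finite.all? vectors {P = λ v → to φ v ≡ v} (subst (λ v → to φ v ≡ v)) λ v → to φ v ≟ᵥ v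

  open IncidenceStructure projectiveClosure using (on-resp) renaming (sym to ≈ₚ-sym; trans to ≈ₚ-trans)

  ≈ₚ-affine : ∀ {u v} → inj₁ u ≈ₚ inj₁ v → u ≡ v
  ≈ₚ-affine (inj₁ eq) = eq

  central⇒fixed : ∀ {φ axis} → ((ψ , _) : IsAffineCentral φ axis) → ∀ x → x ∈ₗ axis → to φ x ≡ x
  central⇒fixed {φ} {axis} (ψ , extends , _ , fixed) x x∈ = ≈ₚ-affine (≈ₚ-trans {inj₁ (to φ x)} {Projective.to ψ (inj₁ x)} {inj₁ x}
      (≈ₚ-sym {Projective.to ψ (inj₁ x)} {inj₁ (to φ x)} (extends x)) (fixed (inj₁ x) x∈))

  -- Stabilizers consisting of scalars

  module _ (allScalar : ∀ {A} → A ∈ Member (G f) → ∃ λ k → matrix A ≡ scalar k) where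

    linear⊆kernel : Member (linearCollineations (ℬ f)) ⊆ Member kernelHomologies
    linear⊆kernel {A} (φ , induces) = conclude (induced⇒similar {A} {φ} induces)
      where
      conclude : Similar A → A ∈ Member kernelHomologies
      conclude similar@(h , h≢0 , maps) = go (allScalar {A GL.∙ scalarGL (h ⁻¹) (⁻¹-≢0 h≢0)} (similar⇒scaled-stabilizer {A} similar))
        where
        go : (∃ λ k → matrix A *ₘ scalar (h ⁻¹) ≡ scalar k) → A ∈ Member kernelHomologies
        go (k , eq) = h * k , eigenvalue-≢0 {A} {h * k} {γ 1#} (γ-≢0 1≢0) (scales (γ 1#)) ,
          matrix-ext λ v → trans (scales v) (sym (·-scalar v (h * k)))
          where
          scales : ∀ v → v · matrix A ≡ (h * k) *ᵥ v
          scales v = unscale {A} {h} h≢0 {v} {k} (trans (cong (v ·_) eq) (·-scalar v k))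

    -- After recentring, the collineation is linear, hence multiplication by some k; it fixes a
    -- nonzero vector of its axis, so k = 1.
    noCentral : ∀ {φ axis} → ¬ φ ≋ identity → ¬ IsAffineCentral φ axis
    noCentral {φ} {v , W , W∈ℬ} φ≢id central = conclude recentered-induced
      where
      open Recentered φ {v} {W} W∈ℬ φ≢id (central⇒fixed {φ} central)
      w₀ : V
      w₀ = ComponentProperties.point W∈ℬ 1#
      conclude : ¬ (∃ λ A → Induces (ℬ f) A recentered)
      conclude (A , induces) = go (linear⊆kernel {A} (recentered , induces))
        where
        go : ¬ (A ∈ Member kernelHomologies)
        go (k , k≢0 , eq) = recentered≢id λ x → trans (scales x) (trans (cong (_*ᵥ x) k≡1) (1*ᵥ x))
          where
          scales : ∀ x → to recentered x ≡ k *ᵥ x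
          scales x = trans (induces x) (trans (cong (x ·_) eq) (·-scalar x k))
          k≡1 : k ≡ 1#
          k≡1 = *ᵥ-cancelʳ {k} {1#} {w₀} (ComponentProperties.point-≢0 W∈ℬ 1≢0)
            (trans (sym (scales w₀)) (trans (recentered-fixed (ComponentProperties.sound W∈ℬ 1#)) (sym (1*ᵥ w₀))))

  -- The q - 1 nonzero F_q-scalars inject into a group of order q - 1 and therefore fill it.
  minimal⇒allScalar : HasOrder (toGroup (G f)) (q ℕ.∸ 1) → ∀ {A} → A ∈ Member (G f) → ∃ λ k → matrix A ≡ scalar k
  minimal⇒allScalar order {A} A∈G = let (a , a≢0) , eq = injection⇒surjection F.units order
                                          (λ { (a , a≢0) → scalarGL ⟦ a ⟧ (⟦⟧-≢0 a≢0) , scalar∈G a≢0 })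
                                          (λ { {a , _} {b , _} eq → ⟦⟧-injective (scalar-injective {⟦ a ⟧} {⟦ b ⟧} eq) }) (A , A∈G)
                                    in ⟦ a ⟧ , sym eq

  partOne : HasOrder (toGroup (G f)) (q ℕ.∸ 1) →
              (∀ H → IsAffineCentralGroup H → IsTrivial H)
            × HasOrder (toGroup (linearCollineations (ℬ f))) (q ℕ.^ n ℕ.∸ 1)
            × Member (linearCollineations (ℬ f)) ≐ Member kernelHomologies
  partOne order = trivial , kernelOrder (linearCollineations (ℬ f)) linear≐kernel , linear≐kernel
    where
    allScalar : ∀ {A} → A ∈ Member (G f) → ∃ λ k → matrix A ≡ scalar k
    allScalar {A} = minimal⇒allScalar order {A}
    linear≐kernel : Member (linearCollineations (ℬ f)) ≐ Member kernelHomologies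
    linear≐kernel = (λ {A} → linear⊆kernel (λ {A} → allScalar {A}) {A}) , (λ {A} → kernel⊆linear {A})
    trivial : ∀ H → IsAffineCentralGroup H → IsTrivial H
    trivial H central φ φ∈H = decide (≋identity? φ)
      where
      decide : Dec (φ ≋ identity) → φ ≋ identity
      decide (yes φ≋id) = φ≋id
      decide (no φ≢id)  = let axis , is-central = central φ φ∈H φ≢id in
        ⊥-elim (noCentral (λ {A} → allScalar {A}) {φ} {axis} φ≢id is-central)

  -- Diagonalization of elements of the stabilizer

  module _ {A : InvertibleMatrix} (A∈G : A ∈ Member (G f)) where

    power : ℕ → InvertibleMatrix
    power zero    = GL.ε
    power (suc k) = power k GL.∙ A

    power∈G : ∀ k → power k ∈ Member (G f)
    power∈G zero    = Subgroup.ε-closed (G f)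
    power∈G (suc k) = Subgroup.∙-closed (G f) {power k} {A} (power∈G k) A∈G

    ·-power : ∀ k v → v · matrix (power k) ≡ (_· matrix A) ^[ k ] v
    ·-power zero    v = ·-1ₘ v
    ·-power (suc k) v = trans (·-*ₘ v (matrix (power k)) (matrix A)) (cong (_· matrix A) (·-power k v))

    private
      step : Group.Carrier (K ˣ) → Group.Carrier (K ˣ)
      step (x , x≢0) = proj₁ (stabilizer⇒maps {A} A∈G x) ,
        γ-≢0⁻¹ (subst (_≢ 0ᵥ) (proj₂ (stabilizer⇒maps {A} A∈G x)) (·-≢0 A (γ-≢0 x≢0)))

      γ-step : ∀ x → γ (proj₁ (step x)) ≡ γ (proj₁ x) · matrix A
      γ-step x = sym (proj₂ (stabilizer⇒maps {A} A∈G (proj₁ x)))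

      γ-steps : ∀ k x → γ (proj₁ (step ^[ k ] x)) ≡ (_· matrix A) ^[ k ] γ (proj₁ x)
      γ-steps zero    x = refl
      γ-steps (suc k) x = trans (γ-step (step ^[ k ] x)) (cong (_· matrix A) (γ-steps k x))

      -- A ^ k lies in G_f and agrees with the identity at γ x, so it is the identity.
      fixes⇒trivial : ∀ k {x} → proj₁ (step ^[ k ] x) ≡ proj₁ x → ∀ v → (_· matrix A) ^[ k ] v ≡ v
      fixes⇒trivial k {x , x≢0} eq v = begin
        (_· matrix A) ^[ k ] v     ≡⟨ sym (·-power k v) ⟩
        v · matrix (power k)       ≡⟨ cong (v ·_) (agree⇒equal {power k} {GL.ε} {γ x} (power∈G k) (Subgroup.ε-closed (G f)) (γ-≢0 x≢0) (begin
          γ x · matrix (power k)                       ≡⟨ ·-power k (γ x) ⟩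
          (_· matrix A) ^[ k ] γ x                     ≡⟨ sym (γ-steps k (x , x≢0)) ⟩
          γ (proj₁ (step ^[ k ] (x , x≢0)))            ≡⟨ cong γ eq ⟩
          γ x                                          ≡⟨ sym (·-1ₘ (γ x)) ⟩
          γ x · 1ₘ                                     ∎)) ⟩
        v · 1ₘ                     ≡⟨ ·-1ₘ v ⟩
        v                          ∎

    -- ⟨ A ⟩ acts freely on the q ^ n - 1 nonzero elements of U.
    periodic : ∀ v → (_· matrix A) ^[ q ℕ.^ n ℕ.∸ 1 ] v ≡ v
    periodic = fixes⇒trivial (q ℕ.^ n ℕ.∸ 1) {1# , 1≢0} (iterate-order units step (λ {x} {y} → step-cong {x} {y}) (λ {x} {y} → step-injective {x} {y}) (λ k {x} → homogeneous k {x}) (1# , 1≢0))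
      where
      step-cong : ∀ {x y} → proj₁ x ≡ proj₁ y → proj₁ (step x) ≡ proj₁ (step y)
      step-cong {x} {y} eq = cong proj₁ (trans (γ-step x) (trans (cong (λ z → γ z · matrix A) eq) (sym (γ-step y))))
      step-injective : ∀ {x y} → proj₁ (step x) ≡ proj₁ (step y) → proj₁ x ≡ proj₁ y
      step-injective {x} {y} eq = cong proj₁ (·-injective A {γ (proj₁ x)} {γ (proj₁ y)}
        (trans (sym (γ-step x)) (trans (cong γ eq) (γ-step y))))
      homogeneous : ∀ k {x} y → proj₁ (step ^[ k ] x) ≡ proj₁ x → proj₁ (step ^[ k ] y) ≡ proj₁ y
      homogeneous k {x} y eq = cong proj₁ (trans (γ-steps k y) (fixes⇒trivial k {x} eq (γ (proj₁ y))))

    -- A single Jordan block λ + x has (λ + x) ^ (N - 1) = 1 - λ⁻¹ x, which is 1 only for x = 0.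
    noJordanBlock : ∀ {w₁ w₂ ƛ x} → w₁ ≢ 0ᵥ → w₁ · matrix A ≡ ƛ *ᵥ w₁ → w₂ · matrix A ≡ x *ᵥ w₁ +ᵥ ƛ *ᵥ w₂ → x ≡ 0#
    noJordanBlock {w₁} {w₂} {ƛ} {x} w₁≢0 eq₁ eq₂ = begin
      x                          ≡⟨ solve 2 (λ x k → x := x :* (con (ℤ.+ 1) :+ k) :- k :* x) refl x (m ×₁) ⟩
      x * (1# + m ×₁) - m ×₁ * x  ≡⟨ cong (λ z → x * z - m ×₁ * x) (trans (cong _×₁ suc[N-1]≡N) characteristic) ⟩
      x * 0# - m ×₁ * x          ≡⟨ cong (λ z → x * 0# - z) m×x≡0 ⟩
      x * 0# - 0#                ≡⟨ solve 1 (λ x → x :* con (ℤ.+ 0) :- con (ℤ.+ 0) := con (ℤ.+ 0)) refl x ⟩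
      0#                         ∎
      where
      m : ℕ
      m = q ℕ.^ n ℕ.∸ 1
      ƛ≢0 : ƛ ≢ 0#
      ƛ≢0 = eigenvalue-≢0 {A} {ƛ} {w₁} w₁≢0 eq₁
      -- `a k` is k ƛ ^ (k - 1) x; the recursion avoids the exponent k - 1, and `ƛa` states the
      -- closed form multiplied by ƛ.
      a : ℕ → Carrier
      a zero    = 0#
      a (suc k) = ƛ * a k + ƛ ^ k * x
      iterate : ∀ k → (_· matrix A) ^[ k ] w₂ ≡ a k *ᵥ w₁ +ᵥ ƛ ^ k *ᵥ w₂
      iterate zero    = sym (trans (cong₂ _+ᵥ_ (0*ᵥ w₁) (1*ᵥ w₂)) (+ᵥ-identityˡ w₂))
      iterate (suc k) = begin
        ((_· matrix A) ^[ k ] w₂) · matrix A                          ≡⟨ cong (_· matrix A) (iterate k) ⟩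
        (a k *ᵥ w₁ +ᵥ ƛ ^ k *ᵥ w₂) · matrix A                         ≡⟨ ·-+ᵥ (a k *ᵥ w₁) (ƛ ^ k *ᵥ w₂) (matrix A) ⟩
        (a k *ᵥ w₁) · matrix A +ᵥ (ƛ ^ k *ᵥ w₂) · matrix A            ≡⟨ cong₂ _+ᵥ_ (·-*ᵥ (a k) w₁ (matrix A)) (·-*ᵥ (ƛ ^ k) w₂ (matrix A)) ⟩
        a k *ᵥ (w₁ · matrix A) +ᵥ ƛ ^ k *ᵥ (w₂ · matrix A)            ≡⟨ cong₂ (λ u v → a k *ᵥ u +ᵥ ƛ ^ k *ᵥ v) eq₁ eq₂ ⟩
        a k *ᵥ ƛ *ᵥ w₁ +ᵥ ƛ ^ k *ᵥ (x *ᵥ w₁ +ᵥ ƛ *ᵥ w₂)               ≡⟨ cong₂ _,_ (collect (proj₁ w₁) (proj₁ w₂)) (collect (proj₂ w₁) (proj₂ w₂)) ⟩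
        (ƛ * a k + ƛ ^ k * x) *ᵥ w₁ +ᵥ (ƛ * ƛ ^ k) *ᵥ w₂              ∎
        where
        collect : ∀ s t → a k * (ƛ * s) + ƛ ^ k * (x * s + ƛ * t) ≡ (ƛ * a k + ƛ ^ k * x) * s + (ƛ * ƛ ^ k) * t
        collect = solve 6 (λ A L P X s t → A :* (L :* s) :+ P :* (X :* s :+ L :* t) := (L :* A :+ P :* X) :* s :+ (L :* P) :* t) refl
          (a k) ƛ (ƛ ^ k) x
      ƛa : ∀ k → ƛ * a k ≡ k ×₁ * (ƛ ^ k * x)
      ƛa zero    = trans (zeroʳ ƛ) (sym (zeroˡ (1# * x)))
      ƛa (suc k) = trans (cong (λ z → ƛ * (z + ƛ ^ k * x)) (ƛa k))
        (solve 4 (λ L K P X → L :* (K :* (P :* X) :+ P :* X) := (con (ℤ.+ 1) :+ K) :* ((L :* P) :* X)) refl ƛ (k ×₁) (ƛ ^ k) x)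
      a-m : a m ≡ 0#
      a-m = *ᵥ-cancelʳ {a m} {0#} {w₁} w₁≢0 (trans (+ᵥ-cancelˡ w₂ (begin
        w₂ +ᵥ a m *ᵥ w₁              ≡⟨ +ᵥ-comm w₂ (a m *ᵥ w₁) ⟩
        a m *ᵥ w₁ +ᵥ w₂              ≡⟨ cong (a m *ᵥ w₁ +ᵥ_) (sym (trans (cong (_*ᵥ w₂) (fermat ƛ≢0)) (1*ᵥ w₂))) ⟩
        a m *ᵥ w₁ +ᵥ ƛ ^ m *ᵥ w₂     ≡⟨ sym (iterate m) ⟩
        (_· matrix A) ^[ m ] w₂      ≡⟨ periodic w₂ ⟩
        w₂                           ≡⟨ sym (+ᵥ-identityʳ w₂) ⟩
        w₂ +ᵥ 0ᵥ                     ∎)) (sym (0*ᵥ w₁)))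
      m×x≡0 : m ×₁ * x ≡ 0#
      m×x≡0 = begin
        m ×₁ * x               ≡⟨ cong (m ×₁ *_) (sym (trans (cong (_* x) (fermat ƛ≢0)) (*-identityˡ x))) ⟩
        m ×₁ * (ƛ ^ m * x)     ≡⟨ sym (ƛa m) ⟩
        ƛ * a m                ≡⟨ cong (ƛ *_) a-m ⟩
        ƛ * 0#                 ≡⟨ zeroʳ ƛ ⟩
        0#                     ∎

    record Eigenbasis : Set where
      field
        e₁ e₂       : V
        independent : det e₁ e₂ ≢ 0#
        λ₁ λ₂       : Carrier
        e₁-eigen    : e₁ · matrix A ≡ λ₁ *ᵥ e₁
        e₂-eigen    : e₂ · matrix A ≡ λ₂ *ᵥ e₂
        λ₁≢λ₂       : λ₁ ≢ λ₂

    complete-basis : ∀ {w} → w ≢ 0ᵥ → ∃ λ w′ → det w w′ ≢ 0#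
    complete-basis {w} w≢0 = go (det w (γ 1#) ≟ 0#) (det w (γ θ) ≟ 0#)
      where
      go : Dec (det w (γ 1#) ≡ 0#) → Dec (det w (γ θ) ≡ 0#) → ∃ λ w′ → det w w′ ≢ 0#
      go (no ≢0) _        = γ 1# , ≢0
      go (yes _) (no ≢0)  = γ θ , ≢0
      go (yes p) (yes p′) = contradiction (∈⟨⟩⇒det≡0 {γ 1#} {γ θ} (proj₁ (⟨⟩-≐ {w} {γ 1#} (γ-≢0 1≢0)
        (proportional {w} {γ 1#} w≢0 p)) (proportional {w} {γ θ} w≢0 p′))) γ-independent

    -- In a basis starting with one eigenvector, A is triangular. Equal diagonal entries would make
    -- it a scalar, by `noJordanBlock`; distinct ones allow the second basis vector to be corrected
    -- to an eigenvector.
    eigenbasis : (∀ k → matrix A ≢ scalar k) → Eigenbasis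
    eigenbasis nonscalar = start (Polynomial.Operator.periodic⇒eigenvector K (matrix A) {γ 1#} (γ-≢0 1≢0) (periodic (γ 1#)))
      where
      start : (∃₂ λ w k → w ≢ 0ᵥ × w · matrix A ≡ k *ᵥ w) → Eigenbasis
      start (w₁ , ƛ , w₁≢0 , eq₁) = extend (complete-basis w₁≢0)
        where
        extend : (∃ λ w′ → det w₁ w′ ≢ 0#) → Eigenbasis
        extend (w₂ , independent) = split (coordinates (w₂ · matrix A))
          where
          open Basis {w₁} {w₂} independent
          split : (∃₂ λ x μ → w₂ · matrix A ≡ x e₁+ μ e₂) → Eigenbasis
          split (x , μ , eq₂) = decide (μ ≟ ƛ)
            where
            decide : Dec (μ ≡ ƛ) → Eigenbasis
            decide (yes μ≡ƛ) = contradiction (matrix-ext-basis {w₁} {w₂} independent {matrix A} {scalar ƛ}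
                (trans eq₁ (sym (·-scalar w₁ ƛ))) (trans w₂A (sym (·-scalar w₂ ƛ)))) (nonscalar ƛ)
              where
              eq₂′ : w₂ · matrix A ≡ x *ᵥ w₁ +ᵥ ƛ *ᵥ w₂
              eq₂′ = trans eq₂ (cong (λ z → x *ᵥ w₁ +ᵥ z *ᵥ w₂) μ≡ƛ)
              w₂A : w₂ · matrix A ≡ ƛ *ᵥ w₂
              w₂A = trans eq₂′ (trans (cong (λ z → z *ᵥ w₁ +ᵥ ƛ *ᵥ w₂) (noJordanBlock {w₁} {w₂} {ƛ} {x} w₁≢0 eq₁ eq₂′))
                (trans (cong (_+ᵥ ƛ *ᵥ w₂) (0*ᵥ w₁)) (+ᵥ-identityˡ (ƛ *ᵥ w₂))))
            decide (no μ≢ƛ) = record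
              { e₁ = w₁ ; e₂ = w₂′ ; independent = independent′ ; λ₁ = ƛ ; λ₂ = μ
              ; e₁-eigen = eq₁ ; e₂-eigen = eq₂′ ; λ₁≢λ₂ = λ ƛ≡μ → μ≢ƛ (sym ƛ≡μ) }
              where
              μ-ƛ≢0 : μ - ƛ ≢ 0#
              μ-ƛ≢0 eq = μ≢ƛ (x-y≡0⇒x≡y eq)
              -- s solves s ƛ + x = μ s, the condition for s w₁ + w₂ to be an eigenvector for μ.
              s : Carrier
              s = x * (μ - ƛ) ⁻¹
              w₂′ : V
              w₂′ = s e₁+ 1# e₂
              independent′ : det w₁ w₂′ ≢ 0#
              independent′ eq = independent (trans (sym (trans (det-e₁ s 1#) (*-identityˡ (det w₁ w₂)))) eq)
              eq₂′ : w₂′ · matrix A ≡ μ *ᵥ w₂′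
              eq₂′ = begin
                (s *ᵥ w₁ +ᵥ 1# *ᵥ w₂) · matrix A                   ≡⟨ ·-+ᵥ (s *ᵥ w₁) (1# *ᵥ w₂) (matrix A) ⟩
                (s *ᵥ w₁) · matrix A +ᵥ (1# *ᵥ w₂) · matrix A      ≡⟨ cong₂ _+ᵥ_ (·-*ᵥ s w₁ (matrix A)) (·-*ᵥ 1# w₂ (matrix A)) ⟩
                s *ᵥ (w₁ · matrix A) +ᵥ 1# *ᵥ (w₂ · matrix A)      ≡⟨ cong₂ (λ u v → s *ᵥ u +ᵥ 1# *ᵥ v) eq₁ eq₂ ⟩
                s *ᵥ ƛ *ᵥ w₁ +ᵥ 1# *ᵥ (x *ᵥ w₁ +ᵥ μ *ᵥ w₂)         ≡⟨ cong (λ z → s *ᵥ ƛ *ᵥ w₁ +ᵥ 1# *ᵥ (z *ᵥ w₁ +ᵥ μ *ᵥ w₂)) (sym (divide μ-ƛ≢0 x)) ⟩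
                s *ᵥ ƛ *ᵥ w₁ +ᵥ 1# *ᵥ ((s * (μ - ƛ)) *ᵥ w₁ +ᵥ μ *ᵥ w₂)  ≡⟨ cong₂ _,_ (collect (proj₁ w₁) (proj₁ w₂)) (collect (proj₂ w₁) (proj₂ w₂)) ⟩
                μ *ᵥ (s *ᵥ w₁ +ᵥ 1# *ᵥ w₂)                         ∎
                where
                collect : ∀ a b → s * (ƛ * a) + 1# * ((s * (μ - ƛ)) * a + μ * b) ≡ μ * (s * a + 1# * b)
                collect = solve 5 (λ s L M a b → s :* (L :* a) :+ con (ℤ.+ 1) :* ((s :* (M :- L)) :* a :+ M :* b) :=
                  M :* (s :* a :+ con (ℤ.+ 1) :* b)) refl s ƛ μ

  open CyclicSubgroups K public using (IsOrder; order-≢0; powers-injective; order⇒generates; commonGenerator)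

  infix 4 _≟ₘ_
  _≟ₘ_ : (A B : Matrix) → Dec (A ≡ B)
  mat a b c d ≟ₘ mat a′ b′ c′ d′ = map′ (λ { (p , r , s , t) → mat-cong p r s t }) (λ { refl → refl , refl , refl , refl })
    (a ≟ a′ ×-dec (b ≟ b′ ×-dec (c ≟ c′ ×-dec d ≟ d′)))

  -- A stabilizer consisting of scalars would inject into the units of F_q and have order at most q
  -- - 1. Being scalar is tested against the scalar matrix of the upper left entry, which makes it
  -- decidable.
  nonscalarElement : ∀ {m} → HasOrder (toGroup (G f)) m → q ℕ.∸ 1 ℕ.< m →
                     ∃ λ (A : InvertibleMatrix) → A ∈ Member (G f) × ∀ k → matrix A ≢ scalar k
  nonscalarElement {m} ord q-1<m = decide (Finite.any? ord {P = λ A → matrix (proj₁ A) ≢ corner (matrix (proj₁ A))}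
      (λ {x} {y} eq ≢ eq′ → ≢ (trans eq (trans eq′ (cong corner (sym eq))))) (λ A → ¬? (matrix (proj₁ A) ≟ₘ corner (matrix (proj₁ A)))))
    where
    corner : Matrix → Matrix
    corner M = scalar (Matrix.a₁₁ M)
    scalar⇒corner : ∀ {M k} → M ≡ scalar k → M ≡ corner M
    scalar⇒corner refl = refl
    decide : Dec (∃ λ (A : Group.Carrier (toGroup (G f))) → matrix (proj₁ A) ≢ corner (matrix (proj₁ A))) →
             ∃ λ (A : InvertibleMatrix) → A ∈ Member (G f) × ∀ k → matrix A ≢ scalar k
    decide (yes ((A , A∈G) , ≢)) = A , A∈G , λ k eq → ≢ (scalar⇒corner eq)
    decide (no none) = contradiction (injection⇒≤ ord F.units unit (λ {A} {B} → unit-injective {A} {B})) (ℕ.<⇒≱ q-1<m)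
      where
      unit-exists : (A : Group.Carrier (toGroup (G f))) → ∃ λ a → a ≢ F.0# × matrix (proj₁ A) ≡ scalar ⟦ a ⟧
      unit-exists (A , A∈G) = go (matrix A ≟ₘ corner (matrix A))
        where
        go : Dec (matrix A ≡ corner (matrix A)) → ∃ λ a → a ≢ F.0# × matrix A ≡ scalar ⟦ a ⟧
        go (yes eq) = scalar∈G⇒ {A} {Matrix.a₁₁ (matrix A)} A∈G eq
        go (no ≢)   = contradiction ((A , A∈G) , ≢) none
      unit : Group.Carrier (toGroup (G f)) → Group.Carrier (F ˣ)
      unit A = let a , a≢0 , _ = unit-exists A in a , a≢0
      unit-injective : ∀ {A B} → proj₁ (unit A) ≡ proj₁ (unit B) → matrix (proj₁ A) ≡ matrix (proj₁ B)
      unit-injective {A} {B} eq = trans (proj₂ (proj₂ (unit-exists A)))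
        (trans (cong (λ a → scalar ⟦ a ⟧) eq) (sym (proj₂ (proj₂ (unit-exists B)))))

  -- Diagonal matrices and the group of eigenvalue quotients

  module DiagonalMatrices {e₁ e₂ : V} (independent : det e₁ e₂ ≢ 0#) where
    open Basis {e₁} {e₂} independent

    private
      Δ : Carrier
      Δ = det e₁ e₂

      -- Cramer's rule, with `det v e₂` written as `- det e₂ v` so that v stands in the argument for
      -- which `det-+ʳ` and `det-*ᵥʳ` state linearity.
      coordinate₁ coordinate₂ : V → Carrier
      coordinate₁ v = Δ ⁻¹ * - det e₂ v
      coordinate₂ v = Δ ⁻¹ * det e₁ v

      coordinate₁-e₁ : coordinate₁ e₁ ≡ 1#
      coordinate₁-e₁ = trans (cong (Δ ⁻¹ *_) (sym (det-swap e₂ e₁))) (inverseˡ independent)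

      coordinate₁-e₂ : coordinate₁ e₂ ≡ 0#
      coordinate₁-e₂ = trans (cong (λ z → Δ ⁻¹ * - z) (det-self e₂)) (trans (cong (Δ ⁻¹ *_) -0#≈0#) (zeroʳ (Δ ⁻¹)))

      coordinate₂-e₁ : coordinate₂ e₁ ≡ 0#
      coordinate₂-e₁ = trans (cong (Δ ⁻¹ *_) (det-self e₁)) (zeroʳ (Δ ⁻¹))

      coordinate₂-e₂ : coordinate₂ e₂ ≡ 1#
      coordinate₂-e₂ = inverseˡ independent

      scale : Carrier → Carrier → V → V
      scale a b v = (a * coordinate₁ v) e₁+ (b * coordinate₂ v) e₂

      scale-+ : ∀ a b u v → scale a b (u +ᵥ v) ≡ scale a b u +ᵥ scale a b v
      scale-+ a b u v = trans (cong₂ (λ s t → (a * (Δ ⁻¹ * - s)) e₁+ (b * (Δ ⁻¹ * t)) e₂) (det-+ʳ e₂ u v) (det-+ʳ e₁ u v))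
        (cong₂ _,_ (lemma (proj₁ e₁) (proj₁ e₂)) (lemma (proj₂ e₁) (proj₂ e₂)))
        where
        lemma : ∀ x y → _
        lemma = solve 9 (λ a b i s s′ t t′ x y →
          (a :* (i :* :- (s :+ s′))) :* x :+ (b :* (i :* (t :+ t′))) :* y :=
          ((a :* (i :* :- s)) :* x :+ (b :* (i :* t)) :* y) :+ ((a :* (i :* :- s′)) :* x :+ (b :* (i :* t′)) :* y)) refl
          a b (Δ ⁻¹) (det e₂ u) (det e₂ v) (det e₁ u) (det e₁ v)

      scale-* : ∀ a b k v → scale a b (k *ᵥ v) ≡ k *ᵥ scale a b v
      scale-* a b k v = trans (cong₂ (λ s t → (a * (Δ ⁻¹ * - s)) e₁+ (b * (Δ ⁻¹ * t)) e₂) (det-*ᵥʳ k e₂ v) (det-*ᵥʳ k e₁ v))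
        (cong₂ _,_ (lemma (proj₁ e₁) (proj₁ e₂)) (lemma (proj₂ e₁) (proj₂ e₂)))
        where
        lemma : ∀ x y → _
        lemma = solve 8 (λ a b i k s t x y →
          (a :* (i :* :- (k :* s))) :* x :+ (b :* (i :* (k :* t))) :* y :=
          k :* ((a :* (i :* :- s)) :* x :+ (b :* (i :* t)) :* y)) refl
          a b (Δ ⁻¹) k (det e₂ v) (det e₁ v)

    abstract
      diagonal : Carrier → Carrier → Matrix
      diagonal a b = proj₁ (linear⇒matrix (scale a b) (scale-+ a b) (scale-* a b))

      e₁-diagonal : ∀ a b → e₁ · diagonal a b ≡ a *ᵥ e₁
      e₁-diagonal a b = begin
        e₁ · diagonal a b                 ≡⟨ sym (proj₂ (linear⇒matrix (scale a b) (scale-+ a b) (scale-* a b)) e₁) ⟩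
        scale a b e₁                      ≡⟨ cong₂ (λ s t → (a * s) e₁+ (b * t) e₂) coordinate₁-e₁ coordinate₂-e₁ ⟩
        (a * 1#) e₁+ (b * 0#) e₂          ≡⟨ cong₂ _e₁+_e₂ (*-identityʳ a) (zeroʳ b) ⟩
        a e₁+ 0# e₂                       ≡⟨ trans (cong (a *ᵥ e₁ +ᵥ_) (0*ᵥ e₂)) (+ᵥ-identityʳ (a *ᵥ e₁)) ⟩
        a *ᵥ e₁                           ∎

      e₂-diagonal : ∀ a b → e₂ · diagonal a b ≡ b *ᵥ e₂
      e₂-diagonal a b = begin
        e₂ · diagonal a b                 ≡⟨ sym (proj₂ (linear⇒matrix (scale a b) (scale-+ a b) (scale-* a b)) e₂) ⟩
        scale a b e₂                      ≡⟨ cong₂ (λ s t → (a * s) e₁+ (b * t) e₂) coordinate₁-e₂ coordinate₂-e₂ ⟩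
        (a * 0#) e₁+ (b * 1#) e₂          ≡⟨ cong₂ _e₁+_e₂ (zeroʳ a) (*-identityʳ b) ⟩
        0# e₁+ b e₂                       ≡⟨ trans (cong (_+ᵥ b *ᵥ e₂) (0*ᵥ e₁)) (+ᵥ-identityˡ (b *ᵥ e₂)) ⟩
        b *ᵥ e₂                           ∎

    diagonal-unique : ∀ {M a b} → e₁ · M ≡ a *ᵥ e₁ → e₂ · M ≡ b *ᵥ e₂ → M ≡ diagonal a b
    diagonal-unique {M} {a} {b} eq₁ eq₂ = matrix-ext-basis {e₁} {e₂} independent {M} {diagonal a b}
      (trans eq₁ (sym (e₁-diagonal a b))) (trans eq₂ (sym (e₂-diagonal a b)))

    private
      eigen-*ₘ : ∀ {M M′ v k l} → v · M ≡ k *ᵥ v → v · M′ ≡ l *ᵥ v → v · (M *ₘ M′) ≡ (k * l) *ᵥ v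
      eigen-*ₘ {M} {M′} {v} {k} {l} eq eq′ = begin
        v · (M *ₘ M′)     ≡⟨ ·-*ₘ v M M′ ⟩
        (v · M) · M′      ≡⟨ cong (_· M′) eq ⟩
        (k *ᵥ v) · M′     ≡⟨ ·-*ᵥ k v M′ ⟩
        k *ᵥ (v · M′)     ≡⟨ cong (k *ᵥ_) eq′ ⟩
        k *ᵥ l *ᵥ v       ≡⟨ sym (*ᵥ-assoc k l v) ⟩
        (k * l) *ᵥ v      ∎

    diagonal-* : ∀ a b c d → diagonal a b *ₘ diagonal c d ≡ diagonal (a * c) (b * d)
    diagonal-* a b c d = diagonal-unique
      (eigen-*ₘ {diagonal a b} {diagonal c d} {e₁} {a} {c} (e₁-diagonal a b) (e₁-diagonal c d))
      (eigen-*ₘ {diagonal a b} {diagonal c d} {e₂} {b} {d} (e₂-diagonal a b) (e₂-diagonal c d))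

    scalar-diagonal : ∀ k → scalar k ≡ diagonal k k
    scalar-diagonal k = diagonal-unique (·-scalar e₁ k) (·-scalar e₂ k)

    diagonal-injective₁ : ∀ {a b c d} → diagonal a b ≡ diagonal c d → a ≡ c
    diagonal-injective₁ {a} {b} {c} {d} eq = *ᵥ-cancelʳ {a} {c} {e₁} e₁≢0
      (trans (sym (e₁-diagonal a b)) (trans (cong (e₁ ·_) eq) (e₁-diagonal c d)))

    diagonal-injective₂ : ∀ {a b c d} → diagonal a b ≡ diagonal c d → b ≡ d
    diagonal-injective₂ {a} {b} {c} {d} eq = *ᵥ-cancelʳ {b} {d} {e₂} e₂≢0
      (trans (sym (e₂-diagonal a b)) (trans (cong (e₂ ·_) eq) (e₂-diagonal c d)))

    diagonalGL : ∀ {a b} → a ≢ 0# → b ≢ 0# → InvertibleMatrix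
    diagonalGL {a} {b} a≢0 b≢0 = record
      { matrix = diagonal a b ; inverse = diagonal (a ⁻¹) (b ⁻¹)
      ; inverseˡ = trans (diagonal-* (a ⁻¹) (b ⁻¹) a b) (trans (cong₂ diagonal (inverseˡ a≢0) (inverseˡ b≢0)) (sym (scalar-diagonal 1#)))
      ; inverseʳ = trans (diagonal-* a b (a ⁻¹) (b ⁻¹)) (trans (cong₂ diagonal (inverseʳ a≢0) (inverseʳ b≢0)) (sym (scalar-diagonal 1#)))
      }

  similar-scaled : ∀ {A A′ k} → k ≢ 0# → (∀ v → v · matrix A′ ≡ k *ᵥ (v · matrix A)) → Similar A → Similar A′
  similar-scaled {A} {A′} {k} k≢0 eq (h , h≢0 , maps) = k * h , *-≢0 k≢0 h≢0 , λ x → proj₁ (maps x) ,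
    trans (eq (γ x)) (trans (cong (k *ᵥ_) (proj₂ (maps x))) (sym (*ᵥ-assoc k h (γ (proj₁ (maps x))))))

  stabilizer⇒similar : ∀ {A} → A ∈ Member (G f) → Similar A
  stabilizer⇒similar {A} A∈G = 1# , 1≢0 , λ x → let y , eq = stabilizer⇒maps {A} A∈G x in y , trans eq (sym (1*ᵥ (γ y)))

  module DiagonalStabilizer {e₁ e₂ : V} (independent : det e₁ e₂ ≢ 0#) {m} (ord : HasOrder (toGroup (G f)) m)
    (eigenvectors : ∀ B → B ∈ Member (G f) → ∃₂ λ a b → e₁ · matrix B ≡ a *ᵥ e₁ × e₂ · matrix B ≡ b *ᵥ e₂) where

    open Basis {e₁} {e₂} independent using (e₁≢0; e₂≢0)
    open DiagonalMatrices {e₁} {e₂} independent public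

    -- r is the eigenvalue on e₁ divided by the eigenvalue on e₂, for some element of G_f. Writing
    -- the first eigenvalue as r * b keeps division out of the closure laws.
    HasRatio : Carrier → Set
    HasRatio r = ∃ λ (B : InvertibleMatrix) → B ∈ Member (G f) × ∃ λ b → b ≢ 0# × matrix B ≡ diagonal (r * b) b

    ratio : ∀ {B} → B ∈ Member (G f) → ∃₂ λ r b → b ≢ 0# × matrix B ≡ diagonal (r * b) b
    ratio {B} B∈G = let a , b , eq₁ , eq₂ = eigenvectors B B∈G
                        b≢0 = eigenvalue-≢0 {B} {b} {e₂} e₂≢0 eq₂
      in a * b ⁻¹ , b , b≢0 , trans (diagonal-unique eq₁ eq₂) (cong (λ z → diagonal z b) (sym (divide b≢0 a)))

    ratio-≢0 : ∀ {r} → HasRatio r → r ≢ 0#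
    ratio-≢0 {r} (B , _ , b , _ , eq) = *-≢0ˡ {r} {b} (eigenvalue-≢0 {B} {r * b} {e₁} e₁≢0 (trans (cong (e₁ ·_) eq) (e₁-diagonal (r * b) b)))

    ratio-1 : HasRatio 1#
    ratio-1 = GL.ε , Subgroup.ε-closed (G f) , 1# , 1≢0 , trans (scalar-diagonal 1#) (cong (λ z → diagonal z 1#) (sym (*-identityʳ 1#)))

    ratio-* : ∀ {r s} → HasRatio r → HasRatio s → HasRatio (r * s)
    ratio-* {r} {s} (B , B∈G , b , b≢0 , eq) (C , C∈G , c , c≢0 , eq′) = B GL.∙ C , Subgroup.∙-closed (G f) {B} {C} B∈G C∈G , b * c , *-≢0 b≢0 c≢0 , (begin
      matrix B *ₘ matrix C                          ≡⟨ cong₂ _*ₘ_ eq eq′ ⟩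
      diagonal (r * b) b *ₘ diagonal (s * c) c      ≡⟨ diagonal-* (r * b) b (s * c) c ⟩
      diagonal (r * b * (s * c)) (b * c)            ≡⟨ cong (λ z → diagonal z (b * c)) (solve 4 (λ r b s c → r :* b :* (s :* c) := r :* s :* (b :* c)) refl r b s c) ⟩
      diagonal (r * s * (b * c)) (b * c)            ∎)

    ratio-unique : ∀ {M r s b c} → b ≢ 0# → M ≡ diagonal (r * b) b → M ≡ diagonal (s * c) c → r ≡ s
    ratio-unique {M} {r} {s} {b} {c} b≢0 eq eq′ = *-cancelʳ {b} {r} {s} b≢0
      (trans (diagonal-injective₁ {r * b} {b} {s * c} {c} (trans (sym eq) eq′))
        (cong (s *_) (sym (diagonal-injective₂ {r * b} {b} {s * c} {c} (trans (sym eq) eq′)))))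

    abstract
      -- The quotients of all elements of G_f, listed along its enumeration, are handed to
      -- `commonGenerator`.
      generators : ∃₂ λ c o → HasRatio c × IsOrder c o × (∀ {B r b} → B ∈ Member (G f) → b ≢ 0# → matrix B ≡ diagonal (r * b) b → r ^ o ≡ 1#)
      generators = conclude (commonGenerator {P = HasRatio} ratio-≢0 ratio-1 ratio-* {List.tabulate r} (All.tabulate⁺ λ i →
          proj₁ (Ord.from i) , proj₂ (Ord.from i) , proj₂ (ratio {proj₁ (Ord.from i)} (proj₂ (Ord.from i)))))
        where
        module Ord = Inverse ord
        r : Fin m → Carrier
        r i = proj₁ (ratio {proj₁ (Ord.from i)} (proj₂ (Ord.from i)))
        conclude : (∃₂ λ c o → HasRatio c × IsOrder c o × All (λ x → x ^ o ≡ 1#) (List.tabulate r)) →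
                   ∃₂ λ c o → HasRatio c × IsOrder c o × (∀ {B r b} → B ∈ Member (G f) → b ≢ 0# → matrix B ≡ diagonal (r * b) b → r ^ o ≡ 1#)
        conclude (c , o , Pc , c-ord , all) = c , o , Pc , c-ord , λ {B} {s} {b} B∈G b≢0 eq →
          let i = Ord.to (B , B∈G)
              r′ , b′ , b′≢0 , eq′ = ratio {proj₁ (Ord.from i)} (proj₂ (Ord.from i))
          in subst (λ z → z ^ o ≡ 1#) (sym (ratio-unique {matrix B} {s} {r′} {b} {b′} b≢0 eq (trans (sym (Ord.strictlyInverseʳ (B , B∈G))) eq′)))
               (All.tabulate⁻ all i)

    c : Carrier
    c = proj₁ generators

    o : ℕ
    o = proj₁ (proj₂ generators)

    c-ratio : HasRatio c
    c-ratio = proj₁ (proj₂ (proj₂ generators))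

    c-order : IsOrder c o
    c-order = proj₁ (proj₂ (proj₂ (proj₂ generators)))

    c≢0 : c ≢ 0#
    c≢0 = ratio-≢0 c-ratio

    ratio-power : ∀ {B r b} → B ∈ Member (G f) → b ≢ 0# → matrix B ≡ diagonal (r * b) b → ∃ λ (i : Fin o) → r ≡ c ^ toℕ i
    ratio-power {B} {r} {b} B∈G b≢0 eq = order⇒generates {c} {o} {r} c≢0 c-order
      (proj₂ (proj₂ (proj₂ (proj₂ generators))) {B} {r} {b} B∈G b≢0 eq)

    powerRatio : ∀ i → HasRatio (c ^ i)
    powerRatio zero    = ratio-1
    powerRatio (suc i) = ratio-* {c} {c ^ i} c-ratio (powerRatio i)

    private
      P : ℕ → InvertibleMatrix
      P i = proj₁ (powerRatio i)
      P∈G : ∀ i → P i ∈ Member (G f)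
      P∈G i = proj₁ (proj₂ (powerRatio i))
      p : ℕ → Carrier
      p i = proj₁ (proj₂ (proj₂ (powerRatio i)))
      p≢0 : ∀ i → p i ≢ 0#
      p≢0 i = proj₁ (proj₂ (proj₂ (proj₂ (powerRatio i))))
      P≡ : ∀ i → matrix (P i) ≡ diagonal (c ^ i * p i) (p i)
      P≡ i = proj₂ (proj₂ (proj₂ (proj₂ (powerRatio i))))

    -- B has the same quotient as one of the chosen elements `P i`, so P i ⁻¹ B is a scalar in G_f,
    -- and such scalars come from F_q.
    decompose : ∀ {B} → B ∈ Member (G f) → ∃ λ (i : Fin o) → ∃ λ a → a ≢ F.0# × matrix B ≡ diagonal (c ^ toℕ i * p (toℕ i) * ⟦ a ⟧) (p (toℕ i) * ⟦ a ⟧)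
    decompose {B} B∈G = go (ratio {B} B∈G)
      where
      go : (∃₂ λ r b → b ≢ 0# × matrix B ≡ diagonal (r * b) b) →
           ∃ λ (i : Fin o) → ∃ λ a → a ≢ F.0# × matrix B ≡ diagonal (c ^ toℕ i * p (toℕ i) * ⟦ a ⟧) (p (toℕ i) * ⟦ a ⟧)
      go (r , b , b≢0 , eq) = go′ (ratio-power {B} {r} {b} B∈G b≢0 eq)
        where
        go′ : (∃ λ (i : Fin o) → r ≡ c ^ toℕ i) →
              ∃ λ (i : Fin o) → ∃ λ a → a ≢ F.0# × matrix B ≡ diagonal (c ^ toℕ i * p (toℕ i) * ⟦ a ⟧) (p (toℕ i) * ⟦ a ⟧)
        go′ (i , r≡c^i) = i , finish (scalar∈G⇒ {Q} {k} (Subgroup.∙-closed (G f) {P (toℕ i) GL.⁻¹} {B}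
                                  (Subgroup.⁻¹-closed (G f) {P (toℕ i)} (P∈G (toℕ i))) B∈G) Q≡scalar)
          where
          -- k is the quotient of the second eigenvalues of B and of `P i`; as the eigenvalue
          -- quotients agree, it is that of the first eigenvalues too.
          s k : Carrier
          s = p (toℕ i)
          k = b * s ⁻¹
          sk≡b : s * k ≡ b
          sk≡b = trans (*-comm s k) (divide (p≢0 (toℕ i)) b)
          Q : InvertibleMatrix
          Q = (P (toℕ i) GL.⁻¹) GL.∙ B
          B≡ : matrix B ≡ matrix (P (toℕ i)) *ₘ scalar k
          B≡ = begin
            matrix B                                              ≡⟨ eq ⟩
            diagonal (r * b) b                                    ≡⟨ cong₂ (λ r b → diagonal (r * b) b) r≡c^i (sym sk≡b) ⟩
            diagonal (c ^ toℕ i * (s * k)) (s * k)                ≡⟨ cong (λ z → diagonal z (s * k)) (sym (*-assoc (c ^ toℕ i) s k)) ⟩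
            diagonal (c ^ toℕ i * s * k) (s * k)                  ≡⟨ sym (diagonal-* (c ^ toℕ i * s) s k k) ⟩
            diagonal (c ^ toℕ i * s) s *ₘ diagonal k k            ≡⟨ sym (cong₂ _*ₘ_ (P≡ (toℕ i)) (scalar-diagonal k)) ⟩
            matrix (P (toℕ i)) *ₘ scalar k                        ∎
          Q≡scalar : matrix Q ≡ scalar k
          Q≡scalar = begin
            InvertibleMatrix.inverse (P (toℕ i)) *ₘ matrix B                                   ≡⟨ cong (InvertibleMatrix.inverse (P (toℕ i)) *ₘ_) B≡ ⟩
            InvertibleMatrix.inverse (P (toℕ i)) *ₘ (matrix (P (toℕ i)) *ₘ scalar k)           ≡⟨ sym (*ₘ-assoc (InvertibleMatrix.inverse (P (toℕ i))) (matrix (P (toℕ i))) (scalar k)) ⟩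
            InvertibleMatrix.inverse (P (toℕ i)) *ₘ matrix (P (toℕ i)) *ₘ scalar k             ≡⟨ cong (_*ₘ scalar k) (InvertibleMatrix.inverseˡ (P (toℕ i))) ⟩
            1ₘ *ₘ scalar k                                                                     ≡⟨ *ₘ-identityˡ (scalar k) ⟩
            scalar k                                                                           ∎
          finish : (∃ λ a → a ≢ F.0# × matrix Q ≡ scalar ⟦ a ⟧) →
                   ∃ λ a → a ≢ F.0# × matrix B ≡ diagonal (c ^ toℕ i * s * ⟦ a ⟧) (s * ⟦ a ⟧)
          finish (a , a≢0 , eq′) = a , a≢0 , (begin
            matrix B                                              ≡⟨ B≡ ⟩
            matrix (P (toℕ i)) *ₘ scalar k                        ≡⟨ cong (matrix (P (toℕ i)) *ₘ_) (trans (sym Q≡scalar) eq′) ⟩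
            matrix (P (toℕ i)) *ₘ scalar ⟦ a ⟧                    ≡⟨ cong₂ _*ₘ_ (P≡ (toℕ i)) (scalar-diagonal ⟦ a ⟧) ⟩
            diagonal (c ^ toℕ i * s) s *ₘ diagonal ⟦ a ⟧ ⟦ a ⟧    ≡⟨ diagonal-* (c ^ toℕ i * s) s ⟦ a ⟧ ⟦ a ⟧ ⟩
            diagonal (c ^ toℕ i * s * ⟦ a ⟧) (s * ⟦ a ⟧)          ∎)

    private
      fromPair : Fin o × Fin (q ℕ.∸ 1) → Group.Carrier (toGroup (G f))
      fromPair (i , j) = P (toℕ i) GL.∙ scalarGL ⟦ proj₁ u ⟧ (⟦⟧-≢0 (proj₂ u)) ,
        Subgroup.∙-closed (G f) {P (toℕ i)} {scalarGL ⟦ proj₁ u ⟧ (⟦⟧-≢0 (proj₂ u))} (P∈G (toℕ i)) (scalar∈G (proj₂ u))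
        where u = Inverse.from F.units j

      fromPair≡ : ∀ i j → matrix (proj₁ (fromPair (i , j))) ≡
        diagonal (c ^ toℕ i * p (toℕ i) * ⟦ proj₁ (Inverse.from F.units j) ⟧) (p (toℕ i) * ⟦ proj₁ (Inverse.from F.units j) ⟧)
      fromPair≡ i j = trans (cong₂ _*ₘ_ (P≡ (toℕ i)) (scalar-diagonal a)) (diagonal-* (c ^ toℕ i * p (toℕ i)) (p (toℕ i)) a a)
        where a = ⟦ proj₁ (Inverse.from F.units j) ⟧

      fromPair-injective : ∀ {x y} → matrix (proj₁ (fromPair x)) ≡ matrix (proj₁ (fromPair y)) → x ≡ y
      fromPair-injective {i , j} {i′ , j′} eq = combine i≡i′ second
        where
        a a′ s s′ : Carrier
        a  = ⟦ proj₁ (Inverse.from F.units j) ⟧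
        a′ = ⟦ proj₁ (Inverse.from F.units j′) ⟧
        s  = p (toℕ i)
        s′ = p (toℕ i′)
        a≢0 : a ≢ 0#
        a≢0 = ⟦⟧-≢0 (proj₂ (Inverse.from F.units j))
        both : diagonal (c ^ toℕ i * s * a) (s * a) ≡ diagonal (c ^ toℕ i′ * s′ * a′) (s′ * a′)
        both = trans (sym (fromPair≡ i j)) (trans eq (fromPair≡ i′ j′))
        second : s * a ≡ s′ * a′
        second = diagonal-injective₂ {c ^ toℕ i * s * a} {s * a} {c ^ toℕ i′ * s′ * a′} {s′ * a′} both
        i≡i′ : i ≡ i′
        i≡i′ = powers-injective {c} {o} c≢0 c-order {i} {i′} (*-cancelʳ {s * a} {c ^ toℕ i} {c ^ toℕ i′} (*-≢0 (p≢0 (toℕ i)) a≢0) (begin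
          c ^ toℕ i * (s * a)        ≡⟨ sym (*-assoc (c ^ toℕ i) s a) ⟩
          c ^ toℕ i * s * a          ≡⟨ diagonal-injective₁ {c ^ toℕ i * s * a} {s * a} {c ^ toℕ i′ * s′ * a′} {s′ * a′} both ⟩
          c ^ toℕ i′ * s′ * a′       ≡⟨ *-assoc (c ^ toℕ i′) s′ a′ ⟩
          c ^ toℕ i′ * (s′ * a′)     ≡⟨ cong (c ^ toℕ i′ *_) (sym second) ⟩
          c ^ toℕ i′ * (s * a)       ∎))
        combine : ∀ {i″} → i ≡ i″ → p (toℕ i) * a ≡ p (toℕ i″) * a′ → (i , j) ≡ (i″ , j′)
        combine refl e = cong (i ,_) (Finite.from-injective F.units {j} {j′} (⟦⟧-injective (*-cancelˡ {s} {a} {a′} (p≢0 (toℕ i)) e)))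

      toPair : Group.Carrier (toGroup (G f)) → Fin o × Fin (q ℕ.∸ 1)
      toPair (B , B∈G) = let i , a , a≢0 , _ = decompose {B} B∈G in i , Inverse.to F.units (a , a≢0)

      toPair-injective : ∀ {B C} → toPair B ≡ toPair C → matrix (proj₁ B) ≡ matrix (proj₁ C)
      toPair-injective {B , B∈G} {C , C∈G} eq =
        let i , a , a≢0 , B≡ = decompose {B} B∈G
            i′ , a′ , a′≢0 , C≡ = decompose {C} C∈G
        in trans B≡ (trans (cong₂ (λ i a → diagonal (c ^ toℕ i * p (toℕ i) * ⟦ a ⟧) (p (toℕ i) * ⟦ a ⟧)) (cong proj₁ eq)
             (Finite.to-injective F.units {a , a≢0} {a′ , a′≢0} (cong proj₂ eq))) (sym C≡))

    -- Each of the o quotients is attained by q - 1 elements of G_f, the F_q-multiples of one of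
    -- them. With the order q ^ t - 1 of G_f known, this evaluates o.
    order-product : m ≡ o ℕ.* (q ℕ.∸ 1)
    order-product = ℕ.≤-antisym
      (injection⇒≤ ord (↔-sym Fin.*↔×) toPair (λ {B} {C} → toPair-injective {B} {C}))
      (injection⇒≤ (↔-sym Fin.*↔×) ord fromPair (λ {x} {y} → fromPair-injective {x} {y}))

    order≡homologyOrder : ∀ {t} → m ≡ q ℕ.^ t ℕ.∸ 1 → o ≡ homologyOrder q t 3<q
    order≡homologyOrder {t} m≡ = sym (trans (cong (ℕ._/ (q ℕ.∸ 1)) (trans (sym m≡) order-product)) (m*n/n≡m o (q ℕ.∸ 1)))
      where instance
        q-1≢0 : NonZero (q ℕ.∸ 1)
        q-1≢0 = F.N-1≢0

    homology₁ homology₂ : ℕ → InvertibleMatrix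
    homology₁ i = diagonalGL {c ^ i} {1#} (^-≢0 c≢0 i) 1≢0
    homology₂ i = diagonalGL {1#} {c ^ i} 1≢0 (^-≢0 c≢0 i)

    private
      scaled : ∀ {a b a′ b′ k} → a′ ≡ k * a → b′ ≡ k * b → ∀ v → v · diagonal a′ b′ ≡ k *ᵥ (v · diagonal a b)
      scaled {a} {b} {a′} {b′} {k} eq eq′ v = begin
        v · diagonal a′ b′                        ≡⟨ cong₂ (λ s t → v · diagonal s t) (trans eq (*-comm k a)) (trans eq′ (*-comm k b)) ⟩
        v · diagonal (a * k) (b * k)              ≡⟨ cong (v ·_) (sym (diagonal-* a b k k)) ⟩
        v · (diagonal a b *ₘ diagonal k k)        ≡⟨ ·-*ₘ v (diagonal a b) (diagonal k k) ⟩
        (v · diagonal a b) · diagonal k k         ≡⟨ cong ((v · diagonal a b) ·_) (sym (scalar-diagonal k)) ⟩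
        (v · diagonal a b) · scalar k             ≡⟨ ·-scalar (v · diagonal a b) k ⟩
        k *ᵥ (v · diagonal a b)                   ∎

    -- It is `P i` divided by its second eigenvalue, and a multiple of an element of G_f is a
    -- similarity.
    homology₁-similar : ∀ i → Similar (homology₁ i)
    homology₁-similar i = similar-scaled {P i} {homology₁ i} {p i ⁻¹} (⁻¹-≢0 (p≢0 i))
      (λ v → trans (scaled {c ^ i * p i} {p i} {c ^ i} {1#} {p i ⁻¹}
          (sym (trans (*-comm (p i ⁻¹) (c ^ i * p i)) (trans (*-assoc (c ^ i) (p i) (p i ⁻¹)) (trans (cong (c ^ i *_) (inverseʳ (p≢0 i))) (*-identityʳ (c ^ i))))))
          (sym (inverseˡ (p≢0 i))) v)
        (cong (λ M → p i ⁻¹ *ᵥ (v · M)) (sym (P≡ i))))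
      (stabilizer⇒similar {P i} (P∈G i))

    -- diag (1 , c ^ i) is c ^ i times the inverse of diag (c ^ i , 1).
    homology₂-similar : ∀ i → Similar (homology₂ i)
    homology₂-similar i = similar-scaled {homology₁ i GL.⁻¹} {homology₂ i} {c ^ i} (^-≢0 c≢0 i)
      (scaled {(c ^ i) ⁻¹} {1# ⁻¹} {1#} {c ^ i} {c ^ i} (sym (inverseʳ (^-≢0 c≢0 i)))
        (sym (trans (cong (c ^ i *_) (trans (sym (*-identityˡ (1# ⁻¹))) (inverseʳ 1≢0))) (*-identityʳ (c ^ i)))))
      (similar-⁻¹ {homology₁ i} (homology₁-similar i))

  -- Homologies and centers

  -- A group embedded by `label` into `K ˣ`, with image the powers of c. The same argument serves a
  -- group of collineations and a group of matrices.
  module Labelled {a ℓ} (𝒢 : Group a ℓ) {c : Carrier} {o : ℕ} (c≢0 : c ≢ 0#) (c-order : IsOrder c o)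
    (label       : Group.Carrier 𝒢 → Carrier)
    (label-cong  : ∀ x y → Group._≈_ 𝒢 x y → label x ≡ label y)
    (label-inj   : ∀ x y → label x ≡ label y → Group._≈_ 𝒢 x y)
    (label-ε     : label (Group.ε 𝒢) ≡ 1#)
    (label-∙     : ∀ x y → label (Group._∙_ 𝒢 x y) ≡ label x * label y)
    (exponent    : ∀ x → ∃ λ i → label x ≡ c ^ i)
    (element     : ∀ i → ∃ λ x → label x ≡ c ^ i) where

    open Group 𝒢 using (_∙_; _⁻¹; rawMonoid) renaming (Carrier to 𝒢-Carrier)
    open RawMonoid rawMonoid using () renaming (_×_ to _·′_)

    private
      generator′ : 𝒢-Carrier
      generator′ = proj₁ (element 1)

      label-power : ∀ k → label (k ·′ generator′) ≡ c ^ k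
      label-power zero    = label-ε
      label-power (suc k) = trans (label-∙ generator′ (k ·′ generator′))
        (cong₂ _*_ (trans (proj₂ (element 1)) (*-identityʳ c)) (label-power k))

      index : ∀ x → ∃ λ (i : Fin o) → label x ≡ c ^ toℕ i
      index x = order⇒generates {c} {o} {label x} c≢0 c-order (let i , eq = exponent x in begin
        label x ^ o       ≡⟨ cong (_^ o) eq ⟩
        (c ^ i) ^ o       ≡⟨ ^-assocʳ c i o ⟩
        c ^ (i ℕ.* o)     ≡⟨ CyclicSubgroups.1^-* K {c} o (proj₁ c-order) i ⟩
        1#                ∎)

    isCyclic : IsCyclic 𝒢
    isCyclic = generator′ , λ x → let i , eq = exponent x in i , inj₁ (label-inj x (i ·′ generator′) (trans eq (sym (label-power i))))

    hasOrder : HasOrder 𝒢 o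
    hasOrder = record
      { to = λ x → proj₁ (index x)
      ; from = λ i → proj₁ (element (toℕ i))
      ; to-cong = λ {x} {y} eq → powers-injective {c} {o} c≢0 c-order
          (trans (sym (proj₂ (index x))) (trans (label-cong x y eq) (proj₂ (index y))))
      ; from-cong = λ { refl → Group.refl 𝒢 }
      ; inverse = (λ {i} {x} eq → powers-injective {c} {o} c≢0 c-order
                    (trans (sym (proj₂ (index x))) (trans (label-cong x (proj₁ (element (toℕ i))) eq) (proj₂ (element (toℕ i))))))
                , (λ { {x} refl → label-inj (proj₁ (element (toℕ (proj₁ (index x))))) x (trans (proj₂ (element (toℕ (proj₁ (index x))))) (sym (proj₂ (index x)))) })
      }

  -- The homologies with center the line of e₁ and axis the line of e₂. The basis is ordered and the
  -- family S is a parameter, so that exchanging e₁ and e₂ yields the second of the two symmetric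
  -- groups.
  module HomologyGroup {e₁ e₂ : V} (independent : det e₁ e₂ ≢ 0#) (X∈ℬ : ⟨ e₁ ⟩ ∈ ℬ f) (Y∈ℬ : ⟨ e₂ ⟩ ∈ ℬ f)
    {c : Carrier} {o : ℕ} (c≢0 : c ≢ 0#) (c-order : IsOrder c o)
    (S : ℕ → InvertibleMatrix) (S-e₁ : ∀ i → e₁ · matrix (S i) ≡ c ^ i *ᵥ e₁) (S-e₂ : ∀ i → e₂ · matrix (S i) ≡ e₂)
    (S-similar : ∀ i → Similar (S i)) where

    open Basis {e₁} {e₂} independent

    X Y : Component
    X = ⟨ e₁ ⟩ , X∈ℬ
    Y = ⟨ e₂ ⟩ , Y∈ℬ

    axis coaxis : AffineLine
    axis   = 0ᵥ , Y
    coaxis = 0ᵥ , X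

    S-+ : ∀ i j → matrix (S i) *ₘ matrix (S j) ≡ matrix (S (i ℕ.+ j))
    S-+ i j = matrix-ext-basis {e₁} {e₂} independent {matrix (S i) *ₘ matrix (S j)} {matrix (S (i ℕ.+ j))} (begin
      e₁ · (matrix (S i) *ₘ matrix (S j))     ≡⟨ ·-*ₘ e₁ (matrix (S i)) (matrix (S j)) ⟩
      (e₁ · matrix (S i)) · matrix (S j)      ≡⟨ cong (_· matrix (S j)) (S-e₁ i) ⟩
      (c ^ i *ᵥ e₁) · matrix (S j)            ≡⟨ ·-*ᵥ (c ^ i) e₁ (matrix (S j)) ⟩
      c ^ i *ᵥ (e₁ · matrix (S j))            ≡⟨ cong (c ^ i *ᵥ_) (S-e₁ j) ⟩
      c ^ i *ᵥ c ^ j *ᵥ e₁                    ≡⟨ sym (*ᵥ-assoc (c ^ i) (c ^ j) e₁) ⟩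
      (c ^ i * c ^ j) *ᵥ e₁                   ≡⟨ cong (_*ᵥ e₁) (sym (^-homo-* c i j)) ⟩
      c ^ (i ℕ.+ j) *ᵥ e₁                     ≡⟨ sym (S-e₁ (i ℕ.+ j)) ⟩
      e₁ · matrix (S (i ℕ.+ j))               ∎)
      (trans (·-*ₘ e₂ (matrix (S i)) (matrix (S j))) (trans (cong (_· matrix (S j)) (S-e₂ i)) (trans (S-e₂ j) (sym (S-e₂ (i ℕ.+ j))))))

    S-cong : ∀ {i j} → c ^ i ≡ c ^ j → matrix (S i) ≡ matrix (S j)
    S-cong {i} {j} eq = matrix-ext-basis {e₁} {e₂} independent {matrix (S i)} {matrix (S j)}
      (trans (S-e₁ i) (trans (cong (_*ᵥ e₁) eq) (sym (S-e₁ j)))) (trans (S-e₂ i) (sym (S-e₂ j)))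

    S-0 : matrix (S 0) ≡ 1ₘ
    S-0 = matrix-ext-basis {e₁} {e₂} independent {matrix (S 0)} {1ₘ}
      (trans (S-e₁ 0) (trans (1*ᵥ e₁) (sym (·-1ₘ e₁)))) (trans (S-e₂ 0) (sym (·-1ₘ e₂)))

    -- Exponents are natural numbers, so the inverse of c ^ i is taken as c ^ (i (o - 1)), using c ^
    -- o = 1.
    S-inverse : ∀ i → matrix (S i) *ₘ matrix (S (i ℕ.* (o ℕ.∸ 1))) ≡ 1ₘ
    S-inverse i = trans (S-+ i (i ℕ.* (o ℕ.∸ 1))) (trans (S-cong {i ℕ.+ i ℕ.* (o ℕ.∸ 1)} {0} (begin
      c ^ (i ℕ.+ i ℕ.* (o ℕ.∸ 1))     ≡⟨ cong (c ^_) (sym (ℕ.*-suc i (o ℕ.∸ 1))) ⟩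
      c ^ (i ℕ.* suc (o ℕ.∸ 1))       ≡⟨ cong (λ k → c ^ (i ℕ.* k)) (ℕ.suc-pred o {{order-≢0 {c} {o} c≢0 c-order}}) ⟩
      c ^ (i ℕ.* o)                   ≡⟨ CyclicSubgroups.1^-* K {c} o (proj₁ c-order) i ⟩
      1#                              ∎)) S-0)

    S-eigenvalue : ∀ {i j} → matrix (S i) ≡ matrix (S j) → c ^ i ≡ c ^ j
    S-eigenvalue {i} {j} eq = *ᵥ-cancelʳ {c ^ i} {c ^ j} {e₁} e₁≢0 (trans (sym (S-e₁ i)) (trans (cong (e₁ ·_) eq) (S-e₁ j)))

    S-combination : ∀ i x y → (x e₁+ y e₂) · matrix (S i) ≡ (x * c ^ i) e₁+ y e₂
    S-combination i x y = begin
      (x *ᵥ e₁ +ᵥ y *ᵥ e₂) · matrix (S i)                   ≡⟨ ·-+ᵥ (x *ᵥ e₁) (y *ᵥ e₂) (matrix (S i)) ⟩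
      (x *ᵥ e₁) · matrix (S i) +ᵥ (y *ᵥ e₂) · matrix (S i)  ≡⟨ cong₂ _+ᵥ_ (·-*ᵥ x e₁ (matrix (S i))) (·-*ᵥ y e₂ (matrix (S i))) ⟩
      x *ᵥ (e₁ · matrix (S i)) +ᵥ y *ᵥ (e₂ · matrix (S i))  ≡⟨ cong₂ (λ u v → x *ᵥ u +ᵥ y *ᵥ v) (S-e₁ i) (S-e₂ i) ⟩
      x *ᵥ c ^ i *ᵥ e₁ +ᵥ y *ᵥ e₂                           ≡⟨ cong (_+ᵥ y *ᵥ e₂) (sym (*ᵥ-assoc x (c ^ i) e₁)) ⟩
      (x * c ^ i) e₁+ y e₂                                  ∎

    -- Every point is moved in the direction of e₁, which is why all lines of that direction are
    -- preserved and X is the center.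
    S-displacement : ∀ i v → v · matrix (S i) -ᵥ v ∈ ⟨ e₁ ⟩
    S-displacement i v = go (coordinates v)
      where
      go : (∃₂ λ x y → v ≡ x e₁+ y e₂) → v · matrix (S i) -ᵥ v ∈ ⟨ e₁ ⟩
      go (x , y , v≡) = x * c ^ i - x , (begin
        v · matrix (S i) -ᵥ v                                 ≡⟨ cong (λ v → v · matrix (S i) -ᵥ v) v≡ ⟩
        (x e₁+ y e₂) · matrix (S i) -ᵥ (x e₁+ y e₂)           ≡⟨ cong (_-ᵥ (x e₁+ y e₂)) (S-combination i x y) ⟩
        ((x * c ^ i) e₁+ y e₂) -ᵥ (x e₁+ y e₂)                ≡⟨ cong₂ _,_ (collect (x * c ^ i) x y (proj₁ e₁) (proj₁ e₂)) (collect (x * c ^ i) x y (proj₂ e₁) (proj₂ e₂)) ⟩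
        (x * c ^ i - x) *ᵥ e₁                                 ∎)
        where
        collect : ∀ z x y a b → (z * a + y * b) - (x * a + y * b) ≡ (z - x) * a
        collect = solve 5 (λ z x y a b → (z :* a :+ y :* b) :- (x :* a :+ y :* b) := (z :- x) :* a) refl

    S-fixes-Y : ∀ i {w} → w ∈ ⟨ e₂ ⟩ → w · matrix (S i) ≡ w
    S-fixes-Y i (k , refl) = trans (·-*ᵥ k e₂ (matrix (S i))) (cong (k *ᵥ_) (S-e₂ i))

    image-Y : ∀ i → image ⟨ e₂ ⟩ (matrix (S i)) ≐ ⟨ e₂ ⟩
    image-Y i = (λ { (w , w∈Y , refl) → subst ⟨ e₂ ⟩ (sym (S-fixes-Y i w∈Y)) w∈Y }) , (λ {w} w∈Y → w , w∈Y , sym (S-fixes-Y i w∈Y))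

    image-X : ∀ i → image ⟨ e₁ ⟩ (matrix (S i)) ≐ ⟨ e₁ ⟩
    image-X i = (λ { (_ , (k , refl) , refl) → k * c ^ i , trans (kS k) (sym (*ᵥ-assoc k (c ^ i) e₁)) }) ,
      (λ { (k , refl) → (k * (c ^ i) ⁻¹) *ᵥ e₁ , (k * (c ^ i) ⁻¹ , refl) , sym (trans (kS (k * (c ^ i) ⁻¹))
        (trans (sym (*ᵥ-assoc (k * (c ^ i) ⁻¹) (c ^ i) e₁)) (cong (_*ᵥ e₁) (divide (^-≢0 c≢0 i) k)))) })
      where
      kS : ∀ k → (k *ᵥ e₁) · matrix (S i) ≡ k *ᵥ c ^ i *ᵥ e₁
      kS k = trans (·-*ᵥ k e₁ (matrix (S i))) (cong (k *ᵥ_) (S-e₁ i))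

    X≢Y : ¬ (⟨ e₁ ⟩ ≐ ⟨ e₂ ⟩)
    X≢Y (⊆ , _) = det-swap-≢0 {e₁} {e₂} independent (∈⟨⟩⇒det≡0 {e₂} {e₁} (⊆ (1# , sym (1*ᵥ e₁))))

    on-axis⇒fixed : ∀ i {x} → x ∈ₗ axis → x · matrix (S i) ≡ x
    on-axis⇒fixed i (w , w∈Y , x≡) = S-fixes-Y i (subst ⟨ e₂ ⟩ (sym (trans x≡ (+ᵥ-identityˡ w))) w∈Y)

    isHomology : ∀ {φ} i → (∀ v → to φ v ≡ v · matrix (S i)) → ¬ φ ≋ identity → IsAffineHomology φ axis (inj₂ X)
    isHomology {φ} i induces φ≢id = ψ , (λ x → inj₁ (sym (induces x))) , (nonidentity , fixesAxis) , center , X≢Y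
      where
      ψ : Projective.Collineation
      ψ = inducedProjective {S i} (S-similar i)
      nonidentity : ¬ ψ Projective.≋ Projective.identity
      nonidentity ψ≋id = φ≢id λ v → trans (induces v) (≈ₚ-affine (ψ≋id (inj₁ v)))
      fixesAxis : Projective.FixesPointwise ψ (inj₁ axis)
      fixesAxis (inj₁ x)       x∈  = inj₁ (on-axis⇒fixed i x∈)
      fixesAxis (inj₂ (Z , _)) Z≐Y = inj₂ (≐-trans (image-≐ {matrix (S i)} {Z} {⟨ e₂ ⟩} Z≐Y) (≐-trans (image-Y i) (≐-sym Z≐Y)))
      center : Projective.IsCenter ψ (inj₂ X)
      center (inj₂ ∞) _ (inj₁ x) = mk⇔ (λ ()) (λ ())
      center (inj₂ ∞) _ (inj₂ Z) = mk⇔ _ _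
      center (inj₁ (v , W , W∈ℬ)) (X⊆W , W⊆X) (inj₁ x) = mk⇔
        (λ x∈ → Equivalence.from (∈ₗ⇔ W∈ℬ) (subst W ([u-v]+[v-w] (x · matrix (S i)) x v)
          (W.+-∈ {x · matrix (S i) -ᵥ x} {x -ᵥ v} displacement (Equivalence.to (∈ₗ⇔ W∈ℬ) x∈))))
        (λ xS∈ → Equivalence.from (∈ₗ⇔ W∈ℬ) (subst W (difference (x · matrix (S i)) x)
          (W.∸-∈ {x · matrix (S i) -ᵥ v} {x · matrix (S i) -ᵥ x} (Equivalence.to (∈ₗ⇔ W∈ℬ) xS∈) displacement)))
        where
        module W = ComponentProperties W∈ℬ
        displacement : x · matrix (S i) -ᵥ x ∈ W
        displacement = X⊆W (S-displacement i x)
        difference : ∀ a b → (a -ᵥ v) -ᵥ (a -ᵥ b) ≡ b -ᵥ v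
        difference a b = trans (cong ((a -ᵥ v) +ᵥ_) (-[u-v] a b)) (trans (+ᵥ-comm (a -ᵥ v) (b -ᵥ a)) ([u-v]+[v-w] b a v))
      center (inj₁ (v , W , W∈ℬ)) X≐W (inj₂ (Z , _)) = mk⇔
        (λ Z≐W → ≐-trans (image-≐ {matrix (S i)} {Z} {W} Z≐W) image-W)
        (λ ZS≐W → ≐-trans (≐-sym (image-inverse (S i) Z)) (≐-trans
          (image-≐ {InvertibleMatrix.inverse (S i)} {image Z (matrix (S i))} {image W (matrix (S i))} (≐-trans ZS≐W (≐-sym image-W)))
          (image-inverse (S i) W)))
        where
        image-W : image W (matrix (S i)) ≐ W
        image-W = ≐-trans (image-≐ {matrix (S i)} {W} {⟨ e₁ ⟩} (≐-sym X≐W)) (≐-trans (image-X i) X≐W)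

    collineationSubgroup : CollineationSubgroup
    collineationSubgroup = record
      { Member    = λ φ → Lift (lsuc 0ℓ) (∃ λ i → ∀ v → to φ v ≡ v · matrix (S i))
      ; resp      = λ { φ≋ψ (lift (i , eq)) → lift (i , λ v → trans (sym (φ≋ψ v)) (eq v)) }
      ; ∙-closed  = λ { {φ} {ψ} (lift (i , eq)) (lift (j , eq′)) → lift (i ℕ.+ j , λ v → begin
          to ψ (to φ v)                         ≡⟨ eq′ (to φ v) ⟩
          to φ v · matrix (S j)                 ≡⟨ cong (_· matrix (S j)) (eq v) ⟩
          (v · matrix (S i)) · matrix (S j)     ≡⟨ sym (·-*ₘ v (matrix (S i)) (matrix (S j))) ⟩
          v · (matrix (S i) *ₘ matrix (S j))    ≡⟨ cong (v ·_) (S-+ i j) ⟩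
          v · matrix (S (i ℕ.+ j))              ∎) }
      ; ε-closed  = lift (0 , λ v → sym (trans (cong (v ·_) S-0) (·-1ₘ v)))
      ; ⁻¹-closed = λ { {φ} (lift (i , eq)) → lift (i ℕ.* (o ℕ.∸ 1) , λ v → let u = Affine.from φ v in begin
          u                                                       ≡⟨ sym (·-1ₘ u) ⟩
          u · 1ₘ                                                  ≡⟨ cong (u ·_) (sym (S-inverse i)) ⟩
          u · (matrix (S i) *ₘ matrix (S (i ℕ.* (o ℕ.∸ 1))))      ≡⟨ ·-*ₘ u (matrix (S i)) (matrix (S (i ℕ.* (o ℕ.∸ 1)))) ⟩
          (u · matrix (S i)) · matrix (S (i ℕ.* (o ℕ.∸ 1)))       ≡⟨ cong (_· matrix (S (i ℕ.* (o ℕ.∸ 1)))) (trans (sym (eq u)) (Affine.Collineation.strictlyInverseˡ φ v)) ⟩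
          v · matrix (S (i ℕ.* (o ℕ.∸ 1)))                        ∎) }
      }

    hasAxisAndCoaxis : HasAxisAndCoaxis collineationSubgroup axis coaxis
    hasAxisAndCoaxis φ (lift (i , eq)) φ≢id = inj₂ X , isHomology {φ} i eq φ≢id , ≐-refl

    private
      -- The exponent is read from the membership proof; `collineationLabel-cong` shows that c ^ i
      -- depends on the collineation alone.
      collineationLabel : Group.Carrier (toGroup collineationSubgroup) → Carrier
      collineationLabel (φ , lift (i , _)) = c ^ i

      collineationLabel-cong : ∀ x y → proj₁ x ≋ proj₁ y → collineationLabel x ≡ collineationLabel y
      collineationLabel-cong (φ , lift (i , eq)) (ψ , lift (j , eq′)) φ≋ψ = S-eigenvalue {i} {j}
        (matrix-ext {matrix (S i)} {matrix (S j)} λ v → trans (sym (eq v)) (trans (φ≋ψ v) (eq′ v)))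

      collineationLabel-injective : ∀ x y → collineationLabel x ≡ collineationLabel y → proj₁ x ≋ proj₁ y
      collineationLabel-injective (φ , lift (i , eq)) (ψ , lift (j , eq′)) c^i≡c^j v =
        trans (eq v) (trans (cong (v ·_) (S-cong {i} {j} c^i≡c^j)) (sym (eq′ v)))

      collineationLabel-∙ : ∀ x y → collineationLabel (Group._∙_ (toGroup collineationSubgroup) x y) ≡ collineationLabel x * collineationLabel y
      collineationLabel-∙ (φ , lift (i , _)) (ψ , lift (j , _)) = ^-homo-* c i j

      collineationLabel-exponent : ∀ x → ∃ λ i → collineationLabel x ≡ c ^ i
      collineationLabel-exponent (φ , lift (i , _)) = i , refl

      collineationElement : ∀ i → ∃ λ x → collineationLabel x ≡ c ^ i
      collineationElement i = (inducedCollineation {S i} (S-similar i) , lift (i , λ v → refl)) , refl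

      module CollineationLabels = Labelled (toGroup collineationSubgroup) {c} {o} c≢0 c-order collineationLabel
        collineationLabel-cong collineationLabel-injective refl collineationLabel-∙ collineationLabel-exponent collineationElement

    collineationSubgroup-cyclic : IsCyclic (toGroup collineationSubgroup)
    collineationSubgroup-cyclic = CollineationLabels.isCyclic

    collineationSubgroup-order : HasOrder (toGroup collineationSubgroup) o
    collineationSubgroup-order = CollineationLabels.hasOrder

    matrixSubgroup : Subgroup GL₂ (lsuc 0ℓ)
    matrixSubgroup = record
      { Member    = λ A → Lift (lsuc 0ℓ) (∃ λ i → matrix A ≡ matrix (S i))
      ; resp      = λ { A≡B (lift (i , eq)) → lift (i , trans (sym A≡B) eq) }
      ; ∙-closed  = λ { {A} {B} (lift (i , eq)) (lift (j , eq′)) → lift (i ℕ.+ j , trans (cong₂ _*ₘ_ eq eq′) (S-+ i j)) }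
      ; ε-closed  = lift (0 , sym S-0)
      ; ⁻¹-closed = λ { {A} (lift (i , eq)) → lift (i ℕ.* (o ℕ.∸ 1) , (let A⁻¹ = InvertibleMatrix.inverse A ; S′ = matrix (S (i ℕ.* (o ℕ.∸ 1))) in begin
          A⁻¹                                 ≡⟨ sym (*ₘ-identityʳ A⁻¹) ⟩
          A⁻¹ *ₘ 1ₘ                           ≡⟨ cong (A⁻¹ *ₘ_) (sym (S-inverse i)) ⟩
          A⁻¹ *ₘ (matrix (S i) *ₘ S′)         ≡⟨ cong (λ M → A⁻¹ *ₘ (M *ₘ S′)) (sym eq) ⟩
          A⁻¹ *ₘ (matrix A *ₘ S′)             ≡⟨ sym (*ₘ-assoc A⁻¹ (matrix A) S′) ⟩
          A⁻¹ *ₘ matrix A *ₘ S′               ≡⟨ cong (_*ₘ S′) (InvertibleMatrix.inverseˡ A) ⟩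
          1ₘ *ₘ S′                            ≡⟨ *ₘ-identityˡ S′ ⟩
          S′                                  ∎)) }
      }

    isLinearHomologyGroup : IsLinearAffineHomologyGroup (ℬ f) matrixSubgroup
    isLinearHomologyGroup A (lift (i , eq)) A≢1 = φ , (λ v → cong (v ·_) (sym eq)) , axis , inj₂ X ,
      isHomology {φ} i (λ v → refl) λ φ≋id → A≢1 (trans eq (matrix-ext {matrix (S i)} {1ₘ} λ v → trans (φ≋id v) (sym (·-1ₘ v))))
      where
      φ : Collineation
      φ = inducedCollineation {S i} (S-similar i)

    private
      matrixLabel : Group.Carrier (toGroup matrixSubgroup) → Carrier
      matrixLabel (A , lift (i , _)) = c ^ i

      matrixLabel-cong : ∀ x y → matrix (proj₁ x) ≡ matrix (proj₁ y) → matrixLabel x ≡ matrixLabel y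
      matrixLabel-cong (A , lift (i , eq)) (B , lift (j , eq′)) A≡B = S-eigenvalue {i} {j} (trans (sym eq) (trans A≡B eq′))

      matrixLabel-injective : ∀ x y → matrixLabel x ≡ matrixLabel y → matrix (proj₁ x) ≡ matrix (proj₁ y)
      matrixLabel-injective (A , lift (i , eq)) (B , lift (j , eq′)) c^i≡c^j = trans eq (trans (S-cong {i} {j} c^i≡c^j) (sym eq′))

      matrixLabel-∙ : ∀ x y → matrixLabel (Group._∙_ (toGroup matrixSubgroup) x y) ≡ matrixLabel x * matrixLabel y
      matrixLabel-∙ (A , lift (i , _)) (B , lift (j , _)) = ^-homo-* c i j

      matrixLabel-exponent : ∀ x → ∃ λ i → matrixLabel x ≡ c ^ i
      matrixLabel-exponent (A , lift (i , _)) = i , refl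

      matrixElement : ∀ i → ∃ λ x → matrixLabel x ≡ c ^ i
      matrixElement i = (S i , lift (i , refl)) , refl

      module MatrixLabels = Labelled (toGroup matrixSubgroup) {c} {o} c≢0 c-order matrixLabel
        matrixLabel-cong matrixLabel-injective refl matrixLabel-∙ matrixLabel-exponent matrixElement

    matrixSubgroup-cyclic : IsCyclic (toGroup matrixSubgroup)
    matrixSubgroup-cyclic = MatrixLabels.isCyclic

    matrixSubgroup-order : HasOrder (toGroup matrixSubgroup) o
    matrixSubgroup-order = MatrixLabels.hasOrder

  -- φ is multiplication by diag (a , 1) with a ≠ 1, moved to the base point v. An arbitrary center
  -- of the extension is compared with the direction of e₁; at this stage it may be an affine point.
  module Center (φ : Collineation) (ψ : Projective.Collineation) (extends : Extends ψ φ) {v : V} {A : InvertibleMatrix}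
    (φ-affine : ∀ x → to φ x ≡ (x -ᵥ v) · matrix A +ᵥ v)
    {e₁ e₂ : V} (independent : det e₁ e₂ ≢ 0#) (X∈ℬ : ⟨ e₁ ⟩ ∈ ℬ f) {a : Carrier} (a≢1 : a ≢ 1#)
    (e₁A : e₁ · matrix A ≡ a *ᵥ e₁) (e₂A : e₂ · matrix A ≡ e₂) where

    open Basis {e₁} {e₂} independent

    private
      a-1≢0 : a - 1# ≢ 0#
      a-1≢0 eq = a≢1 (x-y≡0⇒x≡y eq)

      displaced : ∀ {Z} → Z ∈ ℬ f → (a - 1#) *ᵥ e₁ ∈ Z → Z ≐ ⟨ e₁ ⟩
      displaced Z∈ℬ ∈Z = meet Z∈ℬ X∈ℬ (*ᵥ-≢0 {a - 1#} {e₁} a-1≢0 e₁≢0) ∈Z (a - 1# , refl)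

      preserved : ∀ {p Z} (Z∈ℬ : Z ∈ ℬ f) → Projective.MapsLine (Projective.to ψ) (inj₁ (p , Z , Z∈ℬ)) (inj₁ (p , Z , Z∈ℬ)) →
                  ∀ {x} → x -ᵥ p ∈ Z → to φ x -ᵥ p ∈ Z
      preserved {p} {Z} Z∈ℬ maps {x} x-p∈Z = Equivalence.to (∈ₗ⇔ Z∈ℬ) (on-resp {Projective.to ψ (inj₁ x)} {inj₁ (to φ x)} {inj₁ (p , Z , Z∈ℬ)}
        (extends x) (Equivalence.to (maps (inj₁ x)) (Equivalence.from (∈ₗ⇔ Z∈ℬ) x-p∈Z)))

    -- If p were a center, the line through p in the direction of the component Z of d = e₁ + e₂
    -- would be preserved. Then d A and d A - d = (a - 1) e₁ lie in Z, so Z is the line of e₁, which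
    -- does not contain d.
    notAffine : ∀ p → ¬ Projective.IsCenter ψ (inj₁ p)
    notAffine p center = go (componentOf {d} d≢0)
      where
      d : V
      d = e₁ +ᵥ e₂
      det-d : det e₁ d ≡ det e₁ e₂
      det-d = trans (det-+ʳ e₁ e₁ e₂) (trans (cong (_+ det e₁ e₂) (det-self e₁)) (+-identityˡ (det e₁ e₂)))
      d≢0 : d ≢ 0ᵥ
      d≢0 = det≢0⇒≢0ʳ {e₁} {d} (λ eq → independent (trans (sym det-d) eq))
      go : ¬ (∃ λ Z → Z ∈ ℬ f × d ∈ Z)
      go (Z , Z∈ℬ , d∈Z) = independent (trans (sym det-d) (∈⟨⟩⇒det≡0 {e₁} {d} (proj₁ (displaced Z∈ℬ shift∈Z) d∈Z)))
        where
        module Z = ComponentProperties Z∈ℬ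
        maps : Projective.MapsLine (Projective.to ψ) (inj₁ (p , Z , Z∈ℬ)) (inj₁ (p , Z , Z∈ℬ))
        maps = center (inj₁ (p , Z , Z∈ℬ)) (Equivalence.from (∈ₗ⇔ Z∈ℬ) (subst Z (sym (-ᵥ-inverseʳ p)) Z.0∈))
        φp-p : to φ p -ᵥ p ∈ Z
        φp-p = preserved {p} Z∈ℬ maps {p} (subst Z (sym (-ᵥ-inverseʳ p)) Z.0∈)
        φ[p+d]-p : to φ (p +ᵥ d) -ᵥ p ∈ Z
        φ[p+d]-p = preserved {p} Z∈ℬ maps {p +ᵥ d} (subst Z (sym ([u+v]-u p d)) d∈Z)
        dA : to φ (p +ᵥ d) -ᵥ to φ p ≡ d · matrix A
        dA = begin
          to φ (p +ᵥ d) -ᵥ to φ p                                                     ≡⟨ cong₂ _-ᵥ_ (φ-affine (p +ᵥ d)) (φ-affine p) ⟩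
          ((p +ᵥ d -ᵥ v) · matrix A +ᵥ v) -ᵥ ((p -ᵥ v) · matrix A +ᵥ v)               ≡⟨ cong₂ (λ s t → (s +ᵥ v) -ᵥ (t +ᵥ v)) (·-- (p +ᵥ d) v (matrix A)) (·-- p v (matrix A)) ⟩
          (((p +ᵥ d) · matrix A -ᵥ v · matrix A) +ᵥ v) -ᵥ ((p · matrix A -ᵥ v · matrix A) +ᵥ v)  ≡⟨ cong (λ s → ((s -ᵥ v · matrix A) +ᵥ v) -ᵥ ((p · matrix A -ᵥ v · matrix A) +ᵥ v)) (·-+ᵥ p d (matrix A)) ⟩
          (((p · matrix A +ᵥ d · matrix A) -ᵥ v · matrix A) +ᵥ v) -ᵥ ((p · matrix A -ᵥ v · matrix A) +ᵥ v)
            ≡⟨ cong₂ _,_ (cancel (proj₁ (p · matrix A)) (proj₁ (d · matrix A)) (proj₁ (v · matrix A)) (proj₁ v))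
                         (cancel (proj₂ (p · matrix A)) (proj₂ (d · matrix A)) (proj₂ (v · matrix A)) (proj₂ v)) ⟩
          d · matrix A                                                                ∎
          where
          cancel : ∀ p d w v → (((p + d) - w) + v) - ((p - w) + v) ≡ d
          cancel = solve 4 (λ p d w v → (((p :+ d) :- w) :+ v) :- ((p :- w) :+ v) := d) refl
        dA∈Z : d · matrix A ∈ Z
        dA∈Z = subst Z (trans ([u-w]-[v-w] (to φ (p +ᵥ d)) (to φ p) p) dA)
          (Z.∸-∈ {to φ (p +ᵥ d) -ᵥ p} {to φ p -ᵥ p} φ[p+d]-p φp-p)
        shift∈Z : (a - 1#) *ᵥ e₁ ∈ Z
        shift∈Z = subst Z (begin
          d · matrix A -ᵥ d                              ≡⟨ cong (_-ᵥ d) (·-+ᵥ e₁ e₂ (matrix A)) ⟩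
          (e₁ · matrix A +ᵥ e₂ · matrix A) -ᵥ d          ≡⟨ cong₂ (λ s t → (s +ᵥ t) -ᵥ d) e₁A e₂A ⟩
          (a *ᵥ e₁ +ᵥ e₂) -ᵥ (e₁ +ᵥ e₂)                  ≡⟨ cong₂ _,_ (collect (proj₁ e₁) (proj₁ e₂)) (collect (proj₂ e₁) (proj₂ e₂)) ⟩
          (a - 1#) *ᵥ e₁                                 ∎) (Z.∸-∈ {d · matrix A} {d} dA∈Z d∈Z)
          where
          collect : ∀ x y → (a * x + y) - (x + y) ≡ (a - 1#) * x
          collect = solve 3 (λ a x y → (a :* x :+ y) :- (x :+ y) := (a :- con (ℤ.+ 1)) :* x) refl a

    -- For a center C at infinity, the line through v + e₁ in the direction C is preserved; its
    -- point v + e₁ is displaced by (a - 1) e₁, which must lie in C.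
    center≈X : ∀ c → Projective.IsCenter ψ c → c ≈ₚ inj₂ (⟨ e₁ ⟩ , X∈ℬ)
    center≈X (inj₁ p) center = contradiction center (notAffine p)
    center≈X (inj₂ (C , C∈ℬ)) center = inj₂ (displaced C∈ℬ (subst C shift
        (preserved {p} C∈ℬ (center (inj₁ (p , C , C∈ℬ)) ≐-refl) {p} (subst C (sym (-ᵥ-inverseʳ p)) (ComponentProperties.0∈ C∈ℬ)))))
      where
      p : V
      p = v +ᵥ e₁
      shift : to φ p -ᵥ p ≡ (a - 1#) *ᵥ e₁
      shift = begin
        to φ p -ᵥ p                                          ≡⟨ cong (_-ᵥ p) (φ-affine p) ⟩
        (((v +ᵥ e₁) -ᵥ v) · matrix A +ᵥ v) -ᵥ (v +ᵥ e₁)      ≡⟨ cong (λ u → (u · matrix A +ᵥ v) -ᵥ (v +ᵥ e₁)) ([u+v]-u v e₁) ⟩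
        (e₁ · matrix A +ᵥ v) -ᵥ (v +ᵥ e₁)                    ≡⟨ cong (λ u → (u +ᵥ v) -ᵥ (v +ᵥ e₁)) e₁A ⟩
        (a *ᵥ e₁ +ᵥ v) -ᵥ (v +ᵥ e₁)                          ≡⟨ cong₂ _,_ (collect (proj₁ e₁) (proj₁ v)) (collect (proj₂ e₁) (proj₂ v)) ⟩
        (a - 1#) *ᵥ e₁                                       ∎
        where
        collect : ∀ x y → (a * x + y) - (y + x) ≡ (a - 1#) * x
        collect = solve 3 (λ a x y → (a :* x :+ y) :- (y :+ x) := (a :- con (ℤ.+ 1)) :* x) refl a

  -- Being central is a condition on the extension ψ, whereas recentring needs φ itself to be
  -- different from the identity. The point at infinity Z lies on the line Z through 0, whose image
  -- contains every affine point of Z and so has direction Z; an affine image is excluded because ψ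
  -- is injective and fixes affine points.
  extends-identity : ∀ {ψ φ} → Extends ψ φ → φ ≋ identity → ψ Projective.≋ Projective.identity
  extends-identity {ψ} {φ} extends φ≋id = fixes
    where
    fixes-affine : ∀ x → Projective.to ψ (inj₁ x) ≈ₚ inj₁ x
    fixes-affine x = ≈ₚ-trans {Projective.to ψ (inj₁ x)} {inj₁ (to φ x)} {inj₁ x} (extends x) (inj₁ (φ≋id x))
    fixes : ∀ x → Projective.to ψ x ≈ₚ x
    fixes (inj₁ x) = fixes-affine x
    fixes (inj₂ (Z , Z∈ℬ)) = image-line (Projective.Collineation.to-line ψ (inj₁ (0ᵥ , Z , Z∈ℬ)))
      where
      module Z = ComponentProperties Z∈ℬ
      direction : ∀ {v W} (W∈ℬ : W ∈ ℬ f) → Projective.MapsLine (Projective.to ψ) (inj₁ (0ᵥ , Z , Z∈ℬ)) (inj₁ (v , W , W∈ℬ)) → Z ≐ W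
      direction {v} {W} W∈ℬ maps = meet {v = Z.point 1#} Z∈ℬ W∈ℬ (Z.point-≢0 1≢0) (Z.sound 1#)
        (subst W (trans ([u-w]-[v-w] (Z.point 1#) 0ᵥ v) (-ᵥ0ᵥ (Z.point 1#)))
          (ComponentProperties.∸-∈ W∈ℬ {Z.point 1# -ᵥ v} {0ᵥ -ᵥ v} (member {Z.point 1#} (Z.sound 1#)) (member {0ᵥ} Z.0∈)))
        where
        member : ∀ {z} → z ∈ Z → z -ᵥ v ∈ W
        member {z} z∈Z = Equivalence.to (∈ₗ⇔ W∈ℬ) (on-resp {Projective.to ψ (inj₁ z)} {inj₁ z} {inj₁ (v , W , W∈ℬ)} (fixes-affine z)
          (Equivalence.to (maps (inj₁ z)) (Equivalence.from (∈ₗ⇔ Z∈ℬ) (subst Z (sym (-ᵥ0ᵥ z)) z∈Z))))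
      image-line : (∃ λ m → Projective.MapsLine (Projective.to ψ) (inj₁ (0ᵥ , Z , Z∈ℬ)) m) → Projective.to ψ (inj₂ (Z , Z∈ℬ)) ≈ₚ inj₂ (Z , Z∈ℬ)
      image-line (inj₂ ∞ , maps) = ⊥-elim (on-resp {Projective.to ψ (inj₁ 0ᵥ)} {inj₁ 0ᵥ} {inj₂ ∞} (fixes-affine 0ᵥ)
        (Equivalence.to (maps (inj₁ 0ᵥ)) (Equivalence.from (∈ₗ⇔ Z∈ℬ) (subst Z (sym (-ᵥ0ᵥ 0ᵥ)) Z.0∈))))
      image-line (inj₁ (v , W , W∈ℬ) , maps) = image-point (Projective.to ψ (inj₂ (Z , Z∈ℬ))) (λ h → h) (Equivalence.to (maps (inj₂ (Z , Z∈ℬ))) ≐-refl)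
        where
        image-point : ∀ y → (∀ {z} → z ≈ₚ y → z ≈ₚ Projective.to ψ (inj₂ (Z , Z∈ℬ))) → y on inj₁ (v , W , W∈ℬ) → y ≈ₚ inj₂ (Z , Z∈ℬ)
        image-point (inj₂ (Z′ , _)) _ Z′≐W = inj₂ (≐-trans Z′≐W (≐-sym (direction W∈ℬ maps)))
        image-point (inj₁ x) same _ = ⊥-elim (absurd (≈ₚ-trans {inj₁ x} {Projective.from ψ (Projective.to ψ (inj₁ x))} {inj₂ (Z , Z∈ℬ)}
          (≈ₚ-sym {Projective.from ψ (Projective.to ψ (inj₁ x))} {inj₁ x} (Projective.Collineation.strictlyInverseʳ ψ (inj₁ x)))
          (≈ₚ-trans {Projective.from ψ (Projective.to ψ (inj₁ x))} {Projective.from ψ (Projective.to ψ (inj₂ (Z , Z∈ℬ)))} {inj₂ (Z , Z∈ℬ)}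
            (Projective.Collineation.from-cong ψ {Projective.to ψ (inj₁ x)} {Projective.to ψ (inj₂ (Z , Z∈ℬ))} (same {Projective.to ψ (inj₁ x)} (fixes-affine x)))
            (Projective.Collineation.strictlyInverseʳ ψ (inj₂ (Z , Z∈ℬ))))))
          where
          absurd : ¬ (inj₁ x ≈ₚ inj₂ (Z , Z∈ℬ))
          absurd ()

  -- Stabilizers isomorphic to the multiplicative group of a field

  module _ {t : ℕ} (E : FiniteField (q ℕ.^ t)) (f∈𝒮 : f ∈ 𝒮) (G≅Eˣ : toGroup (G f) ≅ (E ˣ)) where

    private
      module iso = IsGroupIsomorphism (proj₂ G≅Eˣ)
      module E = FieldProperties E

      orderG : HasOrder (toGroup (G f)) (q ℕ.^ t ℕ.∸ 1)
      orderG = record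
        { to        = λ A → U.to (proj₁ G≅Eˣ A)
        ; from      = λ i → proj₁ (iso.surjective (U.from i))
        ; to-cong   = λ {A} {B} eq → U.to-cong {proj₁ G≅Eˣ A} {proj₁ G≅Eˣ B} (iso.⟦⟧-cong {A} {B} eq)
        ; from-cong = λ { refl → refl }
        ; inverse   = (λ {i} {A} eq → trans (U.to-cong {proj₁ G≅Eˣ A} {U.from i} (proj₂ (iso.surjective (U.from i)) {A} eq)) (U.strictlyInverseˡ i))
                    , (λ { {A} refl → iso.injective {proj₁ (iso.surjective (U.from (U.to (proj₁ G≅Eˣ A))))} {A}
                        (trans (proj₂ (iso.surjective (U.from (U.to (proj₁ G≅Eˣ A)))) refl) (U.strictlyInverseʳ (proj₁ G≅Eˣ A))) })
        }
        where module U = Inverse E.units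

      commute : ∀ {A B} → A ∈ Member (G f) → B ∈ Member (G f) → matrix A *ₘ matrix B ≡ matrix B *ₘ matrix A
      commute {A} {B} A∈G B∈G = iso.injective {𝒜 ∙ 𝒷} {𝒷 ∙ 𝒜} (trans (iso.∙-homo 𝒜 𝒷)
          (trans (E.*-comm (proj₁ (proj₁ G≅Eˣ 𝒜)) (proj₁ (proj₁ G≅Eˣ 𝒷))) (sym (iso.∙-homo 𝒷 𝒜))))
        where
        open Group (toGroup (G f)) using (_∙_)
        𝒜 𝒷 : Group.Carrier (toGroup (G f))
        𝒜 = A , A∈G
        𝒷 = B , B∈G

      nonscalar : ∃ λ (A : InvertibleMatrix) → A ∈ Member (G f) × ∀ k → matrix A ≢ scalar k
      nonscalar = let _ , _ , ord , q-1<m = f∈𝒮 in nonscalarElement ord q-1<m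

      A : InvertibleMatrix
      A = proj₁ nonscalar

      A∈G : A ∈ Member (G f)
      A∈G = proj₁ (proj₂ nonscalar)

      A-nonscalar : ∀ k → matrix A ≢ scalar k
      A-nonscalar = proj₂ (proj₂ nonscalar)

      abstract
        basis : Eigenbasis {A} A∈G
        basis = eigenbasis {A} A∈G A-nonscalar

      open Eigenbasis basis
      open Basis {e₁} {e₂} independent

      -- An eigenline in L_f would contain a nonzero point of U, which would then be an eigenvector
      -- and make A a scalar.
      eigenline∈ℬ : ∀ {e k} → e ≢ 0ᵥ → e · matrix A ≡ k *ᵥ e → ⟨ e ⟩ ∈ ℬ f
      eigenline∈ℬ {e} {k} e≢0 eA = go (cover e≢0)
        where
        go : (∃₂ λ h x → h ≢ 0# × x ≢ 0# × e ≡ h *ᵥ γ x) ⊎ ⟨ e ⟩ ∈ ℬ f → ⟨ e ⟩ ∈ ℬ f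
        go (inj₂ ∈ℬ) = ∈ℬ
        go (inj₁ (h , x , h≢0 , x≢0 , e≡)) = let a , _ , eq = eigenpoint⇒scalar {A} {k} {x} A∈G x≢0 γxA in
            contradiction eq (A-nonscalar ⟦ a ⟧)
          where
          γxA : γ x · matrix A ≡ k *ᵥ γ x
          γxA = *ᵥ-cancelˡ {h} {γ x · matrix A} {k *ᵥ γ x} h≢0 (begin
            h *ᵥ (γ x · matrix A)     ≡⟨ sym (·-*ᵥ h (γ x) (matrix A)) ⟩
            (h *ᵥ γ x) · matrix A     ≡⟨ cong (_· matrix A) (sym e≡) ⟩
            e · matrix A              ≡⟨ eA ⟩
            k *ᵥ e                    ≡⟨ cong (k *ᵥ_) e≡ ⟩
            k *ᵥ h *ᵥ γ x             ≡⟨ *ᵥ-comm k h (γ x) ⟩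
            h *ᵥ k *ᵥ γ x             ∎)

      X∈ℬ : ⟨ e₁ ⟩ ∈ ℬ f
      X∈ℬ = eigenline∈ℬ {e₁} {λ₁} e₁≢0 e₁-eigen

      Y∈ℬ : ⟨ e₂ ⟩ ∈ ℬ f
      Y∈ℬ = eigenline∈ℬ {e₂} {λ₂} e₂≢0 e₂-eigen

      -- B commutes with A, hence preserves the eigenspaces of A.
      eigenvectors : ∀ B → B ∈ Member (G f) → ∃₂ λ a b → e₁ · matrix B ≡ a *ᵥ e₁ × e₂ · matrix B ≡ b *ᵥ e₂
      eigenvectors B B∈G = preserve (coordinates (e₁ · matrix B)) (coordinates (e₂ · matrix B))
        where
        eigenspace : ∀ {e k} → e · matrix A ≡ k *ᵥ e → ∀ x y → e · matrix B ≡ x e₁+ y e₂ →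
                     (x * λ₁) e₁+ (y * λ₂) e₂ ≡ (k * x) e₁+ (k * y) e₂
        eigenspace {e} {k} eA x y eB = begin
          (x * λ₁) *ᵥ e₁ +ᵥ (y * λ₂) *ᵥ e₂                   ≡⟨ cong₂ _+ᵥ_ (*ᵥ-assoc x λ₁ e₁) (*ᵥ-assoc y λ₂ e₂) ⟩
          x *ᵥ λ₁ *ᵥ e₁ +ᵥ y *ᵥ λ₂ *ᵥ e₂                     ≡⟨ sym (cong₂ (λ u v → x *ᵥ u +ᵥ y *ᵥ v) e₁-eigen e₂-eigen) ⟩
          x *ᵥ (e₁ · matrix A) +ᵥ y *ᵥ (e₂ · matrix A)       ≡⟨ sym (cong₂ _+ᵥ_ (·-*ᵥ x e₁ (matrix A)) (·-*ᵥ y e₂ (matrix A))) ⟩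
          (x *ᵥ e₁) · matrix A +ᵥ (y *ᵥ e₂) · matrix A       ≡⟨ sym (·-+ᵥ (x *ᵥ e₁) (y *ᵥ e₂) (matrix A)) ⟩
          (x e₁+ y e₂) · matrix A                            ≡⟨ cong (_· matrix A) (sym eB) ⟩
          (e · matrix B) · matrix A                          ≡⟨ sym (·-*ₘ e (matrix B) (matrix A)) ⟩
          e · (matrix B *ₘ matrix A)                         ≡⟨ cong (e ·_) (commute {B} {A} B∈G A∈G) ⟩
          e · (matrix A *ₘ matrix B)                         ≡⟨ ·-*ₘ e (matrix A) (matrix B) ⟩
          (e · matrix A) · matrix B                          ≡⟨ cong (_· matrix B) eA ⟩
          (k *ᵥ e) · matrix B                                ≡⟨ ·-*ᵥ k e (matrix B) ⟩
          k *ᵥ (e · matrix B)                                ≡⟨ cong (k *ᵥ_) eB ⟩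
          k *ᵥ (x e₁+ y e₂)                                  ≡⟨ *-combination k x y ⟩
          (k * x) e₁+ (k * y) e₂                             ∎
        vanishes : ∀ {z k l} → k ≢ l → z * k ≡ l * z → z ≡ 0#
        vanishes {z} {k} {l} k≢l eq = zero-product {k - l} {z} (trans (solve 3 (λ k l z → (k :- l) :* z := z :* k :- l :* z) refl k l z)
          (x≡y⇒x-y≡0 eq)) (λ k-l≡0 → k≢l (x-y≡0⇒x≡y k-l≡0))
        preserve : (∃₂ λ x y → e₁ · matrix B ≡ x e₁+ y e₂) → (∃₂ λ x y → e₂ · matrix B ≡ x e₁+ y e₂) →
                   ∃₂ λ a b → e₁ · matrix B ≡ a *ᵥ e₁ × e₂ · matrix B ≡ b *ᵥ e₂
        preserve (x , y , e₁B) (x′ , y′ , e₂B) = x , y′ ,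
          trans e₁B (trans (cong (λ z → x e₁+ z e₂) y≡0) (trans (cong (x *ᵥ e₁ +ᵥ_) (0*ᵥ e₂)) (+ᵥ-identityʳ (x *ᵥ e₁)))) ,
          trans e₂B (trans (cong (λ z → z e₁+ y′ e₂) x′≡0) (trans (cong (_+ᵥ y′ *ᵥ e₂) (0*ᵥ e₁)) (+ᵥ-identityˡ (y′ *ᵥ e₂))))
          where
          y≡0 : y ≡ 0#
          y≡0 = vanishes {y} {λ₂} {λ₁} (λ eq → λ₁≢λ₂ (sym eq))
            (unique₂ {x * λ₁} {y * λ₂} {λ₁ * x} {λ₁ * y} (eigenspace {e₁} {λ₁} e₁-eigen x y e₁B))
          x′≡0 : x′ ≡ 0#
          x′≡0 = vanishes {x′} {λ₁} {λ₂} λ₁≢λ₂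
            (unique₁ {x′ * λ₁} {y′ * λ₂} {λ₂ * x′} {λ₂ * y′} (eigenspace {e₂} {λ₂} e₂-eigen x′ y′ e₂B))

      open DiagonalStabilizer {e₁} {e₂} independent {q ℕ.^ t ℕ.∸ 1} orderG eigenvectors

      homology₁-e₁ : ∀ i → e₁ · diagonal (c ^ i) 1# ≡ c ^ i *ᵥ e₁
      homology₁-e₁ i = e₁-diagonal (c ^ i) 1#

      homology₁-e₂ : ∀ i → e₂ · diagonal (c ^ i) 1# ≡ e₂
      homology₁-e₂ i = trans (e₂-diagonal (c ^ i) 1#) (1*ᵥ e₂)

      homology₂-e₂ : ∀ i → e₂ · diagonal 1# (c ^ i) ≡ c ^ i *ᵥ e₂
      homology₂-e₂ i = e₂-diagonal 1# (c ^ i)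

      homology₂-e₁ : ∀ i → e₁ · diagonal 1# (c ^ i) ≡ e₁
      homology₂-e₁ i = trans (e₁-diagonal 1# (c ^ i)) (1*ᵥ e₁)

      module H₁ = HomologyGroup {e₁} {e₂} independent X∈ℬ Y∈ℬ {c} {o} c≢0 c-order
        homology₁ homology₁-e₁ homology₁-e₂ homology₁-similar

      module H₂ = HomologyGroup {e₂} {e₁} (det-swap-≢0 {e₁} {e₂} independent) Y∈ℬ X∈ℬ {c} {o} c≢0 c-order
        homology₂ homology₂-e₂ homology₂-e₁ homology₂-similar

      o≡ : o ≡ homologyOrder q t 3<q
      o≡ = order≡homologyOrder {t} refl

      X Y : Component
      X = ⟨ e₁ ⟩ , X∈ℬ
      Y = ⟨ e₂ ⟩ , Y∈ℬ

      similar⇒eigenvectors : ∀ {B} → Similar B → ∃₂ λ a b → e₁ · matrix B ≡ a *ᵥ e₁ × e₂ · matrix B ≡ b *ᵥ e₂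
      similar⇒eigenvectors {B} similar@(h , h≢0 , _) =
        let a , b , eq₁ , eq₂ = eigenvectors (B GL.∙ scalarGL (h ⁻¹) (⁻¹-≢0 h≢0)) (similar⇒scaled-stabilizer {B} similar)
        in h * a , h * b , unscale {B} {h} h≢0 {e₁} {a} eq₁ , unscale {B} {h} h≢0 {e₂} {b} eq₂

      -- Recentred, φ becomes a similarity diag (a , b) in the eigenbasis that fixes the nonzero
      -- vector `w₀` of its axis. If a = b = 1 it would be the identity; if a and b both differ from
      -- 1, `w₀` would be zero. So exactly one entry differs from 1: its eigenline is the center and
      -- the other one gives the direction of the axis. No distinction between elations and
      -- homologies is made yet.
      axis-center : ∀ {φ v W} (W∈ℬ : W ∈ ℬ f) (ψ : Projective.Collineation) → Extends ψ φ → Projective.IsCentral ψ (inj₁ (v , W , W∈ℬ)) →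
                    ∀ c → Projective.IsCenter ψ c → (c ≈ₚ inj₂ X × W ≐ ⟨ e₂ ⟩) ⊎ (c ≈ₚ inj₂ Y × W ≐ ⟨ e₁ ⟩)
      axis-center {φ} {v} {W} W∈ℬ ψ extends (ψ≢id , fixesAxis) c center = analyse recentered-induced
        where
        φ≢id : ¬ φ ≋ identity
        φ≢id φ≋id = ψ≢id (extends-identity {ψ} {φ} extends φ≋id)
        open Recentered φ {v} {W} W∈ℬ φ≢id (central⇒fixed {φ} {v , W , W∈ℬ} (ψ , extends , ψ≢id , fixesAxis))
        module W = ComponentProperties W∈ℬ
        w₀ : V
        w₀ = W.point 1#
        w₀≢0 : w₀ ≢ 0ᵥ
        w₀≢0 = W.point-≢0 1≢0
        Result : Set₁
        Result = (c ≈ₚ inj₂ X × W ≐ ⟨ e₂ ⟩) ⊎ (c ≈ₚ inj₂ Y × W ≐ ⟨ e₁ ⟩)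
        analyse : (∃ λ B → Induces (ℬ f) B recentered) → Result
        analyse (B , induces) = diagonalise (similar⇒eigenvectors {B} (induced⇒similar {B} {recentered} induces))
          where
          φ-affine : ∀ x → to φ x ≡ (x -ᵥ v) · matrix B +ᵥ v
          φ-affine x = trans (recenter x) (cong (_+ᵥ v) (induces (x -ᵥ v)))
          diagonalise : (∃₂ λ a b → e₁ · matrix B ≡ a *ᵥ e₁ × e₂ · matrix B ≡ b *ᵥ e₂) → Result
          diagonalise (a , b , e₁B , e₂B) = locate (coordinates w₀) (a ≟ 1#) (b ≟ 1#)
            where
            w₀B : w₀ · matrix B ≡ w₀
            w₀B = trans (sym (induces w₀)) (recentered-fixed {w₀} (W.sound 1#))
            combination : ∀ x y → (x e₁+ y e₂) · matrix B ≡ (x * a) e₁+ (y * b) e₂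
            combination x y = begin
              (x *ᵥ e₁ +ᵥ y *ᵥ e₂) · matrix B                  ≡⟨ ·-+ᵥ (x *ᵥ e₁) (y *ᵥ e₂) (matrix B) ⟩
              (x *ᵥ e₁) · matrix B +ᵥ (y *ᵥ e₂) · matrix B     ≡⟨ cong₂ _+ᵥ_ (·-*ᵥ x e₁ (matrix B)) (·-*ᵥ y e₂ (matrix B)) ⟩
              x *ᵥ (e₁ · matrix B) +ᵥ y *ᵥ (e₂ · matrix B)     ≡⟨ cong₂ (λ s t → x *ᵥ s +ᵥ y *ᵥ t) e₁B e₂B ⟩
              x *ᵥ a *ᵥ e₁ +ᵥ y *ᵥ b *ᵥ e₂                     ≡⟨ sym (cong₂ _+ᵥ_ (*ᵥ-assoc x a e₁) (*ᵥ-assoc y b e₂)) ⟩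
              (x * a) e₁+ (y * b) e₂                           ∎
            unfixed : ∀ {z k} → k ≢ 1# → z * k ≡ z → z ≡ 0#
            unfixed {z} {k} k≢1 eq = zero-product {k - 1#} {z} (trans (solve 2 (λ k z → (k :- con (ℤ.+ 1)) :* z := z :* k :- z) refl k z)
              (x≡y⇒x-y≡0 eq)) (λ k-1≡0 → k≢1 (x-y≡0⇒x≡y k-1≡0))
            locate : (∃₂ λ x y → w₀ ≡ x e₁+ y e₂) → Dec (a ≡ 1#) → Dec (b ≡ 1#) → Result
            locate (x , y , w₀≡) = cases
              where
              fixed-coordinates : (x * a) e₁+ (y * b) e₂ ≡ x e₁+ y e₂
              fixed-coordinates = trans (sym (combination x y)) (trans (cong (_· matrix B) (sym w₀≡)) (trans w₀B w₀≡))
              xa≡x : x * a ≡ x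
              xa≡x = unique₁ {x * a} {y * b} {x} {y} fixed-coordinates
              yb≡y : y * b ≡ y
              yb≡y = unique₂ {x * a} {y * b} {x} {y} fixed-coordinates
              on-Y : a ≢ 1# → w₀ ∈ ⟨ e₂ ⟩
              on-Y a≢1 = y , trans w₀≡ (trans (cong (λ z → z e₁+ y e₂) (unfixed {x} {a} a≢1 xa≡x))
                (trans (cong (_+ᵥ y *ᵥ e₂) (0*ᵥ e₁)) (+ᵥ-identityˡ (y *ᵥ e₂))))
              on-X : b ≢ 1# → w₀ ∈ ⟨ e₁ ⟩
              on-X b≢1 = x , trans w₀≡ (trans (cong (λ z → x e₁+ z e₂) (unfixed {y} {b} b≢1 yb≡y))
                (trans (cong (x *ᵥ e₁ +ᵥ_) (0*ᵥ e₂)) (+ᵥ-identityʳ (x *ᵥ e₁))))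
              cases : Dec (a ≡ 1#) → Dec (b ≡ 1#) → Result
              cases (yes a≡1) (yes b≡1) = contradiction (λ u → trans (induces u) (trans (cong (u ·_) B≡1) (·-1ₘ u))) recentered≢id
                where
                B≡1 : matrix B ≡ 1ₘ
                B≡1 = matrix-ext-basis {e₁} {e₂} independent {matrix B} {1ₘ}
                  (trans e₁B (trans (cong (_*ᵥ e₁) a≡1) (trans (1*ᵥ e₁) (sym (·-1ₘ e₁)))))
                  (trans e₂B (trans (cong (_*ᵥ e₂) b≡1) (trans (1*ᵥ e₂) (sym (·-1ₘ e₂)))))
              cases (no a≢1) (no b≢1) = contradiction (trans w₀≡ (trans (cong₂ _e₁+_e₂ (unfixed {x} {a} a≢1 xa≡x) (unfixed {y} {b} b≢1 yb≡y)) 0e₁+0e₂)) w₀≢0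
              cases (no a≢1) (yes b≡1) = inj₁ (
                Center.center≈X φ ψ extends {v} {B} φ-affine {e₁} {e₂} independent X∈ℬ {a} a≢1 e₁B
                  (trans e₂B (trans (cong (_*ᵥ e₂) b≡1) (1*ᵥ e₂))) c center ,
                meet W∈ℬ Y∈ℬ w₀≢0 (W.sound 1#) (on-Y a≢1))
              cases (yes a≡1) (no b≢1) = inj₂ (
                Center.center≈X φ ψ extends {v} {B} φ-affine {e₂} {e₁} (det-swap-≢0 {e₁} {e₂} independent) Y∈ℬ {b} b≢1 e₂B
                  (trans e₁B (trans (cong (_*ᵥ e₁) a≡1) (1*ᵥ e₁))) c center ,
                meet W∈ℬ X∈ℬ w₀≢0 (W.sound 1#) (on-X b≢1))

      -- Center and axis direction are always the two different eigenlines, so the center is never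
      -- on the axis.
      noElation : ∀ φ axis c → ¬ IsAffineElation φ axis c
      noElation φ (v , W , W∈ℬ) c (ψ , extends , central , center , c∈axis) = go (axis-center {φ} {v} {W} W∈ℬ ψ extends central c center)
        where
        go : ¬ ((c ≈ₚ inj₂ X × W ≐ ⟨ e₂ ⟩) ⊎ (c ≈ₚ inj₂ Y × W ≐ ⟨ e₁ ⟩))
        go (inj₁ (c≈X , W≐Y)) = H₁.X≢Y (≐-trans (on-resp {c} {inj₂ X} {inj₁ (v , W , W∈ℬ)} c≈X c∈axis) W≐Y)
        go (inj₂ (c≈Y , W≐X)) = H₂.X≢Y (≐-trans (on-resp {c} {inj₂ Y} {inj₁ (v , W , W∈ℬ)} c≈Y c∈axis) W≐X)

      homologyCenter : ∀ φ axis c → IsAffineHomology φ axis c → (c ≈ₚ inj₂ X) ⊎ (c ≈ₚ inj₂ Y)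
      homologyCenter φ (v , W , W∈ℬ) c (ψ , extends , central , center , _) = go (axis-center {φ} {v} {W} W∈ℬ ψ extends central c center)
        where
        go : (c ≈ₚ inj₂ X × W ≐ ⟨ e₂ ⟩) ⊎ (c ≈ₚ inj₂ Y × W ≐ ⟨ e₁ ⟩) → (c ≈ₚ inj₂ X) ⊎ (c ≈ₚ inj₂ Y)
        go (inj₁ (c≈X , _)) = inj₁ c≈X
        go (inj₂ (c≈Y , _)) = inj₂ c≈Y

      directProduct : IsInternalDirectProduct (linearCollineations (ℬ f)) kernelHomologies H₁.matrixSubgroup
      directProduct = record
        { A⊆P     = λ {B} → kernel⊆linear {B}
        ; B⊆P     = λ { {B} (lift (i , eq)) → inducedCollineation {homology₁ i} (homology₁-similar i) , λ v → cong (v ·_) (sym eq) }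
        ; commute = λ { {B} {C} (k , _ , B≡k) _ → matrix-ext λ v → begin
            v · (matrix B *ₘ matrix C)     ≡⟨ cong (λ M → v · (M *ₘ matrix C)) B≡k ⟩
            v · (scalar k *ₘ matrix C)     ≡⟨ ·-*ₘ v (scalar k) (matrix C) ⟩
            (v · scalar k) · matrix C      ≡⟨ cong (_· matrix C) (·-scalar v k) ⟩
            (k *ᵥ v) · matrix C            ≡⟨ ·-*ᵥ k v (matrix C) ⟩
            k *ᵥ (v · matrix C)            ≡⟨ sym (·-scalar (v · matrix C) k) ⟩
            (v · matrix C) · scalar k      ≡⟨ sym (·-*ₘ v (matrix C) (scalar k)) ⟩
            v · (matrix C *ₘ scalar k)     ≡⟨ cong (λ M → v · (matrix C *ₘ M)) (sym B≡k) ⟩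
            v · (matrix C *ₘ matrix B)     ∎ }
        ; trivial = λ { {B} (k , _ , B≡k) (lift (i , B≡S)) → trans B≡k (cong scalar (*ᵥ-cancelʳ {k} {1#} {e₂} e₂≢0 (begin
            k *ᵥ e₂                        ≡⟨ sym (·-scalar e₂ k) ⟩
            e₂ · scalar k                  ≡⟨ cong (e₂ ·_) (trans (sym B≡k) B≡S) ⟩
            e₂ · diagonal (c ^ i) 1#       ≡⟨ e₂-diagonal (c ^ i) 1# ⟩
            1# *ᵥ e₂                       ∎))) }
        ; product = λ { {B} (φ , induces) → factor {B} (induced⇒similar {B} {φ} induces) }
        }
        where
        -- B is h Q with Q = diag (r b , b) in G_f, which splits as the scalar h b times diag (r ,
        -- 1), and r is a power of c.
        factor : ∀ {B} → Similar B → ∃₂ λ C D → C ∈ Member kernelHomologies × D ∈ Member H₁.matrixSubgroup × matrix B ≡ matrix C *ₘ matrix D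
        factor {B} similar@(h , h≢0 , _) = go (ratio {Q} Q∈G)
          where
          Q : InvertibleMatrix
          Q = B GL.∙ scalarGL (h ⁻¹) (⁻¹-≢0 h≢0)
          Q∈G : Q ∈ Member (G f)
          Q∈G = similar⇒scaled-stabilizer {B} similar
          go : (∃₂ λ r b → b ≢ 0# × matrix Q ≡ diagonal (r * b) b) →
               ∃₂ λ C D → C ∈ Member kernelHomologies × D ∈ Member H₁.matrixSubgroup × matrix B ≡ matrix C *ₘ matrix D
          go (r , b , b≢0 , Q≡) = let i , r≡c^i = ratio-power {Q} {r} {b} Q∈G b≢0 Q≡ in
            scalarGL (h * b) (*-≢0 h≢0 b≢0) , homology₁ (toℕ i) , (h * b , *-≢0 h≢0 b≢0 , refl) , lift (toℕ i , refl) , (begin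
              matrix B                                                ≡⟨ diagonal-unique
                (unscale {B} {h} h≢0 {e₁} {r * b} (trans (cong (e₁ ·_) Q≡) (e₁-diagonal (r * b) b)))
                (unscale {B} {h} h≢0 {e₂} {b} (trans (cong (e₂ ·_) Q≡) (e₂-diagonal (r * b) b))) ⟩
              diagonal (h * (r * b)) (h * b)                          ≡⟨ cong₂ diagonal
                (trans (cong (λ z → h * (z * b)) r≡c^i) (solve 3 (λ h r b → h :* (r :* b) := h :* b :* r) refl h (c ^ toℕ i) b))
                (sym (*-identityʳ (h * b))) ⟩
              diagonal (h * b * c ^ toℕ i) (h * b * 1#)               ≡⟨ sym (diagonal-* (h * b) (h * b) (c ^ toℕ i) 1#) ⟩
              diagonal (h * b) (h * b) *ₘ diagonal (c ^ toℕ i) 1#     ≡⟨ cong (_*ₘ diagonal (c ^ toℕ i) 1#) (sym (scalar-diagonal (h * b))) ⟩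
              scalar (h * b) *ₘ diagonal (c ^ toℕ i) 1#               ∎)

    partTwo : let k = homologyOrder q t 3<q in
          (∃₂ λ H₁ H₂ →
              AreSymmetricAffineHomologyGroups H₁ H₂
            × (IsCyclic (toGroup H₁) × HasOrder (toGroup H₁) k)
            × (IsCyclic (toGroup H₂) × HasOrder (toGroup H₂) k))
        × (∀ φ axis c → ¬ IsAffineElation φ axis c)
        × (∃₂ λ X Y →
              ¬ (proj₁ X ≐ proj₁ Y)
            × (∀ φ axis c → IsAffineHomology φ axis c → (c ≈ₚ inj₂ X) ⊎ (c ≈ₚ inj₂ Y))
            × proj₁ X ∈ desarguesianSpread
            × proj₁ Y ∈ desarguesianSpread)
        × HasOrder (toGroup kernelHomologies) (q ℕ.^ n ℕ.∸ 1)
        × (∃ λ H →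
              IsLinearAffineHomologyGroup (ℬ f) H
            × IsCyclic (toGroup H)
            × HasOrder (toGroup H) k
            × IsInternalDirectProduct (linearCollineations (ℬ f)) kernelHomologies H)
    partTwo =
      (H₁.collineationSubgroup , H₂.collineationSubgroup ,
        (H₁.axis , H₁.coaxis , H₁.hasAxisAndCoaxis , H₂.hasAxisAndCoaxis) ,
        (H₁.collineationSubgroup-cyclic , subst (HasOrder (toGroup H₁.collineationSubgroup)) o≡ H₁.collineationSubgroup-order) ,
        (H₂.collineationSubgroup-cyclic , subst (HasOrder (toGroup H₂.collineationSubgroup)) o≡ H₂.collineationSubgroup-order)) ,
      noElation ,
      (X , Y , H₁.X≢Y , homologyCenter , (e₁ , e₁≢0 , ≐-refl) , (e₂ , e₂≢0 , ≐-refl)) ,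
      kernelOrder kernelHomologies ≐-refl ,
      (H₁.matrixSubgroup , H₁.isLinearHomologyGroup , H₁.matrixSubgroup-cyclic ,
        subst (HasOrder (toGroup H₁.matrixSubgroup)) o≡ H₁.matrixSubgroup-order , directProduct)

open import Data.Nat using (_^_; _∸_; _<_)

theorem5p4 : (q n : ℕ) → PrimePower q → (3<q : 3 < q) → 2 < n →
    (F : FiniteField q) (K : FiniteField (q ^ n)) (ι : Embedding F K) →
    let open Scattered q n F K ι in
    (f : QPolynomial) → IsScattered f →
    let open TranslationPlane _+ᵥ_ (ℬ f) in
    ( HasOrder (toGroup (G f)) (q ∸ 1) →
    (∀ H → IsAffineCentralGroup H → IsTrivial H)
    × HasOrder (toGroup (linearCollineations (ℬ f))) (q ^ n ∸ 1)
    × Member (linearCollineations (ℬ f)) ≐ Member kernelHomologies )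
    × ( (t : ℕ) (E : FiniteField (q ^ t)) →
    f ∈ 𝒮 → toGroup (G f) ≅ (E ˣ) →
    let k = homologyOrder q t 3<q in
    (∃₂ λ H₁ H₂ →
    AreSymmetricAffineHomologyGroups H₁ H₂
    × (IsCyclic (toGroup H₁) × HasOrder (toGroup H₁) k)
    × (IsCyclic (toGroup H₂) × HasOrder (toGroup H₂) k))
    × (∀ φ axis c → ¬ IsAffineElation φ axis c)
    × (∃₂ λ X Y →
    ¬ (proj₁ X ≐ proj₁ Y)
    × (∀ φ axis c → IsAffineHomology φ axis c → (c ≈ₚ inj₂ X) ⊎ (c ≈ₚ inj₂ Y))
    × proj₁ X ∈ desarguesianSpread
    × proj₁ Y ∈ desarguesianSpread)
    × HasOrder (toGroup kernelHomologies) (q ^ n ∸ 1)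
    × (∃ λ H →
    IsLinearAffineHomologyGroup (ℬ f) H
    × IsCyclic (toGroup H)
    × HasOrder (toGroup H) k
    × IsInternalDirectProduct (linearCollineations (ℬ f)) kernelHomologies H) )
theorem5p4 q n primePower 3<q 2<n F K ι f scattered =
  ScatteredPlane.partOne (scatteredPolynomial q n primePower 3<q 2<n F K ι f scattered) ,
  λ t → ScatteredPlane.partTwo (scatteredPolynomial q n primePower 3<q 2<n F K ι f scattered) {t}
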